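{- Let $\delta>0$ be sufficiently small (i.e. smaller than some absolute constant). Then there is a constant $c_\delta>0$, depending only on $\delta$, such that for every finite, non-empty set $A\subseteq\mathbb{Z}$ with $|A+A|\le(4+\delta)|A|$, the set $41A-40A$ contains a $d$-dimensional progression $P$ with $d\le2$ and $|P|\ge c_\delta|A|$.
   Context: For $h\in\mathbb{N}$, $hA=\{a_1+\dots+a_h:a_1,\dots,a_h\in A\}$, and $41A-40A=\{x-y:x\in41A,\ y\in40A\}$; $A+A=2A$. For $d\in\mathbb{N}$, a $d$-dimensional progression is a set of the form $\{a_0+l_1a_1+\dots+l_da_d:1\le l_i\le L_i,\ l_i\in\mathbb{Z}\ (1\le i\le d)\}$ with $a_0,\dots,a_d\in\mathbb{Z}$ and $L_1,\dots,L_d\in\mathbb{N}$ (positive integers). -}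

module Defs where

open import Algebra.Definitions.RawMonoid using (sum)
open import Data.Fin.Base using (Fin)
open import Data.Integer.Base as ℤ using (ℤ; +_)
open import Data.List.Base using (List; length)
open import Data.List.Membership.Propositional using (_∈_)
open import Data.List.Relation.Unary.Unique.Propositional using (Unique)
open import Data.Nat.Base as ℕ using (ℕ; _⊔_)
import Data.Nat.Properties as ℕ
open import Data.Product.Base using (Σ-syntax; ∃-syntax; _×_; _,_)
open import Data.Rational.Base using (ℚ; 0ℚ; 1ℚ; ½; _+_; _*_; _-_; ∣_∣; 1/_; _/_; _≤_; _<_; Positive; NonZero; positive; nonNegative)
open import Data.Rational.Properties
open import Data.Rational.Solver using (module +-*-Solver)
open import Data.Vec.Functional using (Vector)
open import Level using (0ℓ)
open import Relation.Binary.PropositionalEquality using (_≡_; refl; sym; trans; cong; cong₂; subst)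
open import Relation.Unary using (Pred; _≐_)
open +-*-Solver using (solve; _:+_; _:*_; _:-_; con; _:=_)

-- Real numbers: Cauchy sequences of rationals, with an explicit modulus.

IsCauchy : (ℕ → ℚ) → Set
IsCauchy x = ∀ ε → 0ℚ < ε → ∃[ N ] (∀ m n → N ℕ.≤ m → N ℕ.≤ n → ∣ x m - x n ∣ < ε)

record ℝ : Set where
  constructor mkℝ
  field
    seq    : ℕ → ℚ
    cauchy : IsCauchy seq

open ℝ public

private
  halves : ∀ ε → ε * ½ + ε * ½ ≡ ε
  halves = solve 1 (λ e → e :* con ½ :+ e :* con ½ := e) refl

  half>0 : ∀ {ε} → 0ℚ < ε → 0ℚ < ε * ½
  half>0 {ε} ε>0 = positive⁻¹ (ε * ½) {{pos*pos⇒pos ε {{positive ε>0}} ½}}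

+-cauchy : ∀ {x y} → IsCauchy x → IsCauchy y → IsCauchy (λ n → x n + y n)
+-cauchy {x} {y} cx cy ε ε>0 with cx (ε * ½) (half>0 ε>0) | cy (ε * ½) (half>0 ε>0)
... | M , p | N , q = M ⊔ N , λ m n m≥ n≥ → begin-strict
  ∣ (x m + y m) - (x n + y n) ∣      ≡⟨ cong ∣_∣ (rearrange (x m) (y m) (x n) (y n)) ⟩
  ∣ (x m - x n) + (y m - y n) ∣      ≤⟨ ∣p+q∣≤∣p∣+∣q∣ (x m - x n) (y m - y n) ⟩
  ∣ x m - x n ∣ + ∣ y m - y n ∣      <⟨ +-mono-< (p m n (ℕ.m⊔n≤o⇒m≤o M N m≥) (ℕ.m⊔n≤o⇒m≤o M N n≥))
                                                 (q m n (ℕ.m⊔n≤o⇒n≤o M N m≥) (ℕ.m⊔n≤o⇒n≤o M N n≥)) ⟩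
  ε * ½ + ε * ½                      ≡⟨ halves ε ⟩
  ε                                  ∎
  where
  open ≤-Reasoning
  rearrange : ∀ a b c d → (a + b) - (c + d) ≡ (a - c) + (b - d)
  rearrange = solve 4 (λ a b c d → (a :+ b) :- (c :+ d) := (a :- c) :+ (b :- d)) refl

eventuallyBounded : ∀ {x} → IsCauchy x →
  ∃[ B ] (0ℚ < B × ∃[ N ] (∀ n → N ℕ.≤ n → ∣ x n ∣ ≤ B))
eventuallyBounded {x} cx with cx 1ℚ (positive⁻¹ 1ℚ)
... | N , p = 1ℚ + ∣ x N ∣ , +-mono-<-≤ (positive⁻¹ 1ℚ) (0≤∣p∣ (x N)) , N , λ n n≥ → begin
  ∣ x n ∣                   ≡⟨ cong ∣_∣ (split (x n) (x N)) ⟩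
  ∣ (x n - x N) + x N ∣     ≤⟨ ∣p+q∣≤∣p∣+∣q∣ (x n - x N) (x N) ⟩
  ∣ x n - x N ∣ + ∣ x N ∣   ≤⟨ +-monoˡ-≤ ∣ x N ∣ (<⇒≤ (p n N n≥ ℕ.≤-refl)) ⟩
  1ℚ + ∣ x N ∣              ∎
  where
  open ≤-Reasoning
  split : ∀ a b → a ≡ (a - b) + b
  split = solve 2 (λ a b → a := (a :- b) :+ b) refl

private
  scale : ∀ B ε → 0ℚ < B → 0ℚ < ε → ∃[ η ] (0ℚ < η × B * η ≡ ε)
  scale B ε B>0 ε>0 = 1/ B * ε , positive⁻¹ (1/ B * ε) {{pos*pos⇒pos (1/ B) {{1/pos⇒pos B}} ε}} ,
    trans (sym (*-assoc B (1/ B) ε)) (trans (cong (_* ε) (*-inverseʳ B)) (*-identityˡ ε))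
    where instance
      _ : Positive B
      _ = positive B>0
      _ : Positive ε
      _ = positive ε>0
      _ : NonZero B
      _ = pos⇒nonZero B

  boundMul : ∀ {B η} a b → 0ℚ < B → ∣ a ∣ ≤ B → ∣ b ∣ < η → ∣ a * b ∣ < B * η
  boundMul {B} {η} a b B>0 a≤ b< = begin-strict
    ∣ a * b ∣       ≡⟨ ∣p*q∣≡∣p∣*∣q∣ a b ⟩
    ∣ a ∣ * ∣ b ∣   ≤⟨ *-monoʳ-≤-nonNeg ∣ b ∣ {{nonNegative (0≤∣p∣ b)}} a≤ ⟩
    B * ∣ b ∣       <⟨ *-monoʳ-<-pos B {{positive B>0}} b< ⟩
    B * η           ∎
    where open ≤-Reasoning

*-cauchy : ∀ {x y} → IsCauchy x → IsCauchy y → IsCauchy (λ n → x n * y n)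
*-cauchy {x} {y} cx cy ε ε>0 =
  let B , B>0 , K , x≤B = eventuallyBounded cx
      C , C>0 , L , y≤C = eventuallyBounded cy
      η , η>0 , Bη≡ = scale B (ε * ½) B>0 (half>0 ε>0)
      θ , θ>0 , Cθ≡ = scale C (ε * ½) C>0 (half>0 ε>0)
      M , q = cy η η>0
      N , p = cx θ θ>0
  in (K ⊔ L) ⊔ (M ⊔ N) , λ m n m≥ n≥ →
    let K⊔L≤m = ℕ.m⊔n≤o⇒m≤o (K ⊔ L) (M ⊔ N) m≥
        K⊔L≤n = ℕ.m⊔n≤o⇒m≤o (K ⊔ L) (M ⊔ N) n≥
        M⊔N≤m = ℕ.m⊔n≤o⇒n≤o (K ⊔ L) (M ⊔ N) m≥
        M⊔N≤n = ℕ.m⊔n≤o⇒n≤o (K ⊔ L) (M ⊔ N) n≥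
    in estimate (x m) (y m) (x n) (y n) Bη≡ Cθ≡
      (boundMul (x m) (y m - y n) B>0 (x≤B m (ℕ.m⊔n≤o⇒m≤o K L K⊔L≤m))
        (q m n (ℕ.m⊔n≤o⇒m≤o M N M⊔N≤m) (ℕ.m⊔n≤o⇒m≤o M N M⊔N≤n)))
      (boundMul (y n) (x m - x n) C>0 (y≤C n (ℕ.m⊔n≤o⇒n≤o K L K⊔L≤n))
        (p m n (ℕ.m⊔n≤o⇒n≤o M N M⊔N≤m) (ℕ.m⊔n≤o⇒n≤o M N M⊔N≤n)))
  where
  open ≤-Reasoning
  rearrange : ∀ a b c d → a * b - c * d ≡ a * (b - d) + d * (a - c)
  rearrange = solve 4 (λ a b c d → a :* b :- c :* d := a :* (b :- d) :+ d :* (a :- c)) refl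
  estimate : ∀ a b c d {s t} → s ≡ ε * ½ → t ≡ ε * ½ →
    ∣ a * (b - d) ∣ < s → ∣ d * (a - c) ∣ < t → ∣ a * b - c * d ∣ < ε
  estimate a b c d {s} {t} s≡ t≡ u v = begin-strict
    ∣ a * b - c * d ∣                      ≡⟨ cong ∣_∣ (rearrange a b c d) ⟩
    ∣ a * (b - d) + d * (a - c) ∣          ≤⟨ ∣p+q∣≤∣p∣+∣q∣ (a * (b - d)) (d * (a - c)) ⟩
    ∣ a * (b - d) ∣ + ∣ d * (a - c) ∣      <⟨ +-mono-< u v ⟩
    s + t                                  ≡⟨ cong₂ _+_ s≡ t≡ ⟩
    ε * ½ + ε * ½                          ≡⟨ halves ε ⟩
    ε                                      ∎

infixl 6 _+ᵣ_
infixl 7 _*ᵣ_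
infix 4 _<ᵣ_ _≤ᵣ_

_+ᵣ_ : ℝ → ℝ → ℝ
x +ᵣ y = mkℝ (λ n → seq x n + seq y n) (+-cauchy {seq x} {seq y} (cauchy x) (cauchy y))

_*ᵣ_ : ℝ → ℝ → ℝ
x *ᵣ y = mkℝ (λ n → seq x n * seq y n) (*-cauchy {seq x} {seq y} (cauchy x) (cauchy y))

fromℚ : ℚ → ℝ
fromℚ q = mkℝ (λ _ → q) λ ε ε>0 →
  0 , λ _ _ _ _ → subst (_< ε) (sym (cong ∣_∣ (+-inverseʳ q))) ε>0

fromℕ : ℕ → ℝ
fromℕ n = fromℚ (+ n / 1)

-- The sequences are representatives of reals, so the order must be insensitive
-- to finitely many terms and to null sequences: x < y asks for a uniform
-- positive rational gap, x ≤ y for an eventual bound up to every rational ε > 0.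

_<ᵣ_ : ℝ → ℝ → Set
x <ᵣ y = ∃[ ε ] (0ℚ < ε × ∃[ N ] (∀ n → N ℕ.≤ n → seq x n + ε ≤ seq y n))

_≤ᵣ_ : ℝ → ℝ → Set
x ≤ᵣ y = ∀ ε → 0ℚ < ε → ∃[ N ] (∀ n → N ℕ.≤ n → seq x n ≤ seq y n + ε)

0ᵣ : ℝ
0ᵣ = fromℕ 0

-- Sets of integers are predicates.  S is finite with exactly n elements when
-- some duplicate-free list of length n enumerates it.

infix 4 ∣_∣≡_

∣_∣≡_ : Pred ℤ 0ℓ → ℕ → Set
∣ S ∣≡ n = Σ[ xs ∈ List ℤ ] (Unique xs × (_∈ xs) ≐ S × length xs ≡ n)

∑ : ∀ {n} → Vector ℤ n → ℤ
∑ = sum ℤ.+-0-rawMonoid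

infix 8 _·_
infixl 6 _⊖_

-- The h-fold sumset hA, not the dilate {h a : a ∈ A}.
_·_ : ℕ → Pred ℤ 0ℓ → Pred ℤ 0ℓ
(h · A) x = Σ[ a ∈ Vector ℤ h ] ((∀ i → A (a i)) × x ≡ ∑ a)

_⊖_ : Pred ℤ 0ℓ → Pred ℤ 0ℓ → Pred ℤ 0ℓ
(X ⊖ Y) z = ∃[ x ] ∃[ y ] (X x × Y y × z ≡ x ℤ.- y)

progression : ∀ {d} → ℤ → Vector ℤ d → Vector ℕ d → Pred ℤ 0ℓ
progression {d} a₀ a L x =
  Σ[ l ∈ Vector ℤ d ] ((∀ i → + 1 ℤ.≤ l i × l i ℤ.≤ + L i) × x ≡ a₀ ℤ.+ ∑ (λ i → l i ℤ.* a i))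

-- Not required to be proper: different l may give the same element.
IsProgression : ℕ → Pred ℤ 0ℓ → Set
IsProgression d P =
  ∃[ a₀ ] Σ[ a ∈ Vector ℤ d ] Σ[ L ∈ Vector ℕ d ] ((∀ i → 1 ℕ.≤ L i) × P ≐ progression a₀ a L)

{-# OPTIONS --safe #-}

-- Characters are modelled by a rational rotation of the circle of almost exact order N, where N
-- is huge compared with A.  Let Σ be the set of frequencies r with |Â(r)| ≥ 0.5001 |A|.  The
-- representation function of A + A is small near its ends, so the additive energy of A exceeds the
-- Cauchy-Schwarz bound |A|³ / 4 by a definite amount, and a Bogolyubov argument with the 40th
-- powers of |Â|² puts the whole Bohr set B of Σ with radius N / 100 into 40A - 40A; it also shows
-- that |B| = O(|A|).  Sampling in the manner of Croot and Sisask gives, in every A₀ ⊆ A of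
-- positive density, a translate of a set of positive density in a Bohr set of Σ of any given radius.
--
-- Consider the vectors (x, φ r x), with φ r x the centred residue of r x mod N and r in Σ, for x in
-- a small Bohr set.  If they span a space of dimension at most 2, successive minima give a
-- progression of dimension at most 2 inside B that is as large as the small Bohr set.  Otherwise
-- three of them are independent already in the coordinates x, φ r x, φ s x.  As |Â(r)| > |A| / 2, a
-- half circle contains more than 3/4 of r A mod N, and likewise for s, hence more than half of A
-- lies in both half circles, and there a ↦ (a, r a mod N, s a mod N) is a Freiman isomorphism into
-- ℤ³.  In the basis of the three vectors few lines parallel to an axis meet the image, since
-- otherwise multiples of a basis vector would overfill B.  A compression argument then gives
-- |A + A| ≥ 8 (1/2 + ε) |A|, a contradiction.

module Submission where

open import Data.Empty using (⊥; ⊥-elim)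
open import Data.Fin.Base using (Fin; zero; suc)
open import Data.Fin.Patterns using (0F; 1F; 2F)
import Data.Integer.Properties as ℤ
import Data.Integer.Tactic.RingSolver as ℤ-Solver
open import Data.List.Base using (List; []; _∷_; _++_; map; cartesianProductWith; filter; length; downFrom; deduplicate; cartesianProduct)
open import Data.List.Membership.Propositional using (_∈_; find; lose; _∉_)
open import Data.List.Membership.Propositional.Properties using (∈-∃++; ∈-map⁻; ∈-++⁺ˡ; ∈-++⁺ʳ; ∈-++⁻; ∈-downFrom⁻; ∈-map⁺; ∈-filter⁺; ∈-filter⁻; ∈-deduplicate⁺; ∈-deduplicate⁻; ∈-cartesianProductWith⁺; ∈-cartesianProductWith⁻; ∈-downFrom⁺; ∈-cartesianProduct⁻)
open import Data.List.Properties using (length-downFrom; length-map; length-++; length-filter; ≡-dec; ∷-injective)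
open import Data.List.Relation.Unary.All as All using (All; []; _∷_; all?)
import Data.List.Relation.Unary.All.Properties as All
open import Data.List.Relation.Unary.AllPairs using ([]; _∷_)
open import Data.List.Relation.Unary.Any using (here; there; any?; Any)
open import Data.List.Relation.Unary.Unique.DecPropositional.Properties using (deduplicate-!)
open import Data.List.Relation.Unary.Unique.Propositional using (Unique)
import Data.List.Relation.Unary.Unique.Propositional.Properties as Unique
open import Data.Nat.Base as ℕ using (ℕ; zero; suc)
import Data.Nat.Properties as ℕ
import Data.Nat.Tactic.RingSolver as ℕ-Solver
open import Data.Product.Base using (∃-syntax; _,_; _×_; proj₁; proj₂; Σ-syntax)
open import Data.Sum.Base using (inj₁; inj₂; [_,_]′; _⊎_)
open import Level using (0ℓ)
open import Relation.Binary.Definitions using (DecidableEquality)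
open import Relation.Binary.PropositionalEquality hiding (J)
open import Relation.Nullary using (yes; no; ¬_; contradiction; Dec)
open import Relation.Nullary.Decidable using (¬?; _×-dec_; decidable-stable)
open import Tactic.RingSolver using (solve-∀)

-- The number 4 is 8 · 1/2: a genuinely three-dimensional set X has |X + X| close to 8 |X| or more,
-- and it is to contain slightly more than half of A. Two half circles must therefore each hold more
-- than 3/4 of A, which needs |Â(r)| > |A| / 2. For |A + A| = 4 |A|, Cauchy-Schwarz alone bounds the
-- weighted mean of |Â|² / |A|² by 1/4 = (1/2)² from below, with nothing to spare; hence the
-- improved energy 0.2548, to be compared with 0.5001² = 0.2501. Their ratio is only about 1.019,
-- and its 39th power is what outweighs the frequencies below the threshold: 98 · 0.2548^39 > 198 ·
-- 0.2501^39. This is the origin of 40A - 40A; an element of A translates the progression into 41A -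
-- 40A.
--
-- All estimates are rational. A rotation with rational cosine and sine closes up only approximately
-- after N steps, so a nontrivial character sum is bounded instead of zero. Densities and radii
-- relative to N are fixed before A is known and N is chosen after it, which makes these errors
-- negligible. Sets with at most 100000 elements receive a one-point progression.

-- Ordered-field arithmetic of the rationals

module RationalOrder where

  open import Data.Integer.Base as ℤ using (ℤ; +_)
  open import Data.Bool.Base using (T)
  open import Data.Maybe.Base using (Maybe; just; nothing)
  open import Data.Rational.Base
  open import Data.Rational.Properties
  import Data.Rational.Unnormalised.Base as ℚᵘ
  import Data.Rational.Unnormalised.Properties as ℚᵘ
  open import Tactic.RingSolver.Core.AlmostCommutativeRing using (AlmostCommutativeRing; fromCommutativeRing)

  ℚ-ring : AlmostCommutativeRing 0ℓ 0ℓ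
  ℚ-ring = fromCommutativeRing +-*-commutativeRing zero?
    where
    zero? : ∀ x → Maybe (0ℚ ≡ x)
    zero? x with 0ℚ ≟ x
    ... | yes p = just p
    ... | no _ = nothing

  private variable a b c d : ℚ

  0≤1 : 0ℚ ≤ 1ℚ
  0≤1 = nonNegative⁻¹ 1ℚ

  +-nonNeg : 0ℚ ≤ a → 0ℚ ≤ b → 0ℚ ≤ a + b
  +-nonNeg = +-mono-≤

  *-mono-≤ʳ : 0ℚ ≤ c → a ≤ b → a * c ≤ b * c
  *-mono-≤ʳ {c} 0≤c = *-monoʳ-≤-nonNeg c {{nonNegative 0≤c}}

  *-mono-≤ˡ : 0ℚ ≤ c → a ≤ b → c * a ≤ c * b
  *-mono-≤ˡ {c} 0≤c = *-monoˡ-≤-nonNeg c {{nonNegative 0≤c}}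

  *-nonNeg : 0ℚ ≤ a → 0ℚ ≤ b → 0ℚ ≤ a * b
  *-nonNeg {a} {b} 0≤a 0≤b = subst (_≤ a * b) (*-zeroˡ b) (*-mono-≤ʳ 0≤b 0≤a)

  *-mono-≤-nonNeg : 0ℚ ≤ a → 0ℚ ≤ d → a ≤ b → c ≤ d → a * c ≤ b * d
  *-mono-≤-nonNeg 0≤a 0≤d a≤b c≤d = ≤-trans (*-mono-≤ˡ 0≤a c≤d) (*-mono-≤ʳ 0≤d a≤b)

  *-pos : 0ℚ < a → 0ℚ < b → 0ℚ < a * b
  *-pos {a} {b} 0<a 0<b = positive⁻¹ (a * b) {{pos*pos⇒pos a {{positive 0<a}} b {{positive 0<b}}}}

  +-pos : 0ℚ < a → 0ℚ ≤ b → 0ℚ < a + b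
  +-pos = +-mono-<-≤

  ≤⇒0≤ : a ≤ b → 0ℚ ≤ b - a
  ≤⇒0≤ {a} {b} a≤b = subst (_≤ b - a) (+-inverseʳ a) (+-monoˡ-≤ (- a) a≤b)

  <⇒0< : a < b → 0ℚ < b - a
  <⇒0< {a} {b} a<b = subst (_< b - a) (+-inverseʳ a) (+-monoˡ-< (- a) a<b)

  -- Reduces an inequality to a ring identity: the certificate `e` is a sum of products of
  -- quantities already known to be non-negative. Most estimates below are proved in this way.
  ≤-by : ∀ {a b} e → 0ℚ ≤ e → b ≡ a + e → a ≤ b
  ≤-by {a} {b} e 0≤e eq = subst₂ _≤_ (+-identityʳ a) (sym eq) (+-monoʳ-≤ a 0≤e)

  <-by : ∀ {a b} e → 0ℚ < e → b ≡ a + e → a < b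
  <-by {a} {b} e 0<e eq = subst₂ _<_ (+-identityʳ a) (sym eq) (+-monoʳ-< a 0<e)

  0≤⇒≤ : 0ℚ ≤ b - a → a ≤ b
  0≤⇒≤ {b} {a} p = ≤-by (b - a) p (lemma a b)
    where
    lemma : ∀ a b → b ≡ a + (b - a)
    lemma = solve-∀ ℚ-ring

  neg-nonNeg : a ≤ 0ℚ → 0ℚ ≤ - a
  neg-nonNeg {a} p = subst (_≤ - a) refl (neg-antimono-≤ p)

  *-nonPos : a ≤ 0ℚ → b ≤ 0ℚ → 0ℚ ≤ a * b
  *-nonPos {a} {b} p q = subst (0ℚ ≤_) (lemma a b) (*-nonNeg (neg-nonNeg p) (neg-nonNeg q))
    where
    lemma : ∀ a b → (- a) * (- b) ≡ a * b
    lemma = solve-∀ ℚ-ring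

  sq-nonNeg : ∀ a → 0ℚ ≤ a * a
  sq-nonNeg a with ≤-total 0ℚ a
  ... | inj₁ 0≤a = *-nonNeg 0≤a 0≤a
  ... | inj₂ a≤0 = *-nonPos a≤0 a≤0

  <⇒≱ : ∀ {a b} → a < b → ¬ (b ≤ a)
  <⇒≱ a<b b≤a = <-irrefl refl (<-≤-trans a<b b≤a)

  -- Stands in for square roots: bounds on moduli are proved for their squares and brought down by
  -- this.
  sq-cancel-≤ : 0ℚ ≤ b → a * a ≤ b * b → a ≤ b
  sq-cancel-≤ {b} {a} 0≤b p with a ≤? b
  ... | yes a≤b = a≤b
  ... | no a≰b = contradiction p (<⇒≱ (<-by ((a - b) * (a - b) + (a - b) * (b + b))
        (+-pos (*-pos 0<a-b 0<a-b) (*-nonNeg (<⇒≤ 0<a-b) (+-nonNeg 0≤b 0≤b))) (lemma a b)))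
    where
    0<a-b : 0ℚ < a - b
    0<a-b = <⇒0< (≰⇒> a≰b)
    lemma : ∀ a b → a * a ≡ b * b + ((a - b) * (a - b) + (a - b) * (b + b))
    lemma = solve-∀ ℚ-ring

  sq-mono-≤ : 0ℚ ≤ a → a ≤ b → a * a ≤ b * b
  sq-mono-≤ 0≤a a≤b = *-mono-≤-nonNeg 0≤a (≤-trans 0≤a a≤b) a≤b a≤b

  *-cancelʳ-≤ : 0ℚ < c → a * c ≤ b * c → a ≤ b
  *-cancelʳ-≤ {c} 0<c = *-cancelʳ-≤-pos c {{positive 0<c}}

  infixr 8 _^_
  _^_ : ℚ → ℕ → ℚ
  x ^ zero = 1ℚ
  x ^ suc k = x * x ^ k

  ^-nonNeg : ∀ {x} k → 0ℚ ≤ x → 0ℚ ≤ x ^ k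
  ^-nonNeg zero 0≤x = 0≤1
  ^-nonNeg (suc k) 0≤x = *-nonNeg 0≤x (^-nonNeg k 0≤x)

  ^-pos : ∀ {x} k → 0ℚ < x → 0ℚ < x ^ k
  ^-pos zero 0<x = positive⁻¹ 1ℚ
  ^-pos (suc k) 0<x = *-pos 0<x (^-pos k 0<x)

  opaque
    -- Opaque, because `i / 1` reduces through a gcd, which must not start on the large numerals
    -- used below.
    ι : ℤ → ℚ
    ι i = i / 1

    ι-def : ∀ i → ι i ≡ i / 1
    ι-def i = refl

  ιₙ : ℕ → ℚ
  ιₙ n = ι (+ n)

  private
    opaque
      unfolding ι
      toℚᵘ-ι : ∀ i → toℚᵘ (ι i) ℚᵘ.≃ ℚᵘ.mkℚᵘ i 0
      toℚᵘ-ι i = toℚᵘ-fromℚᵘ (ℚᵘ.mkℚᵘ i 0)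

  ι-+ : ∀ i j → ι (i ℤ.+ j) ≡ ι i + ι j
  ι-+ i j = toℚᵘ-injective (ℚᵘ.≃-trans (toℚᵘ-ι (i ℤ.+ j)) (ℚᵘ.≃-sym
    (ℚᵘ.≃-trans (toℚᵘ-homo-+ (ι i) (ι j)) (ℚᵘ.≃-trans (ℚᵘ.+-cong (toℚᵘ-ι i) (toℚᵘ-ι j))
      (ℚᵘ.*≡* (cong₂ ℤ._*_ (cong₂ ℤ._+_ (ℤ.*-identityʳ i) (ℤ.*-identityʳ j)) refl))))))

  ι-* : ∀ i j → ι (i ℤ.* j) ≡ ι i * ι j
  ι-* i j = toℚᵘ-injective (ℚᵘ.≃-trans (toℚᵘ-ι (i ℤ.* j)) (ℚᵘ.≃-sym
    (ℚᵘ.≃-trans (toℚᵘ-homo-* (ι i) (ι j)) (ℚᵘ.≃-trans (ℚᵘ.*-cong (toℚᵘ-ι i) (toℚᵘ-ι j))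
      (ℚᵘ.*≡* refl)))))

  ι-neg : ∀ i → ι (ℤ.- i) ≡ - ι i
  ι-neg i = toℚᵘ-injective (ℚᵘ.≃-trans (toℚᵘ-ι (ℤ.- i)) (ℚᵘ.≃-sym
    (ℚᵘ.≃-trans (toℚᵘ-homo‿- (ι i)) (ℚᵘ.-‿cong (toℚᵘ-ι i)))))

  ι-mono-≤ : ∀ {i j} → i ℤ.≤ j → ι i ≤ ι j
  ι-mono-≤ {i} {j} p = toℚᵘ-cancel-≤ (ℚᵘ.≤-respˡ-≃ (ℚᵘ.≃-sym (toℚᵘ-ι i)) (ℚᵘ.≤-respʳ-≃ (ℚᵘ.≃-sym (toℚᵘ-ι j))
    (ℚᵘ.*≤* (ℤ.*-monoʳ-≤-nonNeg (+ 1) p))))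

  ι-mono-< : ∀ {i j} → i ℤ.< j → ι i < ι j
  ι-mono-< {i} {j} p = toℚᵘ-cancel-< (ℚᵘ.<-respˡ-≃ (ℚᵘ.≃-sym (toℚᵘ-ι i)) (ℚᵘ.<-respʳ-≃ (ℚᵘ.≃-sym (toℚᵘ-ι j))
    (ℚᵘ.*<* (ℤ.*-monoʳ-<-pos (+ 1) p))))

  ι-cancel-≤ : ∀ {i j} → ι i ≤ ι j → i ℤ.≤ j
  ι-cancel-≤ {i} {j} p with i ℤ.≤? j
  ... | yes q = q
  ... | no ¬q = contradiction p (<⇒≱ (ι-mono-< (ℤ.≰⇒> ¬q)))

  ι-cancel-< : ∀ {i j} → ι i < ι j → i ℤ.< j
  ι-cancel-< {i} {j} p with i ℤ.<? j
  ... | yes q = q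
  ... | no ¬q = contradiction (ι-mono-≤ (ℤ.≮⇒≥ ¬q)) (<⇒≱ p)

  ιₙ-+ : ∀ m n → ιₙ (m ℕ.+ n) ≡ ιₙ m + ιₙ n
  ιₙ-+ m n = ι-+ (+ m) (+ n)

  ιₙ-* : ∀ m n → ιₙ (m ℕ.* n) ≡ ιₙ m * ιₙ n
  ιₙ-* m n = trans (cong ι (ℤ.pos-* m n)) (ι-* (+ m) (+ n))

  ιₙ-suc : ∀ n → ιₙ (suc n) ≡ 1ℚ + ιₙ n
  ιₙ-suc n = trans (ιₙ-+ 1 n) (cong (_+ ιₙ n) (ι-def (+ 1)))

  ιₙ-mono-≤ : ∀ {m n} → m ℕ.≤ n → ιₙ m ≤ ιₙ n
  ιₙ-mono-≤ p = ι-mono-≤ (ℤ.+≤+ p)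

  ιₙ-mono-< : ∀ {m n} → m ℕ.< n → ιₙ m < ιₙ n
  ιₙ-mono-< p = ι-mono-< (ℤ.+<+ p)

  ιₙ-cancel-≤ : ∀ {m n} → ιₙ m ≤ ιₙ n → m ℕ.≤ n
  ιₙ-cancel-≤ p = ℤ.drop‿+≤+ (ι-cancel-≤ p)

  ιₙ-nonNeg : ∀ n → 0ℚ ≤ ιₙ n
  ιₙ-nonNeg n = subst (_≤ ιₙ n) (ι-def (+ 0)) (ιₙ-mono-≤ ℕ.z≤n)

  -- Numerical inequalities are decided in ℕ: closed rationals are normalised by a unary gcd.
  data Numeral : Set where
    #_ : ℕ → Numeral
    _⊞_ _⊠_ : Numeral → Numeral → Numeral

  infix 10 #_
  infixl 7 _⊠_
  infixl 6 _⊞_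

  ⟦_⟧ₙ : Numeral → ℕ
  ⟦ # n ⟧ₙ = n
  ⟦ a ⊞ b ⟧ₙ = ⟦ a ⟧ₙ ℕ.+ ⟦ b ⟧ₙ
  ⟦ a ⊠ b ⟧ₙ = ⟦ a ⟧ₙ ℕ.* ⟦ b ⟧ₙ

  ⟦_⟧ : Numeral → ℚ
  ⟦ # n ⟧ = ιₙ n
  ⟦ a ⊞ b ⟧ = ⟦ a ⟧ + ⟦ b ⟧
  ⟦ a ⊠ b ⟧ = ⟦ a ⟧ * ⟦ b ⟧

  ⟦⟧-ιₙ : ∀ a → ιₙ ⟦ a ⟧ₙ ≡ ⟦ a ⟧
  ⟦⟧-ιₙ (# n) = refl
  ⟦⟧-ιₙ (a ⊞ b) = trans (ιₙ-+ ⟦ a ⟧ₙ ⟦ b ⟧ₙ) (cong₂ _+_ (⟦⟧-ιₙ a) (⟦⟧-ιₙ b))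
  ⟦⟧-ιₙ (a ⊠ b) = trans (ιₙ-* ⟦ a ⟧ₙ ⟦ b ⟧ₙ) (cong₂ _*_ (⟦⟧-ιₙ a) (⟦⟧-ιₙ b))

  numeral-≤ : ∀ a b → {T (⟦ a ⟧ₙ ℕ.≤ᵇ ⟦ b ⟧ₙ)} → ⟦ a ⟧ ≤ ⟦ b ⟧
  numeral-≤ a b {p} = subst₂ _≤_ (⟦⟧-ιₙ a) (⟦⟧-ιₙ b) (ιₙ-mono-≤ (ℕ.≤ᵇ⇒≤ ⟦ a ⟧ₙ ⟦ b ⟧ₙ p))

  ιₙ-pos : ∀ n → 0ℚ < ιₙ (suc n)
  ιₙ-pos n = subst (_< ιₙ (suc n)) (ι-def (+ 0)) (ιₙ-mono-< (ℕ.s≤s ℕ.z≤n))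

  ιₙ-^ : ∀ n k → ιₙ (n ℕ.^ k) ≡ ιₙ n ^ k
  ιₙ-^ n zero = ι-def (+ 1)
  ιₙ-^ n (suc k) = trans (ιₙ-* n (n ℕ.^ k)) (cong (ιₙ n *_) (ιₙ-^ n k))

  clear-denominator : ∀ x → x * ι (↧ x) ≡ ι (↥ x)
  clear-denominator x@(mkℚ a d _) = toℚᵘ-injective (ℚᵘ.≃-trans (toℚᵘ-homo-* x (ι (↧ x))) (ℚᵘ.≃-trans (ℚᵘ.*-cong {toℚᵘ x} ℚᵘ.≃-refl (toℚᵘ-ι (↧ x)))
    (ℚᵘ.≃-trans (ℚᵘ.*≡* (trans (ℤ.*-identityʳ (a ℤ.* + suc d)) (cong (λ z → a ℤ.* + suc z) (sym (ℕ.*-identityʳ d))))) (ℚᵘ.≃-sym (toℚᵘ-ι a)))))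

  -- A positive rational is at least the reciprocal of its denominator, so the denominator of `p`
  -- times the absolute numerator of `x` will do.
  archimedean : ∀ {p} → 0ℚ < p → ∀ x → ∃[ n ] x ≤ p * ιₙ n
  archimedean {p} 0<p x = ↧ₙ p ℕ.* ℤ.∣ ↥ x ∣ , ≤-trans x≤ (≤-trans (≤-reflexive (sym (*-identityˡ (ιₙ ℤ.∣ ↥ x ∣)))) (≤-trans (*-mono-≤ʳ (ιₙ-nonNeg ℤ.∣ ↥ x ∣) 1≤)
      (≤-reflexive (trans (*-assoc p (ιₙ (↧ₙ p)) (ιₙ ℤ.∣ ↥ x ∣)) (cong (p *_) (sym (ιₙ-* (↧ₙ p) ℤ.∣ ↥ x ∣)))))))
    where
    ↧-pos : ∀ y → 0ℚ < ι (↧ y)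
    ↧-pos y = ιₙ-pos _
    abs-≥ : ∀ i → i ℤ.≤ + ℤ.∣ i ∣
    abs-≥ (+ n) = ℤ.≤-refl
    abs-≥ ℤ.-[1+ n ] = ℤ.-≤+
    x≤ : x ≤ ιₙ ℤ.∣ ↥ x ∣
    x≤ = *-cancelʳ-≤ {ι (↧ x)} {x} {ιₙ ℤ.∣ ↥ x ∣} (↧-pos x) (≤-trans (≤-reflexive (clear-denominator x)) (≤-trans (ι-mono-≤ (abs-≥ (↥ x)))
      (subst (ιₙ ℤ.∣ ↥ x ∣ ≤_) (ιₙ-* ℤ.∣ ↥ x ∣ (↧ₙ x)) (ιₙ-mono-≤ (ℕ.m≤m*n ℤ.∣ ↥ x ∣ (↧ₙ x))))))
    1≤ : 1ℚ ≤ p * ιₙ (↧ₙ p)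
    1≤ = subst₂ _≤_ (ι-def (+ 1)) (sym (clear-denominator p)) (ι-mono-≤ (ℤ.i<j⇒suc[i]≤j (ι-cancel-< (subst₂ _<_ (sym (ι-def (+ 0))) (clear-denominator p) (*-pos 0<p (↧-pos p))))))

-- Finite sums, counting and averaging over lists

module ListSum where

  open import Data.List.Relation.Binary.Subset.Propositional using (_⊆_)
  open import Data.Rational.Base
  open import Data.Rational.Properties
  open import Relation.Unary using (Pred; Decidable)
  open RationalOrder

  private variable
    A B : Set

  ∑ : List A → (A → ℚ) → ℚ
  ∑ [] f = 0ℚ
  ∑ (x ∷ xs) f = f x + ∑ xs f

  ∑-cong : ∀ (xs : List A) {f g : A → ℚ} → (∀ x → x ∈ xs → f x ≡ g x) → ∑ xs f ≡ ∑ xs g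
  ∑-cong [] eq = refl
  ∑-cong (x ∷ xs) eq = cong₂ _+_ (eq x (here refl)) (∑-cong xs λ y y∈ → eq y (there y∈))

  ∑-ext : ∀ (xs : List A) {f g : A → ℚ} → (∀ x → f x ≡ g x) → ∑ xs f ≡ ∑ xs g
  ∑-ext xs eq = ∑-cong xs λ x _ → eq x

  ∑-mono : ∀ (xs : List A) {f g : A → ℚ} → (∀ x → x ∈ xs → f x ≤ g x) → ∑ xs f ≤ ∑ xs g
  ∑-mono [] le = ≤-refl
  ∑-mono (x ∷ xs) le = +-mono-≤ (le x (here refl)) (∑-mono xs λ y y∈ → le y (there y∈))

  ∑-0 : ∀ (xs : List A) → ∑ xs (λ _ → 0ℚ) ≡ 0ℚ
  ∑-0 [] = refl
  ∑-0 (x ∷ xs) = trans (+-identityˡ _) (∑-0 xs)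

  ∑-nonNeg : ∀ (xs : List A) {f : A → ℚ} → (∀ x → x ∈ xs → 0ℚ ≤ f x) → 0ℚ ≤ ∑ xs f
  ∑-nonNeg xs {f} nn = subst (_≤ ∑ xs f) (∑-0 xs) (∑-mono xs nn)

  ∑-+ : ∀ (xs : List A) (f g : A → ℚ) → ∑ xs (λ x → f x + g x) ≡ ∑ xs f + ∑ xs g
  ∑-+ [] f g = refl
  ∑-+ (x ∷ xs) f g = trans (cong (f x + g x +_) (∑-+ xs f g)) (lemma (f x) (g x) (∑ xs f) (∑ xs g))
    where
    lemma : ∀ a b c d → a + b + (c + d) ≡ a + c + (b + d)
    lemma = solve-∀ ℚ-ring

  ∑-*ˡ : ∀ (xs : List A) (c : ℚ) (f : A → ℚ) → ∑ xs (λ x → c * f x) ≡ c * ∑ xs f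
  ∑-*ˡ [] c f = sym (*-zeroʳ c)
  ∑-*ˡ (x ∷ xs) c f = trans (cong (c * f x +_) (∑-*ˡ xs c f)) (sym (*-distribˡ-+ c (f x) (∑ xs f)))

  ∑-*ʳ : ∀ (xs : List A) (c : ℚ) (f : A → ℚ) → ∑ xs (λ x → f x * c) ≡ ∑ xs f * c
  ∑-*ʳ xs c f = trans (∑-ext xs λ x → *-comm (f x) c) (trans (∑-*ˡ xs c f) (*-comm c _))

  ∑-neg : ∀ (xs : List A) (f : A → ℚ) → ∑ xs (λ x → - f x) ≡ - ∑ xs f
  ∑-neg [] f = refl
  ∑-neg (x ∷ xs) f = trans (cong (- f x +_) (∑-neg xs f)) (sym (neg-distrib-+ (f x) (∑ xs f)))

  ∑-swap : ∀ (xs : List A) (ys : List B) (f : A → B → ℚ) →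
           ∑ xs (λ x → ∑ ys (f x)) ≡ ∑ ys (λ y → ∑ xs (λ x → f x y))
  ∑-swap [] ys f = sym (∑-0 ys)
  ∑-swap (x ∷ xs) ys f = trans (cong (∑ ys (f x) +_) (∑-swap xs ys f)) (sym (∑-+ ys (f x) _))

  ∑-++ : ∀ (xs ys : List A) (f : A → ℚ) → ∑ (xs ++ ys) f ≡ ∑ xs f + ∑ ys f
  ∑-++ [] ys f = sym (+-identityˡ _)
  ∑-++ (x ∷ xs) ys f = trans (cong (f x +_) (∑-++ xs ys f)) (sym (+-assoc (f x) _ _))

  ∑-map : ∀ (h : A → B) (xs : List A) (f : B → ℚ) → ∑ (map h xs) f ≡ ∑ xs (λ x → f (h x))
  ∑-map h [] f = refl
  ∑-map h (x ∷ xs) f = cong (f (h x) +_) (∑-map h xs f)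

  ∑-product : ∀ {A B C : Set} (h : A → B → C) xs ys (f : C → ℚ) →
              ∑ (cartesianProductWith h xs ys) f ≡ ∑ xs (λ x → ∑ ys (λ y → f (h x y)))
  ∑-product h [] ys f = refl
  ∑-product h (x ∷ xs) ys f = trans (∑-++ (map (h x) ys) _ f) (cong₂ _+_ (∑-map (h x) ys f) (∑-product h xs ys f))

  ∑-const : ∀ (xs : List A) (c : ℚ) → ∑ xs (λ _ → c) ≡ ιₙ (length xs) * c
  ∑-const [] c = sym (trans (cong (_* c) (ι-def _)) (*-zeroˡ c))
  ∑-const (x ∷ xs) c = trans (cong (c +_) (∑-const xs c))
    (trans (lemma c (ιₙ (length xs))) (cong (_* c) (sym (ιₙ-suc (length xs)))))
    where
    lemma : ∀ c l → c + l * c ≡ (1ℚ + l) * c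
    lemma = solve-∀ ℚ-ring

  ∑-1 : ∀ (xs : List A) → ∑ xs (λ _ → 1ℚ) ≡ ιₙ (length xs)
  ∑-1 xs = trans (∑-const xs 1ℚ) (*-identityʳ _)

  -- The Iverson bracket: cardinalities of decidable subsets become sums, so double counting is
  -- `∑-swap`.
  [_?] : ∀ {P : Set} → Dec P → ℚ
  [ yes _ ?] = 1ℚ
  [ no _ ?] = 0ℚ

  [?]-nonNeg : ∀ {P : Set} (d : Dec P) → 0ℚ ≤ [ d ?]
  [?]-nonNeg (yes _) = 0≤1
  [?]-nonNeg (no _) = ≤-refl

  [?]-yes : ∀ {P : Set} (d : Dec P) → P → [ d ?] ≡ 1ℚ
  [?]-yes (yes _) p = refl
  [?]-yes (no ¬p) p = contradiction p ¬p

  [?]-no : ∀ {P : Set} (d : Dec P) → ¬ P → [ d ?] ≡ 0ℚ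
  [?]-no (yes p) ¬p = contradiction p ¬p
  [?]-no (no _) ¬p = refl

  [?]-cong : ∀ {P Q : Set} (d : Dec P) (e : Dec Q) → (P → Q) → (Q → P) → [ d ?] ≡ [ e ?]
  [?]-cong (yes p) e f g = sym ([?]-yes e (f p))
  [?]-cong (no ¬p) e f g = sym ([?]-no e (λ q → ¬p (g q)))

  [?]-mono : ∀ {P Q : Set} (d : Dec P) (e : Dec Q) → (P → Q) → [ d ?] ≤ [ e ?]
  [?]-mono (yes p) e f = ≤-reflexive (sym ([?]-yes e (f p)))
  [?]-mono (no ¬p) e f = [?]-nonNeg e

  [?]-≤1 : ∀ {P : Set} (d : Dec P) → [ d ?] ≤ 1ℚ
  [?]-≤1 (yes _) = ≤-refl
  [?]-≤1 (no _) = 0≤1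

  length-filter-∑ : ∀ {P : Pred A _} (P? : Decidable P) (xs : List A) →
                    ιₙ (length (filter P? xs)) ≡ ∑ xs (λ x → [ P? x ?])
  length-filter-∑ P? [] = ι-def _
  length-filter-∑ P? (x ∷ xs) with P? x
  ... | yes _ = trans (ιₙ-suc _) (cong (1ℚ +_) (length-filter-∑ P? xs))
  ... | no _ = trans (length-filter-∑ P? xs) (sym (+-identityˡ _))

  private
    remove-⊆ : ∀ {x : A} {xs} ys zs → All (λ y → ¬ x ≡ y) xs → x ∷ xs ⊆ ys ++ x ∷ zs → xs ⊆ ys ++ zs
    remove-⊆ ys zs x∉ sub {y} y∈ with ∈-++⁻ ys (sub (there y∈))
    ... | inj₁ p = ∈-++⁺ˡ p
    ... | inj₂ (here refl) = contradiction refl (All.lookup x∉ y∈)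
    ... | inj₂ (there p) = ∈-++⁺ʳ ys p

  ∑-⊆ : ∀ {xs ys : List A} {f : A → ℚ} → Unique xs → xs ⊆ ys → (∀ y → y ∈ ys → 0ℚ ≤ f y) → ∑ xs f ≤ ∑ ys f
  ∑-⊆ {xs = []} {ys} u sub nn = ∑-nonNeg ys nn
  ∑-⊆ {xs = x ∷ xs} {ys} {f} (x∉ ∷ u) sub nn with ∈-∃++ (sub (here refl))
  ... | as , bs , refl = begin
    f x + ∑ xs f ≤⟨ +-monoʳ-≤ (f x) (∑-⊆ u (remove-⊆ as bs x∉ sub) nn′) ⟩
    f x + ∑ (as ++ bs) f ≡⟨ cong (f x +_) (∑-++ as bs f) ⟩
    f x + (∑ as f + ∑ bs f) ≡⟨ lemma (f x) (∑ as f) (∑ bs f) ⟩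
    ∑ as f + ∑ (x ∷ bs) f ≡⟨ ∑-++ as (x ∷ bs) f ⟨
    ∑ (as ++ x ∷ bs) f ∎
    where
    open ≤-Reasoning
    lemma : ∀ a b c → a + (b + c) ≡ b + (a + c)
    lemma = solve-∀ ℚ-ring
    nn′ : ∀ y → y ∈ as ++ bs → 0ℚ ≤ f y
    nn′ y y∈ = nn y ([ ∈-++⁺ˡ , (λ p → ∈-++⁺ʳ as (there p)) ]′ (∈-++⁻ as y∈))

  InjectiveOn : List A → (A → B) → Set
  InjectiveOn xs f = ∀ {x y} → x ∈ xs → y ∈ xs → f x ≡ f y → x ≡ y

  map-unique : ∀ {xs : List A} {f : A → B} → InjectiveOn xs f → Unique xs → Unique (map f xs)
  map-unique inj [] = []
  map-unique {f = f} inj (_∷_ {x} {xs} x∉ u) =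
    All.tabulate (λ {z} z∈ eq → let y , y∈ , z≡ = ∈-map⁻ f z∈ in
      All.lookup x∉ y∈ (inj (here refl) (there y∈) (trans eq z≡)))
    ∷ map-unique (λ p q → inj (there p) (there q)) u

  ∑-inj : ∀ {xs : List A} {ys : List B} (h : A → B) {f : B → ℚ} → Unique xs → InjectiveOn xs h →
          (∀ x → x ∈ xs → h x ∈ ys) → (∀ y → y ∈ ys → 0ℚ ≤ f y) → ∑ xs (λ x → f (h x)) ≤ ∑ ys f
  ∑-inj {xs = xs} {ys} h {f} u inj into nn = subst (_≤ ∑ ys f) (∑-map h xs f)
    (∑-⊆ (map-unique inj u) (λ z∈ → let x , x∈ , z≡ = ∈-map⁻ h z∈ in subst (_∈ ys) (sym z≡) (into x x∈)) nn)

  length-inj : ∀ {xs : List A} {ys : List B} (h : A → B) → Unique xs → InjectiveOn xs h →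
               (∀ x → x ∈ xs → h x ∈ ys) → length xs ℕ.≤ length ys
  length-inj {xs = xs} {ys} h u inj into = ιₙ-cancel-≤ (subst₂ _≤_ (∑-1 xs) (∑-1 ys)
    (∑-inj h {λ _ → 1ℚ} u inj into λ _ _ → 0≤1))

  length-⊆ : ∀ {xs ys : List A} → Unique xs → xs ⊆ ys → length xs ℕ.≤ length ys
  length-⊆ u sub = length-inj (λ x → x) u (λ _ _ eq → eq) (λ x → sub)

  average : ∀ (xs : List A) (f : A → ℚ) {c} → 1 ℕ.≤ length xs → ιₙ (length xs) * c ≤ ∑ xs f →
            ∃[ x ] (x ∈ xs × c ≤ f x)
  average (x ∷ xs) f {c} _ le = go x xs (subst (_≤ ∑ (x ∷ xs) f) (sym (∑-const (x ∷ xs) c)) le)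
    where
    go : ∀ x xs → ∑ (x ∷ xs) (λ _ → c) ≤ ∑ (x ∷ xs) f → ∃[ y ] (y ∈ x ∷ xs × c ≤ f y)
    go x xs le with c ≤? f x
    ... | yes p = x , here refl , p
    go x [] le | no ¬p = contradiction le (<⇒≱ (+-monoˡ-< 0ℚ (≰⇒> ¬p)))
    go x (y ∷ ys) le | no ¬p with ∑ (y ∷ ys) (λ _ → c) ≤? ∑ (y ∷ ys) f
    ... | yes q = let z , z∈ , r = go y ys q in z , there z∈ , r
    ... | no ¬q = contradiction le (<⇒≱ (+-mono-< (≰⇒> ¬p) (≰⇒> ¬q)))

  -- Lagrange's identity: the double sum of the squares of `f x - f y` is twice the difference of
  -- the two sides.
  cauchy-schwarz : ∀ (xs : List A) (f : A → ℚ) →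
                   ∑ xs f * ∑ xs f ≤ ιₙ (length xs) * ∑ xs (λ x → f x * f x)
  cauchy-schwarz xs f = 0≤⇒≤ (half (subst (0ℚ ≤_) expand (∑-nonNeg xs λ x _ → ∑-nonNeg xs λ y _ → sq-nonNeg (f x - f y))))
    where
    n = ιₙ (length xs)
    Q = ∑ xs (λ x → f x * f x)
    F = ∑ xs f
    half : ∀ {a} → 0ℚ ≤ a + a → 0ℚ ≤ a
    half {a} p = *-cancelʳ-≤ {1ℚ + 1ℚ} (positive⁻¹ (1ℚ + 1ℚ)) (subst₂ _≤_ (sym (*-zeroˡ (1ℚ + 1ℚ))) (lemma a) p)
      where
      lemma : ∀ a → a + a ≡ a * (1ℚ + 1ℚ)
      lemma = solve-∀ ℚ-ring
    sq : ∀ a b → (a - b) * (a - b) ≡ a * a + (b * b + - (a + a) * b)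
    sq = solve-∀ ℚ-ring
    row : ∀ x → ∑ xs (λ y → (f x - f y) * (f x - f y)) ≡ n * (f x * f x) + (Q + - (f x + f x) * F)
    row x = trans (∑-ext xs λ y → sq (f x) (f y)) (trans (∑-+ xs _ _)
      (cong₂ _+_ (∑-const xs _) (trans (∑-+ xs _ _) (cong (Q +_) (∑-*ˡ xs (- (f x + f x)) f)))))
    final : ∀ n q F → n * q + (n * q + - (F + F) * F) ≡ (n * q - F * F) + (n * q - F * F)
    final = solve-∀ ℚ-ring
    expand : ∑ xs (λ x → ∑ xs (λ y → (f x - f y) * (f x - f y))) ≡ (n * Q - F * F) + (n * Q - F * F)
    expand = trans (∑-ext xs row) (trans (∑-+ xs _ _) (trans (cong₂ _+_ (∑-*ˡ xs n _)
      (trans (∑-+ xs _ _) (cong₂ _+_ (∑-const xs Q) (trans (∑-*ʳ xs F _)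
        (cong (_* F) (trans (∑-neg xs _) (cong -_ (∑-+ xs f f)))))))) (final n Q F)))

  average-≥ : ∀ (xs : List A) (f : A → ℚ) {k} → 1 ℕ.≤ length xs → k ≤ ∑ xs f →
              ∃[ x ] (x ∈ xs × k ≤ ιₙ (length xs) * f x)
  average-≥ xs f {k} nonempty le = average xs (λ x → ιₙ (length xs) * f x) nonempty
    (≤-trans (*-mono-≤ˡ (ιₙ-nonNeg (length xs)) le) (≤-reflexive (sym (∑-*ˡ xs (ιₙ (length xs)) f))))

  module _ (_≟_ : DecidableEquality A) where

    ∑-δ-∉ : ∀ {xs : List A} {z} (f : A → ℚ) → All (λ x → ¬ z ≡ x) xs → ∑ xs (λ x → [ z ≟ x ?] * f x) ≡ 0ℚ
    ∑-δ-∉ {xs} {z} f z∉ = trans (∑-cong xs λ x x∈ → trans (cong (_* f x) ([?]-no (z ≟ x) (All.lookup z∉ x∈))) (*-zeroˡ (f x))) (∑-0 xs)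

    ∑-δ : ∀ {xs : List A} {z} (f : A → ℚ) → Unique xs → z ∈ xs → ∑ xs (λ x → [ z ≟ x ?] * f x) ≡ f z
    ∑-δ {x ∷ xs} f (x∉ ∷ u) (here refl) = trans (cong₂ _+_ (trans (cong (_* f x) ([?]-yes (x ≟ x) refl)) (*-identityˡ (f x))) (∑-δ-∉ f x∉)) (+-identityʳ (f x))
    ∑-δ {x ∷ xs} {z} f (x∉ ∷ u) (there z∈) = trans (cong₂ _+_ (trans (cong (_* f x) ([?]-no (z ≟ x) λ { refl → All.lookup x∉ z∈ refl })) (*-zeroˡ (f x))) (∑-δ f u z∈)) (+-identityˡ (f z))

    ∑-δ-≤1 : ∀ {xs : List A} z → Unique xs → ∑ xs (λ x → [ z ≟ x ?]) ≤ 1ℚ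
    ∑-δ-≤1 z [] = 0≤1
    ∑-δ-≤1 z (_∷_ {w} {W} w∉ u) with z ≟ w
    ... | no _ = subst (_≤ 1ℚ) (sym (+-identityˡ _)) (∑-δ-≤1 z u)
    ... | yes refl = ≤-reflexive (trans (cong (1ℚ +_) (trans (∑-cong W λ w′ w′∈ → [?]-no (z ≟ w′) (All.lookup w∉ w′∈)) (∑-0 W))) (+-identityʳ 1ℚ))

-- Rational rotations of the circle and the lengths of chords

module Rotations where

  open import Data.Integer.Base as ℤ using (ℤ; +_; -[1+_])
  import Data.Nat.DivMod as ℕ
  open import Data.Rational.Base
  open import Data.Rational.Properties
  open RationalOrder
  open ListSum

  2ℚ 4ℚ 8ℚ 16ℚ 32ℚ 64ℚ 1024ℚ : ℚ
  2ℚ = 1ℚ + 1ℚ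
  4ℚ = 2ℚ * 2ℚ
  8ℚ = 4ℚ * 2ℚ
  16ℚ = 4ℚ * 4ℚ
  32ℚ = 8ℚ * 4ℚ
  64ℚ = 8ℚ * 8ℚ
  1024ℚ = 32ℚ * 32ℚ

  -- The rotation by twice the angle of slope 1/T, so that its cosine and sine are rational.
  record Slope : Set where
    field
      T : ℕ
      3≤T : 3 ℕ.≤ T
      c₁ s₁ : ℚ
      s₁≡ : s₁ ≡ ιₙ T * (1ℚ - c₁)
      Ts₁≡ : ιₙ T * s₁ ≡ 1ℚ + c₁

  module Rotation (slope : Slope) where
    open Slope slope

    t : ℚ
    t = ιₙ T

    unit₁ : c₁ * c₁ + s₁ * s₁ ≡ 1ℚ
    unit₁ = begin
      c₁ * c₁ + s₁ * s₁ ≡⟨ cong (λ z → c₁ * c₁ + z * s₁) s₁≡ ⟩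
      c₁ * c₁ + t * (1ℚ - c₁) * s₁ ≡⟨ l₁ c₁ t s₁ ⟩
      c₁ * c₁ + (1ℚ - c₁) * (t * s₁) ≡⟨ cong (λ z → c₁ * c₁ + (1ℚ - c₁) * z) Ts₁≡ ⟩
      c₁ * c₁ + (1ℚ - c₁) * (1ℚ + c₁) ≡⟨ l₂ c₁ ⟩
      1ℚ ∎
      where
      open ≡-Reasoning
      l₁ : ∀ c t s → c * c + t * (1ℚ - c) * s ≡ c * c + (1ℚ - c) * (t * s)
      l₁ = solve-∀ ℚ-ring
      l₂ : ∀ c → c * c + (1ℚ - c) * (1ℚ + c) ≡ 1ℚ
      l₂ = solve-∀ ℚ-ring

    C S : ℕ → ℚ
    C zero = 1ℚ
    C (suc n) = C n * c₁ - S n * s₁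
    S zero = 0ℚ
    S (suc n) = S n * c₁ + C n * s₁

    C₁≡ : C 1 ≡ c₁
    C₁≡ = l c₁ s₁
      where
      l : ∀ c s → 1ℚ * c - 0ℚ * s ≡ c
      l = solve-∀ ℚ-ring

    S₁≡ : S 1 ≡ s₁
    S₁≡ = l c₁ s₁
      where
      l : ∀ c s → 0ℚ * c + 1ℚ * s ≡ s
      l = solve-∀ ℚ-ring

    c s : ℤ → ℚ
    c (+ n) = C n
    c -[1+ n ] = C (suc n)
    s (+ n) = S n
    s -[1+ n ] = - S (suc n)

    c-neg : ∀ i → c (ℤ.- i) ≡ c i
    c-neg (+ zero) = refl
    c-neg (+ suc n) = refl
    c-neg -[1+ n ] = refl

    s-neg : ∀ i → s (ℤ.- i) ≡ - s i
    s-neg (+ zero) = refl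
    s-neg (+ suc n) = refl
    s-neg -[1+ n ] = l (S (suc n))
      where
      l : ∀ a → a ≡ - (- a)
      l = solve-∀ ℚ-ring

    private
      unit-C : ∀ n → C n * C n + S n * S n ≡ 1ℚ
      unit-C zero = refl
      unit-C (suc n) = trans (l (C n) (S n) c₁ s₁) (trans (cong₂ _*_ (unit-C n) unit₁) refl)
        where
        l : ∀ x y c s → (x * c - y * s) * (x * c - y * s) + (y * c + x * s) * (y * c + x * s)
          ≡ (x * x + y * y) * (c * c + s * s)
        l = solve-∀ ℚ-ring

      back-C : ∀ n → C n ≡ C (suc n) * c₁ + S (suc n) * s₁
      back-C n = trans (l₁ (C n)) (trans (cong (C n *_) (sym unit₁)) (l (C n) (S n) c₁ s₁))
        where
        l₁ : ∀ x → x ≡ x * 1ℚ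
        l₁ = solve-∀ ℚ-ring
        l : ∀ x y c s → x * (c * c + s * s) ≡ (x * c - y * s) * c + (y * c + x * s) * s
        l = solve-∀ ℚ-ring

      back-S : ∀ n → S n ≡ S (suc n) * c₁ - C (suc n) * s₁
      back-S n = trans (l₁ (S n)) (trans (cong (S n *_) (sym unit₁)) (l (C n) (S n) c₁ s₁))
        where
        l₁ : ∀ x → x ≡ x * 1ℚ
        l₁ = solve-∀ ℚ-ring
        l : ∀ x y c s → y * (c * c + s * s) ≡ (y * c + x * s) * c - (x * c - y * s) * s
        l = solve-∀ ℚ-ring

      step-c : ∀ i → c (ℤ.suc i) ≡ c i * c₁ - s i * s₁
      step-c (+ n) = refl
      step-c -[1+ zero ] = trans (back-C 0) (l (C 1) (S 1) c₁ s₁)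
        where
        l : ∀ x y c s → x * c + y * s ≡ x * c - (- y) * s
        l = solve-∀ ℚ-ring
      step-c -[1+ suc n ] = trans (back-C (suc n)) (l (C (suc (suc n))) (S (suc (suc n))) c₁ s₁)
        where
        l : ∀ x y c s → x * c + y * s ≡ x * c - (- y) * s
        l = solve-∀ ℚ-ring

      step-s : ∀ i → s (ℤ.suc i) ≡ s i * c₁ + c i * s₁
      step-s (+ n) = refl
      step-s -[1+ zero ] = trans (back-S 0) (trans (l₀ (C 1) (S 1) c₁ s₁ (back-S 0)) refl)
        where
        l₁ : ∀ x y c s → - (y * c - x * s) ≡ (- y) * c + x * s
        l₁ = solve-∀ ℚ-ring
        l₀ : ∀ x y c s → 0ℚ ≡ y * c - x * s → y * c - x * s ≡ (- y) * c + x * s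
        l₀ x y c s eq = trans (sym eq) (trans (cong -_ eq) (l₁ x y c s))
      step-s -[1+ suc n ] = trans (cong -_ (back-S (suc n))) (l (C (suc (suc n))) (S (suc (suc n))) c₁ s₁)
        where
        l : ∀ x y c s → - (y * c - x * s) ≡ (- y) * c + x * s
        l = solve-∀ ℚ-ring

      back-c : ∀ i → c i ≡ c (ℤ.suc i) * c₁ + s (ℤ.suc i) * s₁
      back-c i = sym (begin
        c (ℤ.suc i) * c₁ + s (ℤ.suc i) * s₁
          ≡⟨ cong₂ (λ x y → x * c₁ + y * s₁) (step-c i) (step-s i) ⟩
        (c i * c₁ - s i * s₁) * c₁ + (s i * c₁ + c i * s₁) * s₁ ≡⟨ l (c i) (s i) c₁ s₁ ⟩
        c i * (c₁ * c₁ + s₁ * s₁) ≡⟨ cong (c i *_) unit₁ ⟩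
        c i * 1ℚ ≡⟨ *-identityʳ (c i) ⟩
        c i ∎)
        where
        open ≡-Reasoning
        l : ∀ x y c s → (x * c - y * s) * c + (y * c + x * s) * s ≡ x * (c * c + s * s)
        l = solve-∀ ℚ-ring

      back-s : ∀ i → s i ≡ s (ℤ.suc i) * c₁ - c (ℤ.suc i) * s₁
      back-s i = sym (begin
        s (ℤ.suc i) * c₁ - c (ℤ.suc i) * s₁
          ≡⟨ cong₂ (λ x y → y * c₁ - x * s₁) (step-c i) (step-s i) ⟩
        (s i * c₁ + c i * s₁) * c₁ - (c i * c₁ - s i * s₁) * s₁ ≡⟨ l (c i) (s i) c₁ s₁ ⟩
        s i * (c₁ * c₁ + s₁ * s₁) ≡⟨ cong (s i *_) unit₁ ⟩
        s i * 1ℚ ≡⟨ *-identityʳ (s i) ⟩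
        s i ∎)
        where
        open ≡-Reasoning
        l : ∀ x y c s → (y * c + x * s) * c - (x * c - y * s) * s ≡ y * (c * c + s * s)
        l = solve-∀ ℚ-ring

      Add : ℤ → ℤ → Set
      Add i j = (c (i ℤ.+ j) ≡ c i * c j - s i * s j) × (s (i ℤ.+ j) ≡ s i * c j + c i * s j)

      add-suc : ∀ i j → Add i j → Add (ℤ.suc i) j
      add-suc i j (p , q) =
        trans (cong c (ℤ.+-assoc (+ 1) i j)) (trans (step-c (i ℤ.+ j)) (trans
          (cong₂ (λ x y → x * c₁ - y * s₁) p q) (trans (l₁ (c i) (s i) (c j) (s j) c₁ s₁)
          (sym (cong₂ (λ x y → x * c j - y * s j) (step-c i) (step-s i)))))) ,
        trans (cong s (ℤ.+-assoc (+ 1) i j)) (trans (step-s (i ℤ.+ j)) (trans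
          (cong₂ (λ x y → y * c₁ + x * s₁) p q) (trans (l₂ (c i) (s i) (c j) (s j) c₁ s₁)
          (sym (cong₂ (λ x y → y * c j + x * s j) (step-c i) (step-s i))))))
        where
        l₁ : ∀ x y u v c s → (x * u - y * v) * c - (y * u + x * v) * s ≡ (x * c - y * s) * u - (y * c + x * s) * v
        l₁ = solve-∀ ℚ-ring
        l₂ : ∀ x y u v c s → (y * u + x * v) * c + (x * u - y * v) * s ≡ (y * c + x * s) * u + (x * c - y * s) * v
        l₂ = solve-∀ ℚ-ring

      add-pred : ∀ i j → Add (ℤ.suc i) j → Add i j
      add-pred i j (p , q) =
        trans (back-c (i ℤ.+ j)) (trans (cong₂ (λ x y → x * c₁ + y * s₁) p′ q′)
          (trans (l₁ (c (ℤ.suc i)) (s (ℤ.suc i)) (c j) (s j) c₁ s₁)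
            (sym (cong₂ (λ x y → x * c j - y * s j) (back-c i) (back-s i))))) ,
        trans (back-s (i ℤ.+ j)) (trans (cong₂ (λ x y → y * c₁ - x * s₁) p′ q′)
          (trans (l₂ (c (ℤ.suc i)) (s (ℤ.suc i)) (c j) (s j) c₁ s₁)
            (sym (cong₂ (λ x y → y * c j + x * s j) (back-c i) (back-s i)))))
        where
        p′ = trans (cong c (sym (ℤ.+-assoc (+ 1) i j))) p
        q′ = trans (cong s (sym (ℤ.+-assoc (+ 1) i j))) q
        l₁ : ∀ x y u v c s → (x * u - y * v) * c + (y * u + x * v) * s ≡ (x * c + y * s) * u - (y * c - x * s) * v
        l₁ = solve-∀ ℚ-ring
        l₂ : ∀ x y u v c s → (y * u + x * v) * c - (x * u - y * v) * s ≡ (y * c - x * s) * u + (x * c + y * s) * v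
        l₂ = solve-∀ ℚ-ring

      add : ∀ i j → Add i j
      add (+ zero) j = trans (cong c (ℤ.+-identityˡ j)) (l₁ (c j) (s j)) ,
                             trans (cong s (ℤ.+-identityˡ j)) (l₂ (c j) (s j))
        where
        l₁ : ∀ u v → u ≡ 1ℚ * u - 0ℚ * v
        l₁ = solve-∀ ℚ-ring
        l₂ : ∀ u v → v ≡ 0ℚ * u + 1ℚ * v
        l₂ = solve-∀ ℚ-ring
      add (+ suc n) j = add-suc (+ n) j (add (+ n) j)
      add -[1+ zero ] j = add-pred -[1+ zero ] j (add (+ zero) j)
      add -[1+ suc n ] j = add-pred -[1+ suc n ] j (add -[1+ n ] j)

    c-+ : ∀ i j → c (i ℤ.+ j) ≡ c i * c j - s i * s j
    c-+ i j = proj₁ (add i j)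

    s-+ : ∀ i j → s (i ℤ.+ j) ≡ s i * c j + c i * s j
    s-+ i j = proj₂ (add i j)

    unit : ∀ i → c i * c i + s i * s i ≡ 1ℚ
    unit (+ n) = unit-C n
    unit -[1+ n ] = trans (l (C (suc n)) (S (suc n))) (unit-C (suc n))
      where
      l : ∀ x y → x * x + (- y) * (- y) ≡ x * x + y * y
      l = solve-∀ ℚ-ring

    module _ where
      private
        le : ∀ x y → x * x + y * y ≡ 1ℚ → x ≤ 1ℚ
        le x y eq = sq-cancel-≤ 0≤1 (≤-by (y * y) (sq-nonNeg y) (trans (*-identityˡ 1ℚ) (sym eq)))

      c≤1 : ∀ i → c i ≤ 1ℚ
      c≤1 i = le (c i) (s i) (unit i)

      s≤1 : ∀ i → s i ≤ 1ℚ
      s≤1 i = le (s i) (c i) (trans (+-comm (s i * s i) (c i * c i)) (unit i))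

      -1≤c : ∀ i → - 1ℚ ≤ c i
      -1≤c i = subst (- 1ℚ ≤_) (l₂ (c i)) (neg-antimono-≤ (le (- c i) (s i) (trans (l (c i) (s i)) (unit i))))
        where
        l : ∀ x y → (- x) * (- x) + y * y ≡ x * x + y * y
        l = solve-∀ ℚ-ring
        l₂ : ∀ x → - (- x) ≡ x
        l₂ = solve-∀ ℚ-ring

    -- An exact discrete form of sin' = cos: `T` is the cotangent of half a step, so the increment
    -- of the sine is the sum of the two adjacent cosines divided by `T`. Trigonometric sums
    -- telescope through it.
    mid-S : ∀ n → t * (S (suc n) - S n) ≡ C n + C (suc n)
    mid-S n = begin
      t * (S n * c₁ + C n * s₁ - S n) ≡⟨ l₁ t (C n) (S n) c₁ s₁ ⟩
      C n * (t * s₁) - S n * (t * (1ℚ - c₁)) ≡⟨ cong₂ (λ x y → C n * x - S n * y) Ts₁≡ (sym s₁≡) ⟩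
      C n * (1ℚ + c₁) - S n * s₁ ≡⟨ l₂ (C n) (S n) c₁ s₁ ⟩
      C n + (C n * c₁ - S n * s₁) ∎
      where
      open ≡-Reasoning
      l₁ : ∀ t x y c s → t * (y * c + x * s - y) ≡ x * (t * s) - y * (t * (1ℚ - c))
      l₁ = solve-∀ ℚ-ring
      l₂ : ∀ x y c s → x * (1ℚ + c) - y * s ≡ x + (x * c - y * s)
      l₂ = solve-∀ ℚ-ring

    mid-C : ∀ n → t * (C n - C (suc n)) ≡ S n + S (suc n)
    mid-C n = begin
      t * (C n - (C n * c₁ - S n * s₁)) ≡⟨ l₁ t (C n) (S n) c₁ s₁ ⟩
      S n * (t * s₁) + C n * (t * (1ℚ - c₁)) ≡⟨ cong₂ (λ x y → S n * x + C n * y) Ts₁≡ (sym s₁≡) ⟩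
      S n * (1ℚ + c₁) + C n * s₁ ≡⟨ l₂ (C n) (S n) c₁ s₁ ⟩
      S n + (S n * c₁ + C n * s₁) ∎
      where
      open ≡-Reasoning
      l₁ : ∀ t x y c s → t * (x - (x * c - y * s)) ≡ y * (t * s) + x * (t * (1ℚ - c))
      l₁ = solve-∀ ℚ-ring
      l₂ : ∀ x y c s → y * (1ℚ + c) + x * s ≡ y + (y * c + x * s)
      l₂ = solve-∀ ℚ-ring

    0<t : 0ℚ < t
    0<t = subst (_< t) (ι-def _) (ιₙ-mono-< (ℕ.≤-trans (ℕ.s≤s ℕ.z≤n) 3≤T))

    3≤t : 2ℚ + 1ℚ ≤ t
    3≤t = subst (_≤ t) (ι-def _) (ιₙ-mono-≤ 3≤T)

    private
      t-cancel : ∀ {a b} → t * a ≤ t * b → a ≤ b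
      t-cancel {a} {b} p = *-cancelʳ-≤ 0<t (subst₂ _≤_ (*-comm t a) (*-comm t b) p)

    0≤s₁ : 0ℚ ≤ s₁
    0≤s₁ = t-cancel (subst₂ _≤_ (sym (*-zeroʳ t)) (sym Ts₁≡)
      (subst (_≤ 1ℚ + c₁) refl (+-monoʳ-≤ 1ℚ (subst (- 1ℚ ≤_) C₁≡ (-1≤c (+ 1))))))

    -- c₁ = -1 would force s₁ = 0, while s₁ = T (1 - c₁).
    0<s₁ : 0ℚ < s₁
    0<s₁ with 0ℚ <? s₁
    ... | yes p = p
    ... | no ¬p = contradiction (≤-antisym (subst (_≤ 0ℚ) (trans Ts₁≡ refl) ts₁≤0) (subst (0ℚ ≤_) Ts₁≡ (*-nonNeg (<⇒≤ 0<t) 0≤s₁))) absurd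
      where
      ts₁≤0 : t * s₁ ≤ 0ℚ
      ts₁≤0 = subst (t * s₁ ≤_) (*-zeroʳ t) (*-mono-≤ˡ (<⇒≤ 0<t) (≮⇒≥ ¬p))
      absurd : ¬ (1ℚ + c₁ ≡ 0ℚ)
      absurd eq = contradiction (≮⇒≥ ¬p) (<⇒≱ (subst (0ℚ <_) (sym s₁≡) (*-pos 0<t (<-by 2ℚ (positive⁻¹ 2ℚ) (l c₁ eq)))))
        where
        l₁ : ∀ c → 1ℚ - c ≡ 2ℚ - (1ℚ + c)
        l₁ = solve-∀ ℚ-ring
        l : ∀ c → 1ℚ + c ≡ 0ℚ → 1ℚ - c ≡ 0ℚ + 2ℚ
        l c eq = trans (l₁ c) (trans (cong (λ z → 2ℚ - z) eq) refl)

    ts₁≤2 : t * s₁ ≤ 2ℚ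
    ts₁≤2 = subst (_≤ 2ℚ) (sym Ts₁≡) (+-monoʳ-≤ 1ℚ (subst (_≤ 1ℚ) C₁≡ (c≤1 (+ 1))))

    s₁≤⅔ : (2ℚ + 1ℚ) * s₁ ≤ 2ℚ
    s₁≤⅔ = ≤-trans (*-mono-≤ʳ 0≤s₁ 3≤t) ts₁≤2

    0≤c₁ : 0ℚ ≤ c₁
    0≤c₁ = *-cancelʳ-≤ {2ℚ + 1ℚ} (positive⁻¹ (2ℚ + 1ℚ)) (subst (_≤ c₁ * (2ℚ + 1ℚ)) (sym (*-zeroˡ (2ℚ + 1ℚ)))
      (≤-by⁻ (≤-trans (*-mono-≤ʳ 0≤1-c₁ 3≤t) (subst (_≤ 2ℚ) (trans s₁≡ refl) s₁≤2))))
      where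
      s₁≤2 : s₁ ≤ 2ℚ
      s₁≤2 = ≤-trans (subst (_≤ 1ℚ) S₁≡ (s≤1 (+ 1))) (≤-by 1ℚ 0≤1 refl)
      0≤1-c₁ : 0ℚ ≤ 1ℚ - c₁
      0≤1-c₁ = ≤⇒0≤ (subst (_≤ 1ℚ) C₁≡ (c≤1 (+ 1)))
      ≤-by⁻ : (2ℚ + 1ℚ) * (1ℚ - c₁) ≤ 2ℚ → 0ℚ ≤ c₁ * (2ℚ + 1ℚ)
      ≤-by⁻ p = ≤-by (2ℚ - (2ℚ + 1ℚ) * (1ℚ - c₁) + 1ℚ) (+-nonNeg (≤⇒0≤ p) 0≤1) (l c₁)
        where
        l : ∀ c → c * (2ℚ + 1ℚ) ≡ 0ℚ + (2ℚ - (2ℚ + 1ℚ) * (1ℚ - c) + 1ℚ)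
        l = solve-∀ ℚ-ring

    private
      S-step : ∀ n → 0ℚ ≤ C n → 0ℚ ≤ C (suc n) → S n ≤ S (suc n)
      S-step n p q = t-cancel (0≤⇒≤ (subst (0ℚ ≤_) (trans (sym (mid-S n)) (l t (S n) (S (suc n)))) (+-nonNeg p q)))
        where
        l : ∀ t x y → t * (y - x) ≡ t * y - t * x
        l = solve-∀ ℚ-ring

      S-nonNeg : ∀ n → (∀ j → j ℕ.≤ n → 0ℚ ≤ C j) → 0ℚ ≤ S n
      S-nonNeg zero _ = ≤-refl
      S-nonNeg (suc n) p = ≤-trans (S-nonNeg n λ j j≤n → p j (ℕ.m≤n⇒m≤1+n j≤n))
        (S-step n (p n (ℕ.n≤1+n n)) (p (suc n) ℕ.≤-refl))

      1≤C+S : ∀ n → 0ℚ ≤ C n → 0ℚ ≤ S n → 1ℚ ≤ C n + S n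
      1≤C+S n p q = sq-cancel-≤ (+-nonNeg p q) (≤-by (2ℚ * (C n * S n)) (*-nonNeg (nonNegative⁻¹ 2ℚ) (*-nonNeg p q))
        (trans (l (C n) (S n)) (cong (_+ 2ℚ * (C n * S n)) (unit (+ n)))))
        where
        l : ∀ x y → (x + y) * (x + y) ≡ x * x + y * y + 2ℚ * (x * y)
        l = solve-∀ ℚ-ring

      -- In the first quadrant cosine plus sine is at least 1, and their sums telescope by `mid-S`
      -- and `mid-C`. While the cosine is positive the right side stays below `2ℚ * t`, so the
      -- quadrant ends within `T` steps.
      turn : ∀ n → (∀ j → j ℕ.≤ n → 0ℚ ≤ C j) → 2ℚ * ιₙ n ≤ t * (S n - C n + 1ℚ)
      turn zero _ = ≤-reflexive (trans (cong (2ℚ *_) (ι-def _)) (sym (*-zeroʳ t)))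
      turn (suc n) p = begin
        2ℚ * ιₙ (suc n) ≡⟨ cong (2ℚ *_) (ιₙ-suc n) ⟩
        2ℚ * (1ℚ + ιₙ n) ≡⟨ l₁ (ιₙ n) ⟩
        2ℚ * ιₙ n + (1ℚ + 1ℚ) ≤⟨ +-mono-≤ (turn n p′)
                                                            (+-mono-≤ (1≤C+S n (p n (ℕ.n≤1+n n)) (S-nonNeg n p′))
                                                                      (1≤C+S (suc n) (p (suc n) ℕ.≤-refl) (S-nonNeg (suc n) p))) ⟩
        t * (S n - C n + 1ℚ) + ((C n + S n) + (C (suc n) + S (suc n)))
                                                      ≡⟨ cong (λ z → t * (S n - C n + 1ℚ) + z) (l₂ (C n) (S n) (C (suc n)) (S (suc n))) ⟩
        t * (S n - C n + 1ℚ) + ((C n + C (suc n)) + (S n + S (suc n)))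
                                                      ≡⟨ cong (λ z → t * (S n - C n + 1ℚ) + z) (cong₂ _+_ (mid-S n) (mid-C n)) ⟨
        t * (S n - C n + 1ℚ) + (t * (S (suc n) - S n) + t * (C n - C (suc n)))
                                                      ≡⟨ l₃ t (C n) (S n) (C (suc n)) (S (suc n)) ⟩
        t * (S (suc n) - C (suc n) + 1ℚ) ∎
        where
        open ≤-Reasoning
        p′ : ∀ j → j ℕ.≤ n → 0ℚ ≤ C j
        p′ j j≤n = p j (ℕ.m≤n⇒m≤1+n j≤n)
        l₁ : ∀ n → 2ℚ * (1ℚ + n) ≡ 2ℚ * n + (1ℚ + 1ℚ)
        l₁ = solve-∀ ℚ-ring
        l₂ : ∀ a b c d → (a + b) + (c + d) ≡ (a + c) + (b + d)
        l₂ = solve-∀ ℚ-ring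
        l₃ : ∀ t x y u v → t * (y - x + 1ℚ) + (t * (v - y) + t * (x - u)) ≡ t * (v - u + 1ℚ)
        l₃ = solve-∀ ℚ-ring

      search : ∀ n → (∃[ q ] (q ℕ.≤ n × C q ≤ 0ℚ × (∀ j → j ℕ.< q → 0ℚ < C j))) ⊎ (∀ j → j ℕ.≤ n → 0ℚ < C j)
      search zero = inj₂ λ { zero ℕ.z≤n → positive⁻¹ 1ℚ }
      search (suc n) with search n
      ... | inj₁ (q , q≤n , r) = inj₁ (q , ℕ.m≤n⇒m≤1+n q≤n , r)
      ... | inj₂ all with C (suc n) ≤? 0ℚ
      ... | yes p = inj₁ (suc n , ℕ.≤-refl , p , λ j j< → all j (ℕ.s≤s⁻¹ j<))
      ... | no ¬p = inj₂ λ j j≤ → extend j j≤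
        where
        extend : ∀ j → j ℕ.≤ suc n → 0ℚ < C j
        extend j j≤ with ℕ.m≤n⇒m<n∨m≡n j≤
        ... | inj₁ j< = all j (ℕ.s≤s⁻¹ j<)
        ... | inj₂ refl = ≰⇒> ¬p

      quarter : ∃[ q ] (q ℕ.≤ T × C q ≤ 0ℚ × (∀ j → j ℕ.< q → 0ℚ < C j))
      quarter with search T
      ... | inj₁ r = r
      ... | inj₂ all = contradiction (turn T λ j j≤ → <⇒≤ (all j j≤)) (<⇒≱ (subst (t * (S T - C T + 1ℚ) <_) (*-comm t 2ℚ)
          (*-monoʳ-<-pos t {{positive 0<t}} (<-by (1ℚ - S T + C T) (subst (0ℚ <_) (+-comm (C T) (1ℚ - S T)) (+-pos (all T ℕ.≤-refl) (≤⇒0≤ (s≤1 (+ T)))))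
            (l (S T) (C T))))))
        where
        l : ∀ x y → 2ℚ ≡ x - y + 1ℚ + (1ℚ - x + y)
        l = solve-∀ ℚ-ring

    opaque
      -- The number of steps in a quarter turn, rounded up.
      q : ℕ
      q = proj₁ quarter

      q≤T : q ℕ.≤ T
      q≤T = proj₁ (proj₂ quarter)

      Cq≤0 : C q ≤ 0ℚ
      Cq≤0 = proj₁ (proj₂ (proj₂ quarter))

      0<C : ∀ {j} → j ℕ.< q → 0ℚ < C j
      0<C {j} = proj₂ (proj₂ (proj₂ quarter)) j

    1≤q : 1 ℕ.≤ q
    1≤q = go q Cq≤0
      where
      go : ∀ q → C q ≤ 0ℚ → 1 ℕ.≤ q
      go zero p = contradiction p (<⇒≱ (positive⁻¹ 1ℚ))
      go (suc q) _ = ℕ.s≤s ℕ.z≤n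

    0≤S : ∀ {j} → j ℕ.< q → 0ℚ ≤ S j
    0≤S {j} j<q = S-nonNeg j λ i i≤j → <⇒≤ (0<C (ℕ.≤-<-trans i≤j j<q))

    private
      -- One step earlier the cosine is still positive and the sine non-negative, so the rounded
      -- quarter turn overshoots the vertical axis by at most one step.
      atq : ∀ q′ → q′ ℕ.< q → (0ℚ < S (suc q′)) × (- s₁ ≤ C (suc q′))
      atq q′ q′<q =
        subst (0ℚ <_) (+-comm (C q′ * s₁) (S q′ * c₁)) (+-pos (*-pos (0<C q′<q) 0<s₁) (*-nonNeg (0≤S q′<q) 0≤c₁)) ,
        ≤-by (C q′ * c₁ + (1ℚ - S q′) * s₁) (+-nonNeg (*-nonNeg (<⇒≤ (0<C q′<q)) 0≤c₁) (*-nonNeg (≤⇒0≤ (s≤1 (+ q′))) 0≤s₁))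
          (l (C q′) (S q′) c₁ s₁)
        where
        l : ∀ x y c s → x * c - y * s ≡ - s + (x * c + (1ℚ - y) * s)
        l = solve-∀ ℚ-ring
      q-pred : suc (ℕ.pred q) ≡ q
      q-pred = ℕ.suc-pred q {{ℕ.>-nonZero 1≤q}}

    0<Sq : 0ℚ < S q
    0<Sq = subst (λ k → 0ℚ < S k) q-pred (proj₁ (atq (ℕ.pred q) (ℕ.≤-reflexive q-pred)))

    -s₁≤Cq : - s₁ ≤ C q
    -s₁≤Cq = subst (λ k → - s₁ ≤ C k) q-pred (proj₂ (atq (ℕ.pred q) (ℕ.≤-reflexive q-pred)))

    Cq²≤s₁² : C q * C q ≤ s₁ * s₁
    Cq²≤s₁² = ≤-by ((s₁ + C q) * (s₁ - C q)) (*-nonNeg (subst (0ℚ ≤_) (l₁ (C q) s₁) (≤⇒0≤ -s₁≤Cq))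
        (+-nonNeg 0≤s₁ (neg-nonNeg Cq≤0))) (l (C q) s₁)
      where
      l₁ : ∀ x y → x - (- y) ≡ y + x
      l₁ = solve-∀ ℚ-ring
      l : ∀ x y → y * y ≡ x * x + (y + x) * (y - x)
      l = solve-∀ ℚ-ring

    -- The squared chord |e(i) - 1|².
    κ : ℤ → ℚ
    κ i = 2ℚ * (1ℚ - c i)

    κ-nonNeg : ∀ i → 0ℚ ≤ κ i
    κ-nonNeg i = *-nonNeg (nonNegative⁻¹ 2ℚ) (≤⇒0≤ (c≤1 i))

    κ-neg : ∀ i → κ (ℤ.- i) ≡ κ i
    κ-neg i = cong (λ z → 2ℚ * (1ℚ - z)) (c-neg i)

    κ-norm : ∀ i → (c i - 1ℚ) * (c i - 1ℚ) + s i * s i ≡ κ i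
    κ-norm i = trans (l₁ (c i) (s i)) (trans (cong (λ z → z + (1ℚ - 2ℚ * c i)) (unit i)) (l₂ (c i)))
      where
      l₁ : ∀ x y → (x - 1ℚ) * (x - 1ℚ) + y * y ≡ x * x + y * y + (1ℚ - 2ℚ * x)
      l₁ = solve-∀ ℚ-ring
      l₂ : ∀ x → 1ℚ + (1ℚ - 2ℚ * x) ≡ 2ℚ * (1ℚ - x)
      l₂ = solve-∀ ℚ-ring

    -- Real and imaginary part of the geometric sum of e(r y) over 0 ≤ r < n.
    Gc Gs : ℕ → ℤ → ℚ
    Gc n y = ∑ (downFrom n) (λ r → c (+ r ℤ.* y))
    Gs n y = ∑ (downFrom n) (λ r → s (+ r ℤ.* y))

    private
      suc-* : ∀ n y → + suc n ℤ.* y ≡ + n ℤ.* y ℤ.+ y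
      suc-* n y = trans (cong (ℤ._* y) (ℤ.+-comm (+ 1) (+ n))) (trans (ℤ.*-distribʳ-+ y (+ n) (+ 1)) (cong (λ z → + n ℤ.* y ℤ.+ z) (ℤ.*-identityˡ y)))

      geo-c : ∀ n y → Gc n y * (c y - 1ℚ) - Gs n y * s y ≡ c (+ n ℤ.* y) - 1ℚ
      geo-c zero y = l (c y) (s y)
        where
        l : ∀ u v → 0ℚ * (u - 1ℚ) - 0ℚ * v ≡ 1ℚ - 1ℚ
        l = solve-∀ ℚ-ring
      geo-c (suc n) y = begin
        (c ny + Gc n y) * (c y - 1ℚ) - (s ny + Gs n y) * s y
          ≡⟨ l₁ (c ny) (s ny) (Gc n y) (Gs n y) (c y) (s y) ⟩
        (c ny * c y - s ny * s y - c ny) + (Gc n y * (c y - 1ℚ) - Gs n y * s y)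
          ≡⟨ cong₂ (λ a b → a - c ny + b) (sym (c-+ ny y)) (geo-c n y) ⟩
        (c (ny ℤ.+ y) - c ny) + (c ny - 1ℚ) ≡⟨ l₂ (c (ny ℤ.+ y)) (c ny) ⟩
        c (ny ℤ.+ y) - 1ℚ ≡⟨ cong (λ z → c z - 1ℚ) (suc-* n y) ⟨
        c (+ suc n ℤ.* y) - 1ℚ ∎
        where
        open ≡-Reasoning
        ny = + n ℤ.* y
        l₁ : ∀ a b g h u v → (a + g) * (u - 1ℚ) - (b + h) * v ≡ (a * u - b * v - a) + (g * (u - 1ℚ) - h * v)
        l₁ = solve-∀ ℚ-ring
        l₂ : ∀ a b → (a - b) + (b - 1ℚ) ≡ a - 1ℚ
        l₂ = solve-∀ ℚ-ring

      geo-s : ∀ n y → Gc n y * s y + Gs n y * (c y - 1ℚ) ≡ s (+ n ℤ.* y)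
      geo-s zero y = l (c y) (s y)
        where
        l : ∀ u v → 0ℚ * v + 0ℚ * (u - 1ℚ) ≡ 0ℚ
        l = solve-∀ ℚ-ring
      geo-s (suc n) y = begin
        (c ny + Gc n y) * s y + (s ny + Gs n y) * (c y - 1ℚ)
          ≡⟨ l₁ (c ny) (s ny) (Gc n y) (Gs n y) (c y) (s y) ⟩
        (s ny * c y + c ny * s y - s ny) + (Gc n y * s y + Gs n y * (c y - 1ℚ))
          ≡⟨ cong₂ (λ a b → a - s ny + b) (sym (s-+ ny y)) (geo-s n y) ⟩
        (s (ny ℤ.+ y) - s ny) + s ny ≡⟨ l₂ (s (ny ℤ.+ y)) (s ny) ⟩
        s (ny ℤ.+ y) ≡⟨ cong s (suc-* n y) ⟨
        s (+ suc n ℤ.* y) ∎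
        where
        open ≡-Reasoning
        ny = + n ℤ.* y
        l₁ : ∀ a b g h u v → (a + g) * v + (b + h) * (u - 1ℚ) ≡ (b * u + a * v - b) + (g * v + h * (u - 1ℚ))
        l₁ = solve-∀ ℚ-ring
        l₂ : ∀ a b → (a - b) + b ≡ a
        l₂ = solve-∀ ℚ-ring

    -- The squared modulus of the identity (e(y) - 1) · ∑ e(r y) = e(n y) - 1.
    geometric : ∀ n y → (Gc n y * Gc n y + Gs n y * Gs n y) * κ y ≡ κ (+ n ℤ.* y)
    geometric n y = begin
      (Gc n y * Gc n y + Gs n y * Gs n y) * κ y ≡⟨ cong ((Gc n y * Gc n y + Gs n y * Gs n y) *_) (κ-norm y) ⟨
      (Gc n y * Gc n y + Gs n y * Gs n y) * ((c y - 1ℚ) * (c y - 1ℚ) + s y * s y) ≡⟨ l (Gc n y) (Gs n y) (c y - 1ℚ) (s y) ⟩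
      (Gc n y * (c y - 1ℚ) - Gs n y * s y) * (Gc n y * (c y - 1ℚ) - Gs n y * s y)
        + (Gc n y * s y + Gs n y * (c y - 1ℚ)) * (Gc n y * s y + Gs n y * (c y - 1ℚ))
        ≡⟨ cong₂ (λ a b → a * a + b * b) (geo-c n y) (geo-s n y) ⟩
      (c ny - 1ℚ) * (c ny - 1ℚ) + s ny * s ny ≡⟨ κ-norm ny ⟩
      κ ny ∎
      where
      open ≡-Reasoning
      ny = + n ℤ.* y
      l : ∀ g h u v → (g * g + h * h) * (u * u + v * v) ≡ (g * u - h * v) * (g * u - h * v) + (g * v + h * u) * (g * v + h * u)
      l = solve-∀ ℚ-ring

    -- By `geometric` the quotient of the two squared chords is the squared modulus of a sum of `n`
    -- unit vectors, which Cauchy-Schwarz bounds by n².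
    κ-* : ∀ n y → κ (+ n ℤ.* y) ≤ ιₙ n * ιₙ n * κ y
    κ-* n y = subst (_≤ ιₙ n * ιₙ n * κ y) (geometric n y) (*-mono-≤ʳ (κ-nonNeg y) (begin
      Gc n y * Gc n y + Gs n y * Gs n y
        ≤⟨ +-mono-≤ (cauchy-schwarz rs (λ r → c (+ r ℤ.* y))) (cauchy-schwarz rs (λ r → s (+ r ℤ.* y))) ⟩
      l * ∑ rs (λ r → c (+ r ℤ.* y) * c (+ r ℤ.* y)) + l * ∑ rs (λ r → s (+ r ℤ.* y) * s (+ r ℤ.* y))
        ≡⟨ *-distribˡ-+ l _ _ ⟨
      l * (∑ rs (λ r → c (+ r ℤ.* y) * c (+ r ℤ.* y)) + ∑ rs (λ r → s (+ r ℤ.* y) * s (+ r ℤ.* y)))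
        ≡⟨ cong (l *_) (∑-+ rs _ _) ⟨
      l * ∑ rs (λ r → c (+ r ℤ.* y) * c (+ r ℤ.* y) + s (+ r ℤ.* y) * s (+ r ℤ.* y))
        ≡⟨ cong (l *_) (∑-ext rs λ r → unit (+ r ℤ.* y)) ⟩
      l * ∑ rs (λ _ → 1ℚ) ≡⟨ cong₂ _*_ l≡ (trans (∑-1 rs) l≡) ⟩
      ιₙ n * ιₙ n ∎))
      where
      open ≤-Reasoning
      rs = downFrom n
      l = ιₙ (length rs)
      l≡ : l ≡ ιₙ n
      l≡ = cong ιₙ (length-downFrom n)

    -- Four rounded quarter turns. Because of the rounding, `N` steps make a full turn only up to
    -- the small chord controlled by `κ-turn`.
    N : ℕ
    N = 4 ℕ.* q

    N≤4T : ιₙ N ≤ 4ℚ * t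
    N≤4T = subst (_≤ 4ℚ * t) (sym (trans (ιₙ-* 4 q) (cong (_* ιₙ q) (ι-def _)))) (*-mono-≤ˡ (nonNegative⁻¹ 4ℚ) (ιₙ-mono-≤ q≤T))

    private
      abs-sq : (P : ℤ → ℚ → Set) → (∀ i x → P i x → P (ℤ.- i) x) → (∀ n → P (+ n) (ιₙ n * ιₙ n)) → ∀ i → P i (ι i * ι i)
      abs-sq P neg pos (+ n) = pos n
      abs-sq P neg pos -[1+ n ] = subst (P -[1+ n ]) (trans (l (ιₙ (suc n))) (sym (cong₂ _*_ (ι-neg (+ suc n)) (ι-neg (+ suc n)))))
        (neg (+ suc n) _ (pos (suc n)))
        where
        l : ∀ a → a * a ≡ (- a) * (- a)
        l = solve-∀ ℚ-ring

      κ₁ : t * t * κ (+ 1) ≤ 4ℚ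
      κ₁ = begin
        t * t * κ (+ 1) ≡⟨ cong (λ z → t * t * (2ℚ * (1ℚ - z))) C₁≡ ⟩
        t * t * (2ℚ * (1ℚ - c₁)) ≡⟨ l t c₁ ⟩
        2ℚ * (t * (t * (1ℚ - c₁))) ≡⟨ cong (λ z → 2ℚ * (t * z)) s₁≡ ⟨
        2ℚ * (t * s₁) ≤⟨ *-mono-≤ˡ (nonNegative⁻¹ 2ℚ) ts₁≤2 ⟩
        4ℚ ∎
        where
        open ≤-Reasoning
        l : ∀ t c → t * t * (2ℚ * (1ℚ - c)) ≡ 2ℚ * (t * (t * (1ℚ - c)))
        l = solve-∀ ℚ-ring

    N²≤16t² : ιₙ N * ιₙ N ≤ 4ℚ * 4ℚ * (t * t)
    N²≤16t² = ≤-trans (sq-mono-≤ (ιₙ-nonNeg N) N≤4T) (≤-reflexive (l t))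
      where
      l : ∀ t → 4ℚ * t * (4ℚ * t) ≡ 4ℚ * 4ℚ * (t * t)
      l = solve-∀ ℚ-ring

    -- One step has chord at most 2/T and N ≤ 4T, whence 64 = 16 · 4.
    κ-upper : ∀ i → ιₙ N * ιₙ N * κ i ≤ 64ℚ * (ι i * ι i)
    κ-upper = abs-sq (λ i x → ιₙ N * ιₙ N * κ i ≤ 64ℚ * x)
      (λ i x → subst (λ z → ιₙ N * ιₙ N * z ≤ 64ℚ * x) (sym (κ-neg i))) λ n → begin
        ιₙ N * ιₙ N * κ (+ n) ≤⟨ *-mono-≤-nonNeg (*-nonNeg (ιₙ-nonNeg N) (ιₙ-nonNeg N))
                                                  (*-nonNeg (*-nonNeg (ιₙ-nonNeg n) (ιₙ-nonNeg n)) (κ-nonNeg (+ 1))) N²≤16t²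
                                                  (subst (λ z → κ z ≤ ιₙ n * ιₙ n * κ (+ 1)) (ℤ.*-identityʳ (+ n)) (κ-* n (+ 1))) ⟩
        4ℚ * 4ℚ * (t * t) * (ιₙ n * ιₙ n * κ (+ 1)) ≡⟨ l t (ιₙ n * ιₙ n) (κ (+ 1)) ⟩
        4ℚ * 4ℚ * (ιₙ n * ιₙ n) * (t * t * κ (+ 1)) ≤⟨ *-mono-≤ˡ (*-nonNeg (nonNegative⁻¹ (4ℚ * 4ℚ)) (sq-nonNeg (ιₙ n))) κ₁ ⟩
        4ℚ * 4ℚ * (ιₙ n * ιₙ n) * 4ℚ ≡⟨ l₂ (ιₙ n * ιₙ n) ⟩
        64ℚ * (ιₙ n * ιₙ n) ∎
      where
      open ≤-Reasoning
      l : ∀ t a k → 4ℚ * 4ℚ * (t * t) * (a * k) ≡ 4ℚ * 4ℚ * a * (t * t * k)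
      l = solve-∀ ℚ-ring
      l₂ : ∀ a → 4ℚ * 4ℚ * a * 4ℚ ≡ 64ℚ * a
      l₂ = solve-∀ ℚ-ring

    private
      C+ : ∀ i j → C (i ℕ.+ j) ≡ C i * C j - S i * S j
      C+ i j = c-+ (+ i) (+ j)

      S-half : S (2 ℕ.* q) ≡ 2ℚ * (S q * C q)
      S-half = trans (cong (λ z → S (q ℕ.+ z)) (ℕ.+-identityʳ q)) (trans (s-+ (+ q) (+ q)) (l (C q) (S q)))
        where
        l : ∀ x y → y * x + x * y ≡ 2ℚ * (y * x)
        l = solve-∀ ℚ-ring

      κ-N : κ (+ N) ≤ 4ℚ * 4ℚ * (s₁ * s₁)
      κ-N = begin
        2ℚ * (1ℚ - C N) ≡⟨ cong (λ z → 2ℚ * (1ℚ - C z)) N≡ ⟩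
        2ℚ * (1ℚ - C (2 ℕ.* q ℕ.+ 2 ℕ.* q)) ≡⟨ cong (λ z → 2ℚ * (1ℚ - z)) (C+ (2 ℕ.* q) (2 ℕ.* q)) ⟩
        2ℚ * (1ℚ - (C₂ * C₂ - S₂ * S₂)) ≡⟨ l₁ C₂ S₂ ⟩
        2ℚ * (1ℚ - (C₂ * C₂ + S₂ * S₂)) + 4ℚ * (S₂ * S₂) ≡⟨ cong₂ (λ a b → 2ℚ * (1ℚ - a) + 4ℚ * (b * b)) (unit (+ (2 ℕ.* q))) S-half ⟩
        2ℚ * (1ℚ - 1ℚ) + 4ℚ * (2ℚ * (S q * C q) * (2ℚ * (S q * C q))) ≡⟨ l₂ (C q) (S q) ⟩
        4ℚ * 4ℚ * (C q * C q * (S q * S q)) ≤⟨ *-mono-≤ˡ (nonNegative⁻¹ (4ℚ * 4ℚ)) (*-mono-≤-nonNeg (sq-nonNeg (C q)) 0≤1 Cq²≤s₁² S²≤1) ⟩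
        4ℚ * 4ℚ * (s₁ * s₁ * 1ℚ) ≡⟨ cong (λ z → 4ℚ * 4ℚ * z) (*-identityʳ (s₁ * s₁)) ⟩
        4ℚ * 4ℚ * (s₁ * s₁) ∎
        where
        open ≤-Reasoning
        C₂ = C (2 ℕ.* q)
        S₂ = S (2 ℕ.* q)
        N≡ : N ≡ 2 ℕ.* q ℕ.+ 2 ℕ.* q
        N≡ = ℕ.*-distribʳ-+ q 2 2
        S²≤1 : S q * S q ≤ 1ℚ
        S²≤1 = sq-mono-≤ (<⇒≤ 0<Sq) (s≤1 (+ q))
        l₁ : ∀ x y → 2ℚ * (1ℚ - (x * x - y * y)) ≡ 2ℚ * (1ℚ - (x * x + y * y)) + 4ℚ * (y * y)
        l₁ = solve-∀ ℚ-ring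
        l₂ : ∀ x y → 2ℚ * (1ℚ - 1ℚ) + 4ℚ * (2ℚ * (y * x) * (2ℚ * (y * x))) ≡ 4ℚ * 4ℚ * (x * x * (y * y))
        l₂ = solve-∀ ℚ-ring

    -- The cosine at the rounded quarter turn lies between -s₁ and 0, and doubling the angle twice
    -- leaves a chord of at most 4 s₁ after `N` steps. With t s₁ ≤ 2 and N ≤ 4T this gives 1024 = 16
    -- · 16 · 4.
    κ-turn : ∀ k → ιₙ N * ιₙ N * κ (+ N ℤ.* k) ≤ 1024ℚ * (ι k * ι k)
    κ-turn = abs-sq (λ k x → ιₙ N * ιₙ N * κ (+ N ℤ.* k) ≤ 1024ℚ * x)
      (λ k x → subst (λ z → ιₙ N * ιₙ N * z ≤ 1024ℚ * x) (trans (sym (κ-neg (+ N ℤ.* k))) (cong κ (ℤ.neg-distribʳ-* (+ N) k)))) λ n → begin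
        ιₙ N * ιₙ N * κ (+ N ℤ.* + n) ≡⟨ cong (λ z → ιₙ N * ιₙ N * κ z) (ℤ.*-comm (+ N) (+ n)) ⟩
        ιₙ N * ιₙ N * κ (+ n ℤ.* + N) ≤⟨ *-mono-≤-nonNeg (*-nonNeg (ιₙ-nonNeg N) (ιₙ-nonNeg N))
                                            (*-nonNeg (sq-nonNeg (ιₙ n)) (*-nonNeg (nonNegative⁻¹ (4ℚ * 4ℚ)) (sq-nonNeg s₁)))
                                            N²≤16t² (≤-trans (κ-* n (+ N)) (*-mono-≤ˡ (sq-nonNeg (ιₙ n)) κ-N)) ⟩
        4ℚ * 4ℚ * (t * t) * (ιₙ n * ιₙ n * (4ℚ * 4ℚ * (s₁ * s₁))) ≡⟨ l t s₁ (ιₙ n * ιₙ n) ⟩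
        4ℚ * 4ℚ * (4ℚ * 4ℚ) * (ιₙ n * ιₙ n) * ((t * s₁) * (t * s₁))
                                       ≤⟨ *-mono-≤ˡ (*-nonNeg (nonNegative⁻¹ (4ℚ * 4ℚ * (4ℚ * 4ℚ))) (sq-nonNeg (ιₙ n)))
                                            (sq-mono-≤ (*-nonNeg (<⇒≤ 0<t) 0≤s₁) ts₁≤2) ⟩
        4ℚ * 4ℚ * (4ℚ * 4ℚ) * (ιₙ n * ιₙ n) * (2ℚ * 2ℚ) ≡⟨ l₂ (ιₙ n * ιₙ n) ⟩
        1024ℚ * (ιₙ n * ιₙ n) ∎
      where
      open ≤-Reasoning
      l : ∀ t s a → 4ℚ * 4ℚ * (t * t) * (a * (4ℚ * 4ℚ * (s * s))) ≡ 4ℚ * 4ℚ * (4ℚ * 4ℚ) * a * ((t * s) * (t * s))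
      l = solve-∀ ℚ-ring
      l₃ : ∀ e a d → e * a * d ≡ e * d * a
      l₃ = solve-∀ ℚ-ring
      l₂ : ∀ a → 4ℚ * 4ℚ * (4ℚ * 4ℚ) * a * (2ℚ * 2ℚ) ≡ 1024ℚ * a
      l₂ a = l₃ (4ℚ * 4ℚ * (4ℚ * 4ℚ)) a (2ℚ * 2ℚ)

    private
      C-left : ∀ i → i ℕ.≤ q → C (q ℕ.+ i) ≤ 0ℚ
      C-left i i≤q with ℕ.m≤n⇒m<n∨m≡n i≤q
      ... | inj₁ i<q = subst (_≤ 0ℚ) (sym (C+ q i)) (≤-by (S q * S i + (- C q) * C i)
          (+-nonNeg (*-nonNeg (<⇒≤ 0<Sq) (0≤S i<q)) (*-nonNeg (neg-nonNeg Cq≤0) (<⇒≤ (0<C i<q)))) (l (C q) (S q) (C i) (S i)))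
        where
        l : ∀ x y u v → 0ℚ ≡ x * u - y * v + (y * v + (- x) * u)
        l = solve-∀ ℚ-ring
      ... | inj₂ i≡q = subst (λ z → C z ≤ 0ℚ) (sym (cong (q ℕ.+_) i≡q)) (subst (_≤ 0ℚ) (sym (C+ q q))
          (≤-by ((1ℚ - 2ℚ * (s₁ * s₁)) + 2ℚ * (s₁ * s₁ - C q * C q)) (+-nonNeg 0≤1-2s₁² (*-nonNeg (nonNegative⁻¹ 2ℚ) (≤⇒0≤ Cq²≤s₁²)))
            (trans (l₁ (C q) (S q) s₁) (cong (λ z → C q * C q - S q * S q + (z - 2ℚ * (s₁ * s₁) + 2ℚ * (s₁ * s₁ - C q * C q))) (unit (+ q))))))
        where
        l₁ : ∀ x y s → 0ℚ ≡ x * x - y * y + (x * x + y * y - 2ℚ * (s * s) + 2ℚ * (s * s - x * x))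
        l₁ = solve-∀ ℚ-ring
        3ℚ = 2ℚ + 1ℚ
        0≤1-2s₁² : 0ℚ ≤ 1ℚ - 2ℚ * (s₁ * s₁)
        0≤1-2s₁² = *-cancelʳ-≤ {3ℚ * 3ℚ} (positive⁻¹ (3ℚ * 3ℚ)) (subst (_≤ (1ℚ - 2ℚ * (s₁ * s₁)) * (3ℚ * 3ℚ)) (sym (*-zeroˡ (3ℚ * 3ℚ)))
          (≤-by (1ℚ + 2ℚ * (4ℚ - 3ℚ * s₁ * (3ℚ * s₁))) (+-nonNeg 0≤1 (*-nonNeg (nonNegative⁻¹ 2ℚ)
            (≤⇒0≤ (sq-mono-≤ (*-nonNeg (nonNegative⁻¹ 3ℚ) 0≤s₁) s₁≤⅔)))) (l₂ s₁)))
          where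
          l₂ : ∀ s → (1ℚ - 2ℚ * (s * s)) * (3ℚ * 3ℚ) ≡ 0ℚ + (1ℚ + 2ℚ * (4ℚ - 3ℚ * s * (3ℚ * s)))
          l₂ = solve-∀ ℚ-ring

      κ-left : ∀ j → q ℕ.≤ j → j ℕ.≤ 2 ℕ.* q → 2ℚ ≤ κ (+ j)
      κ-left j q≤j j≤2q = ≤-by (2ℚ * (- C j)) (*-nonNeg (nonNegative⁻¹ 2ℚ) (neg-nonNeg Cj≤0)) (l (C j))
        where
        l : ∀ x → 2ℚ * (1ℚ - x) ≡ 2ℚ + 2ℚ * (- x)
        l = solve-∀ ℚ-ring
        Cj≤0 : C j ≤ 0ℚ
        Cj≤0 = subst (λ z → C z ≤ 0ℚ) (ℕ.m+[n∸m]≡n q≤j) (C-left (j ℕ.∸ q) (ℕ.m≤n+o⇒m∸n≤o j q (ℕ.≤-trans j≤2q (ℕ.≤-reflexive (cong (q ℕ.+_) (ℕ.+-identityʳ q))))))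

      4q² : ∀ {j} → j ℕ.≤ 2 ℕ.* q → ιₙ j * ιₙ j ≤ 4ℚ * (ιₙ q * ιₙ q)
      4q² {j} p = ≤-trans (sq-mono-≤ (ιₙ-nonNeg j) (subst (ιₙ j ≤_) (trans (ιₙ-* 2 q) (cong (_* ιₙ q) (ι-def _))) (ιₙ-mono-≤ p))) (≤-reflexive (l (ιₙ q)))
        where
        l : ∀ a → 2ℚ * a * (2ℚ * a) ≡ 4ℚ * (a * a)
        l = solve-∀ ℚ-ring

      -- Some multiple n j with n = ⌊q / j⌋ + 1 lands between a quarter and a half turn, where the
      -- squared chord is at least 2. As the chord of n j is at most n times that of j, the latter
      -- cannot be small.
      κ-lowerₙ : ∀ j → j ℕ.≤ 2 ℕ.* q → ιₙ j * ιₙ j ≤ 2ℚ * (ιₙ q * ιₙ q) * κ (+ j)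
      κ-lowerₙ zero _ = subst (_≤ 2ℚ * (ιₙ q * ιₙ q) * κ (+ 0)) (trans (sym (*-zeroˡ 0ℚ)) (cong₂ _*_ (sym (ι-def _)) (sym (ι-def _))))
        (*-nonNeg (*-nonNeg (nonNegative⁻¹ 2ℚ) (sq-nonNeg (ιₙ q))) (κ-nonNeg (+ 0)))
      κ-lowerₙ j@(suc j′) j≤2q with q ℕ.≤? j
      ... | yes q≤j = begin
        ιₙ j * ιₙ j ≤⟨ 4q² j≤2q ⟩
        4ℚ * (ιₙ q * ιₙ q) ≡⟨ l (ιₙ q * ιₙ q) ⟩
        2ℚ * (ιₙ q * ιₙ q) * 2ℚ ≤⟨ *-mono-≤ˡ (*-nonNeg (nonNegative⁻¹ 2ℚ) (sq-nonNeg (ιₙ q))) (κ-left j q≤j j≤2q) ⟩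
        2ℚ * (ιₙ q * ιₙ q) * κ (+ j) ∎
        where
        open ≤-Reasoning
        l : ∀ a → 4ℚ * a ≡ 2ℚ * a * 2ℚ
        l = solve-∀ ℚ-ring
      ... | no q≰j = *-cancelʳ-≤ {2ℚ} (positive⁻¹ 2ℚ) (begin
        ιₙ j * ιₙ j * 2ℚ ≤⟨ *-mono-≤ˡ (sq-nonNeg (ιₙ j)) (κ-left (n ℕ.* j) q≤nj nj≤2q) ⟩
        ιₙ j * ιₙ j * κ (+ (n ℕ.* j)) ≤⟨ *-mono-≤ˡ (sq-nonNeg (ιₙ j)) (subst (λ z → κ z ≤ ιₙ n * ιₙ n * κ (+ j)) (sym (ℤ.pos-* n j)) (κ-* n (+ j))) ⟩
        ιₙ j * ιₙ j * (ιₙ n * ιₙ n * κ (+ j)) ≡⟨ l (ιₙ j) (ιₙ n) (κ (+ j)) ⟩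
        (ιₙ n * ιₙ j) * (ιₙ n * ιₙ j) * κ (+ j) ≡⟨ cong (λ z → z * z * κ (+ j)) (ιₙ-* n j) ⟨
        ιₙ (n ℕ.* j) * ιₙ (n ℕ.* j) * κ (+ j) ≤⟨ *-mono-≤ʳ (κ-nonNeg (+ j)) (4q² nj≤2q) ⟩
        4ℚ * (ιₙ q * ιₙ q) * κ (+ j) ≡⟨ l₂ (ιₙ q * ιₙ q) (κ (+ j)) ⟩
        2ℚ * (ιₙ q * ιₙ q) * κ (+ j) * 2ℚ ∎)
        where
        open ≤-Reasoning
        n = suc (q ℕ./ j)
        q≡ : q ≡ q ℕ.% j ℕ.+ (q ℕ./ j) ℕ.* j
        q≡ = ℕ.m≡m%n+[m/n]*n q j
        q≤nj : q ℕ.≤ n ℕ.* j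
        q≤nj = ℕ.≤-trans (ℕ.≤-reflexive q≡) (ℕ.+-monoˡ-≤ ((q ℕ./ j) ℕ.* j) (ℕ.<⇒≤ (ℕ.m%n<n q j)))
        nj≤2q : n ℕ.* j ℕ.≤ 2 ℕ.* q
        nj≤2q = ℕ.≤-trans (ℕ.+-mono-≤ (ℕ.<⇒≤ (ℕ.≰⇒> q≰j)) (ℕ.≤-trans (ℕ.m≤n+m _ (q ℕ.% j)) (ℕ.≤-reflexive (sym q≡))))
          (ℕ.≤-reflexive (cong (q ℕ.+_) (sym (ℕ.+-identityʳ q))))
        l : ∀ a b k → a * a * (b * b * k) ≡ (b * a) * (b * a) * k
        l = solve-∀ ℚ-ring
        l₂ : ∀ a k → 4ℚ * a * k ≡ 2ℚ * a * k * 2ℚ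
        l₂ = solve-∀ ℚ-ring

    κ-lower : ∀ i → ℤ.∣ i ∣ ℕ.≤ 2 ℕ.* q → 8ℚ * (ι i * ι i) ≤ ιₙ N * ιₙ N * κ i
    κ-lower = abs-sq (λ i x → ℤ.∣ i ∣ ℕ.≤ 2 ℕ.* q → 8ℚ * x ≤ ιₙ N * ιₙ N * κ i)
      (λ i x p le → subst (λ z → 8ℚ * x ≤ ιₙ N * ιₙ N * z) (sym (κ-neg i)) (p (subst (ℕ._≤ 2 ℕ.* q) (ℤ.∣-i∣≡∣i∣ i) le)))
      λ n n≤ → begin
        8ℚ * (ιₙ n * ιₙ n) ≤⟨ *-mono-≤ˡ (nonNegative⁻¹ 8ℚ) (κ-lowerₙ n n≤) ⟩
        8ℚ * (2ℚ * (ιₙ q * ιₙ q) * κ (+ n)) ≡⟨ l (ιₙ q) (κ (+ n)) ⟩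
        4ℚ * ιₙ q * (4ℚ * ιₙ q) * κ (+ n) ≡⟨ cong (λ z → z * z * κ (+ n)) (trans (ιₙ-* 4 q) (cong (_* ιₙ q) (ι-def _))) ⟨
        ιₙ N * ιₙ N * κ (+ n) ∎
      where
      open ≤-Reasoning
      l : ∀ a k → 8ℚ * (2ℚ * (a * a) * k) ≡ 4ℚ * a * (4ℚ * a) * k
      l = solve-∀ ℚ-ring

    -- Each step has chord at most 2/T, while `q` of them reach a squared chord of at least 2; so
    -- `q` cannot be small compared with `T`. This is how `N` is made as large as desired.
    T≤N : T ℕ.≤ N
    T≤N = ιₙ-cancel-≤ (sq-cancel-≤ (ιₙ-nonNeg N) (*-cancelʳ-≤ {4ℚ} {t * t} {ιₙ N * ιₙ N} (positive⁻¹ 4ℚ) (begin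
      t * t * 4ℚ ≤⟨ *-mono-≤ˡ (sq-nonNeg t) (*-mono-≤ˡ (nonNegative⁻¹ 2ℚ) (κ-left q ℕ.≤-refl (ℕ.m≤m+n q _))) ⟩
      t * t * (2ℚ * κ (+ q)) ≡⟨ l₁ (t * t) (κ (+ q)) ⟩
      2ℚ * (t * t * κ (+ q)) ≤⟨ *-mono-≤ˡ (nonNegative⁻¹ 2ℚ) t²κ≤ ⟩
      2ℚ * (4ℚ * (ιₙ q * ιₙ q)) ≤⟨ ≤-by (8ℚ * (8ℚ - 1ℚ) * (ιₙ q * ιₙ q)) (*-nonNeg (nonNegative⁻¹ (8ℚ * (8ℚ - 1ℚ))) (sq-nonNeg (ιₙ q))) (l₂ (ιₙ q)) ⟩
      4ℚ * ιₙ q * (4ℚ * ιₙ q) * 4ℚ ≡⟨ cong (λ z → z * z * 4ℚ) (trans (ιₙ-* 4 q) (cong (_* ιₙ q) (ι-def _))) ⟨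
      ιₙ N * ιₙ N * 4ℚ ∎)))
      where
      open ≤-Reasoning
      l₁ : ∀ a k → a * (2ℚ * k) ≡ 2ℚ * (a * k)
      l₁ = solve-∀ ℚ-ring
      l₂ : ∀ a → 4ℚ * a * (4ℚ * a) * 4ℚ ≡ 2ℚ * (4ℚ * (a * a)) + 8ℚ * (8ℚ - 1ℚ) * (a * a)
      l₂ = solve-∀ ℚ-ring
      t²κ≤ : t * t * κ (+ q) ≤ 4ℚ * (ιₙ q * ιₙ q)
      t²κ≤ = begin
        t * t * κ (+ q) ≤⟨ *-mono-≤ˡ (sq-nonNeg t) (subst (λ z → κ z ≤ ιₙ q * ιₙ q * κ (+ 1)) (ℤ.*-identityʳ (+ q)) (κ-* q (+ 1))) ⟩
        t * t * (ιₙ q * ιₙ q * κ (+ 1)) ≡⟨ l₃ (t * t) (ιₙ q * ιₙ q) (κ (+ 1)) ⟩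
        ιₙ q * ιₙ q * (t * t * κ (+ 1)) ≤⟨ *-mono-≤ˡ (sq-nonNeg (ιₙ q)) κ₁ ⟩
        ιₙ q * ιₙ q * 4ℚ ≡⟨ *-comm (ιₙ q * ιₙ q) 4ℚ ⟩
        4ℚ * (ιₙ q * ιₙ q) ∎
        where
        l₃ : ∀ a b k → a * (b * k) ≡ b * (a * k)
        l₃ = solve-∀ ℚ-ring

-- Congruences and residues of integers

module Residue where

  open import Data.Integer.Base
  open import Data.Integer.DivMod using (_%ℕ_; _/ℕ_; n%ℕd<d; a≡a%ℕn+[a/ℕn]*n)
  open import Data.Integer.Properties

  infix 4 _≡_[mod_]
  infixr 4 _,_

  record _≡_[mod_] (i j : ℤ) (n : ℕ) : Set where
    constructor _,_
    field
      quotient : ℤ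
      equality : i ≡ j + quotient * + n

  mod-refl : ∀ {n} i → i ≡ i [mod n ]
  mod-refl {n} i = 0ℤ , l i (+ n)
    where
    l : ∀ i n → i ≡ i + 0ℤ * n
    l = ℤ-Solver.solve-∀

  mod-sym : ∀ {n i j} → i ≡ j [mod n ] → j ≡ i [mod n ]
  mod-sym {n} {i} {j} (k , refl) = - k , l j k (+ n)
    where
    l : ∀ j k n → j ≡ j + k * n + (- k) * n
    l = ℤ-Solver.solve-∀

  mod-trans : ∀ {n i j k} → i ≡ j [mod n ] → j ≡ k [mod n ] → i ≡ k [mod n ]
  mod-trans {n} {k = k} (a , refl) (b , refl) = a + b , l k a b (+ n)
    where
    l : ∀ k a b n → k + b * n + a * n ≡ k + (a + b) * n
    l = ℤ-Solver.solve-∀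

  mod-+ : ∀ {n i j i′ j′} → i ≡ j [mod n ] → i′ ≡ j′ [mod n ] → i + i′ ≡ j + j′ [mod n ]
  mod-+ {n} {j = j} {j′ = j′} (a , refl) (b , refl) = a + b , l j j′ a b (+ n)
    where
    l : ∀ j k a b n → j + a * n + (k + b * n) ≡ j + k + (a + b) * n
    l = ℤ-Solver.solve-∀

  mod-*ˡ : ∀ {n i j} k → i ≡ j [mod n ] → k * i ≡ k * j [mod n ]
  mod-*ˡ {n} {j = j} k (a , refl) = k * a , l j k a (+ n)
    where
    l : ∀ j k a n → k * (j + a * n) ≡ k * j + k * a * n
    l = ℤ-Solver.solve-∀

  mod-neg : ∀ {n i j} → i ≡ j [mod n ] → - i ≡ - j [mod n ]
  mod-neg {n} {j = j} (a , refl) = - a , l j a (+ n)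
    where
    l : ∀ j a n → - (j + a * n) ≡ - j + (- a) * n
    l = ℤ-Solver.solve-∀

  mod-≡ : ∀ {n i j} → i ≡ j → i ≡ j [mod n ]
  mod-≡ refl = mod-refl _

  mod-unique : ∀ {n i j} → i ≡ j [mod n ] → ∣ i - j ∣ ℕ.< n → i ≡ j
  mod-unique {n} {i} {j} (k , i≡) lt = zero-or k i≡ (subst (ℕ._< n) (trans (cong ∣_∣ (trans (cong (_- j) i≡) (l j k (+ n)))) (abs-* k (+ n))) lt)
    where
    l : ∀ j k n → j + k * n - j ≡ k * n
    l = ℤ-Solver.solve-∀
    zero-or : ∀ k → i ≡ j + k * + n → ∣ k ∣ ℕ.* n ℕ.< n → i ≡ j
    zero-or (+ zero) eq _ = trans eq (+-identityʳ j)
    zero-or +[1+ k ] _ lt = contradiction lt (ℕ.≤⇒≯ (ℕ.m≤m+n n (k ℕ.* n)))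
    zero-or -[1+ k ] _ lt = contradiction lt (ℕ.≤⇒≯ (ℕ.m≤m+n n (k ℕ.* n)))

  ∣+-+∣< : ∀ {k l n} → k ℕ.< n → l ℕ.< n → ∣ + k - + l ∣ ℕ.< n
  ∣+-+∣< {k} {l} k<n l<n = subst (ℕ._< _) (sym (cong ∣_∣ (m-n≡m⊖n k l))) (ℕ.≤-<-trans (∣m⊝n∣≤m⊔n k l) (ℕ.⊔-pres-<m k<n l<n))

  module _ (n : ℕ) .{{_ : ℕ.NonZero n}} where

    %-mod : ∀ i → i ≡ + (i %ℕ n) [mod n ]
    %-mod i = i /ℕ n , a≡a%ℕn+[a/ℕn]*n i n

    %-unique : ∀ {i k} → k ℕ.< n → i ≡ + k [mod n ] → i %ℕ n ≡ k
    %-unique {i} {k} k<n i≡k = +-injective (mod-unique (mod-trans (mod-sym (%-mod i)) i≡k) (∣+-+∣< (n%ℕd<d i n) k<n))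

-- Half circles that capture many points, by averaging

module HalfWindow where

  open import Data.Integer.Base as ℤ using (ℤ; +_)
  open import Data.Integer.DivMod using (_%ℕ_; n%ℕd<d)
  open import Data.Rational.Base
  open import Data.Rational.Properties
  open RationalOrder
  open ListSum
  open Rotations
  open Residue

  module Windows (slope : Slope) where
    open Slope slope
    open Rotation slope

    instance
      N≢0 : ℕ.NonZero N
      N≢0 = ℕ.>-nonZero (ℕ.≤-trans 1≤q (ℕ.m≤m+n q _))

    -- The half circle made of the 2q consecutive residues that start at `β`.
    InWindow : ℤ → ℤ → Set
    InWindow β i = (i ℤ.- β) %ℕ N ℕ.< 2 ℕ.* q

    inWindow? : ∀ β i → Dec (InWindow β i)
    inWindow? β i = _ ℕ.<? _

    hits : ℤ → List ℤ → ℚ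
    hits β is = ∑ is (λ i → [ inWindow? β i ?])

    private
      2q<N : 2 ℕ.* q ℕ.≤ N
      2q<N = ℕ.*-monoˡ-≤ q {2} {4} (ℕ.s≤s (ℕ.s≤s ℕ.z≤n))

      in-window : ∀ β i k → k ℕ.< 2 ℕ.* q → i ℤ.- β ≡ + k [mod N ] → InWindow β i
      in-window β i k k<2q eq = subst (ℕ._< 2 ℕ.* q) (sym (%-unique N (ℕ.<-≤-trans k<2q 2q<N) eq)) k<2q

      A : ℕ → ℚ
      A n = ∑ (downFrom n) C

      -- The cosine sum telescopes by `mid-S`; the last two terms are the boundary terms of the
      -- trapezoidal rule.
      2A : ∀ n → 2ℚ * A n ≡ t * S n + 1ℚ - C n
      2A zero = l t
        where
        l : ∀ t → 2ℚ * 0ℚ ≡ t * 0ℚ + 1ℚ - 1ℚ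
        l = solve-∀ ℚ-ring
      2A (suc n) = begin
        2ℚ * (C n + A n) ≡⟨ l₁ (C n) (A n) (C (suc n)) ⟩
        (C n + C (suc n)) + C n + 2ℚ * A n - C (suc n) ≡⟨ cong₂ (λ a b → a + C n + b - C (suc n)) (sym (mid-S n)) (2A n) ⟩
        t * (S (suc n) - S n) + C n + (t * S n + 1ℚ - C n) - C (suc n) ≡⟨ l₂ t (S (suc n)) (S n) (C n) (C (suc n)) ⟩
        t * S (suc n) + 1ℚ - C (suc n) ∎
        where
        open ≡-Reasoning
        l₁ : ∀ x a y → 2ℚ * (x + a) ≡ (x + y) + x + 2ℚ * a - y
        l₁ = solve-∀ ℚ-ring
        l₂ : ∀ t u v x y → t * (u - v) + x + (t * v + 1ℚ - x) - y ≡ t * u + 1ℚ - y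
        l₂ = solve-∀ ℚ-ring

      2A-≥ : ∀ n → t * S n ≤ 2ℚ * A n
      2A-≥ n = ≤-by (1ℚ - C n) (≤⇒0≤ (c≤1 (+ n))) (trans (2A n) (+-assoc (t * S n) 1ℚ (- C n)))

      weights-initial : ∀ n (P : ℕ → Set) (P? : ∀ b → Dec (P b)) → n ℕ.≤ q → (∀ b → b ℕ.< n → P b) →
                        ∀ m → n ℕ.≤ m → m ℕ.≤ q → A n ≤ ∑ (downFrom m) (λ b → C b * [ P? b ?])
      weights-initial n P P? n≤q h m n≤m m≤q with ℕ.m≤n⇒m<n∨m≡n n≤m
      ... | inj₂ refl = ≤-reflexive (∑-cong (downFrom n) λ b b∈ → sym (trans (cong (C b *_) ([?]-yes (P? b) (h b (∈-downFrom⁻ b∈)))) (*-identityʳ (C b))))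
      weights-initial n P P? n≤q h (suc m) n≤m m≤q | inj₁ n<m = subst (_≤ _) (+-identityˡ (A n))
        (+-mono-≤ (*-nonNeg (<⇒≤ (0<C m≤q)) ([?]-nonNeg (P? m))) (weights-initial n P P? n≤q h m (ℕ.s≤s⁻¹ n<m) (ℕ.<⇒≤ m≤q)))

      weights-final : ∀ n (P : ℕ → Set) (P? : ∀ b → Dec (P b)) → (∀ b → n ℕ.≤ b → b ℕ.< q → P b) →
                      ∀ m → m ℕ.≤ q → A m - A n ≤ ∑ (downFrom m) (λ b → C b * [ P? b ?]) ⊎ m ℕ.< n
      weights-final n P P? h m m≤q with n ℕ.≤? m
      ... | no n≰m = inj₂ (ℕ.≰⇒> n≰m)
      ... | yes n≤m = inj₁ (go m n≤m m≤q)
        where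
        go : ∀ m → n ℕ.≤ m → m ℕ.≤ q → A m - A n ≤ ∑ (downFrom m) (λ b → C b * [ P? b ?])
        go m n≤m m≤q with ℕ.m≤n⇒m<n∨m≡n n≤m
        ... | inj₂ refl = subst (_≤ ∑ (downFrom n) (λ b → C b * [ P? b ?])) (sym (+-inverseʳ (A n)))
          (∑-nonNeg (downFrom n) λ b b∈ → *-nonNeg (<⇒≤ (0<C (ℕ.<-≤-trans (∈-downFrom⁻ b∈) m≤q))) ([?]-nonNeg (P? b)))
        go (suc m) n≤m m≤q | inj₁ n<m = subst (_≤ _) (sym (+-assoc (C m) (A m) (- A n)))
          (+-mono-≤ (≤-reflexive (sym (trans (cong (C m *_) ([?]-yes (P? m) (h m (ℕ.s≤s⁻¹ n<m) m≤q))) (*-identityʳ (C m)))))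
            (go m (ℕ.s≤s⁻¹ n<m) (ℕ.<⇒≤ m≤q)))

      weights-nonNeg : ∀ (P : ℕ → Set) (P? : ∀ b → Dec (P b)) → 0ℚ ≤ ∑ (downFrom q) (λ b → C b * [ P? b ?])
      weights-nonNeg P P? = ∑-nonNeg (downFrom q) λ b b∈ → *-nonNeg (<⇒≤ (0<C (∈-downFrom⁻ b∈))) ([?]-nonNeg (P? b))

      -- The cosine weight of those windows starting at b, respectively -b, for 0 ≤ b < q, that
      -- contain `i`. Convolving the indicator of a half circle with the positive half of the cosine
      -- gives 1 + sin, so together these should be about t (1 + sin i) / 2.
      V⁺ V⁻ : ℤ → ℚ
      V⁺ i = ∑ (downFrom q) (λ b → C b * [ inWindow? (+ b) i ?])
      V⁻ i = ∑ (downFrom q) (λ b → C b * [ inWindow? (ℤ.- + b) i ?])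

      t-2≤tSq : t - 2ℚ ≤ t * S q
      t-2≤tSq = ≤-by (t * (S q * (1ℚ - S q)) + (t * (s₁ * s₁ - C q * C q) + (2ℚ - t * s₁ + t * s₁ * (1ℚ - s₁))))
        (+-nonNeg (*-nonNeg (<⇒≤ 0<t) (*-nonNeg (<⇒≤ 0<Sq) (≤⇒0≤ (s≤1 (+ q)))))
          (+-nonNeg (*-nonNeg (<⇒≤ 0<t) (≤⇒0≤ Cq²≤s₁²))
            (+-nonNeg (≤⇒0≤ ts₁≤2) (*-nonNeg (*-nonNeg (<⇒≤ 0<t) 0≤s₁) (≤⇒0≤ (subst (_≤ 1ℚ) S₁≡ (s≤1 (+ 1))))))))
        (trans (l₁ t (S q)) (trans (cong (λ z → t * S q + t * (1ℚ - z)) (sym (unit (+ q)))) (l₂ t (C q) (S q) s₁)))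
        where
        l₁ : ∀ t y → t * y ≡ t * y + t * (1ℚ - 1ℚ)
        l₁ = solve-∀ ℚ-ring
        l₂ : ∀ t x y s → t * y + t * (1ℚ - (x * x + y * y)) ≡ t - 2ℚ +
             (t * (y * (1ℚ - y)) + (t * (s * s - x * x) + (2ℚ - t * s + t * s * (1ℚ - s))))
        l₂ = solve-∀ ℚ-ring

      -- Reflection in the vertical axis, up to the rounding of the quarter turn.
      reflect-≥ : ∀ i → t * s i - 8ℚ ≤ t * s (+ (2 ℕ.* q) ℤ.- i)
      reflect-≥ i = ≤-by e e≥0 (trans (cong (t *_) s≡) (l t (S q) (C q) (c i) (s i) (unit (+ q))))
        where
        e = 2ℚ * (t * (S q * (- C q)) * (1ℚ - c i)) + (2ℚ * (t * (C q * C q) * (1ℚ - s i)) + (8ℚ - 2ℚ * (t * (S q * (- C q))) - 2ℚ * (t * (C q * C q))))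
        s≡ : s (+ (2 ℕ.* q) ℤ.- i) ≡ 2ℚ * (S q * C q) * c i - (C q * C q - S q * S q) * s i
        s≡ = begin
          s (+ (2 ℕ.* q) ℤ.- i) ≡⟨ s-+ (+ (2 ℕ.* q)) (ℤ.- i) ⟩
          S (2 ℕ.* q) * c (ℤ.- i) + C (2 ℕ.* q) * s (ℤ.- i) ≡⟨ cong₂ (λ a b → S (2 ℕ.* q) * a + C (2 ℕ.* q) * b) (c-neg i) (s-neg i) ⟩
          S (2 ℕ.* q) * c i + C (2 ℕ.* q) * (- s i) ≡⟨ cong₂ (λ a b → a * c i + b * (- s i)) (trans (cong S q+q) (s-+ (+ q) (+ q))) (trans (cong C q+q) (c-+ (+ q) (+ q))) ⟩
          (S q * C q + C q * S q) * c i + (C q * C q - S q * S q) * (- s i) ≡⟨ l′ (S q) (C q) (c i) (s i) ⟩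
          2ℚ * (S q * C q) * c i - (C q * C q - S q * S q) * s i ∎
          where
          open ≡-Reasoning
          q+q : 2 ℕ.* q ≡ q ℕ.+ q
          q+q = cong (q ℕ.+_) (ℕ.+-identityʳ q)
          l′ : ∀ y x u v → (y * x + x * y) * u + (x * x - y * y) * (- v) ≡ 2ℚ * (y * x) * u - (x * x - y * y) * v
          l′ = solve-∀ ℚ-ring
        l : ∀ t y x u v → x * x + y * y ≡ 1ℚ → t * (2ℚ * (y * x) * u - (x * x - y * y) * v) ≡ t * v - 8ℚ +
            (2ℚ * (t * (y * (- x)) * (1ℚ - u)) + (2ℚ * (t * (x * x) * (1ℚ - v)) + (8ℚ - 2ℚ * (t * (y * (- x))) - 2ℚ * (t * (x * x)))))
        l t y x u v eq = trans (l₁ t y x u v) (trans (cong (λ z → t * (2ℚ * (y * x) * u - (x * x + x * x - z) * v)) eq) (l₂ t y x u v))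
          where
          l₁ : ∀ t y x u v → t * (2ℚ * (y * x) * u - (x * x - y * y) * v) ≡ t * (2ℚ * (y * x) * u - (x * x + x * x - (x * x + y * y)) * v)
          l₁ = solve-∀ ℚ-ring
          l₂ : ∀ t y x u v → t * (2ℚ * (y * x) * u - (x * x + x * x - 1ℚ) * v) ≡ t * v - 8ℚ +
            (2ℚ * (t * (y * (- x)) * (1ℚ - u)) + (2ℚ * (t * (x * x) * (1ℚ - v)) + (8ℚ - 2ℚ * (t * (y * (- x))) - 2ℚ * (t * (x * x)))))
          l₂ = solve-∀ ℚ-ring
        0≤-Cq = neg-nonNeg Cq≤0
        -Cq≤s₁ : - C q ≤ s₁
        -Cq≤s₁ = subst (- C q ≤_) (l′ s₁) (neg-antimono-≤ -s₁≤Cq)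
          where
          l′ : ∀ x → - (- x) ≡ x
          l′ = solve-∀ ℚ-ring
        tyx≤2 : t * (S q * (- C q)) ≤ 2ℚ
        tyx≤2 = ≤-trans (*-mono-≤ˡ (<⇒≤ 0<t) (≤-trans (*-mono-≤-nonNeg (<⇒≤ 0<Sq) 0≤s₁ (s≤1 (+ q)) -Cq≤s₁) (≤-reflexive (*-identityˡ s₁)))) ts₁≤2
        s₁≤1 : s₁ ≤ 1ℚ
        s₁≤1 = subst (_≤ 1ℚ) S₁≡ (s≤1 (+ 1))
        txx≤2 : t * (C q * C q) ≤ 2ℚ
        txx≤2 = ≤-trans (*-mono-≤ˡ (<⇒≤ 0<t) (≤-trans Cq²≤s₁² (≤-trans (*-mono-≤ˡ 0≤s₁ s₁≤1) (≤-reflexive (*-identityʳ s₁))))) ts₁≤2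
        e≥0 : 0ℚ ≤ e
        e≥0 = +-nonNeg (*-nonNeg (nonNegative⁻¹ 2ℚ) (*-nonNeg (*-nonNeg (<⇒≤ 0<t) (*-nonNeg (<⇒≤ 0<Sq) 0≤-Cq)) (≤⇒0≤ (c≤1 i))))
          (+-nonNeg (*-nonNeg (nonNegative⁻¹ 2ℚ) (*-nonNeg (*-nonNeg (<⇒≤ 0<t) (sq-nonNeg (C q))) (≤⇒0≤ (s≤1 i))))
            (subst (0ℚ ≤_) (l₃ (t * (S q * (- C q))) (t * (C q * C q))) (*-nonNeg (nonNegative⁻¹ 2ℚ) (+-nonNeg (≤⇒0≤ tyx≤2) (≤⇒0≤ txx≤2)))))
          where
          l₃ : ∀ a b → 2ℚ * ((2ℚ - a) + (2ℚ - b)) ≡ 8ℚ - 2ℚ * a - 2ℚ * b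
          l₃ = solve-∀ ℚ-ring

      reflect-≤ : ∀ i → t * s (+ (2 ℕ.* q) ℤ.- i) ≤ t * s i + 8ℚ
      reflect-≤ i = ≤-by (t * s i - (t * s i′ - 8ℚ)) (≤⇒0≤ (subst (λ z → t * s i′ - 8ℚ ≤ t * s z) (l (+ (2 ℕ.* q)) i) (reflect-≥ i′))) (l₂ (t * s i) (t * s i′))
        where
        i′ = + (2 ℕ.* q) ℤ.- i
        l : ∀ a b → a ℤ.- (a ℤ.- b) ≡ b
        l = ℤ-Solver.solve-∀
        l₂ : ∀ a b → a + 8ℚ ≡ b + (a - (b - 8ℚ))
        l₂ = solve-∀ ℚ-ring

      S-lip : ∀ n → t * S n - 2ℚ ≤ t * S (suc n)
      S-lip n = ≤-by ((C n + 1ℚ) + (C (suc n) + 1ℚ)) (+-nonNeg (p (+ n)) (p (+ suc n)))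
        (trans (l t (S n) (S (suc n))) (trans (cong (λ z → t * S n - 2ℚ + (z + 2ℚ)) (mid-S n)) (l₂ (t * S n) (C n) (C (suc n)))))
        where
        p : ∀ i → 0ℚ ≤ c i + 1ℚ
        p i = ≤⇒0≤ (-1≤c i)
        l : ∀ t x y → t * y ≡ t * x - 2ℚ + (t * (y - x) + 2ℚ)
        l = solve-∀ ℚ-ring
        l₂ : ∀ a x y → a - 2ℚ + (x + y + 2ℚ) ≡ a - 2ℚ + ((x + 1ℚ) + (y + 1ℚ))
        l₂ = solve-∀ ℚ-ring

      S-lip⁺ : ∀ n → t * S (suc n) ≤ t * S n + 2ℚ
      S-lip⁺ n = ≤-by ((1ℚ - C n) + (1ℚ - C (suc n))) (+-nonNeg (≤⇒0≤ (c≤1 (+ n))) (≤⇒0≤ (c≤1 (+ suc n))))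
        (trans (l₂ (t * S n) (C n) (C (suc n))) (trans (cong (λ z → t * S n + z + ((1ℚ - C n) + (1ℚ - C (suc n)))) (sym (mid-S n)))
          (l t (S n) (S (suc n)) ((1ℚ - C n) + (1ℚ - C (suc n))))))
        where
        l : ∀ t x y e → t * x + t * (y - x) + e ≡ t * y + e
        l = solve-∀ ℚ-ring
        l₂ : ∀ a x y → a + 2ℚ ≡ a + (x + y) + ((1ℚ - x) + (1ℚ - y))
        l₂ = solve-∀ ℚ-ring

      rotate-≤ : ∀ i → t * s (i ℤ.- + (2 ℕ.* q)) ≤ 8ℚ - t * s i
      rotate-≤ i = ≤-by (t * s i′ - (t * s i - 8ℚ)) (≤⇒0≤ (reflect-≥ i))
        (trans (l (t * s i) (t * s i′)) (cong (λ z → z + (t * s i′ - (t * s i - 8ℚ))) (trans (l₂ t (s i′)) (cong (t *_) (trans (sym (s-neg i′)) (cong s (l₃ (+ (2 ℕ.* q)) i)))))))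
        where
        i′ = + (2 ℕ.* q) ℤ.- i
        l : ∀ a b → 8ℚ - a ≡ - b + (b - (a - 8ℚ))
        l = solve-∀ ℚ-ring
        l₂ : ∀ t x → - (t * x) ≡ t * (- x)
        l₂ = solve-∀ ℚ-ring
        l₃ : ∀ a b → ℤ.- (a ℤ.- b) ≡ b ℤ.- a
        l₃ = ℤ-Solver.solve-∀

      A-diff : ∀ n → t * S q - t * S n - 1ℚ ≤ 2ℚ * (A q - A n)
      A-diff n = ≤-by ((- C q) + (C n - - 1ℚ)) (+-nonNeg (neg-nonNeg Cq≤0) (≤⇒0≤ (-1≤c (+ n))))
        (trans (l (A q) (A n)) (trans (cong₂ _-_ (2A q) (2A n)) (l₂ (t * S q) (t * S n) (C q) (C n))))
        where
        l : ∀ a b → 2ℚ * (a - b) ≡ 2ℚ * a - 2ℚ * b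
        l = solve-∀ ℚ-ring
        l₂ : ∀ a b x y → (a + 1ℚ - x) - (b + 1ℚ - y) ≡ a - b - 1ℚ + ((- x) + (y - - 1ℚ))
        l₂ = solve-∀ ℚ-ring

      2*-mono : ∀ {a b} → a ≤ b → 2ℚ * a ≤ 2ℚ * b
      2*-mono = *-mono-≤ˡ (nonNegative⁻¹ 2ℚ)

      module _ (i : ℤ) where
        ρ : ℕ
        ρ = i %ℕ N

        ρ<N : ρ ℕ.< N
        ρ<N = n%ℕd<d i N

        plus-window : ∀ b → b ℕ.≤ ρ → ρ ℕ.< b ℕ.+ 2 ℕ.* q → InWindow (+ b) i
        plus-window b b≤ρ lt = in-window (+ b) i (ρ ℕ.∸ b) (ℕ.+-cancelˡ-< b _ _ (subst (ℕ._< b ℕ.+ 2 ℕ.* q) (sym (ℕ.m+[n∸m]≡n b≤ρ)) lt))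
          (mod-trans (mod-+ (%-mod N i) (mod-refl (ℤ.- + b))) (mod-≡ (trans (ℤ.m-n≡m⊖n ρ b) (ℤ.⊖-≥ b≤ρ))))

        neg-neg : ∀ b → (+ ρ) ℤ.- (ℤ.- + b) ≡ + (ρ ℕ.+ b)
        neg-neg b = trans (cong (λ z → + ρ ℤ.+ z) (ℤ.neg-involutive (+ b))) refl

        minus-window : ∀ b → ρ ℕ.+ b ℕ.< 2 ℕ.* q → InWindow (ℤ.- + b) i
        minus-window b lt = in-window (ℤ.- + b) i (ρ ℕ.+ b) lt
          (mod-trans (mod-+ (%-mod N i) (mod-refl (ℤ.- (ℤ.- + b)))) (mod-≡ (neg-neg b)))

        wrap-window : ∀ b → N ℕ.≤ ρ ℕ.+ b → ρ ℕ.+ b ℕ.< N ℕ.+ 2 ℕ.* q → InWindow (ℤ.- + b) i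
        wrap-window b le lt = in-window (ℤ.- + b) i (ρ ℕ.+ b ℕ.∸ N)
          (ℕ.+-cancelˡ-< N _ _ (subst (ℕ._< N ℕ.+ 2 ℕ.* q) (sym (ℕ.m+[n∸m]≡n le)) lt))
          (mod-trans (mod-+ (%-mod N i) (mod-refl (ℤ.- (ℤ.- + b)))) (mod-trans (mod-≡ (neg-neg b))
            (+ 1 , trans (cong +_ (sym (ℕ.m+[n∸m]≡n le))) (trans (ℤ.+-comm (+ N) (+ (ρ ℕ.+ b ℕ.∸ N))) (cong (λ z → + (ρ ℕ.+ b ℕ.∸ N) ℤ.+ z) (sym (ℤ.*-identityˡ (+ N))))))))

        V⁺-initial : ∀ n → n ℕ.≤ q → (∀ b → b ℕ.< n → InWindow (+ b) i) → t * S n ≤ 2ℚ * V⁺ i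
        V⁺-initial n n≤q h = ≤-trans (2A-≥ n) (2*-mono (weights-initial n _ (λ b → inWindow? (+ b) i) n≤q h q n≤q ℕ.≤-refl))

        V⁻-initial : ∀ n → n ℕ.≤ q → (∀ b → b ℕ.< n → InWindow (ℤ.- + b) i) → t * S n ≤ 2ℚ * V⁻ i
        V⁻-initial n n≤q h = ≤-trans (2A-≥ n) (2*-mono (weights-initial n _ (λ b → inWindow? (ℤ.- + b) i) n≤q h q n≤q ℕ.≤-refl))

        final : ∀ n {x} → n ℕ.≤ q → A q - A n ≤ x ⊎ q ℕ.< n → t * S q - t * S n - 1ℚ ≤ 2ℚ * x
        final n n≤q (inj₁ p) = ≤-trans (A-diff n) (2*-mono p)
        final n n≤q (inj₂ p) = contradiction n≤q (ℕ.<⇒≱ p)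

        V⁺-final : ∀ n → n ℕ.≤ q → (∀ b → n ℕ.≤ b → b ℕ.< q → InWindow (+ b) i) → t * S q - t * S n - 1ℚ ≤ 2ℚ * V⁺ i
        V⁺-final n n≤q h = final n n≤q (weights-final n _ (λ b → inWindow? (+ b) i) h q ℕ.≤-refl)

        V⁻-final : ∀ n → n ℕ.≤ q → (∀ b → n ℕ.≤ b → b ℕ.< q → InWindow (ℤ.- + b) i) → t * S q - t * S n - 1ℚ ≤ 2ℚ * V⁻ i
        V⁻-final n n≤q h = final n n≤q (weights-final n _ (λ b → inWindow? (ℤ.- + b) i) h q ℕ.≤-refl)

        V⁺-nonNeg : 0ℚ ≤ 2ℚ * V⁺ i
        V⁺-nonNeg = *-nonNeg (nonNegative⁻¹ 2ℚ) (weights-nonNeg _ (λ b → inWindow? (+ b) i))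

        V⁻-nonNeg : 0ℚ ≤ 2ℚ * V⁻ i
        V⁻-nonNeg = *-nonNeg (nonNegative⁻¹ 2ℚ) (weights-nonNeg _ (λ b → inWindow? (ℤ.- + b) i))

        2q≡ : 2 ℕ.* q ≡ q ℕ.+ q
        2q≡ = cong (q ℕ.+_) (ℕ.+-identityʳ q)

        N≡ : N ≡ 2 ℕ.* q ℕ.+ 2 ℕ.* q
        N≡ = ℕ.*-distribʳ-+ q 2 2

        combine : ∀ {a b} k → 0ℚ ≤ 32ℚ - k → a ≤ 2ℚ * V⁺ i → b ≤ 2ℚ * V⁻ i → t * (1ℚ + S ρ) - k ≤ a + b →
                  t * (1ℚ + S ρ) - 32ℚ ≤ 2ℚ * (V⁺ i + V⁻ i)
        combine {a} {b} k k≤ p r le = ≤-trans (≤-by (32ℚ - k) k≤ (l (t * (1ℚ + S ρ)) k)) (≤-trans le (≤-trans (+-mono-≤ p r) (≤-reflexive (sym (*-distribˡ-+ 2ℚ (V⁺ i) (V⁻ i))))))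
          where
          l : ∀ a k → a - k ≡ a - 32ℚ + (32ℚ - k)
          l = solve-∀ ℚ-ring

        -- In each quadrant the starting points whose window contains the residue are all, or an
        -- initial or a final run, of one family, and their weights telescope; in the last two
        -- quadrants the other family is merely bounded by 0. The number 32 collects the rounding
        -- errors.
        window-weight : t * (1ℚ + S ρ) - 32ℚ ≤ 2ℚ * (V⁺ i + V⁻ i)
        window-weight with ρ ℕ.<? q
        ... | yes ρ<q = combine 4ℚ (nonNegative⁻¹ (32ℚ - 4ℚ))
                (V⁺-initial (suc ρ) ρ<q λ b b≤ρ → plus-window b (ℕ.s≤s⁻¹ b≤ρ) (ℕ.<-≤-trans (ℕ.<-≤-trans ρ<q (ℕ.m≤m+n q _)) (ℕ.m≤n+m _ b)))
                (V⁻-initial q ℕ.≤-refl λ b b<q → minus-window b (subst (ρ ℕ.+ b ℕ.<_) (sym 2q≡) (ℕ.+-mono-< ρ<q b<q)))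
                (≤-trans (≤-reflexive (l t (S ρ))) (+-mono-≤ (S-lip ρ) t-2≤tSq))
          where
          l : ∀ t x → t * (1ℚ + x) - 4ℚ ≡ t * x - 2ℚ + (t - 2ℚ)
          l = solve-∀ ℚ-ring
        ... | no ρ≮q with ρ ℕ.<? 2 ℕ.* q
        ... | yes ρ<2q = combine (8ℚ + 2ℚ) (nonNegative⁻¹ (32ℚ - (8ℚ + 2ℚ)))
                (V⁺-initial q ℕ.≤-refl λ b b<q → plus-window b (ℕ.≤-trans (ℕ.<⇒≤ b<q) q≤ρ) (ℕ.<-≤-trans ρ<2q (ℕ.m≤n+m _ b)))
                (V⁻-initial (2 ℕ.* q ℕ.∸ ρ) n≤q λ b b< → minus-window b (subst (ρ ℕ.+ b ℕ.<_) (ℕ.m+[n∸m]≡n (ℕ.<⇒≤ ρ<2q)) (ℕ.+-monoʳ-< ρ b<)))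
                (≤-trans (≤-reflexive (l t (S ρ))) (+-mono-≤ t-2≤tSq (subst (λ z → t * S ρ - 8ℚ ≤ t * s z) (trans (ℤ.m-n≡m⊖n (2 ℕ.* q) ρ) (ℤ.⊖-≥ (ℕ.<⇒≤ ρ<2q))) (reflect-≥ (+ ρ)))))
          where
          q≤ρ = ℕ.≮⇒≥ ρ≮q
          n≤q : 2 ℕ.* q ℕ.∸ ρ ℕ.≤ q
          n≤q = ℕ.m≤n+o⇒m∸n≤o (2 ℕ.* q) ρ (subst (ℕ._≤ ρ ℕ.+ q) (sym 2q≡) (ℕ.+-monoˡ-≤ q q≤ρ))
          l : ∀ t x → t * (1ℚ + x) - (8ℚ + 2ℚ) ≡ t - 2ℚ + (t * x - 8ℚ)
          l = solve-∀ ℚ-ring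
        ... | no ρ≮2q with ρ ℕ.<? q ℕ.+ 2 ℕ.* q
        ... | yes ρ<3q = combine (8ℚ + 4ℚ + 1ℚ) (nonNegative⁻¹ (32ℚ - (8ℚ + 4ℚ + 1ℚ)))
                (V⁺-final n n≤q λ b n≤b b<q → plus-window b (ℕ.≤-trans (ℕ.<⇒≤ b<q) (ℕ.≤-trans (ℕ.m≤m+n q _) 2q≤ρ))
                  (subst (ℕ._< b ℕ.+ 2 ℕ.* q) (ℕ.m∸n+n≡m 2q≤ρ) (ℕ.+-monoˡ-< (2 ℕ.* q) n≤b)))
                V⁻-nonNeg
                (≤-by (((t * S q - (t - 2ℚ)) + (t * S k + 2ℚ - t * S n)) + (8ℚ - t * S ρ - t * S k))
                   (+-nonNeg (+-nonNeg (≤⇒0≤ t-2≤tSq) (≤⇒0≤ (S-lip⁺ k))) (≤⇒0≤ tSk≤)) (l t (S ρ) (t * S q) (t * S k) (t * S n)))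
          where
          2q≤ρ = ℕ.≮⇒≥ ρ≮2q
          k = ρ ℕ.∸ 2 ℕ.* q
          n = suc k
          n≤q : n ℕ.≤ q
          n≤q = ℕ.+-cancelʳ-< (2 ℕ.* q) k q (subst (ℕ._< q ℕ.+ 2 ℕ.* q) (sym (ℕ.m∸n+n≡m 2q≤ρ)) ρ<3q)
          tSk≤ : t * S k ≤ 8ℚ - t * S ρ
          tSk≤ = subst (λ z → t * s z ≤ 8ℚ - t * S ρ) (trans (ℤ.m-n≡m⊖n ρ (2 ℕ.* q)) (ℤ.⊖-≥ 2q≤ρ)) (rotate-≤ (+ ρ))
          l : ∀ t x a b d → a - d - 1ℚ + 0ℚ ≡ t * (1ℚ + x) - (8ℚ + 4ℚ + 1ℚ) + (((a - (t - 2ℚ)) + (b + 2ℚ - d)) + (8ℚ - t * x - b))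
          l = solve-∀ ℚ-ring
        ... | no ρ≮3q = combine (16ℚ + 2ℚ + 1ℚ) (nonNegative⁻¹ (32ℚ - (16ℚ + 2ℚ + 1ℚ)))
                V⁺-nonNeg
                (V⁻-final n n≤q λ b n≤b b<q → wrap-window b
                   (subst (ℕ._≤ ρ ℕ.+ b) (ℕ.m+[n∸m]≡n (ℕ.<⇒≤ ρ<N)) (ℕ.+-monoʳ-≤ ρ n≤b)) (ℕ.+-mono-<-≤ ρ<N (ℕ.≤-trans (ℕ.<⇒≤ b<q) (ℕ.m≤m+n q _))))
                (≤-by (((t * S q - (t - 2ℚ)) + (t * s ρ′ + 8ℚ - t * S n)) + (8ℚ - t * S ρ - t * s ρ′))
                   (+-nonNeg (+-nonNeg (≤⇒0≤ t-2≤tSq) (≤⇒0≤ tSn≤)) (≤⇒0≤ (rotate-≤ (+ ρ)))) (l t (S ρ) (t * S q) (t * s ρ′) (t * S n)))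
          where
          n = N ℕ.∸ ρ
          ρ≤N = ℕ.<⇒≤ ρ<N
          n≤q : n ℕ.≤ q
          n≤q = ℕ.m≤n+o⇒m∸n≤o N ρ (subst (ℕ._≤ ρ ℕ.+ q) (l₀ q) (ℕ.+-monoˡ-≤ q (ℕ.≮⇒≥ ρ≮3q)))
            where
            l₀ : ∀ q → q ℕ.+ 2 ℕ.* q ℕ.+ q ≡ 4 ℕ.* q
            l₀ = ℕ-Solver.solve-∀
          ρ′ = + ρ ℤ.- + (2 ℕ.* q)
          n≡ : + (2 ℕ.* q) ℤ.- ρ′ ≡ + n
          n≡ = trans (l₁ (+ (2 ℕ.* q)) (+ ρ)) (trans (cong (λ z → + z ℤ.- + ρ) (sym N≡)) (trans (ℤ.m-n≡m⊖n N ρ) (ℤ.⊖-≥ ρ≤N)))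
            where
            l₁ : ∀ a b → a ℤ.- (b ℤ.- a) ≡ a ℤ.+ a ℤ.- b
            l₁ = ℤ-Solver.solve-∀
          tSn≤ : t * S n ≤ t * s ρ′ + 8ℚ
          tSn≤ = subst (λ z → t * s z ≤ t * s ρ′ + 8ℚ) n≡ (reflect-≤ ρ′)
          l : ∀ t x a b d → 0ℚ + (a - d - 1ℚ) ≡ t * (1ℚ + x) - (16ℚ + 2ℚ + 1ℚ) + (((a - (t - 2ℚ)) + (b + 8ℚ - d)) + (8ℚ - t * x - b))
          l = solve-∀ ℚ-ring

    -- Averaging the windows b and -b with weight C b: each i is hit with total weight about t (1 + sin i) / 2.
    half-window : ∀ is D X → 0ℚ ≤ D → 0ℚ ≤ X →
                  2ℚ * ((t + 2ℚ) * X) < D * ∑ is (λ i → t * (1ℚ + S (i %ℕ N)) - 32ℚ) →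
                  ∃[ β ] X ≤ D * hits β is
    half-window is D X 0≤D 0≤X large with any? (λ b → X ≤? D * hits (+ b) is) (downFrom q) | any? (λ b → X ≤? D * hits (ℤ.- + b) is) (downFrom q)
    ... | yes p | _ = let b , _ , r = find p in + b , r
    ... | no _ | yes p = let b , _ , r = find p in ℤ.- + b , r
    ... | no ¬p | no ¬r = contradiction upper (<⇒≱ large)
      where
      open ≤-Reasoning
      below : ∀ β → ¬ (X ≤ D * hits β is) → D * hits β is ≤ X
      below β ¬le = <⇒≤ (≰⇒> ¬le)
      swap : ∀ (β : ℕ → ℤ) → ∑ is (λ i → ∑ (downFrom q) (λ b → C b * [ inWindow? (β b) i ?])) ≡ ∑ (downFrom q) (λ b → C b * hits (β b) is)
      swap β = trans (∑-swap is (downFrom q) _) (∑-ext (downFrom q) λ b → ∑-*ˡ is (C b) _)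
      bound : ∀ (β : ℕ → ℤ) → (∀ b → b ∈ downFrom q → D * hits (β b) is ≤ X) → D * ∑ (downFrom q) (λ b → C b * hits (β b) is) ≤ A q * X
      bound β h = ≤-trans (≤-reflexive (sym (∑-*ˡ (downFrom q) D _))) (≤-trans (∑-mono (downFrom q) λ b b∈ →
        ≤-trans (≤-reflexive (l D (C b) (hits (β b) is))) (*-mono-≤ˡ (<⇒≤ (0<C (∈-downFrom⁻ b∈))) (h b b∈))) (≤-reflexive (∑-*ʳ (downFrom q) X C)))
        where
        l : ∀ a b x → a * (b * x) ≡ b * (a * x)
        l = solve-∀ ℚ-ring
      2Aq≤ : 2ℚ * A q ≤ t + 2ℚ
      2Aq≤ = ≤-by (t * (1ℚ - S q) + (C q - - 1ℚ)) (+-nonNeg (*-nonNeg (<⇒≤ 0<t) (≤⇒0≤ (s≤1 (+ q)))) (≤⇒0≤ (-1≤c (+ q))))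
        (trans (l t (S q) (C q)) (cong (λ z → z + (t * (1ℚ - S q) + (C q - - 1ℚ))) (sym (2A q))))
        where
        l : ∀ t x y → t + 2ℚ ≡ t * x + 1ℚ - y + (t * (1ℚ - x) + (y - - 1ℚ))
        l = solve-∀ ℚ-ring
      H⁺ = ∑ (downFrom q) (λ b → C b * hits (+ b) is)
      H⁻ = ∑ (downFrom q) (λ b → C b * hits (ℤ.- + b) is)
      upper : D * ∑ is (λ i → t * (1ℚ + S (i %ℕ N)) - 32ℚ) ≤ 2ℚ * ((t + 2ℚ) * X)
      upper = begin
        D * ∑ is (λ i → t * (1ℚ + S (i %ℕ N)) - 32ℚ) ≤⟨ *-mono-≤ˡ 0≤D (∑-mono is (λ i _ → window-weight i)) ⟩
        D * ∑ is (λ i → 2ℚ * (V⁺ i + V⁻ i)) ≡⟨ cong (D *_) (trans (∑-*ˡ is 2ℚ _) (cong (2ℚ *_) (∑-+ is V⁺ V⁻))) ⟩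
        D * (2ℚ * (∑ is V⁺ + ∑ is V⁻)) ≡⟨ cong (λ z → D * (2ℚ * z)) (cong₂ _+_ (swap (λ b → + b)) (swap (λ b → ℤ.- + b))) ⟩
        D * (2ℚ * (H⁺ + H⁻)) ≡⟨ l₁ D H⁺ H⁻ ⟩
        2ℚ * (D * H⁺ + D * H⁻)
          ≤⟨ 2*-mono (+-mono-≤ (bound (λ b → + b) λ b b∈ → below (+ b) λ le → ¬p (lose b∈ le))
                               (bound (λ b → ℤ.- + b) λ b b∈ → below (ℤ.- + b) λ le → ¬r (lose b∈ le))) ⟩
        2ℚ * (A q * X + A q * X) ≡⟨ l (A q) X ⟩
        2ℚ * (2ℚ * A q * X) ≤⟨ 2*-mono (*-mono-≤ʳ 0≤X 2Aq≤) ⟩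
        2ℚ * ((t + 2ℚ) * X) ∎
        where
        l : ∀ a x → 2ℚ * (a * x + a * x) ≡ 2ℚ * (2ℚ * a * x)
        l = solve-∀ ℚ-ring
        l₁ : ∀ d a b → d * (2ℚ * (a + b)) ≡ 2ℚ * (d * a + d * b)
        l₁ = solve-∀ ℚ-ring

-- A large exponential sum forces concentration on a half circle

module Arc where

  open import Data.Integer.Base as ℤ using (ℤ; +_; -[1+_])
  open import Data.Integer.DivMod using (_%ℕ_; _/ℕ_; n%ℕd<d; a≡a%ℕn+[a/ℕn]*n)
  open import Data.Rational.Base
  open import Data.Rational.Properties
  open RationalOrder
  open ListSum
  open Rotations
  open Residue
  open HalfWindow

  module Arcs (slope : Slope) where
    open Slope slope
    open Rotation slope
    open Windows slope

    rotˣ rotʸ : ℚ → ℚ → ℤ → ℚ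
    rotˣ x y β = x * c β - y * s β
    rotʸ x y β = y * c β + x * s β

    private
      rot-norm : ∀ x y β → rotˣ x y β * rotˣ x y β + rotʸ x y β * rotʸ x y β ≡ x * x + y * y
      rot-norm x y β = trans (l x y (c β) (s β)) (trans (cong ((x * x + y * y) *_) (unit β)) (*-identityʳ _))
        where
        l : ∀ x y u v → (x * u - y * v) * (x * u - y * v) + (y * u + x * v) * (y * u + x * v) ≡ (x * x + y * y) * (u * u + v * v)
        l = solve-∀ ℚ-ring

      rotˣ-+ : ∀ x y β γ → rotˣ (rotˣ x y β) (rotʸ x y β) γ ≡ rotˣ x y (β ℤ.+ γ)
      rotˣ-+ x y β γ = trans (l x y (c β) (s β) (c γ) (s γ)) (sym (cong₂ (λ a b → x * a - y * b) (c-+ β γ) (s-+ β γ)))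
        where
        l : ∀ x y u v a b → (x * u - y * v) * a - (y * u + x * v) * b ≡ x * (u * a - v * b) - y * (v * a + u * b)
        l = solve-∀ ℚ-ring

      rotʸ-+ : ∀ x y β γ → rotʸ (rotˣ x y β) (rotʸ x y β) γ ≡ rotʸ x y (β ℤ.+ γ)
      rotʸ-+ x y β γ = trans (l x y (c β) (s β) (c γ) (s γ)) (sym (cong₂ (λ a b → y * a + x * b) (c-+ β γ) (s-+ β γ)))
        where
        l : ∀ x y u v a b → (y * u + x * v) * a + (x * u - y * v) * b ≡ y * (u * a - v * b) + x * (v * a + u * b)
        l = solve-∀ ℚ-ring

    -- A rotation by at most k quarter turns takes (x , y) close to the positive vertical axis.
    Upright : ℕ → ℚ → ℚ → Set
    Upright k x y = ∃[ β ] (β ℕ.≤ k ℕ.* q × 0ℚ ≤ rotʸ x y (+ β) × t * t * (rotˣ x y (+ β) * rotˣ x y (+ β)) ≤ 8ℚ * (x * x + y * y))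

    private
      7/9 : ℚ
      7/9 = + 7 / 9

      ½≤c₁² : ½ ≤ c₁ * c₁
      ½≤c₁² = ≤-trans (≤-by (7/9 * 7/9 - ½) (nonNegative⁻¹ (7/9 * 7/9 - ½)) refl) (sq-mono-≤ (nonNegative⁻¹ 7/9) 7/9≤c₁)
        where
        3ℚ = 2ℚ + 1ℚ
        7/9≤c₁ : 7/9 ≤ c₁
        7/9≤c₁ = *-cancelʳ-≤ {3ℚ * 3ℚ} (positive⁻¹ (3ℚ * 3ℚ)) (≤-by ((2ℚ - 3ℚ * s₁) + 3ℚ * (s₁ - 3ℚ * (1ℚ - c₁)))
          (+-nonNeg (≤⇒0≤ s₁≤⅔) (*-nonNeg (nonNegative⁻¹ 3ℚ) (≤⇒0≤ (≤-trans (*-mono-≤ʳ (≤⇒0≤ (subst (_≤ 1ℚ) C₁≡ (c≤1 (+ 1)))) 3≤t) (≤-reflexive (sym s₁≡)))))) (l s₁ c₁))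
          where
          l : ∀ s c → c * (3ℚ * 3ℚ) ≡ 7/9 * (3ℚ * 3ℚ) + ((2ℚ - 3ℚ * s) + 3ℚ * (s - 3ℚ * (1ℚ - c)))
          l = solve-∀ ℚ-ring

      small : ∀ {a w} → 0ℚ ≤ w → a ≤ w * (s₁ * s₁) → t * t * a ≤ 4ℚ * w
      small {a} {w} 0≤w p = ≤-trans (*-mono-≤ˡ (sq-nonNeg t) p) (≤-trans (≤-reflexive (l t w s₁))
        (*-mono-≤ʳ 0≤w (sq-mono-≤ (*-nonNeg (<⇒≤ 0<t) 0≤s₁) ts₁≤2)))
        where
        l : ∀ t w s → t * t * (w * (s * s)) ≡ t * s * (t * s) * w
        l = solve-∀ ℚ-ring

      4≤8 : ∀ {w} → 0ℚ ≤ w → 4ℚ * w ≤ 8ℚ * w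
      4≤8 {w} 0≤w = *-mono-≤ʳ {w} {4ℚ} {8ℚ} 0≤w (≤-by 4ℚ (nonNegative⁻¹ 4ℚ) refl)

      norm-nonNeg : ∀ x y → 0ℚ ≤ x * x + y * y
      norm-nonNeg x y = +-nonNeg (sq-nonNeg x) (sq-nonNeg y)

      crossing : ∀ x y → 0ℚ ≤ x → ∀ n → rotˣ x y (+ n) ≤ 0ℚ → (∃[ j ] (j ℕ.< n × 0ℚ ≤ rotˣ x y (+ j) × rotˣ x y (+ suc j) ≤ 0ℚ)) ⊎ x ≡ 0ℚ
      crossing x y 0≤x zero p = inj₂ (≤-antisym (subst (_≤ 0ℚ) (l x y) p) 0≤x)
        where
        l : ∀ x y → x * 1ℚ - y * 0ℚ ≡ x
        l = solve-∀ ℚ-ring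
      crossing x y 0≤x (suc n) p with 0ℚ ≤? rotˣ x y (+ n)
      ... | yes r = inj₁ (n , ℕ.≤-refl , r , p)
      ... | no ¬r with crossing x y 0≤x n (<⇒≤ (≰⇒> ¬r))
      ... | inj₁ (j , j<n , r) = inj₁ (j , ℕ.m<n⇒m<1+n j<n , r)
      ... | inj₂ x≡0 = inj₂ x≡0

      -- At the last step before the horizontal coordinate changes sign, `X * c₁ ≤ Y * s₁`, so X is
      -- smaller than the modulus by a factor of order 1/T. Dividing by c₁² ≥ 1/2 turns the constant
      -- 4 of `small` into 8.
      upright₁ : ∀ x y → 0ℚ ≤ x → 0ℚ ≤ y → Upright 1 x y
      upright₁ x y 0≤x 0≤y = case (crossing x y 0≤x q (≤-by (y * S q + x * (- C q)) (+-nonNeg (*-nonNeg 0≤y (<⇒≤ 0<Sq)) (*-nonNeg 0≤x (neg-nonNeg Cq≤0))) (l₀ x y (C q) (S q))))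
        where
        l₀ : ∀ x y u v → 0ℚ ≡ x * u - y * v + (y * v + x * (- u))
        l₀ = solve-∀ ℚ-ring
        case : (∃[ j ] (j ℕ.< q × 0ℚ ≤ rotˣ x y (+ j) × rotˣ x y (+ suc j) ≤ 0ℚ)) ⊎ x ≡ 0ℚ → Upright 1 x y
        case (inj₂ x≡0) = 0 , ℕ.z≤n , subst (0ℚ ≤_) (sym (l₁ x y)) 0≤y , subst (_≤ 8ℚ * (x * x + y * y)) (sym at-0) (*-nonNeg (nonNegative⁻¹ 8ℚ) (norm-nonNeg x y))
          where
          l₁ : ∀ x y → y * 1ℚ + x * 0ℚ ≡ y
          l₁ = solve-∀ ℚ-ring
          l₂ : ∀ t x y → t * t * ((x * 1ℚ - y * 0ℚ) * (x * 1ℚ - y * 0ℚ)) ≡ t * t * x * x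
          l₂ = solve-∀ ℚ-ring
          at-0 : t * t * (rotˣ x y (+ 0) * rotˣ x y (+ 0)) ≡ 0ℚ
          at-0 = trans (l₂ t x y) (trans (cong (t * t * x *_) x≡0) (*-zeroʳ (t * t * x)))
        case (inj₁ (j , j<q , 0≤X , X′≤0)) = j , ℕ.≤-trans (ℕ.<⇒≤ j<q) (ℕ.≤-reflexive (sym (ℕ.*-identityˡ q))) , 0≤Y , *-cancelʳ-≤ {½} (positive⁻¹ ½) (begin
            t * t * (X * X) * ½ ≤⟨ *-mono-≤ˡ (*-nonNeg (sq-nonNeg t) (sq-nonNeg X)) ½≤c₁² ⟩
            t * t * (X * X) * (c₁ * c₁) ≡⟨ l₁ t X c₁ ⟩
            t * t * (X * c₁ * (X * c₁)) ≤⟨ small (norm-nonNeg x y) (≤-trans (sq-mono-≤ (*-nonNeg 0≤X 0≤c₁) Xc≤Ys) Y²s²≤) ⟩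
            4ℚ * W ≡⟨ l₂ W ⟩
            8ℚ * W * ½ ∎)
          where
          open ≤-Reasoning
          X = rotˣ x y (+ j)
          Y = rotʸ x y (+ j)
          W = x * x + y * y
          0≤Y : 0ℚ ≤ Y
          0≤Y = +-nonNeg (*-nonNeg 0≤y (<⇒≤ (0<C j<q))) (*-nonNeg 0≤x (0≤S j<q))
          Xc≤Ys : X * c₁ ≤ Y * s₁
          Xc≤Ys = 0≤⇒≤ (subst (0ℚ ≤_) (l x y (C j) (S j) c₁ s₁) (neg-nonNeg X′≤0))
            where
            l : ∀ x y u v c s → - (x * (u * c - v * s) - y * (v * c + u * s)) ≡ (y * u + x * v) * s - (x * u - y * v) * c
            l = solve-∀ ℚ-ring
          Y²s²≤ : Y * s₁ * (Y * s₁) ≤ W * (s₁ * s₁)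
          Y²s²≤ = subst (_≤ W * (s₁ * s₁)) (l Y s₁) (*-mono-≤ʳ {s₁ * s₁} {Y * Y} {W} (sq-nonNeg s₁) (≤-by (X * X) (sq-nonNeg X) (trans (sym (rot-norm x y (+ j))) (+-comm (X * X) (Y * Y)))))
            where
            l : ∀ a b → a * a * (b * b) ≡ a * b * (a * b)
            l = solve-∀ ℚ-ring
          l₁ : ∀ t x c → t * t * (x * x) * (c * c) ≡ t * t * (x * c * (x * c))
          l₁ = solve-∀ ℚ-ring
          l₂ : ∀ w → 4ℚ * w ≡ 8ℚ * w * ½
          l₂ = solve-∀ ℚ-ring

      turned : ∀ k x y → Upright k (rotˣ x y (+ q)) (rotʸ x y (+ q)) → Upright (suc k) x y
      turned k x y (β , β≤ , 0≤Y , X≤) = q ℕ.+ β , ℕ.+-monoʳ-≤ q β≤ , subst (0ℚ ≤_) (rotʸ-+ x y (+ q) (+ β)) 0≤Y ,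
        subst₂ (λ a b → t * t * (a * a) ≤ 8ℚ * b) (rotˣ-+ x y (+ q) (+ β)) (rot-norm x y (+ q)) X≤

      widen : ∀ k l x y → k ℕ.≤ l → Upright k x y → Upright l x y
      widen k l x y k≤l (β , β≤ , r) = β , ℕ.≤-trans β≤ (ℕ.*-monoˡ-≤ q k≤l) , r

      0≤-neg : ∀ {a} → ¬ (0ℚ ≤ a) → 0ℚ ≤ - a
      0≤-neg ¬p = neg-nonNeg (<⇒≤ (≰⇒> ¬p))

      -- A quarter turn leads to the first quadrant unless its rounding overshoots the vertical
      -- axis; in that case the horizontal coordinate is already at most s₁ times the modulus.
      upright₂ : ∀ x y → 0ℚ ≤ x → 0ℚ ≤ - y → Upright 2 x y
      upright₂ x y 0≤x 0≤-y with 0ℚ ≤? rotˣ x y (+ q)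
      ... | yes 0≤x′ = turned 1 x y (upright₁ (rotˣ x y (+ q)) (rotʸ x y (+ q)) 0≤x′ 0≤y′)
        where
        0≤y′ : 0ℚ ≤ rotʸ x y (+ q)
        0≤y′ = subst (0ℚ ≤_) (l x y (C q) (S q)) (+-nonNeg (*-nonNeg 0≤-y (neg-nonNeg Cq≤0)) (*-nonNeg 0≤x (<⇒≤ 0<Sq)))
          where
          l : ∀ x y u v → (- y) * (- u) + x * v ≡ y * u + x * v
          l = solve-∀ ℚ-ring
      ... | no ¬0≤x′ = q , ℕ.m≤m+n q _ , 0≤y′ , ≤-trans (small (norm-nonNeg x y) x′²≤) (4≤8 (norm-nonNeg x y))
        where
        0≤y′ : 0ℚ ≤ rotʸ x y (+ q)
        0≤y′ = subst (0ℚ ≤_) (l x y (C q) (S q)) (+-nonNeg (*-nonNeg 0≤-y (neg-nonNeg Cq≤0)) (*-nonNeg 0≤x (<⇒≤ 0<Sq)))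
          where
          l : ∀ x y u v → (- y) * (- u) + x * v ≡ y * u + x * v
          l = solve-∀ ℚ-ring
        x′ = rotˣ x y (+ q)
        -x′≤ : - x′ ≤ x * (- C q)
        -x′≤ = ≤-by ((- y) * S q) (*-nonNeg 0≤-y (<⇒≤ 0<Sq)) (l x y (C q) (S q))
          where
          l : ∀ x y u v → x * (- u) ≡ - (x * u - y * v) + (- y) * v
          l = solve-∀ ℚ-ring
        x′²≤ : x′ * x′ ≤ (x * x + y * y) * (s₁ * s₁)
        x′²≤ = begin
          x′ * x′ ≡⟨ l₁ x′ ⟩
          (- x′) * (- x′) ≤⟨ sq-mono-≤ (0≤-neg ¬0≤x′) -x′≤ ⟩
          x * (- C q) * (x * (- C q)) ≡⟨ l₂ x (C q) ⟩
          x * x * (C q * C q) ≤⟨ *-mono-≤-nonNeg (sq-nonNeg x) (sq-nonNeg s₁) (≤-by (y * y) (sq-nonNeg y) refl) Cq²≤s₁² ⟩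
          (x * x + y * y) * (s₁ * s₁) ∎
          where
          open ≤-Reasoning
          l₁ : ∀ a → a * a ≡ (- a) * (- a)
          l₁ = solve-∀ ℚ-ring
          l₂ : ∀ x u → x * (- u) * (x * (- u)) ≡ x * x * (u * u)
          l₂ = solve-∀ ℚ-ring

      upright₃ : ∀ x y → 0ℚ ≤ - x → 0ℚ ≤ - y → Upright 3 x y
      upright₃ x y 0≤-x 0≤-y with 0ℚ ≤? rotʸ x y (+ q)
      ... | yes 0≤y′ = widen 2 3 x y (ℕ.s≤s (ℕ.s≤s ℕ.z≤n)) (turned 1 x y (upright₁ (rotˣ x y (+ q)) (rotʸ x y (+ q)) 0≤x′ 0≤y′))
        where
        0≤x′ : 0ℚ ≤ rotˣ x y (+ q)
        0≤x′ = subst (0ℚ ≤_) (l x y (C q) (S q)) (+-nonNeg (*-nonNeg 0≤-x (neg-nonNeg Cq≤0)) (*-nonNeg 0≤-y (<⇒≤ 0<Sq)))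
          where
          l : ∀ x y u v → (- x) * (- u) + (- y) * v ≡ x * u - y * v
          l = solve-∀ ℚ-ring
      ... | no ¬0≤y′ = turned 2 x y (upright₂ (rotˣ x y (+ q)) (rotʸ x y (+ q)) 0≤x′ (0≤-neg ¬0≤y′))
        where
        0≤x′ : 0ℚ ≤ rotˣ x y (+ q)
        0≤x′ = subst (0ℚ ≤_) (l x y (C q) (S q)) (+-nonNeg (*-nonNeg 0≤-x (neg-nonNeg Cq≤0)) (*-nonNeg 0≤-y (<⇒≤ 0<Sq)))
          where
          l : ∀ x y u v → (- x) * (- u) + (- y) * v ≡ x * u - y * v
          l = solve-∀ ℚ-ring

      upright₄ : ∀ x y → 0ℚ ≤ - x → 0ℚ ≤ y → Upright 4 x y
      upright₄ x y 0≤-x 0≤y = turned 3 x y (case (0ℚ ≤? rotˣ x y (+ q)))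
        where
        0≤-y′ : 0ℚ ≤ - rotʸ x y (+ q)
        0≤-y′ = subst (0ℚ ≤_) (l x y (C q) (S q)) (+-nonNeg (*-nonNeg 0≤y (neg-nonNeg Cq≤0)) (*-nonNeg 0≤-x (<⇒≤ 0<Sq)))
          where
          l : ∀ x y u v → y * (- u) + (- x) * v ≡ - (y * u + x * v)
          l = solve-∀ ℚ-ring
        case : Dec (0ℚ ≤ rotˣ x y (+ q)) → Upright 3 (rotˣ x y (+ q)) (rotʸ x y (+ q))
        case (yes 0≤x′) = widen 2 3 (rotˣ x y (+ q)) (rotʸ x y (+ q)) (ℕ.s≤s (ℕ.s≤s ℕ.z≤n)) (upright₂ (rotˣ x y (+ q)) (rotʸ x y (+ q)) 0≤x′ 0≤-y′)
        case (no ¬0≤x′) = upright₃ (rotˣ x y (+ q)) (rotʸ x y (+ q)) (0≤-neg ¬0≤x′) 0≤-y′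

    upright : ∀ x y → Upright 4 x y
    upright x y with 0ℚ ≤? x | 0ℚ ≤? y
    ... | yes p | yes r = widen 1 4 x y (ℕ.s≤s ℕ.z≤n) (upright₁ x y p r)
    ... | yes p | no ¬r = widen 2 4 x y (ℕ.s≤s (ℕ.s≤s ℕ.z≤n)) (upright₂ x y p (0≤-neg ¬r))
    ... | no ¬p | no ¬r = widen 3 4 x y (ℕ.s≤s (ℕ.s≤s (ℕ.s≤s ℕ.z≤n))) (upright₃ x y (0≤-neg ¬p) (0≤-neg ¬r))
    ... | no ¬p | yes r = upright₄ x y (0≤-neg ¬p) r

    private
      chord : ∀ i d → (c (i ℤ.+ d) - c i) * (c (i ℤ.+ d) - c i) + (s (i ℤ.+ d) - s i) * (s (i ℤ.+ d) - s i) ≡ κ d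
      chord i d = trans (cong₂ (λ a b → (a - c i) * (a - c i) + (b - s i) * (b - s i)) (c-+ i d) (s-+ i d))
        (trans (l (c i) (s i) (c d) (s d)) (trans (cong (_* ((c d - 1ℚ) * (c d - 1ℚ) + s d * s d)) (unit i)) (trans (*-identityˡ _) (κ-norm d))))
        where
        l : ∀ x y u v → (x * u - y * v - x) * (x * u - y * v - x) + (y * u + x * v - y) * (y * u + x * v - y)
                      ≡ (x * x + y * y) * ((u - 1ℚ) * (u - 1ℚ) + v * v)
        l = solve-∀ ℚ-ring

      k-bound : ∀ {K} k → ℤ.∣ k ∣ ℕ.≤ K → ι k * ι k ≤ ιₙ K * ιₙ K
      k-bound (+ n) le = sq-mono-≤ (ιₙ-nonNeg n) (ιₙ-mono-≤ le)
      k-bound {K} -[1+ n ] le = subst (_≤ ιₙ K * ιₙ K) (trans (l (ιₙ (suc n))) (sym (cong₂ _*_ (ι-neg (+ suc n)) (ι-neg (+ suc n)))))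
        (sq-mono-≤ (ιₙ-nonNeg (suc n)) (ιₙ-mono-≤ le))
        where
        l : ∀ a → a * a ≡ (- a) * (- a)
        l = solve-∀ ℚ-ring

    0<N : 0ℚ < ιₙ N
    0<N = subst (_< ιₙ N) (ι-def (+ 0)) (ιₙ-mono-< (ℕ.>-nonZero⁻¹ N))

    -- Two sines differ by at most the chord between the points, and by `κ-turn` the chord of k
    -- approximate turns is at most 32 k / N.
    reduction-error : ∀ ρ k {K D} → 0ℚ ≤ D → ℤ.∣ k ∣ ℕ.≤ K → D * (32ℚ * ιₙ K) ≤ ιₙ N → D * (s (ρ ℤ.+ k ℤ.* + N) - s ρ) ≤ 1ℚ
    reduction-error ρ k {K} {D} 0≤D k≤K small = *-cancelʳ-≤ {ιₙ N} {D * Δ} {1ℚ} 0<N (begin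
        D * Δ * ιₙ N ≡⟨ *-assoc D Δ (ιₙ N) ⟩
        D * (Δ * ιₙ N) ≤⟨ *-mono-≤ˡ 0≤D Δ≤ ⟩
        D * (32ℚ * ιₙ K) ≤⟨ small ⟩
        ιₙ N ≡⟨ *-identityˡ (ιₙ N) ⟨
        1ℚ * ιₙ N ∎)
      where
      open ≤-Reasoning
      i = ρ ℤ.+ k ℤ.* + N
      Δ = s i - s ρ
      Δ²≤ : Δ * ιₙ N * (Δ * ιₙ N) ≤ 32ℚ * ιₙ K * (32ℚ * ιₙ K)
      Δ²≤ = begin
        Δ * ιₙ N * (Δ * ιₙ N) ≡⟨ l₁ Δ (ιₙ N) ⟩
        ιₙ N * ιₙ N * (Δ * Δ) ≤⟨ *-mono-≤ˡ (sq-nonNeg (ιₙ N)) (≤-by ((c i - c ρ) * (c i - c ρ)) (sq-nonNeg (c i - c ρ))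
                                                (trans (sym (chord ρ (k ℤ.* + N))) (+-comm ((c i - c ρ) * (c i - c ρ)) (Δ * Δ)))) ⟩
        ιₙ N * ιₙ N * κ (k ℤ.* + N) ≡⟨ cong (λ z → ιₙ N * ιₙ N * κ z) (ℤ.*-comm k (+ N)) ⟩
        ιₙ N * ιₙ N * κ (+ N ℤ.* k) ≤⟨ κ-turn k ⟩
        1024ℚ * (ι k * ι k) ≤⟨ *-mono-≤ˡ (nonNegative⁻¹ 1024ℚ) (k-bound k k≤K) ⟩
        1024ℚ * (ιₙ K * ιₙ K) ≡⟨ l₂ (ιₙ K) ⟩
        32ℚ * ιₙ K * (32ℚ * ιₙ K) ∎
        where
        l₁ : ∀ d n → d * n * (d * n) ≡ n * n * (d * d)
        l₁ = solve-∀ ℚ-ring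
        l₂ : ∀ k → 1024ℚ * (k * k) ≡ 32ℚ * k * (32ℚ * k)
        l₂ = solve-∀ ℚ-ring
      Δ≤ : Δ * ιₙ N ≤ 32ℚ * ιₙ K
      Δ≤ = sq-cancel-≤ (*-nonNeg (nonNegative⁻¹ 32ℚ) (ιₙ-nonNeg K)) Δ²≤

    turns : ∀ {K} j β → ℤ.∣ j ∣ ℕ.≤ K ℕ.* N → β ℕ.≤ N → ℤ.∣ (j ℤ.+ + β) /ℕ N ∣ ℕ.≤ 2 ℕ.+ K
    turns {K} j β j≤ β≤ = ℕ.*-cancelʳ-≤ _ _ N (begin
      ℤ.∣ k ∣ ℕ.* N ≡⟨ ℤ.abs-* k (+ N) ⟨
      ℤ.∣ k ℤ.* + N ∣ ≡⟨ cong ℤ.∣_∣ (trans (l (+ ρ) (k ℤ.* + N)) (cong (ℤ._- + ρ) (sym (a≡a%ℕn+[a/ℕn]*n i N)))) ⟩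
      ℤ.∣ i ℤ.- + ρ ∣ ≤⟨ ℤ.∣i-j∣≤∣i∣+∣j∣ i (+ ρ) ⟩
      ℤ.∣ i ∣ ℕ.+ ρ ≤⟨ ℕ.+-mono-≤ (ℕ.≤-trans (ℤ.∣i+j∣≤∣i∣+∣j∣ j (+ β)) (ℕ.+-mono-≤ j≤ β≤)) (ℕ.<⇒≤ (n%ℕd<d i N)) ⟩
      K ℕ.* N ℕ.+ N ℕ.+ N ≡⟨ trans (ℕ.+-assoc (K ℕ.* N) N N) (ℕ.+-comm (K ℕ.* N) (N ℕ.+ N)) ⟩
      N ℕ.+ N ℕ.+ K ℕ.* N ≡⟨ ℕ.+-assoc N N (K ℕ.* N) ⟩
      (2 ℕ.+ K) ℕ.* N ∎)
      where
      open ℕ.≤-Reasoning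
      i = j ℤ.+ + β
      k = i /ℕ N
      ρ = i %ℕ N
      l : ∀ a b → b ≡ a ℤ.+ b ℤ.- a
      l = ℤ-Solver.solve-∀

    private
      -- In units of 1/100000: `a` is the assumed bias, `b` what is left of it after the sum is
      -- turned upright, and `P` is almost (1 + b) / 2. Of the slack 2 in 4P + 2 = 2D + 2b, one unit
      -- pays for the reduction modulo `N` and the other for the additive errors 64D + 8P, which
      -- `T₀` exceeds.
      D a b P T₀ : ℚ
      D = ιₙ 100000
      a = ιₙ 50010
      b = ιₙ 50009
      P = ιₙ 75004
      T₀ = ιₙ 100000000

      0≤D : 0ℚ ≤ D
      0≤D = ιₙ-nonNeg 100000

      a²≡b²+ : a * a ≡ b * b + ιₙ 100019
      a²≡b²+ = trans (sym (ιₙ-* 50010 50010)) (trans (ιₙ-+ (50009 ℕ.* 50009) 100019) (cong (_+ ιₙ 100019) (ιₙ-* 50009 50009)))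

      8a²≤ : 8ℚ * (a * a) ≤ T₀ * T₀ * ιₙ 100019
      8a²≤ = subst₂ _≤_ (trans (ιₙ-* 8 (50010 ℕ.* 50010)) (cong₂ _*_ (ι-def _) (ιₙ-* 50010 50010)))
        (trans (ιₙ-* (100000000 ℕ.* 100000000) 100019) (cong (_* ιₙ 100019) (ιₙ-* 100000000 100000000)))
        (ιₙ-mono-≤ (ℕ.≤ᵇ⇒≤ (8 ℕ.* (50010 ℕ.* 50010)) (100000000 ℕ.* 100000000 ℕ.* 100019) _))

      8≤T₀² : 8ℚ ≤ T₀ * T₀
      8≤T₀² = subst₂ _≤_ (ι-def _) (ιₙ-* 100000000 100000000) (ιₙ-mono-≤ (ℕ.≤ᵇ⇒≤ 8 (100000000 ℕ.* 100000000) _))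

      4P+1≡ : 4ℚ * P + 1ℚ + 1ℚ ≡ 2ℚ * D + 2ℚ * b
      4P+1≡ = trans (sym (trans (ιₙ-+ (4 ℕ.* 75004 ℕ.+ 1) 1) (cong₂ _+_ (trans (ιₙ-+ (4 ℕ.* 75004) 1) (cong₂ _+_ (trans (ιₙ-* 4 75004) (cong (_* P) (ι-def _))) (ι-def _))) (ι-def _))))
        (trans (ιₙ-+ (2 ℕ.* 100000) (2 ℕ.* 50009)) (cong₂ _+_ (trans (ιₙ-* 2 100000) (cong (_* D) (ι-def _))) (trans (ιₙ-* 2 50009) (cong (_* b) (ι-def _)))))

      T₀-large : 64ℚ * D + 8ℚ * P < T₀
      T₀-large = subst (_< T₀) (trans (ιₙ-+ (64 ℕ.* 100000) (8 ℕ.* 75004)) (cong₂ _+_ (trans (ιₙ-* 64 100000) (cong (_* D) (ι-def _))) (trans (ιₙ-* 8 75004) (cong (_* P) (ι-def _)))))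
        (ιₙ-mono-< (ℕ.<ᵇ⇒< (64 ℕ.* 100000 ℕ.+ 8 ℕ.* 75004) 100000000 _))

    -- 0.75004 is (1 + 0.5001) / 2 less a little for rounding.
    arc : ∀ (js : List ℤ) K → 100000000 ℕ.≤ T → 2ℚ * ιₙ 100000 * (32ℚ * ιₙ (2 ℕ.+ K)) ≤ ιₙ N → (∀ j → j ∈ js → ℤ.∣ j ∣ ℕ.≤ K ℕ.* N) →
          1 ℕ.≤ length js →
          ιₙ 50010 * ιₙ 50010 * (ιₙ (length js) * ιₙ (length js)) ≤ ιₙ 100000 * ιₙ 100000 * (∑ js c * ∑ js c + ∑ js s * ∑ js s) →
          ∃[ β ] ιₙ (length js) * ιₙ 75004 ≤ ιₙ 100000 * hits β js
    arc js K T-large N-large bounded nonempty biased = β ℤ.- + β₀ , subst (λ z → m * P ≤ D * z) hits≡ hit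
      where
      open ≤-Reasoning
      m = ιₙ (length js)
      W = ∑ js c * ∑ js c + ∑ js s * ∑ js s
      up = upright (∑ js c) (∑ js s)
      β₀ = proj₁ up
      β₀≤N : β₀ ℕ.≤ N
      β₀≤N = proj₁ (proj₂ up)
      X = rotˣ (∑ js c) (∑ js s) (+ β₀)
      Y = rotʸ (∑ js c) (∑ js s) (+ β₀)
      0≤Y : 0ℚ ≤ Y
      0≤Y = proj₁ (proj₂ (proj₂ up))
      T₀≤t : T₀ ≤ t
      T₀≤t = ιₙ-mono-≤ T-large
      0≤T₀ = ιₙ-nonNeg 100000000
      0<m : 0ℚ < m
      0<m = subst (_< m) (ι-def (+ 0)) (ιₙ-mono-< nonempty)
      g = ιₙ 100019
      -- The horizontal component carries at most the proportion 8 / t² of the squared modulus; the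
      -- difference `g` of the squares of `a` and `b` pays for it.
      bm≤DY : b * m ≤ D * Y
      bm≤DY = sq-cancel-≤ (*-nonNeg 0≤D 0≤Y) (*-cancelʳ-≤ {t * t} {b * m * (b * m)} {D * Y * (D * Y)} (*-pos 0<t 0<t) (begin
        b * m * (b * m) * (t * t)
          ≤⟨ ≤-by (g * ((t - T₀) * (t + T₀)) * (m * m) + (T₀ * T₀ * g - 8ℚ * (a * a)) * (m * m))
               (+-nonNeg (*-nonNeg (*-nonNeg (ιₙ-nonNeg 100019) (*-nonNeg (≤⇒0≤ T₀≤t) (+-nonNeg (<⇒≤ 0<t) 0≤T₀))) (sq-nonNeg m))
                  (*-nonNeg (≤⇒0≤ 8a²≤) (sq-nonNeg m)))
               (trans (cong (λ z → (t * t - 8ℚ) * (z * (m * m))) a²≡b²+) (trans (l₁ (b * b) g T₀ m t) (cong₂ (λ u v → u + (g * ((t - T₀) * (t + T₀)) * (m * m) + (T₀ * T₀ * g - 8ℚ * v) * (m * m))) (l₀ b m t) (sym a²≡b²+)))) ⟩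
        (t * t - 8ℚ) * (a * a * (m * m)) ≤⟨ *-mono-≤ˡ (≤⇒0≤ (≤-trans 8≤T₀² (sq-mono-≤ 0≤T₀ T₀≤t))) biased ⟩
        (t * t - 8ℚ) * (D * D * W) ≡⟨ l₂ t W D ⟩
        D * D * (t * t * W - 8ℚ * W) ≤⟨ *-mono-≤ˡ (sq-nonNeg D) (+-monoʳ-≤ (t * t * W) (neg-antimono-≤ (proj₂ (proj₂ (proj₂ up))))) ⟩
        D * D * (t * t * W - t * t * (X * X)) ≡⟨ cong (λ z → D * D * (t * t * z - t * t * (X * X))) (sym (rot-norm (∑ js c) (∑ js s) (+ β₀))) ⟩
        D * D * (t * t * (X * X + Y * Y) - t * t * (X * X)) ≡⟨ l₃ t X Y D ⟩
        D * Y * (D * Y) * (t * t) ∎))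
        where
        l₀ : ∀ b m t → b * b * (m * m) * (t * t) ≡ b * m * (b * m) * (t * t)
        l₀ = solve-∀ ℚ-ring
        l₁ : ∀ b g T m t → (t * t - 8ℚ) * ((b + g) * (m * m)) ≡ b * (m * m) * (t * t) +
             (g * ((t - T) * (t + T)) * (m * m) + (T * T * g - 8ℚ * (b + g)) * (m * m))
        l₁ = solve-∀ ℚ-ring
        l₂ : ∀ t w d → (t * t - 8ℚ) * (d * d * w) ≡ d * d * (t * t * w - 8ℚ * w)
        l₂ = solve-∀ ℚ-ring
        l₃ : ∀ t x y d → d * d * (t * t * (x * x + y * y) - t * t * (x * x)) ≡ d * y * (d * y) * (t * t)
        l₃ = solve-∀ ℚ-ring
      Y≡ : ∑ js (λ j → s (j ℤ.+ + β₀)) ≡ Y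
      Y≡ = trans (∑-ext js λ j → s-+ j (+ β₀)) (trans (∑-+ js _ _) (cong₂ _+_ (∑-*ʳ js (C β₀) s) (∑-*ʳ js (S β₀) c)))
      is = map (ℤ._+ + β₀) js
      Σ = ∑ is (λ i → t * (1ℚ + S (i %ℕ N)) - 32ℚ)
      Z = ∑ js (λ j → S ((j ℤ.+ + β₀) %ℕ N))
      -- Windows depend on residues only, so each phase is reduced modulo `N`; the error per point
      -- is at most 1 / (2D).
      reduced : ∀ j → j ∈ js → 2ℚ * D * s (j ℤ.+ + β₀) ≤ 2ℚ * D * S ((j ℤ.+ + β₀) %ℕ N) + 1ℚ
      reduced j j∈ = ≤-by (1ℚ - 2ℚ * D * (s i - S (i %ℕ N)))
        (≤⇒0≤ (subst (λ z → 2ℚ * D * (s z - S (i %ℕ N)) ≤ 1ℚ) (sym (a≡a%ℕn+[a/ℕn]*n i N))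
          (reduction-error (+ (i %ℕ N)) (i /ℕ N) (*-nonNeg (nonNegative⁻¹ 2ℚ) 0≤D) (turns {K} j β₀ (bounded j j∈) β₀≤N) N-large)))
        (l D (s i) (S (i %ℕ N)))
        where
        i = j ℤ.+ + β₀
        l : ∀ d x y → 2ℚ * d * y + 1ℚ ≡ 2ℚ * d * x + (1ℚ - 2ℚ * d * (x - y))
        l = solve-∀ ℚ-ring
      2DY≤ : 2ℚ * D * Y ≤ 2ℚ * D * Z + m
      2DY≤ = begin
        2ℚ * D * Y ≡⟨ cong (λ z → 2ℚ * D * z) (sym Y≡) ⟩
        2ℚ * D * ∑ js (λ j → s (j ℤ.+ + β₀)) ≡⟨ ∑-*ˡ js (2ℚ * D) _ ⟨
        ∑ js (λ j → 2ℚ * D * s (j ℤ.+ + β₀)) ≤⟨ ∑-mono js reduced ⟩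
        ∑ js (λ j → 2ℚ * D * S ((j ℤ.+ + β₀) %ℕ N) + 1ℚ) ≡⟨ trans (∑-+ js _ _) (cong₂ _+_ (∑-*ˡ js (2ℚ * D) _) (∑-1 js)) ⟩
        2ℚ * D * Z + m ∎
      Σ≡ : Σ ≡ t * (m + Z) - m * 32ℚ
      Σ≡ = trans (∑-map (ℤ._+ + β₀) js _) (trans (∑-ext js λ j → l₂ t (S ((j ℤ.+ + β₀) %ℕ N))) (trans (∑-+ js _ _)
          (trans (cong₂ _+_ (∑-*ˡ js t _) (∑-const js _)) (l₃ t Z m))))
        where
        l₂ : ∀ t x → t * (1ℚ + x) - 32ℚ ≡ t * x + (t * 1ℚ - 32ℚ)
        l₂ = solve-∀ ℚ-ring
        l₃ : ∀ t y m → t * y + m * (t * 1ℚ - 32ℚ) ≡ t * (m + y) - m * 32ℚ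
        l₃ = solve-∀ ℚ-ring
      large : 2ℚ * ((t + 2ℚ) * (m * P)) < D * Σ
      large = *-cancelʳ-<-nonNeg 2ℚ (begin-strict
        2ℚ * ((t + 2ℚ) * (m * P)) * 2ℚ
          <⟨ <-by (m * (T₀ - (64ℚ * D + 8ℚ * P)) + (m * (t - T₀) + t * (2ℚ * D * Z + m - 2ℚ * D * Y) + 2ℚ * t * (D * Y - b * m)))
               (+-pos (*-pos 0<m (<⇒0< T₀-large)) (+-nonNeg (+-nonNeg (*-nonNeg (<⇒≤ 0<m) (≤⇒0≤ T₀≤t)) (*-nonNeg (<⇒≤ 0<t) (≤⇒0≤ 2DY≤)))
                 (*-nonNeg (*-nonNeg (nonNegative⁻¹ 2ℚ) (<⇒≤ 0<t)) (≤⇒0≤ bm≤DY))))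
               (trans (l₁ t m D Z b) (trans (cong (λ z → t * m * (z - 1ℚ) + e) (sym 4P+1≡)) (l₂ t m P D T₀ Y Z b))) ⟩
        D * (t * (m + Z) - m * 32ℚ) * 2ℚ ≡⟨ cong (λ z → D * z * 2ℚ) Σ≡ ⟨
        D * Σ * 2ℚ ∎)
        where
        e = t * (2ℚ * D * Z + m - 2ℚ * b * m) - 64ℚ * D * m
        l₁ : ∀ t m d z b → d * (t * (m + z) - m * 32ℚ) * 2ℚ ≡ t * m * (2ℚ * d + 2ℚ * b - 1ℚ) + (t * (2ℚ * d * z + m - 2ℚ * b * m) - 64ℚ * d * m)
        l₁ = solve-∀ ℚ-ring
        l₂ : ∀ t m p d T y z b → t * m * (4ℚ * p + 1ℚ + 1ℚ - 1ℚ) + (t * (2ℚ * d * z + m - 2ℚ * b * m) - 64ℚ * d * m) ≡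
             2ℚ * ((t + 2ℚ) * (m * p)) * 2ℚ + (m * (T - (64ℚ * d + 8ℚ * p)) + (m * (t - T) + t * (2ℚ * d * z + m - 2ℚ * d * y) + 2ℚ * t * (d * y - b * m)))
        l₂ = solve-∀ ℚ-ring
      found = half-window is D (m * P) 0≤D (*-nonNeg (<⇒≤ 0<m) (ιₙ-nonNeg 75004)) large
      β = proj₁ found
      hit : m * P ≤ D * hits β is
      hit = proj₂ found
      hits≡ : hits β is ≡ hits (β ℤ.- + β₀) js
      hits≡ = trans (∑-map (ℤ._+ + β₀) js _) (∑-ext js λ j → cong (λ z → [ z %ℕ N ℕ.<? 2 ℕ.* q ?]) (l j (+ β₀) β))
        where
        l : ∀ a b d → a ℤ.+ b ℤ.- d ≡ a ℤ.- (d ℤ.- b)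
        l = ℤ-Solver.solve-∀

-- The circle as an abstract source of characters

module Characters where

  open import Data.Integer.Base as ℤ using (ℤ; +_; -[1+_])
  open import Data.Integer.DivMod using (_%ℕ_)
  open import Data.Rational.Base
  open import Data.Rational.Properties
  open RationalOrder
  open ListSum
  open Rotations
  open Arc

  -- `κ-turn` and `κ-lower` bound the squared modulus of a full geometric sum by 1024 / 8 = 128,
  -- which is less than 12².
  12ℚ : ℚ
  12ℚ = 8ℚ + 4ℚ

  -- The functions c and s behave like the cosine and sine of 2πi/N with N = 4q, except that
  -- a full turn is only approximately the identity (κ-turn).
  record Circle : Set where
    field
      q : ℕ
      1≤q : 1 ℕ.≤ q

    N : ℕ
    N = 4 ℕ.* q

    field
      c s : ℤ → ℚ
      c-0 : c (+ 0) ≡ 1ℚ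
      s-0 : s (+ 0) ≡ 0ℚ
      c-+ : ∀ i j → c (i ℤ.+ j) ≡ c i * c j - s i * s j
      s-+ : ∀ i j → s (i ℤ.+ j) ≡ s i * c j + c i * s j
      c-neg : ∀ i → c (ℤ.- i) ≡ c i
      s-neg : ∀ i → s (ℤ.- i) ≡ - s i
      unit : ∀ i → c i * c i + s i * s i ≡ 1ℚ
      c≤1 : ∀ i → c i ≤ 1ℚ
      -1≤c : ∀ i → - 1ℚ ≤ c i

    κ : ℤ → ℚ
    κ i = 2ℚ * (1ℚ - c i)

    instance
      N≢0 : ℕ.NonZero N
      N≢0 = ℕ.>-nonZero (ℕ.≤-trans 1≤q (ℕ.m≤m+n q _))

    InWindow : ℤ → ℤ → Set
    InWindow β i = (i ℤ.- β) %ℕ N ℕ.< 2 ℕ.* q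

    field
      κ-upper : ∀ i → ιₙ N * ιₙ N * κ i ≤ 64ℚ * (ι i * ι i)
      κ-lower : ∀ i → ℤ.∣ i ∣ ℕ.≤ 2 ℕ.* q → 8ℚ * (ι i * ι i) ≤ ιₙ N * ιₙ N * κ i
      κ-turn : ∀ k → ιₙ N * ιₙ N * κ (+ N ℤ.* k) ≤ 1024ℚ * (ι k * ι k)
      -- Approximate orthogonality of characters: for exact roots of unity the sum would be 0, and
      -- here it is bounded independently of `N`.
      kernel : ∀ y → y ≢ + 0 → ℤ.∣ y ∣ ℕ.≤ 2 ℕ.* q →
                - 12ℚ ≤ ∑ (downFrom N) (λ r → c (+ r ℤ.* y)) × ∑ (downFrom N) (λ r → c (+ r ℤ.* y)) ≤ 12ℚ
      arc : ∀ (js : List ℤ) K → 2ℚ * ιₙ 100000 * (32ℚ * ιₙ (2 ℕ.+ K)) ≤ ιₙ N →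
                (∀ j → j ∈ js → ℤ.∣ j ∣ ℕ.≤ K ℕ.* N) → 1 ℕ.≤ length js →
                ιₙ 50010 * ιₙ 50010 * (ιₙ (length js) * ιₙ (length js)) ≤ ιₙ 100000 * ιₙ 100000 * (∑ js c * ∑ js c + ∑ js s * ∑ js s) →
                ∃[ β ] ιₙ (length js) * ιₙ 75004 ≤ ιₙ 100000 * ∑ js (λ j → [ (j ℤ.- β) %ℕ N ℕ.<? 2 ℕ.* q ?])

  module Transform (𝒞 : Circle) where
    open Circle 𝒞

    -- Real and imaginary part of the exponential sum of the list at frequency `r`, that is, of its
    -- Fourier coefficient; `intensity` is the squared modulus.
    Fc Fs : ℤ → List ℤ → ℚ
    Fc r xs = ∑ xs (λ a → c (r ℤ.* a))
    Fs r xs = ∑ xs (λ a → s (r ℤ.* a))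

    intensity : List ℤ → ℤ → ℚ
    intensity xs r = Fc r xs * Fc r xs + Fs r xs * Fs r xs

  module _ (T : ℕ) (T-large : 100000000 ℕ.≤ T) where
    private
      t D : ℚ
      t = ιₙ T
      D = t * t + 1ℚ

      3≤T : 3 ℕ.≤ T
      3≤T = ℕ.≤-trans (ℕ.≤ᵇ⇒≤ 3 100000000 _) T-large

      0<D : 0ℚ < D
      0<D = subst (0ℚ <_) (+-comm 1ℚ (t * t)) (+-pos (positive⁻¹ 1ℚ) (sq-nonNeg t))

      instance
        D-pos : Positive D
        D-pos = positive 0<D
        D≢0 : NonZero D
        D≢0 = pos⇒nonZero D

      -- The rational parametrisation of the unit circle, for half an angle whose cotangent is `t`.
      c₁ s₁ : ℚ
      c₁ = (t * t - 1ℚ) * 1/ D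
      s₁ = 2ℚ * t * 1/ D

      scaled : ∀ {a b} → a * D ≡ b * D → a ≡ b
      scaled {a} {b} eq = ≤-antisym (*-cancelʳ-≤ 0<D (≤-reflexive eq)) (*-cancelʳ-≤ 0<D (≤-reflexive (sym eq)))

      /D : ∀ a → a * 1/ D * D ≡ a
      /D a = trans (*-assoc a (1/ D) D) (trans (cong (a *_) (*-inverseˡ D)) (*-identityʳ a))

      s₁≡ : s₁ ≡ t * (1ℚ - c₁)
      s₁≡ = scaled (trans (/D (2ℚ * t)) (sym (trans (l t D c₁) (trans (cong (λ z → t * (D - z)) (/D (t * t - 1ℚ))) (l₂ t)))))
        where
        l : ∀ t d c → t * (1ℚ - c) * d ≡ t * (d - c * d)
        l = solve-∀ ℚ-ring
        l₂ : ∀ t → t * (t * t + 1ℚ - (t * t - 1ℚ)) ≡ 2ℚ * t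
        l₂ = solve-∀ ℚ-ring

      Ts₁≡ : t * s₁ ≡ 1ℚ + c₁
      Ts₁≡ = scaled (trans (*-assoc t s₁ D) (trans (cong (t *_) (/D (2ℚ * t))) (sym (trans (*-distribʳ-+ D 1ℚ c₁)
        (trans (cong (λ z → 1ℚ * D + z) (/D (t * t - 1ℚ))) (l t))))))
        where
        l : ∀ t → 1ℚ * (t * t + 1ℚ) + (t * t - 1ℚ) ≡ t * (2ℚ * t)
        l = solve-∀ ℚ-ring

      slope : Slope
      slope = record { T = T ; 3≤T = 3≤T ; c₁ = c₁ ; s₁ = s₁ ; s₁≡ = s₁≡ ; Ts₁≡ = Ts₁≡ }

      module R = Rotation slope
      module A = Arcs slope

      kernel-bound : ∀ y → y ≢ + 0 → ℤ.∣ y ∣ ℕ.≤ 2 ℕ.* R.q → - 12ℚ ≤ R.Gc R.N y × R.Gc R.N y ≤ 12ℚ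
      kernel-bound y y≢0 y≤ = ≤-by (12ℚ - - G) (≤⇒0≤ (sq-cancel-≤ {12ℚ} { - G} (nonNegative⁻¹ 12ℚ) (subst (_≤ 12ℚ * 12ℚ) (l₃ G) G²≤))) (l₄ G) , sq-cancel-≤ {12ℚ} {G} (nonNegative⁻¹ 12ℚ) G²≤
        where
        open ≤-Reasoning
        G = R.Gc R.N y
        H = R.Gs R.N y
        n = ιₙ R.N
        0<y² : 0ℚ < ι y * ι y
        0<y² = sq-pos y y≢0
          where
          ι-pos : ∀ k → 0ℚ < ιₙ (suc k)
          ι-pos k = subst (_< ιₙ (suc k)) (ι-def (+ 0)) (ιₙ-mono-< (ℕ.s≤s ℕ.z≤n))
          sq-pos : ∀ y → y ≢ + 0 → 0ℚ < ι y * ι y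
          sq-pos (+ zero) ne = contradiction refl ne
          sq-pos (+ suc k) ne = *-pos (ι-pos k) (ι-pos k)
          sq-pos -[1+ k ] ne = subst (0ℚ <_) (trans (l (ιₙ (suc k))) (sym (cong₂ _*_ (ι-neg (+ suc k)) (ι-neg (+ suc k))))) (*-pos (ι-pos k) (ι-pos k))
            where
            l : ∀ a → a * a ≡ (- a) * (- a)
            l = solve-∀ ℚ-ring
        l₃ : ∀ a → a * a ≡ (- a) * (- a)
        l₃ = solve-∀ ℚ-ring
        l₄ : ∀ a → a ≡ - 12ℚ + (12ℚ - - a)
        l₄ = solve-∀ ℚ-ring
        G²≤ : G * G ≤ 12ℚ * 12ℚ
        G²≤ = *-cancelʳ-≤ {8ℚ * (ι y * ι y)} {G * G} {12ℚ * 12ℚ} (*-pos (positive⁻¹ 8ℚ) 0<y²) (begin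
          G * G * (8ℚ * (ι y * ι y)) ≤⟨ *-mono-≤ˡ (sq-nonNeg G) (R.κ-lower y y≤) ⟩
          G * G * (n * n * R.κ y) ≤⟨ ≤-by (H * H * (n * n * R.κ y)) (*-nonNeg (sq-nonNeg H) (*-nonNeg (sq-nonNeg n) (R.κ-nonNeg y))) (l G H (n * n) (R.κ y)) ⟩
          n * n * ((G * G + H * H) * R.κ y) ≡⟨ cong (λ z → n * n * z) (R.geometric R.N y) ⟩
          n * n * R.κ (+ R.N ℤ.* y) ≤⟨ R.κ-turn y ⟩
          1024ℚ * (ι y * ι y) ≤⟨ *-mono-≤ʳ {ι y * ι y} {1024ℚ} {12ℚ * 12ℚ * 8ℚ} (<⇒≤ 0<y²) (≤-by (12ℚ * 12ℚ * 8ℚ - 1024ℚ) (nonNegative⁻¹ (12ℚ * 12ℚ * 8ℚ - 1024ℚ)) refl) ⟩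
          12ℚ * 12ℚ * 8ℚ * (ι y * ι y) ≡⟨ l₂ (ι y * ι y) ⟩
          12ℚ * 12ℚ * (8ℚ * (ι y * ι y)) ∎)
          where
          l : ∀ g h n k → n * ((g * g + h * h) * k) ≡ g * g * (n * k) + h * h * (n * k)
          l = solve-∀ ℚ-ring
          l₂ : ∀ a → 12ℚ * 12ℚ * 8ℚ * a ≡ 12ℚ * 12ℚ * (8ℚ * a)
          l₂ = solve-∀ ℚ-ring

    rotation-circle : Circle
    rotation-circle = record
      { q = R.q ; 1≤q = R.1≤q ; c = R.c ; s = R.s ; c-0 = refl ; s-0 = refl ; c-+ = R.c-+ ; s-+ = R.s-+
      ; c-neg = R.c-neg ; s-neg = R.s-neg ; unit = R.unit ; c≤1 = R.c≤1 ; -1≤c = R.-1≤c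
      ; κ-upper = R.κ-upper ; κ-lower = R.κ-lower ; κ-turn = R.κ-turn
      ; kernel = kernel-bound
      ; arc = λ js K large → A.arc js K T-large large }

    T≤N : T ℕ.≤ Circle.N rotation-circle
    T≤N = R.T≤N

  opaque
    -- The added 100000000 is the least `T` for which `arc` is available.
    circle : ∀ B → ∃[ C ] B ℕ.≤ Circle.N C
    circle B = rotation-circle T (ℕ.m≤n+m 100000000 B) , ℕ.≤-trans (ℕ.m≤m+n B 100000000) (T≤N T (ℕ.m≤n+m 100000000 B))
      where
      T : ℕ
      T = B ℕ.+ 100000000

-- Sumsets of sets that meet few lines in each axis direction

module BoxSums where

  open import Data.Integer.Base as ℤ using (ℤ; +_)
  open import Algebra.Properties.AbelianGroup ℤ.+-0-abelianGroup using (∙-cancelˡ; ∙-cancelʳ)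
  open import Data.Rational.Base hiding (_/_)
  open import Data.Rational.Properties
  open import Data.Vec.Base using (Vec; []; _∷_; head; tail; zipWith; _[_]≔_)
  import Data.Vec.Properties as Vec
  open RationalOrder
  open ListSum
  open Rotations using (2ℚ)

  private variable
    d : ℕ

  infixl 6 _⊕_
  _⊕_ : Vec ℤ d → Vec ℤ d → Vec ℤ d
  _⊕_ = zipWith ℤ._+_

  _≟ⱽ_ : DecidableEquality (Vec ℤ d)
  _≟ⱽ_ = Vec.≡-dec ℤ._≟_

  -- Erasing a coordinate instead of deleting it keeps the dimension. Two points have the same image
  -- exactly when they lie on a common line parallel to axis `i`.
  kill : Fin d → Vec ℤ d → Vec ℤ d
  kill i v = v [ i ]≔ + 0

  sumᶠ : (Fin d → ℚ) → ℚ
  sumᶠ {zero} f = 0ℚ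
  sumᶠ {suc d} f = f zero + sumᶠ (λ i → f (suc i))

  sumᶠ-mono : ∀ {d} {f g : Fin d → ℚ} → (∀ i → f i ≤ g i) → sumᶠ f ≤ sumᶠ g
  sumᶠ-mono {zero} le = ≤-refl
  sumᶠ-mono {suc d} le = +-mono-≤ (le zero) (sumᶠ-mono λ i → le (suc i))

  ∑-sumᶠ : ∀ {A : Set} {d} (xs : List A) (f : A → Fin d → ℚ) → ∑ xs (λ x → sumᶠ (f x)) ≡ sumᶠ (λ i → ∑ xs (λ x → f x i))
  ∑-sumᶠ {d = zero} xs f = ∑-0 xs
  ∑-sumᶠ {d = suc d} xs f = trans (∑-+ xs _ _) (cong (λ z → ∑ xs (λ x → f x zero) + z) (∑-sumᶠ xs λ x i → f x (suc i)))

  2^ : ℕ → ℚ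
  2^ zero = 1ℚ
  2^ (suc n) = 2ℚ * 2^ n

  2^-nonNeg : ∀ n → 0ℚ ≤ 2^ n
  2^-nonNeg zero = 0≤1
  2^-nonNeg (suc n) = *-nonNeg (nonNegative⁻¹ 2ℚ) (2^-nonNeg n)

  minimum : ∀ (xs : List ℤ) → 1 ℕ.≤ length xs → ∃[ m ] (m ∈ xs × ∀ {y} → y ∈ xs → m ℤ.≤ y)
  minimum (x ∷ []) _ = x , here refl , λ { (here refl) → ℤ.≤-refl }
  minimum (x ∷ y ∷ ys) _ with minimum (y ∷ ys) (ℕ.s≤s ℕ.z≤n)
  ... | m , m∈ , m≤ with ℤ.≤-total x m
  ... | inj₁ x≤m = x , here refl , λ { (here refl) → ℤ.≤-refl ; (there p) → ℤ.≤-trans x≤m (m≤ p) }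
  ... | inj₂ m≤x = m , there m∈ , λ { (here refl) → m≤x ; (there p) → m≤ p }

  maximum : ∀ (xs : List ℤ) → 1 ℕ.≤ length xs → ∃[ m ] (m ∈ xs × ∀ {y} → y ∈ xs → y ℤ.≤ m)
  maximum (x ∷ []) _ = x , here refl , λ { (here refl) → ℤ.≤-refl }
  maximum (x ∷ y ∷ ys) _ with maximum (y ∷ ys) (ℕ.s≤s ℕ.z≤n)
  ... | m , m∈ , ≤m with ℤ.≤-total m x
  ... | inj₁ m≤x = x , here refl , λ { (here refl) → ℤ.≤-refl ; (there p) → ℤ.≤-trans (≤m p) m≤x }
  ... | inj₂ x≤m = m , there m∈ , λ { (here refl) → x≤m ; (there p) → ≤m p }

  -- min S + T and S + max T meet only in min S + max T.
  sumset-of-integers : ∀ {S T : List ℤ} {k} → Unique S → Unique T → suc k ℕ.≤ length S → suc k ℕ.≤ length T →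
                       ∃[ H ] (Unique H × suc k ℕ.+ k ℕ.≤ length H × ∀ {h} → h ∈ H → ∃[ s ] ∃[ t ] (s ∈ S × t ∈ T × h ≡ s ℤ.+ t))
  sumset-of-integers {S} {T} {k} uS uT k<S k<T = H₁ ++ H₂ , Unique.++⁺ u₁ u₂ disjoint ,
      subst (suc k ℕ.+ k ℕ.≤_) (sym (length-++ H₁)) (ℕ.+-mono-≤ (subst (suc k ℕ.≤_) (sym (length-map (λ t → m ℤ.+ t) T)) k<T)
        (subst (k ℕ.≤_) (sym (length-map (ℤ._+ M) S′)) (ℕ.s≤s⁻¹ (ℕ.≤-trans k<S |S|≤)))) , sums
    where
    minS = minimum S (ℕ.≤-trans (ℕ.s≤s ℕ.z≤n) k<S)
    maxT = maximum T (ℕ.≤-trans (ℕ.s≤s ℕ.z≤n) k<T)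
    m = proj₁ minS
    M = proj₁ maxT
    S′ = filter (m ℤ.<?_) S
    H₁ = map (λ t → m ℤ.+ t) T
    H₂ = map (ℤ._+ M) S′
    u₁ : Unique H₁
    u₁ = map-unique (λ _ _ eq → ∙-cancelˡ m _ _ eq) uT
    u₂ : Unique H₂
    u₂ = map-unique (λ _ _ eq → ∙-cancelʳ M _ _ eq) (Unique.filter⁺ (m ℤ.<?_) uS)
    disjoint : ∀ {h} → ¬ (h ∈ H₁ × h ∈ H₂)
    disjoint (p , q) with ∈-map⁻ (λ t → m ℤ.+ t) p | ∈-map⁻ (ℤ._+ M) q
    ... | t , t∈ , refl | s , s∈ , eq = ℤ.<-irrefl eq (ℤ.+-mono-<-≤ (proj₂ (∈-filter⁻ (m ℤ.<?_) {xs = S} s∈)) (proj₂ (proj₂ maxT) t∈))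
    |S|≤ : length S ℕ.≤ suc (length S′)
    |S|≤ = length-⊆ uS λ {s} s∈ → cover s s∈
      where
      cover : ∀ s → s ∈ S → s ∈ m ∷ S′
      cover s s∈ with m ℤ.≟ s
      ... | yes refl = here refl
      ... | no m≢s = there (∈-filter⁺ (m ℤ.<?_) s∈ (ℤ.≤∧≢⇒< (proj₂ (proj₂ minS) s∈) m≢s))
    sums : ∀ {h} → h ∈ H₁ ++ H₂ → ∃[ s ] ∃[ t ] (s ∈ S × t ∈ T × h ≡ s ℤ.+ t)
    sums h∈ with ∈-++⁻ H₁ h∈
    ... | inj₁ p = let t , t∈ , eq = ∈-map⁻ (λ t → m ℤ.+ t) p in m , t , proj₁ (proj₂ minS) , t∈ , eq
    ... | inj₂ p = let s , s∈ , eq = ∈-map⁻ (ℤ._+ M) p in s , M , proj₁ (∈-filter⁻ (m ℤ.<?_) {xs = S} s∈) , proj₁ (proj₂ maxT) , eq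

  -- Only the largest k with `P k` matters, since at most k + 1 indices do not exceed it. This turns
  -- a lower bound for a fibre, valid for each layer containing its base point, into a bound for the
  -- number of those layers.
  ∑-initial : ∀ {P : ℕ → Set} (P? : ∀ k → Dec (P k)) {f} → 0ℚ ≤ f → (∀ k → P k → ιₙ (suc k) ≤ f) →
              ∀ J → ∑ (downFrom J) (λ k → [ P? k ?]) ≤ f
  ∑-initial P? 0≤f h zero = 0≤f
  ∑-initial {P} P? {f} 0≤f h (suc J) = case (P? J)
    where
    open ≤-Reasoning
    all : ∀ J → ∑ (downFrom J) (λ k → [ P? k ?]) ≤ ιₙ J
    all zero = ≤-reflexive (sym (ι-def _))
    all (suc J) = ≤-trans (+-mono-≤ ([?]-≤1 (P? J)) (all J)) (≤-reflexive (sym (ιₙ-suc J)))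
    case : (p : Dec (P J)) → [ P? J ?] + ∑ (downFrom J) (λ k → [ P? k ?]) ≤ f
    case (yes p) = ≤-trans (all (suc J)) (h J p)
    case (no ¬p) = ≤-trans (≤-reflexive (trans (cong (_+ ∑ (downFrom J) (λ k → [ P? k ?])) ([?]-no (P? J) ¬p)) (+-identityˡ _))) (∑-initial P? 0≤f h J)

  ∑-shift : ∀ (g : ℕ → ℚ) → (∀ k → 0ℚ ≤ g k) → ∀ J → ∑ (downFrom J) g ≤ g 0 + ∑ (downFrom J) (λ k → g (suc k))
  ∑-shift g nn zero = +-nonNeg (nn 0) ≤-refl
  ∑-shift g nn (suc J) = ≤-trans (lemma J) (+-monoʳ-≤ (g 0) (≤-by (g (suc J)) (nn (suc J)) (+-comm (g (suc J)) _)))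
    where
    lemma : ∀ J → ∑ (downFrom (suc J)) g ≤ g 0 + ∑ (downFrom J) (λ k → g (suc k))
    lemma zero = ≤-refl
    lemma (suc J) = ≤-trans (+-monoʳ-≤ (g (suc J)) (lemma J)) (≤-reflexive (l (g (suc J)) (g 0) _))
      where
      l : ∀ a b c → a + (b + c) ≡ b + (a + c)
      l = solve-∀ ℚ-ring

  module _ {d : ℕ} (X : List (Vec ℤ (suc d))) (uX : Unique X) where
    private
      fibre : ∀ {e} → List (Vec ℤ (suc e)) → Vec ℤ e → List ℤ
      fibre Y v = map head (filter (λ z → tail z ≟ⱽ v) Y)

      head-tail : ∀ {e} (z : Vec ℤ (suc e)) → z ≡ head z ∷ tail z
      head-tail (x ∷ v) = refl

      ∈-fibre⁻ : ∀ {e} (Y : List (Vec ℤ (suc e))) {v x} → x ∈ fibre Y v → x ∷ v ∈ Y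
      ∈-fibre⁻ Y {v} x∈ with ∈-map⁻ head x∈
      ... | z , z∈ , refl with ∈-filter⁻ (λ z → tail z ≟ⱽ v) {xs = Y} z∈
      ... | z∈Y , refl = subst (_∈ Y) (head-tail z) z∈Y

      fibre-unique : ∀ v → Unique (fibre X v)
      fibre-unique v = map-unique inj (Unique.filter⁺ (λ z → tail z ≟ⱽ v) uX)
        where
        inj : InjectiveOn (filter (λ z → tail z ≟ⱽ v) X) head
        inj {x} {y} x∈ y∈ eq = trans (head-tail x) (trans (cong₂ _∷_ eq (trans (proj₂ (∈-filter⁻ (λ z → tail z ≟ⱽ v) {xs = X} x∈))
          (sym (proj₂ (∈-filter⁻ (λ z → tail z ≟ⱽ v) {xs = X} y∈))))) (sym (head-tail y)))

      size : Vec ℤ d → ℕ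
      size v = length (fibre X v)

      fibre-≥ : ∀ {e} (Y : List (Vec ℤ (suc e))) w {H} → Unique H → (∀ {h} → h ∈ H → h ∷ w ∈ Y) →
                ιₙ (length H) ≤ ∑ Y (λ z → [ tail z ≟ⱽ w ?])
      fibre-≥ Y w {H} uH into = subst (ιₙ (length H) ≤_) (length-filter-∑ (λ z → tail z ≟ⱽ w) Y)
        (ιₙ-mono-≤ (length-inj {xs = H} (_∷ w) uH (λ _ _ → λ { refl → refl }) λ h h∈ → ∈-filter⁺ (λ z → tail z ≟ⱽ w) (into h∈) refl))

      fibres-≤ : ∀ {e} (Y : List (Vec ℤ (suc e))) {W} → Unique W → ∑ W (λ w → ∑ Y (λ z → [ tail z ≟ⱽ w ?])) ≤ ιₙ (length Y)
      fibres-≤ Y {W} uW = subst₂ _≤_ (∑-swap Y W _) (∑-1 Y) (∑-mono Y λ z _ → once (tail z) uW)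
        where
        once : ∀ {e} (v : Vec ℤ e) {W} → Unique W → ∑ W (λ w → [ v ≟ⱽ w ?]) ≤ 1ℚ
        once v [] = 0≤1
        once v (_∷_ {w} {W} w∉ u) with v ≟ⱽ w
        ... | no _ = subst (_≤ 1ℚ) (sym (+-identityˡ _)) (once v u)
        ... | yes refl = ≤-reflexive (trans (cong (λ z → 1ℚ + z) (trans (∑-cong W λ w′ w′∈ → [?]-no (v ≟ⱽ w′) (All.lookup w∉ w′∈)) (∑-0 W))) (+-identityʳ 1ℚ))

      V : List (Vec ℤ d)
      V = deduplicate _≟ⱽ_ (map tail X)

      uV : Unique V
      uV = deduplicate-! _≟ⱽ_ (map tail X)

      J : ℕ
      J = length X

      B : ℕ → List (Vec ℤ d)
      B k = filter (λ v → suc k ℕ.≤? size v) V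

      uB : ∀ k → Unique (B k)
      uB k = Unique.filter⁺ (λ v → suc k ℕ.≤? size v) uV

      B-size : ∀ k {v} → v ∈ B k → suc k ℕ.≤ size v
      B-size k v∈ = proj₂ (∈-filter⁻ (λ v → suc k ℕ.≤? size v) {xs = V} v∈)

      B⊆V : ∀ k {v} → v ∈ B k → v ∈ V
      B⊆V k v∈ = proj₁ (∈-filter⁻ (λ v → suc k ℕ.≤? size v) {xs = V} v∈)

      -- The layer-cake formula: a fibre with s points is counted once by each `B k` with k < s.
      layers : ιₙ (length X) ≤ ∑ (downFrom J) (λ k → ιₙ (length (B k)))
      layers = begin
        ιₙ (length X) ≡⟨ ∑-1 X ⟨
        ∑ X (λ _ → 1ℚ) ≤⟨ ∑-mono X (λ z z∈ → found z z∈) ⟩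
        ∑ X (λ z → ∑ V (λ v → [ tail z ≟ⱽ v ?])) ≡⟨ ∑-swap X V _ ⟩
        ∑ V (λ v → ∑ X (λ z → [ tail z ≟ⱽ v ?])) ≤⟨ ∑-mono V (λ v _ → column v) ⟩
        ∑ V (λ v → ∑ (downFrom J) (λ k → [ suc k ℕ.≤? size v ?])) ≡⟨ ∑-swap V (downFrom J) _ ⟩
        ∑ (downFrom J) (λ k → ∑ V (λ v → [ suc k ℕ.≤? size v ?])) ≡⟨ ∑-ext (downFrom J) (λ k → length-filter-∑ (λ v → suc k ℕ.≤? size v) V) ⟨
        ∑ (downFrom J) (λ k → ιₙ (length (B k))) ∎
        where
        open ≤-Reasoning
        found : ∀ z → z ∈ X → 1ℚ ≤ ∑ V (λ v → [ tail z ≟ⱽ v ?])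
        found z z∈ = subst (_≤ ∑ V (λ v → [ tail z ≟ⱽ v ?])) (trans (+-identityʳ [ tail z ≟ⱽ tail z ?]) ([?]-yes (tail z ≟ⱽ tail z) refl))
          (∑-⊆ {xs = tail z ∷ []} ([] ∷ []) (λ { (here refl) → ∈-deduplicate⁺ _≟ⱽ_ (∈-map⁺ tail z∈) }) λ v _ → [?]-nonNeg (tail z ≟ⱽ v))
        count : ∀ n J → n ℕ.≤ J → ιₙ n ≤ ∑ (downFrom J) (λ k → [ suc k ℕ.≤? n ?])
        count n zero ℕ.z≤n = ≤-reflexive (ι-def _)
        count n (suc J) n≤ with ℕ.m≤n⇒m<n∨m≡n n≤
        ... | inj₁ n< = ≤-trans (count n J (ℕ.s≤s⁻¹ n<)) (≤-by [ suc J ℕ.≤? n ?] ([?]-nonNeg (suc J ℕ.≤? n)) (+-comm [ suc J ℕ.≤? n ?] (∑ (downFrom J) (λ k → [ suc k ℕ.≤? n ?]))))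
        ... | inj₂ refl = ≤-trans (≤-reflexive (ιₙ-suc J)) (+-mono-≤ (≤-reflexive (sym ([?]-yes (suc J ℕ.≤? n) ℕ.≤-refl)))
                            (≤-trans (≤-reflexive (trans (sym (cong ιₙ (length-downFrom J))) (sym (∑-1 (downFrom J)))))
                              (≤-reflexive (∑-cong (downFrom J) λ k k∈ → sym ([?]-yes (suc k ℕ.≤? n) (ℕ.m≤n⇒m≤1+n (∈-downFrom⁻ k∈)))))))
        column : ∀ v → ∑ X (λ z → [ tail z ≟ⱽ v ?]) ≤ ∑ (downFrom J) (λ k → [ suc k ℕ.≤? size v ?])
        column v = subst (_≤ ∑ (downFrom J) (λ k → [ suc k ℕ.≤? size v ?]))
          (trans (cong ιₙ (length-map head (filter (λ z → tail z ≟ⱽ v) X))) (length-filter-∑ (λ z → tail z ≟ⱽ v) X))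
          (count (size v) J (ℕ.≤-trans (ℕ.≤-reflexive (length-map head (filter (λ z → tail z ≟ⱽ v) X))) (length-filter (λ z → tail z ≟ⱽ v) X)))

      sumset : ℕ → List (Vec ℤ d)
      sumset k = deduplicate _≟ⱽ_ (cartesianProductWith _⊕_ (B k) (B k))

      -- Above a point of `sumset (suc k)` there are at least 2k + 3 sums, so twice the number of
      -- such k is at most the size of the fibre. Layer 0 is left out because one point above each
      -- summand yields a single sum and no factor 2.
      sumset-layers : ∀ Z → (∀ {x y} → x ∈ X → y ∈ X → x ⊕ y ∈ Z) →
                      2ℚ * ∑ (downFrom J) (λ k → ιₙ (length (sumset (suc k)))) ≤ ιₙ (length Z)
      sumset-layers Z into = begin
        2ℚ * ∑ (downFrom J) (λ k → ιₙ (length (sumset (suc k))))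
          ≤⟨ *-mono-≤ˡ (nonNegative⁻¹ 2ℚ) (∑-mono (downFrom J) λ k _ → members k) ⟩
        2ℚ * ∑ (downFrom J) (λ k → ∑ W (λ w → [ w ∈? sumset (suc k) ?]))
          ≡⟨ cong (2ℚ *_) (∑-swap (downFrom J) W _) ⟩
        2ℚ * ∑ W (λ w → ∑ (downFrom J) (λ k → [ w ∈? sumset (suc k) ?]))
          ≡⟨ ∑-*ˡ W 2ℚ _ ⟨
        ∑ W (λ w → 2ℚ * ∑ (downFrom J) (λ k → [ w ∈? sumset (suc k) ?]))
          ≤⟨ ∑-mono W (λ w _ → column w) ⟩
        ∑ W (λ w → ∑ Z (λ z → [ tail z ≟ⱽ w ?]))
          ≤⟨ fibres-≤ Z {W} (deduplicate-! _≟ⱽ_ (cartesianProductWith _⊕_ V V)) ⟩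
        ιₙ (length Z) ∎
        where
        open ≤-Reasoning
        open import Data.List.Membership.DecPropositional (_≟ⱽ_ {d}) using (_∈?_)
        W = deduplicate _≟ⱽ_ (cartesianProductWith _⊕_ V V)
        sumset⊆W : ∀ k {w} → w ∈ sumset k → w ∈ W
        sumset⊆W k w∈ = let u , v , u∈ , v∈ , eq = ∈-cartesianProductWith⁻ _⊕_ (B k) (B k) (∈-deduplicate⁻ _≟ⱽ_ _ w∈) in
          subst (_∈ W) (sym eq) (∈-deduplicate⁺ _≟ⱽ_ (∈-cartesianProductWith⁺ _⊕_ (B⊆V k u∈) (B⊆V k v∈)))
        members : ∀ k → ιₙ (length (sumset (suc k))) ≤ ∑ W (λ w → [ w ∈? sumset (suc k) ?])
        members k = subst (_≤ ∑ W (λ w → [ w ∈? sumset (suc k) ?]))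
          (trans (∑-cong (sumset (suc k)) λ w w∈ → [?]-yes (w ∈? sumset (suc k)) w∈) (∑-1 (sumset (suc k))))
          (∑-⊆ (deduplicate-! _≟ⱽ_ (cartesianProductWith _⊕_ (B (suc k)) (B (suc k)))) (sumset⊆W (suc k)) λ w _ → [?]-nonNeg (w ∈? sumset (suc k)))
        Zʷ : Vec ℤ d → ℚ
        Zʷ w = ∑ Z (λ z → [ tail z ≟ⱽ w ?])
        pair-large : ∀ k {u v} → u ∈ B (suc k) → v ∈ B (suc k) → ιₙ (suc k) ≤ ½ * Zʷ (u ⊕ v)
        pair-large k {u} {v} u∈ v∈ = begin
          ιₙ (suc k) ≡⟨ l (ιₙ (suc k)) ⟩
          ½ * (ιₙ (suc k) + ιₙ (suc k)) ≡⟨ cong (½ *_) (ιₙ-+ (suc k) (suc k)) ⟨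
          ½ * ιₙ (suc k ℕ.+ suc k) ≤⟨ *-mono-≤ˡ (nonNegative⁻¹ ½) (≤-trans (ιₙ-mono-≤ (ℕ.≤-trans (ℕ.n≤1+n _) (proj₁ (proj₂ (proj₂ sum))))) (fibre-≥ Z (u ⊕ v) (proj₁ (proj₂ sum)) into′)) ⟩
          ½ * Zʷ (u ⊕ v) ∎
          where
          sum = sumset-of-integers (fibre-unique u) (fibre-unique v) (B-size (suc k) u∈) (B-size (suc k) v∈)
          l : ∀ a → a ≡ ½ * (a + a)
          l = solve-∀ ℚ-ring
          into′ : ∀ {h} → h ∈ proj₁ sum → h ∷ (u ⊕ v) ∈ Z
          into′ h∈ = let a , b , a∈ , b∈ , eq = proj₂ (proj₂ (proj₂ sum)) h∈ in
            subst (λ h → h ∷ (u ⊕ v) ∈ Z) (sym eq) (into (∈-fibre⁻ X a∈) (∈-fibre⁻ X b∈))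
        large : ∀ w k → w ∈ sumset (suc k) → ιₙ (suc k) ≤ ½ * Zʷ w
        large w k w∈ = let u , v , u∈ , v∈ , eq = ∈-cartesianProductWith⁻ _⊕_ (B (suc k)) (B (suc k)) (∈-deduplicate⁻ _≟ⱽ_ _ w∈) in
          subst (λ w → ιₙ (suc k) ≤ ½ * Zʷ w) (sym eq) (pair-large k u∈ v∈)
        column : ∀ w → 2ℚ * ∑ (downFrom J) (λ k → [ w ∈? sumset (suc k) ?]) ≤ Zʷ w
        column w = ≤-trans (*-mono-≤ˡ (nonNegative⁻¹ 2ℚ) (∑-initial (λ k → w ∈? sumset (suc k))
          (*-nonNeg (nonNegative⁻¹ ½) (∑-nonNeg Z λ z _ → [?]-nonNeg (tail z ≟ⱽ w))) (large w) J)) (≤-reflexive (l (Zʷ w)))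
          where
          l : ∀ a → 2ℚ * (½ * a) ≡ a
          l = solve-∀ ℚ-ring

      shadow : Fin d → ℕ → List (Vec ℤ d)
      shadow i k = deduplicate _≟ⱽ_ (map (kill i) (B k))

      shadow-layers : ∀ i L → (∀ {x} → x ∈ X → kill (suc i) x ∈ L) →
                      ∑ (downFrom J) (λ k → ιₙ (length (shadow i k))) ≤ ιₙ (length L)
      shadow-layers i L into = begin
        ∑ (downFrom J) (λ k → ιₙ (length (shadow i k))) ≤⟨ ∑-mono (downFrom J) (λ k _ → members k) ⟩
        ∑ (downFrom J) (λ k → ∑ K (λ w → [ w ∈? shadow i k ?])) ≡⟨ ∑-swap (downFrom J) K _ ⟩
        ∑ K (λ w → ∑ (downFrom J) (λ k → [ w ∈? shadow i k ?])) ≤⟨ ∑-mono K (λ w _ → ∑-initial (λ k → w ∈? shadow i k) (∑-nonNeg L λ z _ → [?]-nonNeg (tail z ≟ⱽ w)) (large w) J) ⟩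
        ∑ K (λ w → ∑ L (λ z → [ tail z ≟ⱽ w ?])) ≤⟨ fibres-≤ L {K} (deduplicate-! _≟ⱽ_ (map (kill i) V)) ⟩
        ιₙ (length L) ∎
        where
        open ≤-Reasoning
        open import Data.List.Membership.DecPropositional (_≟ⱽ_ {d}) using (_∈?_)
        K = deduplicate _≟ⱽ_ (map (kill i) V)
        members : ∀ k → ιₙ (length (shadow i k)) ≤ ∑ K (λ w → [ w ∈? shadow i k ?])
        members k = subst (_≤ ∑ K (λ w → [ w ∈? shadow i k ?]))
          (trans (∑-cong (shadow i k) λ w w∈ → [?]-yes (w ∈? shadow i k) w∈) (∑-1 (shadow i k)))
          (∑-⊆ (deduplicate-! _≟ⱽ_ (map (kill i) (B k))) sub λ w _ → [?]-nonNeg (w ∈? shadow i k))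
          where
          sub : ∀ {w} → w ∈ shadow i k → w ∈ K
          sub w∈ = let v , v∈ , eq = ∈-map⁻ (kill i) (∈-deduplicate⁻ _≟ⱽ_ _ w∈) in
            subst (_∈ K) (sym eq) (∈-deduplicate⁺ _≟ⱽ_ (∈-map⁺ (kill i) (B⊆V k v∈)))
        large : ∀ w k → w ∈ shadow i k → ιₙ (suc k) ≤ ∑ L (λ z → [ tail z ≟ⱽ w ?])
        large w k w∈ = let v , v∈ , eq = ∈-map⁻ (kill i) (∈-deduplicate⁻ _≟ⱽ_ _ w∈) in
          subst (λ w → ιₙ (suc k) ≤ ∑ L (λ z → [ tail z ≟ⱽ w ?])) (sym eq)
            (≤-trans (ιₙ-mono-≤ (B-size k v∈)) (fibre-≥ L (kill i v) (fibre-unique v) λ h∈ → into (∈-fibre⁻ X h∈)))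

      -- A tail with a point above it is a line parallel to the first axis that meets `X`. Hence the
      -- layer lost in `sumset-layers` is paid for by the error term of that axis.
      base-layer : ∀ L → (∀ {x} → x ∈ X → kill zero x ∈ L) → ιₙ (length (B 0)) ≤ ιₙ (length L)
      base-layer L into = ιₙ-mono-≤ (length-inj (+ 0 ∷_) (uB 0) (λ _ _ → λ { refl → refl }) λ v v∈ → member v (B⊆V 0 v∈))
        where
        member : ∀ v → v ∈ V → + 0 ∷ v ∈ L
        member v v∈ with ∈-map⁻ tail (∈-deduplicate⁻ _≟ⱽ_ _ v∈)
        ... | (x ∷ v) , x∈ , refl = into x∈

    -- Layer 0 is charged to the first axis, and the induction hypothesis applies to every higher
    -- layer. The factor 2 of `sumset-layers` raises `2^ d` to `2^ (suc d)`, while the shadows of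
    -- the layers add up to at most the lines in the remaining directions.
    box-step : (∀ (Y : List (Vec ℤ d)) → Unique Y → ∀ Z → (∀ {x y} → x ∈ Y → y ∈ Y → x ⊕ y ∈ Z) → ∀ (L : Fin d → List (Vec ℤ d)) → (∀ i {x} → x ∈ Y → kill i x ∈ L i) →
                 2^ d * ιₙ (length Y) ≤ ιₙ (length Z) + 2^ d * sumᶠ (λ i → ιₙ (length (L i)))) →
               ∀ Z → (∀ {x y} → x ∈ X → y ∈ X → x ⊕ y ∈ Z) → ∀ (L : Fin (suc d) → List (Vec ℤ (suc d))) → (∀ i {x} → x ∈ X → kill i x ∈ L i) →
               2^ (suc d) * ιₙ (length X) ≤ ιₙ (length Z) + 2^ (suc d) * sumᶠ (λ i → ιₙ (length (L i)))
    box-step IH Z intoZ L intoL = begin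
      2ℚ * 2^ d * ιₙ (length X)
        ≤⟨ *-mono-≤ˡ (2^-nonNeg (suc d)) (≤-trans layers (∑-shift (λ k → ιₙ (length (B k))) (λ k → ιₙ-nonNeg _) J)) ⟩
      2ℚ * 2^ d * (b₀ + Σb)
        ≡⟨ l₁ (2^ d) b₀ Σb ⟩
      2ℚ * 2^ d * b₀ + 2ℚ * (2^ d * Σb)
        ≤⟨ +-mono-≤ (*-mono-≤ˡ (2^-nonNeg (suc d)) (base-layer (L zero) (intoL zero))) (*-mono-≤ˡ (nonNegative⁻¹ 2ℚ) sum-IH) ⟩
      2ℚ * 2^ d * ℓ₀ + 2ℚ * (Σz + 2^ d * Σs)
        ≡⟨ l₂ (2^ d) ℓ₀ Σz Σs ⟩
      2ℚ * Σz + 2ℚ * 2^ d * (ℓ₀ + Σs)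
        ≤⟨ +-mono-≤ (sumset-layers Z intoZ) (*-mono-≤ˡ (2^-nonNeg (suc d)) (+-monoʳ-≤ ℓ₀ shadows)) ⟩
      ιₙ (length Z) + 2ℚ * 2^ d * (ℓ₀ + sumᶠ (λ i → ιₙ (length (L (suc i))))) ∎
      where
      open ≤-Reasoning
      b₀ = ιₙ (length (B 0))
      ℓ₀ = ιₙ (length (L zero))
      Σb = ∑ (downFrom J) (λ k → ιₙ (length (B (suc k))))
      Σz = ∑ (downFrom J) (λ k → ιₙ (length (sumset (suc k))))
      Σs = ∑ (downFrom J) (λ k → sumᶠ (λ i → ιₙ (length (shadow i (suc k)))))
      l₁ : ∀ e b c → 2ℚ * e * (b + c) ≡ 2ℚ * e * b + 2ℚ * (e * c)
      l₁ = solve-∀ ℚ-ring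
      l₂ : ∀ e b z s → 2ℚ * e * b + 2ℚ * (z + e * s) ≡ 2ℚ * z + 2ℚ * e * (b + s)
      l₂ = solve-∀ ℚ-ring
      sum-IH : 2^ d * Σb ≤ Σz + 2^ d * Σs
      sum-IH = subst₂ _≤_ (∑-*ˡ (downFrom J) (2^ d) _) (trans (∑-+ (downFrom J) _ _) (cong (λ z → Σz + z) (∑-*ˡ (downFrom J) (2^ d) _)))
        (∑-mono (downFrom J) λ k _ → IH (B (suc k)) (uB (suc k)) (sumset (suc k))
          (λ x∈ y∈ → ∈-deduplicate⁺ _≟ⱽ_ (∈-cartesianProductWith⁺ _⊕_ x∈ y∈)) (λ i → shadow i (suc k))
          (λ i x∈ → ∈-deduplicate⁺ _≟ⱽ_ (∈-map⁺ (kill i) x∈)))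
      unshift : ∀ (g : ℕ → ℚ) → (∀ k → 0ℚ ≤ g k) → ∀ J → ∑ (downFrom J) (λ k → g (suc k)) ≤ ∑ (downFrom (suc J)) g
      unshift g nn zero = +-nonNeg (nn 0) ≤-refl
      unshift g nn (suc J) = +-monoʳ-≤ (g (suc J)) (unshift g nn J)
      top : ∀ i → ιₙ (length (shadow i J)) ≡ 0ℚ
      top i = trans (cong (λ Y → ιₙ (length (deduplicate _≟ⱽ_ (map (kill i) Y)))) (empty (B J) (λ v v∈ → ℕ.<⇒≱ (B-size J v∈)
        (ℕ.≤-trans (ℕ.≤-reflexive (length-map head (filter (λ z → tail z ≟ⱽ v) X))) (length-filter (λ z → tail z ≟ⱽ v) X))))) (ι-def _)
        where
        empty : ∀ (Y : List (Vec ℤ d)) → (∀ v → ¬ v ∈ Y) → Y ≡ []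
        empty [] _ = refl
        empty (y ∷ _) h = contradiction (here refl) (h y)
      shadows : Σs ≤ sumᶠ (λ i → ιₙ (length (L (suc i))))
      shadows = ≤-trans (≤-reflexive (∑-sumᶠ (downFrom J) (λ k i → ιₙ (length (shadow i (suc k)))))) (sumᶠ-mono λ i →
        ≤-trans (unshift (λ k → ιₙ (length (shadow i k))) (λ k → ιₙ-nonNeg _) J)
          (≤-trans (≤-reflexive (trans (cong (_+ ∑ (downFrom J) (λ k → ιₙ (length (shadow i k)))) (top i)) (+-identityˡ _)))
            (shadow-layers i (L (suc i)) (intoL (suc i)))))

  -- Induction on d: B k consists of the tails with more than k points of X above them, so that
  -- X + X has at least 2 k + 1 points above each point of B k + B k.
  box-sumset : ∀ {d} (X : List (Vec ℤ d)) → Unique X → ∀ Z → (∀ {x y} → x ∈ X → y ∈ X → x ⊕ y ∈ Z) →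
               ∀ (L : Fin d → List (Vec ℤ d)) → (∀ i {x} → x ∈ X → kill i x ∈ L i) →
               2^ d * ιₙ (length X) ≤ ιₙ (length Z) + 2^ d * sumᶠ (λ i → ιₙ (length (L i)))
  box-sumset {zero} X uX Z intoZ L intoL = ≤-trans (≤-reflexive (*-identityˡ _)) (≤-trans (ιₙ-mono-≤ (point X uX intoZ)) (≤-reflexive (sym (+-identityʳ _))))
    where
    point : ∀ (X : List (Vec ℤ 0)) → Unique X → (∀ {x y} → x ∈ X → y ∈ X → x ⊕ y ∈ Z) → length X ℕ.≤ length Z
    point X u into = length-⊆ u λ { {[]} x∈ → into x∈ x∈ }
  box-sumset {suc d} X uX = box-step X uX box-sumset

-- A lower bound for the additive energy

module Energy where

  open import Data.Integer.Base as ℤ using (ℤ; +_)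
  open import Algebra.Properties.AbelianGroup ℤ.+-0-abelianGroup using (∙-cancelˡ)
  open import Data.List.Membership.DecPropositional ℤ._≟_ using (_∈?_)
  open import Data.Nat.DivMod using (m/n<m; m/n*n≤m; m%n<n; m≡m%n+[m/n]*n)
  open import Data.Rational.Base
  open import Data.Rational.Properties
  open RationalOrder
  open ListSum
  open Rotations using (2ℚ)

  record Sumset : Set where
    field
      as S : List ℤ
      u-as : Unique as
      u-S : Unique S
      as+as : ∀ {a b} → a ∈ as → b ∈ as → a ℤ.+ b ∈ S
      nonempty : 1 ℕ.≤ length as

  reps : List ℤ → ℤ → ℚ
  reps as y = ∑ as λ a → ∑ as λ b → [ a ℤ.+ b ℤ.≟ y ?]

  ∑-reps : ∀ {as S} (f : ℤ → ℚ) → Unique S → (∀ {a b} → a ∈ as → b ∈ as → a ℤ.+ b ∈ S) →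
           ∑ S (λ y → reps as y * f y) ≡ ∑ as (λ a → ∑ as (λ b → f (a ℤ.+ b)))
  ∑-reps {as} {S} f u sums = trans (∑-ext S λ y → trans (sym (∑-*ʳ as (f y) _)) (∑-ext as λ a → sym (∑-*ʳ as (f y) _)))
    (trans (∑-swap S as _) (∑-cong as λ a a∈ → trans (∑-swap S as _) (∑-cong as λ b b∈ → ∑-δ ℤ._≟_ f u (sums a∈ b∈))))

  least : ∀ (f : ℤ → ℤ) (xs : List ℤ) → 1 ℕ.≤ length xs → ∃[ x ] (x ∈ xs × ∀ {y} → y ∈ xs → f x ℤ.≤ f y)
  least f (x ∷ []) _ = x , here refl , λ { (here refl) → ℤ.≤-refl }
  least f (x ∷ y ∷ ys) _ with least f (y ∷ ys) (ℕ.s≤s ℕ.z≤n)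
  ... | m , m∈ , m≤ with ℤ.≤-total (f x) (f m)
  ... | inj₁ x≤m = x , here refl , λ { (here refl) → ℤ.≤-refl ; (there p) → ℤ.≤-trans x≤m (m≤ p) }
  ... | inj₂ m≤x = m , there m∈ , λ { (here refl) → m≤x ; (there p) → m≤ p }

  -- The k elements with the least values of `f`. The identity and negation in the role of `f` give
  -- the two ends of the set.
  record Lower (f : ℤ → ℤ) (as : List ℤ) (k : ℕ) : Set where
    field
      lo : List ℤ
      unique : Unique lo
      size : length lo ≡ k
      subset : ∀ {x} → x ∈ lo → x ∈ as
      below : ∀ {x p} → x ∈ lo → p ∈ as → p ∉ lo → f x ℤ.< f p

  module _ (f : ℤ → ℤ) (f-inj : ∀ {x y} → f x ≡ f y → x ≡ y) {as : List ℤ} (u : Unique as) where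

    lower : ∀ k → k ℕ.≤ length as → Lower f as k
    lower zero _ = record { lo = [] ; unique = [] ; size = refl ; subset = λ () ; below = λ () }
    lower (suc k) k< = record
      { lo = z ∷ L.lo ; unique = All.tabulate (λ { y∈ refl → proj₂ z∈′ y∈ }) ∷ L.unique ; size = cong suc L.size
      ; subset = λ { (here refl) → proj₁ z∈′ ; (there p) → L.subset p }
      ; below = λ { (here refl) p∈ p∉ → ℤ.≤∧≢⇒< (proj₂ (proj₂ min) (∈-filter⁺ out? p∈ (λ q → p∉ (there q)))) (λ eq → p∉ (here (sym (f-inj eq))))
                  ; (there x∈) p∈ p∉ → L.below x∈ p∈ (λ q → p∉ (there q)) } }
      where
      module L = Lower (lower k (ℕ.<⇒≤ k<))
      out? = λ x → ¬? (x ∈? L.lo)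
      rest : List ℤ
      rest = filter out? as
      nonempty : 1 ℕ.≤ length rest
      nonempty with length rest in eq
      ... | suc _ = ℕ.s≤s ℕ.z≤n
      ... | zero = contradiction (length-⊆ u covered) (ℕ.<⇒≱ (subst (ℕ._< length as) (sym L.size) k<))
        where
        covered : ∀ {x} → x ∈ as → x ∈ L.lo
        covered {x} x∈ with x ∈? L.lo
        ... | yes p = p
        ... | no ¬p = contradiction (∈-filter⁺ out? x∈ ¬p) (empty rest eq)
          where
          empty : ∀ {x} xs → length xs ≡ 0 → ¬ (x ∈ xs)
          empty [] _ ()
      min = least f rest nonempty
      z = proj₁ min
      z∈′ : z ∈ as × z ∉ L.lo
      z∈′ = ∈-filter⁻ out? {xs = as} (proj₁ (proj₂ min))

    module _ (f-+ : ∀ x y → f (x ℤ.+ y) ≡ f x ℤ.+ f y) {k} (l : Lower f as k) where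
      open Lower l

      lower-closed : ∀ {x p} → x ∈ lo → p ∈ as → f p ℤ.≤ f x → p ∈ lo
      lower-closed {x} {p} x∈ p∈ p≤x with p ∈? lo
      ... | yes q = q
      ... | no ¬q = contradiction (below x∈ p∈ ¬q) (ℤ.≤⇒≯ p≤x)

      -- If a + x = p + b, then f b ≥ f a forces f p ≤ f x, so p is among the k lowest; and p
      -- determines b.
      reps-lower : ∀ {a x} → (∀ {y} → y ∈ as → f a ℤ.≤ f y) → x ∈ lo → reps as (a ℤ.+ x) ≤ ιₙ k
      reps-lower {a} {x} least-a x∈ = begin
        reps as (a ℤ.+ x) ≤⟨ ∑-mono as row ⟩
        ∑ as (λ p → [ p ∈? lo ?]) ≡⟨ sym (length-filter-∑ (_∈? lo) as) ⟩
        ιₙ (length (filter (_∈? lo) as)) ≤⟨ ιₙ-mono-≤ (length-⊆ (Unique.filter⁺ (_∈? lo) u) (λ p → proj₂ (∈-filter⁻ (_∈? lo) {xs = as} p))) ⟩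
        ιₙ (length lo) ≡⟨ cong ιₙ size ⟩
        ιₙ k ∎
        where
        open ≤-Reasoning
        cancel : ∀ {p b} → p ℤ.+ b ≡ a ℤ.+ x → a ℤ.+ x ℤ.- p ≡ b
        cancel {p} {b} eq = trans (cong (ℤ._- p) (sym eq)) (e p b)
          where
          e : ∀ p b → p ℤ.+ b ℤ.- p ≡ b
          e = ℤ-Solver.solve-∀
        row : ∀ p → p ∈ as → ∑ as (λ b → [ p ℤ.+ b ℤ.≟ a ℤ.+ x ?]) ≤ [ p ∈? lo ?]
        row p p∈ with p ∈? lo
        ... | yes _ = ≤-trans (∑-mono as λ b _ → [?]-mono (p ℤ.+ b ℤ.≟ a ℤ.+ x) (a ℤ.+ x ℤ.- p ℤ.≟ b) cancel) (∑-δ-≤1 ℤ._≟_ (a ℤ.+ x ℤ.- p) u)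
        ... | no p∉ = ≤-reflexive (trans (∑-cong as λ b b∈ → [?]-no (p ℤ.+ b ℤ.≟ a ℤ.+ x) λ eq → p∉ (lower-closed x∈ p∈ (ℤ.≮⇒≥ λ x<p →
          ℤ.<-irrefl (trans (sym (f-+ a x)) (trans (cong f (sym eq)) (trans (f-+ p b) (ℤ.+-comm (f p) (f b))))) (ℤ.+-mono-≤-< (least-a b∈) x<p)))) (∑-0 as))

  module _ {as S : List ℤ} (u : Unique as) (u-S : Unique S) (sums : ∀ {a b} → a ∈ as → b ∈ as → a ℤ.+ b ∈ S)
           {k} (k<m : k ℕ.< length as) where
    private
      id-+ : ∀ x y → x ℤ.+ y ≡ x ℤ.+ y
      id-+ _ _ = refl
      bottom = lower (λ x → x) (λ eq → eq) u k (ℕ.<⇒≤ k<m)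
      top = lower ℤ.-_ ℤ.neg-injective u k (ℕ.<⇒≤ k<m)
      module B = Lower bottom
      module T = Lower top
      1≤m : 1 ℕ.≤ length as
      1≤m = ℕ.≤-trans (ℕ.s≤s ℕ.z≤n) k<m
      minimum = least (λ x → x) as 1≤m
      maximum = least ℤ.-_ as 1≤m
      a z : ℤ
      a = proj₁ minimum
      z = proj₁ maximum
      a∈ : a ∈ as
      a∈ = proj₁ (proj₂ minimum)
      z∈ : z ∈ as
      z∈ = proj₁ (proj₂ maximum)

    -- The least element plus the k lowest, and the greatest plus the k highest. These 2k sums are
    -- distinct, and each has at most k representations.
    extremes : List ℤ
    extremes = map (λ x → a ℤ.+ x) B.lo ++ map (λ x → z ℤ.+ x) T.lo

    private
      z∉ : z ∉ B.lo
      z∉ p = ℕ.<⇒≱ k<m (subst (length as ℕ.≤_) B.size (length-⊆ u λ x∈ → lower-closed (λ x → x) (λ eq → eq) u id-+ bottom p x∈ (ℤ.neg-cancel-≤ (proj₂ (proj₂ maximum) x∈))))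

      below-z : ∀ {x} → x ∈ B.lo → x ℤ.< z
      below-z x∈ = ℤ.≤∧≢⇒< (ℤ.neg-cancel-≤ (proj₂ (proj₂ maximum) (B.subset x∈))) (λ { refl → z∉ x∈ })

      shift-unique : ∀ {xs} c → Unique xs → Unique (map (λ x → c ℤ.+ x) xs)
      shift-unique c = Unique.map⁺ λ {x} {y} → ∙-cancelˡ c x y

      extremes-unique : Unique extremes
      extremes-unique = Unique.++⁺ (shift-unique a B.unique) (shift-unique z T.unique) λ { (p , q) →
        let x , x∈ , eq = ∈-map⁻ (λ x → a ℤ.+ x) p ; y , y∈ , eq′ = ∈-map⁻ (λ x → z ℤ.+ x) q in
        ℤ.<-irrefl (trans (sym eq) eq′) (subst (a ℤ.+ x ℤ.<_) (ℤ.+-comm y z) (ℤ.+-mono-≤-< (proj₂ (proj₂ minimum) (T.subset y∈)) (below-z x∈))) }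

      extremes-S : ∀ {y} → y ∈ extremes → y ∈ S
      extremes-S y∈ with ∈-++⁻ (map (λ x → a ℤ.+ x) B.lo) y∈
      ... | inj₁ p = let x , x∈ , eq = ∈-map⁻ (λ x → a ℤ.+ x) p in subst (_∈ S) (sym eq) (sums a∈ (B.subset x∈))
      ... | inj₂ p = let x , x∈ , eq = ∈-map⁻ (λ x → z ℤ.+ x) p in subst (_∈ S) (sym eq) (sums z∈ (T.subset x∈))

      extremes-reps : ∀ y → y ∈ extremes → reps as y ≤ ιₙ k
      extremes-reps y y∈ with ∈-++⁻ (map (λ x → a ℤ.+ x) B.lo) y∈
      ... | inj₁ p = let x , x∈ , eq = ∈-map⁻ (λ x → a ℤ.+ x) p in subst (λ y → reps as y ≤ ιₙ k) (sym eq) (reps-lower (λ x → x) (λ eq → eq) u id-+ bottom (proj₂ (proj₂ minimum)) x∈)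
      ... | inj₂ p = let x , x∈ , eq = ∈-map⁻ (λ x → z ℤ.+ x) p in subst (λ y → reps as y ≤ ιₙ k) (sym eq) (reps-lower ℤ.-_ ℤ.neg-injective u ℤ.neg-distrib-+ top (proj₂ (proj₂ maximum)) x∈)

      extremes-size : ιₙ (length extremes) ≡ 2ℚ * ιₙ k
      extremes-size = trans (cong ιₙ (trans (length-++ (map (λ x → a ℤ.+ x) B.lo)) (cong₂ ℕ._+_ (trans (length-map _ B.lo) B.size) (trans (length-map _ T.lo) T.size)))) (trans (ιₙ-+ k k) (e (ιₙ k)))
        where
        e : ∀ a → a + a ≡ 2ℚ * a
        e = solve-∀ ℚ-ring

    -- Extremal sums have few representations, so the representation function is far from
    -- constant and the Cauchy-Schwarz bound E ≥ m⁴/n can be improved.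
    energy-defect : ∀ U G → 0ℚ ≤ U → U * ιₙ k ≤ G →
      2ℚ * ιₙ k * ((G - U * ιₙ k) * (G - U * ιₙ k)) ≤
      U * U * ∑ S (λ y → reps as y * reps as y) + (G * G * ιₙ (length S) - 2ℚ * U * G * (ιₙ (length as) * ιₙ (length as)))
    energy-defect U G 0≤U Uk≤G = begin
      -- `G / U` is a trial value for the typical number of representations. The square of the
      -- deviation from it is summed over S, where it expands into the energy, and is bounded below
      -- by the terms at the extremal sums, whose deviation is large.
      2ℚ * κ * ((G - U * κ) * (G - U * κ)) ≡⟨ sym (trans (∑-const extremes _) (cong (_* ((G - U * κ) * (G - U * κ))) extremes-size)) ⟩
      ∑ extremes (λ _ → (G - U * κ) * (G - U * κ)) ≤⟨ ∑-mono extremes (λ y y∈ → sq-mono-≤ (≤⇒0≤ Uk≤G) (+-monoʳ-≤ G (neg-antimono-≤ (U*-mono (extremes-reps y y∈))))) ⟩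
      ∑ extremes (λ y → (G - U * g y) * (G - U * g y)) ≤⟨ ∑-⊆ extremes-unique extremes-S (λ y _ → sq-nonNeg (G - U * g y)) ⟩
      ∑ S (λ y → (G - U * g y) * (G - U * g y)) ≡⟨ trans (∑-ext S λ y → e U G (g y)) (trans (∑-+ S _ _) (cong₂ _+_ (∑-*ˡ S (U * U) _) (trans (∑-+ S _ _) (cong₂ _+_ (trans (∑-const S _) (*-comm n (G * G))) (trans (∑-*ˡ S (- (2ℚ * U * G)) (λ y → g y * 1ℚ)) (cong (- (2ℚ * U * G) *_) total)))))) ⟩
      U * U * E + (G * G * n + - (2ℚ * U * G) * (m * m)) ≡⟨ cong (λ w → U * U * E + (G * G * n + w)) (e′ (2ℚ * U * G) (m * m)) ⟩
      U * U * E + (G * G * n - 2ℚ * U * G * (m * m)) ∎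
      where
      open ≤-Reasoning
      g = reps as
      κ m n E : ℚ
      κ = ιₙ k
      m = ιₙ (length as)
      n = ιₙ (length S)
      E = ∑ S (λ y → g y * g y)
      U*-mono : ∀ {v} → v ≤ κ → U * v ≤ U * κ
      U*-mono = *-mono-≤ˡ 0≤U
      e : ∀ U G g → (G - U * g) * (G - U * g) ≡ U * U * (g * g) + (G * G + - (2ℚ * U * G) * (g * 1ℚ))
      e = solve-∀ ℚ-ring
      e′ : ∀ a b → - a * b ≡ - (a * b)
      e′ = solve-∀ ℚ-ring
      total : ∑ S (λ y → g y * 1ℚ) ≡ m * m
      total = trans (∑-reps (λ _ → 1ℚ) u-S sums) (trans (∑-ext as λ a → ∑-1 as) (∑-const as m))

  private
    -- Numerals enter as variables, so that the ring solver meets only polynomials and the single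
    -- inequality `numeric` is left to arithmetic. With common denominator `U`: `D` is the doubling
    -- constant, `c` the trial value per m and `w` the energy constant; κ / m lies between e / t and
    -- 1 / v.
    record Quantities : Set where
      field
        U D c w d e t v m n κ E : ℚ
        0≤D : 0ℚ ≤ D
        0≤c : 0ℚ ≤ c
        0≤d : 0ℚ ≤ d
        0≤e : 0ℚ ≤ e
        0<U : 0ℚ < U
        0<t : 0ℚ < t
        0<v : 0ℚ < v
        0≤m : 0ℚ ≤ m
        0≤κ : 0ℚ ≤ κ
        vc≡ : v * c ≡ d + U
        numeric : t * (v * v) * (c * c * D) + t * (v * v) * (U * U * w) ≤ 2ℚ * U * (e * (d * d)) + 2ℚ * (t * (v * v) * (U * U * c))
        doubling : U * n ≤ D * m
        κ-upper : v * κ ≤ m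
        κ-lower : e * m ≤ t * κ

    module Optimisation (quantities : Quantities) where
      open Quantities quantities

      gap : d * m ≤ v * (c * m - U * κ)
      gap = ≤-by (U * (m - v * κ)) (*-nonNeg (<⇒≤ 0<U) (≤⇒0≤ κ-upper)) (trans (l v c m U κ) (trans (cong (λ z → z * m - U * (v * κ)) vc≡) (l′ d U m (v * κ))))
        where
        l : ∀ v c m U κ → v * (c * m - U * κ) ≡ v * c * m - U * (v * κ)
        l = solve-∀ ℚ-ring
        l′ : ∀ d U m z → (d + U) * m - U * z ≡ d * m + U * (m - z)
        l′ = solve-∀ ℚ-ring

      Uκ≤cm : U * κ ≤ c * m
      Uκ≤cm = 0≤⇒≤ (*-cancelʳ-≤ {v} {0ℚ} {c * m - U * κ} 0<v (subst₂ _≤_ (sym (*-zeroˡ v)) (*-comm v (c * m - U * κ)) (≤-trans (*-nonNeg 0≤d 0≤m) gap)))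

      -- `final` exhibits the claim, multiplied by t v² U², as a non-negative combination of
      -- `numeric`, `cubes`, the defect inequality and the doubling hypothesis.
      conclusion : 2ℚ * κ * ((c * m - U * κ) * (c * m - U * κ)) ≤ U * U * E + (c * m * (c * m) * n - 2ℚ * U * (c * m) * (m * m)) →
                   w * (m * m * m) ≤ U * E
      conclusion defect = *-cancelʳ-≤ {T * (U * U)} {w * (m * m * m)} {U * E} (*-pos 0<T (*-pos 0<U 0<U)) (0≤⇒≤ (subst (0ℚ ≤_) (final U D c w d e t v m n κ E)
          (+-nonNeg (+-nonNeg (*-nonNeg (*-nonNeg 0≤m (*-nonNeg 0≤m 0≤m)) (≤⇒0≤ numeric))
            (*-nonNeg (nonNeg-2U) (≤⇒0≤ cubes)))
            (+-nonNeg (*-nonNeg (<⇒≤ (*-pos 0<T 0<U)) (≤⇒0≤ defect))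
              (*-nonNeg (*-nonNeg (<⇒≤ 0<T) (sq-nonNeg (c * m))) (≤⇒0≤ doubling))))))
        where
        T : ℚ
        T = t * (v * v)
        0<T : 0ℚ < T
        0<T = *-pos 0<t (*-pos 0<v 0<v)
        nonNeg-2U : 0ℚ ≤ 2ℚ * U
        nonNeg-2U = *-nonNeg (nonNegative⁻¹ 2ℚ) (<⇒≤ 0<U)
        cubes : e * m * (d * m * (d * m)) ≤ t * κ * (v * (c * m - U * κ) * (v * (c * m - U * κ)))
        cubes = *-mono-≤-nonNeg (*-nonNeg 0≤e 0≤m) (sq-nonNeg (v * (c * m - U * κ))) κ-lower (sq-mono-≤ (*-nonNeg 0≤d 0≤m) gap)
        final : ∀ U D c w d e t v m n κ E →
          m * (m * m) * (2ℚ * U * (e * (d * d)) + 2ℚ * (t * (v * v) * (U * U * c)) - (t * (v * v) * (c * c * D) + t * (v * v) * (U * U * w)))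
          + 2ℚ * U * (t * κ * (v * (c * m - U * κ) * (v * (c * m - U * κ))) - e * m * (d * m * (d * m)))
          + (t * (v * v) * U * (U * U * E + (c * m * (c * m) * n - 2ℚ * U * (c * m) * (m * m)) - 2ℚ * κ * ((c * m - U * κ) * (c * m - U * κ)))
             + t * (v * v) * (c * m * (c * m)) * (D * m - U * n))
          ≡ U * E * (t * (v * v) * (U * U)) - w * (m * m * m) * (t * (v * v) * (U * U))
        final = solve-∀ ℚ-ring

  -- γ = 0.25724 m nearly maximises 2γm² - γ²n + 2k(γ - k)² for n = 4m and k = m/12.
  energy-bound : ∀ {as S} → Unique as → Unique S → (∀ {a b} → a ∈ as → b ∈ as → a ℤ.+ b ∈ S) → 100000 ℕ.≤ length as →
    ιₙ 100000 * ιₙ (length S) ≤ ιₙ 400001 * ιₙ (length as) →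
    ιₙ 25480 * (ιₙ (length as) * ιₙ (length as) * ιₙ (length as)) ≤ ιₙ 100000 * ∑ S (λ y → reps as y * reps as y)
  energy-bound {as} {S} u u-S sums large doubling = conclusion (energy-defect u u-S sums k<M (ιₙ 100000) (ιₙ 25724 * m) (ιₙ-nonNeg 100000) Uκ≤cm)
    where
    M k : ℕ
    M = length as
    k = M ℕ./ 12
    m n κ E : ℚ
    m = ιₙ M
    n = ιₙ (length S)
    κ = ιₙ k
    E = ∑ S (λ y → reps as y * reps as y)
    k<M : k ℕ.< M
    k<M = m/n<m M 12 {{ℕ.>-nonZero (ℕ.≤-trans (ℕ.s≤s ℕ.z≤n) large)}} (ℕ.s≤s (ℕ.s≤s ℕ.z≤n))
    κ-upper : ιₙ 12 * κ ≤ m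
    κ-upper = subst (_≤ m) (ιₙ-* 12 k) (ιₙ-mono-≤ (subst (ℕ._≤ M) (ℕ.*-comm k 12) (m/n*n≤m M 12)))
    -- 0.0833 is just below 1/12; the remainder of at most 11 in the division by 12 is absorbed once
    -- m is at least 27500.
    κ-lower : ιₙ 833 * m ≤ ιₙ 10000 * κ
    κ-lower = subst₂ _≤_ (ιₙ-* 833 M) (ιₙ-* 10000 k) (ιₙ-mono-≤ (ℕ.*-cancelˡ-≤ 12 (ℕ.+-cancelʳ-≤ (10000 ℕ.* 11) _ _ (begin
      12 ℕ.* (833 ℕ.* M) ℕ.+ 10000 ℕ.* 11 ≤⟨ ℕ.+-monoʳ-≤ (12 ℕ.* (833 ℕ.* M)) (ℕ.≤-trans (ℕ.*-monoʳ-≤ 4 large′) ℕ.≤-refl) ⟩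
      12 ℕ.* (833 ℕ.* M) ℕ.+ 4 ℕ.* M ≡⟨ l₁ M ⟩
      10000 ℕ.* M ≤⟨ ℕ.*-monoʳ-≤ 10000 M≤ ⟩
      10000 ℕ.* (11 ℕ.+ k ℕ.* 12) ≡⟨ l₂ k ⟩
      12 ℕ.* (10000 ℕ.* k) ℕ.+ 10000 ℕ.* 11 ∎))))
      where
      open ℕ.≤-Reasoning
      large′ : 27500 ℕ.≤ M
      large′ = ℕ.≤-trans (ℕ.≤ᵇ⇒≤ 27500 100000 _) large
      M≤ : M ℕ.≤ 11 ℕ.+ k ℕ.* 12
      M≤ = ℕ.≤-trans (ℕ.≤-reflexive (m≡m%n+[m/n]*n M 12)) (ℕ.+-monoˡ-≤ (k ℕ.* 12) (ℕ.s≤s⁻¹ (m%n<n M 12)))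
      l₁ : ∀ M → 12 ℕ.* (833 ℕ.* M) ℕ.+ 4 ℕ.* M ≡ 10000 ℕ.* M
      l₁ M = trans (cong (ℕ._+ 4 ℕ.* M) (sym (ℕ.*-assoc 12 833 M))) (sym (ℕ.*-distribʳ-+ M 9996 4))
      l₂ : ∀ k → 10000 ℕ.* (11 ℕ.+ k ℕ.* 12) ≡ 12 ℕ.* (10000 ℕ.* k) ℕ.+ 10000 ℕ.* 11
      l₂ k = trans (ℕ.*-distribˡ-+ 10000 11 (k ℕ.* 12)) (trans (ℕ.+-comm (10000 ℕ.* 11) (10000 ℕ.* (k ℕ.* 12)))
        (cong (ℕ._+ 10000 ℕ.* 11) (trans (sym (ℕ.*-assoc 10000 k 12)) (ℕ.*-comm (10000 ℕ.* k) 12))))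
    2≡ : 2ℚ ≡ ιₙ 2
    2≡ = sym (ι-def (+ 2))
    quantities : Quantities
    quantities = record
      { U = ιₙ 100000 ; D = ιₙ 400001 ; c = ιₙ 25724 ; w = ιₙ 25480 ; d = ιₙ 208688 ; e = ιₙ 833 ; t = ιₙ 10000 ; v = ιₙ 12 ; m = m ; n = n ; κ = κ ; E = E
      ; 0≤D = ιₙ-nonNeg 400001 ; 0≤c = ιₙ-nonNeg 25724 ; 0≤d = ιₙ-nonNeg 208688 ; 0≤e = ιₙ-nonNeg 833 ; 0<U = ιₙ-pos 99999 ; 0<t = ιₙ-pos 9999 ; 0<v = ιₙ-pos 11
      ; 0≤m = ιₙ-nonNeg M ; 0≤κ = ιₙ-nonNeg k ; vc≡ = trans (sym (ιₙ-* 12 25724)) (ιₙ-+ 208688 100000)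
      ; numeric = subst (λ z → ⟦ # 10000 ⊠ (# 12 ⊠ # 12) ⊠ (# 25724 ⊠ # 25724 ⊠ # 400001) ⊞ # 10000 ⊠ (# 12 ⊠ # 12) ⊠ (# 100000 ⊠ # 100000 ⊠ # 25480) ⟧ ≤
                               z * ιₙ 100000 * ⟦ # 833 ⊠ (# 208688 ⊠ # 208688) ⟧ + z * ⟦ # 10000 ⊠ (# 12 ⊠ # 12) ⊠ (# 100000 ⊠ # 100000 ⊠ # 25724) ⟧) (sym 2≡)
          (numeral-≤ (# 10000 ⊠ (# 12 ⊠ # 12) ⊠ (# 25724 ⊠ # 25724 ⊠ # 400001) ⊞ # 10000 ⊠ (# 12 ⊠ # 12) ⊠ (# 100000 ⊠ # 100000 ⊠ # 25480))
            (# 2 ⊠ # 100000 ⊠ (# 833 ⊠ (# 208688 ⊠ # 208688)) ⊞ # 2 ⊠ (# 10000 ⊠ (# 12 ⊠ # 12) ⊠ (# 100000 ⊠ # 100000 ⊠ # 25724))))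
      ; doubling = doubling ; κ-upper = κ-upper ; κ-lower = κ-lower }
    open Optimisation quantities

-- Almost periods by random sampling

module AlmostPeriods where

  open import Data.Integer.Base as ℤ using (ℤ; +_)
  open import Data.Rational.Base
  open import Data.Rational.Properties
  open RationalOrder
  open ListSum
  open Rotations using (2ℚ; 4ℚ)
  open Characters
  open Energy using (Sumset)

  -- 5 is a crude bound both for |S| / m and for m² divided by the intensity of a large frequency. A
  -- good sample has error constant 50 = 5 · 5 · 2, and an almost period 4000 = 50 · 80.
  5ℚ 50ℚ 4000ℚ : ℚ
  5ℚ = 4ℚ + 1ℚ
  50ℚ = 5ℚ * 5ℚ * 2ℚ
  4000ℚ = 50ℚ * (5ℚ * 4ℚ * 4ℚ)

  private
    -- The squared error of u / T as an estimate of x / m, cleared of denominators.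
    δ : ℚ → ℚ → ℚ → ℚ → ℚ
    δ m T x u = (m * u - T * x) * (m * u - T * x)

    square : ∀ T m x u → T * T * (x * x) ≤ 2ℚ * (m * m * (u * u)) + 2ℚ * δ m T x u
    square T m x u = ≤-by ((2ℚ * (m * u) - T * x) * (2ℚ * (m * u) - T * x)) (sq-nonNeg (2ℚ * (m * u) - T * x)) (l T m x u)
      where
      l : ∀ T m x u → 2ℚ * (m * m * (u * u)) + 2ℚ * ((m * u - T * x) * (m * u - T * x)) ≡ T * T * (x * x) + (2ℚ * (m * u) - T * x) * (2ℚ * (m * u) - T * x)
      l = solve-∀ ℚ-ring

    difference : ∀ m T x u a → m * m * ((a - u) * (a - u)) ≤ 2ℚ * δ m T x u + 2ℚ * δ m T x a
    difference m T x u a = ≤-by ((m * a + m * u - 2ℚ * (T * x)) * (m * a + m * u - 2ℚ * (T * x))) (sq-nonNeg (m * a + m * u - 2ℚ * (T * x))) (l m T x u a)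
      where
      l : ∀ m T x u a → 2ℚ * ((m * u - T * x) * (m * u - T * x)) + 2ℚ * ((m * a - T * x) * (m * a - T * x)) ≡
          m * m * ((a - u) * (a - u)) + (m * a + m * u - 2ℚ * (T * x)) * (m * a + m * u - 2ℚ * (T * x))
      l = solve-∀ ℚ-ring

    two-squares : ∀ T m x y u v → T * T * (x * x + y * y) ≤ 2ℚ * (m * m * (u * u + v * v)) + 2ℚ * (δ m T x u + δ m T y v)
    two-squares T m x y u v = ≤-trans (≤-reflexive (*-distribˡ-+ (T * T) (x * x) (y * y))) (≤-trans (+-mono-≤ (square T m x u) (square T m y v))
      (≤-reflexive (gather (m * m) (u * u) (v * v) (δ m T x u) (δ m T y v))))
      where
      gather : ∀ a u v d e → 2ℚ * (a * u) + 2ℚ * d + (2ℚ * (a * v) + 2ℚ * e) ≡ 2ℚ * (a * (u + v)) + 2ℚ * (d + e)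
      gather = solve-∀ ℚ-ring

    two-differences : ∀ m T x y u v a b → m * m * ((a - u) * (a - u) + (b - v) * (b - v)) ≤ 2ℚ * (δ m T x u + δ m T y v) + 2ℚ * (δ m T x a + δ m T y b)
    two-differences m T x y u v a b = ≤-trans (≤-reflexive (*-distribˡ-+ (m * m) ((a - u) * (a - u)) ((b - v) * (b - v))))
      (≤-trans (+-mono-≤ (difference m T x u a) (difference m T y v b)) (≤-reflexive (gather (δ m T x u) (δ m T x a) (δ m T y v) (δ m T y b))))
      where
      gather : ∀ a b d e → 2ℚ * a + 2ℚ * b + (2ℚ * d + 2ℚ * e) ≡ 2ℚ * (a + d) + 2ℚ * (b + e)
      gather = solve-∀ ℚ-ring

  module Sampling (𝒞 : Circle) (sumset : Sumset) where
    open Sumset sumset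
    open Circle 𝒞
    open Transform 𝒞

    m n : ℚ
    m = ιₙ (length as)
    n = ιₙ (length S)

    0<m : 0ℚ < m
    0<m = subst (_< m) (ι-def (+ 0)) (ιₙ-mono-< nonempty)

    tuples : List ℤ → ℕ → List (List ℤ)
    tuples xs zero = [] ∷ []
    tuples xs (suc t) = cartesianProductWith _∷_ xs (tuples xs t)

    tuples-count : ∀ xs t → ιₙ (length (tuples xs t)) ≡ ιₙ (length xs) ^ t
    tuples-count xs zero = ι-def _
    tuples-count xs (suc t) = begin
      ιₙ (length (tuples xs (suc t))) ≡⟨ ∑-1 (tuples xs (suc t)) ⟨
      ∑ (tuples xs (suc t)) (λ _ → 1ℚ) ≡⟨ ∑-product _∷_ xs (tuples xs t) _ ⟩
      ∑ xs (λ _ → ∑ (tuples xs t) (λ _ → 1ℚ)) ≡⟨ ∑-const xs _ ⟩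
      ιₙ (length xs) * ∑ (tuples xs t) (λ _ → 1ℚ) ≡⟨ cong (ιₙ (length xs) *_) (trans (∑-1 (tuples xs t)) (tuples-count xs t)) ⟩
      ιₙ (length xs) ^ suc t ∎
      where open ≡-Reasoning

    tuples-length : ∀ xs t {τ} → τ ∈ tuples xs t → length τ ≡ t
    tuples-length xs zero (here refl) = refl
    tuples-length xs (suc t) τ∈ = let a , τ′ , _ , τ′∈ , eq = ∈-cartesianProductWith⁻ _∷_ xs (tuples xs t) τ∈ in
      trans (cong length eq) (cong suc (tuples-length xs t τ′∈))

    tuples-elements : ∀ xs t {τ} → τ ∈ tuples xs t → ∀ {a} → a ∈ τ → a ∈ xs
    tuples-elements xs zero (here refl) ()
    tuples-elements xs (suc t) τ∈ a∈ with ∈-cartesianProductWith⁻ _∷_ xs (tuples xs t) τ∈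
    tuples-elements xs (suc t) τ∈ (here refl) | a , τ′ , x∈ , τ′∈ , refl = x∈
    tuples-elements xs (suc t) τ∈ (there a∈) | a , τ′ , x∈ , τ′∈ , refl = tuples-elements xs t τ′∈ a∈

    tuples-unique : ∀ {xs} t → Unique xs → Unique (tuples xs t)
    tuples-unique zero u = [] ∷ []
    tuples-unique {xs} (suc t) u = Unique.cartesianProductWith⁺ _∷_ ∷-injective u (tuples-unique t u)

    shift : ℤ → List ℤ → List ℤ
    shift x = map (ℤ._+ x)

    shift-tuples : ∀ t {τ a} → τ ∈ tuples as t → a ∈ as → shift a τ ∈ tuples S t
    shift-tuples zero (here refl) a∈ = here refl
    shift-tuples (suc t) {a = x} τ∈ a∈ = let b , τ′ , b∈ , τ′∈ , eq = ∈-cartesianProductWith⁻ _∷_ as (tuples as t) τ∈ in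
      subst (λ τ → shift x τ ∈ tuples S (suc t)) (sym eq) (∈-cartesianProductWith⁺ _∷_ (as+as b∈ a∈) (shift-tuples t τ′∈ a∈))

    -- The indicator of a + A at y. Its sum over a is the convolution `g`, so for a uniform a in A
    -- it is an unbiased estimate of g / m; `deviation` is its error times m.
    e : ℤ → ℤ → ℚ
    e y a = ∑ as (λ b → [ a ℤ.+ b ℤ.≟ y ?])

    g : ℤ → ℚ
    g y = ∑ as (e y)

    e-nonNeg : ∀ y a → 0ℚ ≤ e y a
    e-nonNeg y a = ∑-nonNeg as λ b _ → [?]-nonNeg (a ℤ.+ b ℤ.≟ y)

    e≤1 : ∀ y a → e y a ≤ 1ℚ
    e≤1 y a = ≤-trans (∑-mono as λ b _ → [?]-mono (a ℤ.+ b ℤ.≟ y) (y ℤ.- a ℤ.≟ b) λ eq → trans (cong (ℤ._- a) (sym eq)) (l a b))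
      (∑-δ-≤1 ℤ._≟_ (y ℤ.- a) u-as)
      where
      l : ∀ a b → a ℤ.+ b ℤ.- a ≡ b
      l = ℤ-Solver.solve-∀

    e-sum : ∀ {a} (f : ℤ → ℚ) → a ∈ as → ∑ S (λ y → e y a * f y) ≡ ∑ as (λ b → f (a ℤ.+ b))
    e-sum {a} f a∈ = trans (∑-ext S λ y → sym (∑-*ʳ as (f y) _)) (trans (∑-swap S as _)
      (∑-cong as λ b b∈ → ∑-δ ℤ._≟_ f u-S (as+as a∈ b∈)))

    g-sum : ∀ (f : ℤ → ℚ) → ∑ S (λ y → g y * f y) ≡ ∑ as (λ a → ∑ as (λ b → f (a ℤ.+ b)))
    g-sum f = trans (∑-ext S λ y → sym (∑-*ʳ as (f y) _)) (trans (∑-swap S as _) (∑-cong as λ a a∈ → e-sum f a∈))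

    deviation : ℤ → ℤ → ℚ
    deviation y a = m * e y a - g y

    private
      deviation-sum : ∀ y → ∑ as (deviation y) ≡ 0ℚ
      deviation-sum y = trans (∑-+ as _ _) (trans (cong₂ _+_ (∑-*ˡ as m (e y)) (trans (∑-const as (- g y)) refl)) (l m (g y)))
        where
        l : ∀ m g → m * g + m * (- g) ≡ 0ℚ
        l = solve-∀ ℚ-ring

      -- The values of `e y` lie between 0 and 1 and hence dominate their squares.
      variance : ∀ y → ∑ as (λ a → deviation y a * deviation y a) ≤ m * m * g y
      variance y = begin
        ∑ as (λ a → deviation y a * deviation y a)
          ≤⟨ ∑-mono as (λ a _ → ≤-by (m * m * (e y a * (1ℚ - e y a))) (*-nonNeg (sq-nonNeg m) (*-nonNeg (e-nonNeg y a) (≤⇒0≤ (e≤1 y a)))) (l₁ m (e y a) (g y))) ⟩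
        ∑ as (λ a → (m * m - 2ℚ * m * g y) * e y a + g y * g y)
          ≡⟨ trans (∑-+ as _ _) (cong₂ _+_ (∑-*ˡ as (m * m - 2ℚ * m * g y) (e y)) (∑-const as (g y * g y))) ⟩
        (m * m - 2ℚ * m * g y) * g y + m * (g y * g y)
          ≤⟨ ≤-by (m * (g y * g y)) (*-nonNeg (<⇒≤ 0<m) (sq-nonNeg (g y))) (l₂ m (g y)) ⟩
        m * m * g y ∎
        where
        open ≤-Reasoning
        l₁ : ∀ m e g → (m * m - 2ℚ * m * g) * e + g * g ≡ (m * e - g) * (m * e - g) + m * m * (e * (1ℚ - e))
        l₁ = solve-∀ ℚ-ring
        l₂ : ∀ m g → m * m * g ≡ (m * m - 2ℚ * m * g) * g + m * (g * g) + m * (g * g)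
        l₂ = solve-∀ ℚ-ring

      -- The samples are independent and `X` has mean zero, so cross terms vanish and second moments
      -- add. The factor m on the left avoids the exponent t - 1.
      moment : ∀ (X : ℤ → ℚ) → ∑ as X ≡ 0ℚ → ∀ t →
               m * ∑ (tuples as t) (λ τ → ∑ τ X * ∑ τ X) ≡ ιₙ t * (m ^ t * ∑ as (λ a → X a * X a))
      moment X ΣX≡0 zero = trans (l m) (sym (trans (cong (_* (1ℚ * ∑ as (λ a → X a * X a))) (ι-def (+ 0))) (*-zeroˡ (1ℚ * ∑ as (λ a → X a * X a)))))
        where
        l : ∀ m → m * (0ℚ * 0ℚ + 0ℚ) ≡ 0ℚ
        l = solve-∀ ℚ-ring
      moment X ΣX≡0 (suc t) = begin
        m * ∑ (tuples as (suc t)) (λ τ → ∑ τ X * ∑ τ X)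
          ≡⟨ cong (m *_) (∑-product _∷_ as (tuples as t) _) ⟩
        m * ∑ as (λ a → ∑ (tuples as t) (λ τ → (X a + ∑ τ X) * (X a + ∑ τ X)))
          ≡⟨ cong (m *_) (∑-ext as row) ⟩
        m * ∑ as (λ a → L * (X a * X a) + (2ℚ * X a * M + Q))
          ≡⟨ cong (m *_) (trans (∑-+ as _ _) (cong₂ _+_ (∑-*ˡ as L _) (trans (∑-+ as _ _) (cong₂ _+_ (trans (∑-*ʳ as M _) (cong (_* M) (∑-*ˡ as 2ℚ X))) (∑-const as Q))))) ⟩
        m * (L * V + (2ℚ * ∑ as X * M + m * Q))
          ≡⟨ cong (λ z → m * (L * V + (2ℚ * z * M + m * Q))) ΣX≡0 ⟩
        m * (L * V + (2ℚ * 0ℚ * M + m * Q))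
          ≡⟨ l₁ m L V M Q ⟩
        m * (L * V) + m * (m * Q)
          ≡⟨ cong₂ (λ a b → m * (a * V) + m * b) (tuples-count as t) (moment X ΣX≡0 t) ⟩
        m * (m ^ t * V) + m * (ιₙ t * (m ^ t * V))
          ≡⟨ l₂ m (m ^ t) V (ιₙ t) ⟩
        (1ℚ + ιₙ t) * (m * m ^ t * V)
          ≡⟨ cong (_* (m * m ^ t * V)) (ιₙ-suc t) ⟨
        ιₙ (suc t) * (m * m ^ t * V) ∎
        where
        open ≡-Reasoning
        V = ∑ as (λ a → X a * X a)
        L = ιₙ (length (tuples as t))
        M = ∑ (tuples as t) (λ τ → ∑ τ X)
        Q = ∑ (tuples as t) (λ τ → ∑ τ X * ∑ τ X)
        sq : ∀ a b → (a + b) * (a + b) ≡ a * a + (2ℚ * a * b + b * b)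
        sq = solve-∀ ℚ-ring
        row : ∀ a → ∑ (tuples as t) (λ τ → (X a + ∑ τ X) * (X a + ∑ τ X)) ≡ L * (X a * X a) + (2ℚ * X a * M + Q)
        row a = trans (∑-ext (tuples as t) λ τ → sq (X a) (∑ τ X)) (trans (∑-+ (tuples as t) _ _)
          (cong₂ _+_ (∑-const (tuples as t) _) (trans (∑-+ (tuples as t) _ _) (cong (_+ Q) (∑-*ˡ (tuples as t) (2ℚ * X a) _)))))
        l₁ : ∀ m L V M Q → m * (L * V + (2ℚ * 0ℚ * M + m * Q)) ≡ m * (L * V) + m * (m * Q)
        l₁ = solve-∀ ℚ-ring
        l₂ : ∀ m e V t → m * (e * V) + m * (t * (e * V)) ≡ (1ℚ + t) * (m * e * V)
        l₂ = solve-∀ ℚ-ring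

    -- The squared ℓ² distance of the sampled convolution from the exact one.
    energy : List ℤ → ℚ
    energy τ = ∑ S (λ y → ∑ τ (deviation y) * ∑ τ (deviation y))

    energy-nonNeg : ∀ τ → 0ℚ ≤ energy τ
    energy-nonNeg τ = ∑-nonNeg S λ y _ → sq-nonNeg (∑ τ (deviation y))

    total-energy : ∀ t → ∑ (tuples as t) energy ≤ ιₙ t * (m ^ t * (m * m * m))
    total-energy t = *-cancelʳ-≤ {m} 0<m (begin
      ∑ (tuples as t) energy * m
        ≡⟨ trans (*-comm _ m) (cong (m *_) (∑-swap (tuples as t) S _)) ⟩
      m * ∑ S (λ y → ∑ (tuples as t) (λ τ → ∑ τ (deviation y) * ∑ τ (deviation y)))
        ≡⟨ trans (sym (∑-*ˡ S m _)) (∑-ext S λ y → moment (deviation y) (deviation-sum y) t) ⟩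
      ∑ S (λ y → ιₙ t * (m ^ t * ∑ as (λ a → deviation y a * deviation y a)))
        ≤⟨ ∑-mono S (λ y _ → *-mono-≤ˡ (ιₙ-nonNeg t) (*-mono-≤ˡ (^-nonNeg t (<⇒≤ 0<m)) (variance y))) ⟩
      ∑ S (λ y → ιₙ t * (m ^ t * (m * m * g y)))
        ≡⟨ trans (∑-ext S λ y → l₁ (ιₙ t) (m ^ t) m (g y)) (∑-*ˡ S (ιₙ t * (m ^ t * (m * m))) _) ⟩
      ιₙ t * (m ^ t * (m * m)) * ∑ S (λ y → g y * 1ℚ)
        ≡⟨ cong (ιₙ t * (m ^ t * (m * m)) *_) (trans (g-sum (λ _ → 1ℚ)) (trans (∑-ext as λ _ → ∑-1 as) (∑-const as m))) ⟩
      ιₙ t * (m ^ t * (m * m)) * (m * m)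
        ≡⟨ l₂ (ιₙ t) (m ^ t) m ⟩
      ιₙ t * (m ^ t * (m * m * m)) * m ∎)
      where
      open ≤-Reasoning
      l₁ : ∀ t p m g → t * (p * (m * m * g)) ≡ t * (p * (m * m)) * (g * 1ℚ)
      l₁ = solve-∀ ℚ-ring
      l₂ : ∀ t p m → t * (p * (m * m)) * (m * m) ≡ t * (p * (m * m * m)) * m
      l₂ = solve-∀ ℚ-ring

    module Samples (t : ℕ) (1≤t : 1 ℕ.≤ t) where
      B : ℚ
      B = ιₙ t * (m * m * m)

      0<B : 0ℚ < B
      0<B = *-pos (subst (_< ιₙ t) (ι-def (+ 0)) (ιₙ-mono-< 1≤t)) (*-pos (*-pos 0<m 0<m) 0<m)

      Good : List ℤ → Set
      Good τ = energy τ ≤ 2ℚ * B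

      good? : ∀ τ → Dec (Good τ)
      good? τ = energy τ ≤? 2ℚ * B

      -- Markov's inequality: the mean energy of a sample is at most `B`, so at least half of the
      -- samples stay below twice that.
      many-good : m ^ t ≤ 2ℚ * ∑ (tuples as t) (λ τ → [ good? τ ?])
      many-good = *-cancelʳ-≤ {B} {m ^ t} {2ℚ * G} 0<B (≤-by-sub (begin
        m ^ t * (2ℚ * B) ≡⟨ cong (_* (2ℚ * B)) (tuples-count as t) ⟨
        ιₙ (length (tuples as t)) * (2ℚ * B) ≡⟨ ∑-const (tuples as t) (2ℚ * B) ⟨
        ∑ (tuples as t) (λ _ → 2ℚ * B) ≤⟨ ∑-mono (tuples as t) (λ τ _ → markov τ (good? τ)) ⟩
        ∑ (tuples as t) (λ τ → energy τ + [ good? τ ?] * (2ℚ * B)) ≡⟨ trans (∑-+ (tuples as t) _ _) (cong (λ z → ∑ (tuples as t) energy + z) (∑-*ʳ (tuples as t) (2ℚ * B) _)) ⟩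
        ∑ (tuples as t) energy + G * (2ℚ * B) ≤⟨ +-monoˡ-≤ (G * (2ℚ * B)) (total-energy t) ⟩
        ιₙ t * (m ^ t * (m * m * m)) + G * (2ℚ * B) ∎))
        where
        open ≤-Reasoning
        G = ∑ (tuples as t) (λ τ → [ good? τ ?])
        markov : ∀ τ (d : Dec (Good τ)) → 2ℚ * B ≤ energy τ + [ d ?] * (2ℚ * B)
        markov τ (yes p) = ≤-by (energy τ) (energy-nonNeg τ) (l (energy τ) (2ℚ * B))
          where
          l : ∀ e b → e + 1ℚ * b ≡ b + e
          l = solve-∀ ℚ-ring
        markov τ (no ¬p) = ≤-trans (<⇒≤ (≰⇒> ¬p)) (≤-reflexive (l (energy τ) (2ℚ * B)))
          where
          l : ∀ e b → e ≡ e + 0ℚ * b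
          l = solve-∀ ℚ-ring
        ≤-by-sub : m ^ t * (2ℚ * B) ≤ ιₙ t * (m ^ t * (m * m * m)) + G * (2ℚ * B) → m ^ t * B ≤ 2ℚ * G * B
        ≤-by-sub p = ≤-by (ιₙ t * (m ^ t * (m * m * m)) + G * (2ℚ * B) - m ^ t * (2ℚ * B)) (≤⇒0≤ p) (l (m ^ t) (ιₙ t) (m * m * m) G)
          where
          l : ∀ e t c G → 2ℚ * G * (t * c) ≡ e * (t * c) + (t * (e * c) + G * (2ℚ * (t * c)) - e * (2ℚ * (t * c)))
          l = solve-∀ ℚ-ring

      power : ℤ → ℚ
      power = intensity as

      -- The squared distance of the sampled from the exact Fourier coefficient.
      error : ℤ → List ℤ → ℚ
      error r τ = (m * Fc r τ - ιₙ t * Fc r as) * (m * Fc r τ - ιₙ t * Fc r as) + (m * Fs r τ - ιₙ t * Fs r as) * (m * Fs r τ - ιₙ t * Fs r as)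

      error-nonNeg : ∀ r τ → 0ℚ ≤ error r τ
      error-nonNeg r τ = +-nonNeg (sq-nonNeg (m * Fc r τ - ιₙ t * Fc r as)) (sq-nonNeg (m * Fs r τ - ιₙ t * Fs r as))

      private
        c-pair : ∀ r a b → c (r ℤ.* (a ℤ.+ b)) ≡ c (r ℤ.* a) * c (r ℤ.* b) - s (r ℤ.* a) * s (r ℤ.* b)
        c-pair r a b = trans (cong c (ℤ.*-distribˡ-+ r a b)) (c-+ (r ℤ.* a) (r ℤ.* b))

        s-pair : ∀ r a b → s (r ℤ.* (a ℤ.+ b)) ≡ s (r ℤ.* a) * c (r ℤ.* b) + c (r ℤ.* a) * s (r ℤ.* b)
        s-pair r a b = trans (cong s (ℤ.*-distribˡ-+ r a b)) (s-+ (r ℤ.* a) (r ℤ.* b))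

        c-row : ∀ r a → ∑ as (λ b → c (r ℤ.* (a ℤ.+ b))) ≡ c (r ℤ.* a) * Fc r as - s (r ℤ.* a) * Fs r as
        c-row r a = trans (∑-ext as λ b → c-pair r a b) (trans (∑-+ as _ _) (cong₂ _+_ (∑-*ˡ as (c (r ℤ.* a)) _)
          (trans (∑-neg as _) (cong -_ (∑-*ˡ as (s (r ℤ.* a)) _)))))

        s-row : ∀ r a → ∑ as (λ b → s (r ℤ.* (a ℤ.+ b))) ≡ s (r ℤ.* a) * Fc r as + c (r ℤ.* a) * Fs r as
        s-row r a = trans (∑-ext as λ b → s-pair r a b) (trans (∑-+ as _ _) (cong₂ _+_ (∑-*ˡ as (s (r ℤ.* a)) _) (∑-*ˡ as (c (r ℤ.* a)) _)))

        c-grid : ∀ r τ → ∑ τ (λ a → ∑ as (λ b → c (r ℤ.* (a ℤ.+ b)))) ≡ Fc r τ * Fc r as - Fs r τ * Fs r as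
        c-grid r τ = trans (∑-ext τ (c-row r)) (trans (∑-+ τ _ _) (cong₂ _+_ (∑-*ʳ τ (Fc r as) _) (trans (∑-neg τ _) (cong -_ (∑-*ʳ τ (Fs r as) _)))))

        s-grid : ∀ r τ → ∑ τ (λ a → ∑ as (λ b → s (r ℤ.* (a ℤ.+ b)))) ≡ Fs r τ * Fc r as + Fc r τ * Fs r as
        s-grid r τ = trans (∑-ext τ (s-row r)) (trans (∑-+ τ _ _) (cong₂ _+_ (∑-*ʳ τ (Fc r as) _) (∑-*ʳ τ (Fs r as) _)))

        transform : ∀ {τ} (f : ℤ → ℚ) → (∀ {a} → a ∈ τ → a ∈ as) → length τ ≡ t →
                    ∑ S (λ y → ∑ τ (deviation y) * f y) ≡ m * ∑ τ (λ a → ∑ as (λ b → f (a ℤ.+ b))) - ιₙ t * ∑ as (λ a → ∑ as (λ b → f (a ℤ.+ b)))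
        transform {τ} f τ⊆ |τ| = begin
          ∑ S (λ y → ∑ τ (deviation y) * f y)
            ≡⟨ ∑-ext S (λ y → trans (cong (_* f y) (row y)) (l m (∑ τ (e y)) (ιₙ t) (g y) (f y))) ⟩
          ∑ S (λ y → m * (∑ τ (e y) * f y) - ιₙ t * (g y * f y))
            ≡⟨ trans (∑-+ S _ _) (cong₂ _+_ (∑-*ˡ S m _) (trans (∑-neg S _) (cong -_ (∑-*ˡ S (ιₙ t) _)))) ⟩
          m * ∑ S (λ y → ∑ τ (e y) * f y) - ιₙ t * ∑ S (λ y → g y * f y)
            ≡⟨ cong₂ (λ a b → m * a - ιₙ t * b) (trans (∑-ext S λ y → sym (∑-*ʳ τ (f y) _)) (trans (∑-swap S τ _) (∑-cong τ λ a a∈ → e-sum f (τ⊆ a∈)))) (g-sum f) ⟩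
          m * ∑ τ (λ a → ∑ as (λ b → f (a ℤ.+ b))) - ιₙ t * ∑ as (λ a → ∑ as (λ b → f (a ℤ.+ b))) ∎
          where
          open ≡-Reasoning
          row : ∀ y → ∑ τ (deviation y) ≡ m * ∑ τ (e y) - ιₙ t * g y
          row y = trans (∑-+ τ _ _) (cong₂ _+_ (∑-*ˡ τ m (e y)) (trans (∑-const τ (- g y)) (trans (cong (λ k → ιₙ k * (- g y)) |τ|) (sym (neg-distribʳ-* (ιₙ t) (g y))))))
          l : ∀ m e t g f → (m * e - t * g) * f ≡ m * (e * f) - t * (g * f)
          l = solve-∀ ℚ-ring

      -- The transform of a convolution is a product, so Â(r) times the error of the sampled
      -- coefficient is the transform of the deviation at `r`. The deviation is summed over S only,
      -- and Cauchy-Schwarz applies there.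
      error-bound : ∀ r {τ} → τ ∈ tuples as t → power r * error r τ ≤ n * energy τ
      error-bound r {τ} τ∈ = begin
        power r * error r τ ≡⟨ l (Fc r as) (Fs r as) m (Fc r τ) (Fs r τ) (ιₙ t) ⟩
        Dc * Dc + Ds * Ds ≡⟨ cong₂ (λ a b → a * a + b * b) (sym Dc≡) (sym Ds≡) ⟩
        ∑ S (λ y → Y y * c (r ℤ.* y)) * ∑ S (λ y → Y y * c (r ℤ.* y)) + ∑ S (λ y → Y y * s (r ℤ.* y)) * ∑ S (λ y → Y y * s (r ℤ.* y))
          ≤⟨ +-mono-≤ (cauchy-schwarz S (λ y → Y y * c (r ℤ.* y))) (cauchy-schwarz S (λ y → Y y * s (r ℤ.* y))) ⟩
        n * ∑ S (λ y → Y y * c (r ℤ.* y) * (Y y * c (r ℤ.* y))) + n * ∑ S (λ y → Y y * s (r ℤ.* y) * (Y y * s (r ℤ.* y)))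
          ≡⟨ trans (sym (*-distribˡ-+ n _ _)) (cong (n *_) (sym (∑-+ S _ _))) ⟩
        n * ∑ S (λ y → Y y * c (r ℤ.* y) * (Y y * c (r ℤ.* y)) + Y y * s (r ℤ.* y) * (Y y * s (r ℤ.* y)))
          ≡⟨ cong (n *_) (∑-ext S λ y → trans (l₂ (Y y) (c (r ℤ.* y)) (s (r ℤ.* y))) (trans (cong (Y y * Y y *_) (unit (r ℤ.* y))) (*-identityʳ _))) ⟩
        n * energy τ ∎
        where
        open ≤-Reasoning
        Y : ℤ → ℚ
        Y y = ∑ τ (deviation y)
        Dc = m * (Fc r τ * Fc r as - Fs r τ * Fs r as) - ιₙ t * (Fc r as * Fc r as - Fs r as * Fs r as)
        Ds = m * (Fs r τ * Fc r as + Fc r τ * Fs r as) - ιₙ t * (Fs r as * Fc r as + Fc r as * Fs r as)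
        Dc≡ : ∑ S (λ y → Y y * c (r ℤ.* y)) ≡ Dc
        Dc≡ = trans (transform (λ y → c (r ℤ.* y)) (tuples-elements as t τ∈) (tuples-length as t τ∈)) (cong₂ (λ a b → m * a - ιₙ t * b) (c-grid r τ) (c-grid r as))
        Ds≡ : ∑ S (λ y → Y y * s (r ℤ.* y)) ≡ Ds
        Ds≡ = trans (transform (λ y → s (r ℤ.* y)) (tuples-elements as t τ∈) (tuples-length as t τ∈)) (cong₂ (λ a b → m * a - ιₙ t * b) (s-grid r τ) (s-grid r as))
        l : ∀ x y m u v t → (x * x + y * y) * ((m * u - t * x) * (m * u - t * x) + (m * v - t * y) * (m * v - t * y)) ≡
            (m * (u * x - v * y) - t * (x * x - y * y)) * (m * (u * x - v * y) - t * (x * x - y * y)) + (m * (v * x + u * y) - t * (y * x + x * y)) * (m * (v * x + u * y) - t * (y * x + x * y))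
        l = solve-∀ ℚ-ring
        l₂ : ∀ y u v → y * u * (y * u) + y * v * (y * v) ≡ y * y * (u * u + v * v)
        l₂ = solve-∀ ℚ-ring

      module _ (n≤5m : n ≤ 5ℚ * m) where

        good-error : ∀ r {τ} → m * m ≤ 5ℚ * power r → τ ∈ tuples as t → Good τ → error r τ ≤ 50ℚ * (ιₙ t * (m * m))
        good-error r {τ} m²≤ τ∈ good = *-cancelʳ-≤ {m * m} {error r τ} {50ℚ * (ιₙ t * (m * m))} (*-pos 0<m 0<m) (begin
          error r τ * (m * m) ≤⟨ *-mono-≤ˡ (error-nonNeg r τ) m²≤ ⟩
          error r τ * (5ℚ * power r) ≡⟨ l₁ (error r τ) (power r) ⟩
          5ℚ * (power r * error r τ) ≤⟨ *-mono-≤ˡ (nonNegative⁻¹ 5ℚ) (error-bound r τ∈) ⟩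
          5ℚ * (n * energy τ) ≤⟨ *-mono-≤ˡ (nonNegative⁻¹ 5ℚ) (*-mono-≤-nonNeg (ιₙ-nonNeg (length S)) (*-nonNeg (nonNegative⁻¹ 2ℚ) (<⇒≤ 0<B)) n≤5m good) ⟩
          5ℚ * (5ℚ * m * (2ℚ * B)) ≡⟨ l₂ m (ιₙ t) ⟩
          50ℚ * (ιₙ t * (m * m)) * (m * m) ∎)
          where
          open ≤-Reasoning
          l₁ : ∀ e p → e * (5ℚ * p) ≡ 5ℚ * (p * e)
          l₁ = solve-∀ ℚ-ring
          l₂ : ∀ m t → 5ℚ * (5ℚ * m * (2ℚ * (t * (m * m * m)))) ≡ 50ℚ * (t * (m * m)) * (m * m)
          l₂ = solve-∀ ℚ-ring

        Fc-shift : ∀ r x τ → Fc r (shift x τ) ≡ Fc r τ * c (r ℤ.* x) - Fs r τ * s (r ℤ.* x)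
        Fc-shift r x τ = trans (∑-map (ℤ._+ x) τ _) (trans (∑-ext τ λ a → c-pair r a x) (trans (∑-+ τ _ _)
          (cong₂ _+_ (∑-*ʳ τ (c (r ℤ.* x)) _) (trans (∑-neg τ _) (cong -_ (∑-*ʳ τ (s (r ℤ.* x)) _))))))

        Fs-shift : ∀ r x τ → Fs r (shift x τ) ≡ Fs r τ * c (r ℤ.* x) + Fc r τ * s (r ℤ.* x)
        Fs-shift r x τ = trans (∑-map (ℤ._+ x) τ _) (trans (∑-ext τ λ a → s-pair r a x) (trans (∑-+ τ _ _)
          (cong₂ _+_ (∑-*ʳ τ (c (r ℤ.* x)) _) (∑-*ʳ τ (s (r ℤ.* x)) _))))

        -- Two good samples that are translates of each other by x make x an almost period.
        almost-period : ∀ r {τ x} → m * m ≤ 5ℚ * power r → τ ∈ tuples as t → Good τ → shift x τ ∈ tuples as t → Good (shift x τ) →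
                        κ (r ℤ.* x) * ιₙ t ≤ 4000ℚ
        almost-period r {τ} {x} m²≤ τ∈ good τ′∈ good′ = *-cancelʳ-≤ {T * (m * m)} {K * T} {4000ℚ} (*-pos 0<T (*-pos 0<m 0<m)) (begin
          K * T * (T * (m * m))
            ≤⟨ *-mono-≤ˡ (*-nonNeg 0≤K (<⇒≤ 0<T)) (*-mono-≤ˡ (<⇒≤ 0<T) m²≤) ⟩
          K * T * (T * (5ℚ * power r))
            ≡⟨ l₁ K T (power r) ⟩
          5ℚ * (K * (T * T * power r))
            ≤⟨ *-mono-≤ˡ (nonNegative⁻¹ 5ℚ) (*-mono-≤ˡ 0≤K lower) ⟩
          5ℚ * (K * (2ℚ * (m * m * (Fc r τ * Fc r τ + Fs r τ * Fs r τ)) + 2ℚ * error r τ))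
            ≡⟨ l₃ K (m * m) (Fc r τ * Fc r τ + Fs r τ * Fs r τ) (error r τ) ⟩
          5ℚ * (2ℚ * (m * m * (K * (Fc r τ * Fc r τ + Fs r τ * Fs r τ))) + K * (2ℚ * error r τ))
            ≡⟨ cong (λ z → 5ℚ * (2ℚ * (m * m * z) + K * (2ℚ * error r τ))) K|Z|² ⟩
          5ℚ * (2ℚ * (m * m * ((Zc - Fc r τ) * (Zc - Fc r τ) + (Zs - Fs r τ) * (Zs - Fs r τ))) + K * (2ℚ * error r τ))
            ≤⟨ *-mono-≤ˡ (nonNegative⁻¹ 5ℚ) (+-mono-≤ (*-mono-≤ˡ (nonNegative⁻¹ 2ℚ) Δ) (*-mono-≤ʳ {2ℚ * error r τ} {K} {4ℚ} (*-nonNeg (nonNegative⁻¹ 2ℚ) 0≤err) K≤4)) ⟩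
          5ℚ * (2ℚ * (2ℚ * error r τ + 2ℚ * error r (shift x τ)) + 4ℚ * (2ℚ * error r τ))
            ≤⟨ *-mono-≤ˡ (nonNegative⁻¹ 5ℚ) (+-mono-≤ (*-mono-≤ˡ (nonNegative⁻¹ 2ℚ) (+-mono-≤ (*-mono-≤ˡ (nonNegative⁻¹ 2ℚ) E) (*-mono-≤ˡ (nonNegative⁻¹ 2ℚ) E′))) (*-mono-≤ˡ (nonNegative⁻¹ 4ℚ) (*-mono-≤ˡ (nonNegative⁻¹ 2ℚ) E))) ⟩
          5ℚ * (2ℚ * (2ℚ * (50ℚ * (T * (m * m))) + 2ℚ * (50ℚ * (T * (m * m)))) + 4ℚ * (2ℚ * (50ℚ * (T * (m * m)))))
            ≡⟨ l₂ 50ℚ (T * (m * m)) ⟩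
          4000ℚ * (T * (m * m)) ∎)
          where
          open ≤-Reasoning
          T = ιₙ t
          K = κ (r ℤ.* x)
          0<T : 0ℚ < T
          0<T = subst (_< T) (ι-def (+ 0)) (ιₙ-mono-< 1≤t)
          0≤K : 0ℚ ≤ K
          0≤K = *-nonNeg (nonNegative⁻¹ 2ℚ) (≤⇒0≤ (c≤1 (r ℤ.* x)))
          K≤4 : K ≤ 4ℚ
          K≤4 = ≤-by (2ℚ * (c (r ℤ.* x) - - 1ℚ)) (*-nonNeg (nonNegative⁻¹ 2ℚ) (≤⇒0≤ (-1≤c (r ℤ.* x)))) (l (c (r ℤ.* x)))
            where
            l : ∀ a → 4ℚ ≡ 2ℚ * (1ℚ - a) + 2ℚ * (a - - 1ℚ)
            l = solve-∀ ℚ-ring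
          Zc = Fc r (shift x τ)
          Zs = Fs r (shift x τ)
          0≤err : 0ℚ ≤ error r τ
          0≤err = error-nonNeg r τ
          E = good-error r m²≤ τ∈ good
          E′ = good-error r m²≤ τ′∈ good′
          l₁ : ∀ K T p → K * T * (T * (5ℚ * p)) ≡ 5ℚ * (K * (T * T * p))
          l₁ = solve-∀ ℚ-ring
          l₃ : ∀ K a z e → 5ℚ * (K * (2ℚ * (a * z) + 2ℚ * e)) ≡ 5ℚ * (2ℚ * (a * (K * z)) + K * (2ℚ * e))
          l₃ = solve-∀ ℚ-ring
          l₂ : ∀ f z → 5ℚ * (2ℚ * (2ℚ * (f * z) + 2ℚ * (f * z)) + 4ℚ * (2ℚ * (f * z))) ≡ f * (5ℚ * 4ℚ * 4ℚ) * z
          l₂ = solve-∀ ℚ-ring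
          lower : T * T * power r ≤ 2ℚ * (m * m * (Fc r τ * Fc r τ + Fs r τ * Fs r τ)) + 2ℚ * error r τ
          lower = two-squares T m (Fc r as) (Fs r as) (Fc r τ) (Fs r τ)
          -- Translation by x multiplies the exponential sum by e(r x), so the squared change is the
          -- squared chord times the squared modulus.
          K|Z|² : K * (Fc r τ * Fc r τ + Fs r τ * Fs r τ) ≡ (Zc - Fc r τ) * (Zc - Fc r τ) + (Zs - Fs r τ) * (Zs - Fs r τ)
          K|Z|² = sym (trans (cong₂ (λ a b → (a - Fc r τ) * (a - Fc r τ) + (b - Fs r τ) * (b - Fs r τ)) (Fc-shift r x τ) (Fs-shift r x τ))
            (trans (l (Fc r τ) (Fs r τ) (c (r ℤ.* x)) (s (r ℤ.* x))) (trans (cong (λ z → (z - 1ℚ + 2ℚ * (1ℚ - c (r ℤ.* x))) * (Fc r τ * Fc r τ + Fs r τ * Fs r τ)) (unit (r ℤ.* x)))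
              (l′ (Fc r τ * Fc r τ + Fs r τ * Fs r τ) (c (r ℤ.* x))))))
            where
            l : ∀ u v a b → (u * a - v * b - u) * (u * a - v * b - u) + (v * a + u * b - v) * (v * a + u * b - v) ≡ (a * a + b * b - 1ℚ + 2ℚ * (1ℚ - a)) * (u * u + v * v)
            l = solve-∀ ℚ-ring
            l′ : ∀ z a → (1ℚ - 1ℚ + 2ℚ * (1ℚ - a)) * z ≡ 2ℚ * (1ℚ - a) * z
            l′ = solve-∀ ℚ-ring
          Δ : m * m * ((Zc - Fc r τ) * (Zc - Fc r τ) + (Zs - Fs r τ) * (Zs - Fs r τ)) ≤ 2ℚ * error r τ + 2ℚ * error r (shift x τ)
          Δ = two-differences m T (Fc r as) (Fs r as) (Fc r τ) (Fs r τ) Zc Zs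

        open import Data.List.Membership.DecPropositional (≡-dec ℤ._≟_) using (_∈?_)

        Centre : List ℤ → ℤ → Set
        Centre σ a = shift (ℤ.- a) σ ∈ tuples as t × Good (shift (ℤ.- a) σ)

        centre? : ∀ σ a → Dec (Centre σ a)
        centre? σ a = (shift (ℤ.- a) σ ∈? tuples as t) ×-dec good? (shift (ℤ.- a) σ)

        private
          shift-shift : ∀ x y τ → shift x (shift y τ) ≡ shift (y ℤ.+ x) τ
          shift-shift x y [] = refl
          shift-shift x y (z ∷ τ) = cong₂ _∷_ (ℤ.+-assoc z y x) (shift-shift x y τ)

          shift-0 : ∀ τ → shift (+ 0) τ ≡ τ
          shift-0 [] = refl
          shift-0 (z ∷ τ) = cong₂ _∷_ (ℤ.+-identityʳ z) (shift-0 τ)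

          unshift : ∀ {a σ τ} → shift a τ ≡ σ → τ ≡ shift (ℤ.- a) σ
          unshift {a} {σ} {τ} eq = sym (trans (cong (shift (ℤ.- a)) (sym eq)) (trans (shift-shift (ℤ.- a) a τ) (trans (cong (λ z → shift z τ) (ℤ.+-inverseʳ a)) (shift-0 τ))))

        -- Pairs of an element a of A₀ and a good sample τ are sorted by the translate τ + a, which
        -- lies in the t-th power of S and so takes at most (5m)^t values. A popular value σ comes
        -- from many a, and for two of them σ - a and σ - a′ are good samples that are translates of
        -- each other.
        cluster : ∀ A₀ → Unique A₀ → (∀ {a} → a ∈ A₀ → a ∈ as) → 1 ℕ.≤ length S →
                  ∃[ T₀ ] (Unique T₀ × (∀ {a} → a ∈ T₀ → a ∈ A₀) × ιₙ (length A₀) ≤ 2ℚ * 5ℚ ^ t * ιₙ (length T₀) ×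
                    (∀ {a a′} r → a ∈ T₀ → a′ ∈ T₀ → m * m ≤ 5ℚ * power r → κ (r ℤ.* (a ℤ.- a′)) * ιₙ t ≤ 4000ℚ))
        cluster A₀ u-A₀ A₀⊆ S-nonempty = T₀ , Unique.filter⁺ (centre? σ) u-A₀ , (λ a∈ → proj₁ (∈-filter⁻ (centre? σ) {xs = A₀} a∈)) , count , close
          where
          open ≤-Reasoning
          _≟ᴸ_ = ≡-dec ℤ._≟_
          weight : List ℤ → ℤ → ℚ
          weight σ a = ∑ (tuples as t) (λ τ → [ good? τ ?] * [ shift a τ ≟ᴸ σ ?])
          G = ∑ (tuples as t) (λ τ → [ good? τ ?])
          total : ιₙ (length A₀) * G ≤ ∑ (tuples S t) (λ σ → ∑ A₀ (weight σ))
          total = begin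
            ιₙ (length A₀) * G ≡⟨ ∑-const A₀ G ⟨
            ∑ A₀ (λ a → G) ≤⟨ ∑-mono A₀ (λ a a∈ → ∑-mono (tuples as t) λ τ τ∈ → hit a a∈ τ τ∈) ⟩
            ∑ A₀ (λ a → ∑ (tuples as t) (λ τ → ∑ (tuples S t) (λ σ → [ good? τ ?] * [ shift a τ ≟ᴸ σ ?])))
                                                                        ≡⟨ ∑-ext A₀ (λ a → ∑-swap (tuples as t) (tuples S t) _) ⟩
            ∑ A₀ (λ a → ∑ (tuples S t) (λ σ → weight σ a)) ≡⟨ ∑-swap A₀ (tuples S t) _ ⟩
            ∑ (tuples S t) (λ σ → ∑ A₀ (weight σ)) ∎
            where
            hit : ∀ a → a ∈ A₀ → ∀ τ → τ ∈ tuples as t → [ good? τ ?] ≤ ∑ (tuples S t) (λ σ → [ good? τ ?] * [ shift a τ ≟ᴸ σ ?])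
            hit a a∈ τ τ∈ = ≤-reflexive (sym (trans (∑-ext (tuples S t) λ σ → *-comm [ good? τ ?] [ shift a τ ≟ᴸ σ ?])
              (∑-δ _≟ᴸ_ (λ _ → [ good? τ ?]) (tuples-unique t u-S) (shift-tuples t τ∈ (A₀⊆ a∈)))))
          tuples-nonempty : ∀ t → 1 ℕ.≤ length (tuples S t)
          tuples-nonempty t = ι-pos (subst (0ℚ <_) (sym (tuples-count S t)) (^-pos t (subst (_< n) (ι-def (+ 0)) (ιₙ-mono-< S-nonempty))))
            where
            ι-pos : ∀ {k} → 0ℚ < ιₙ k → 1 ℕ.≤ k
            ι-pos {zero} p = contradiction (≤-reflexive (ι-def (+ 0))) (<⇒≱ p)
            ι-pos {suc k} p = ℕ.s≤s ℕ.z≤n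
          rich = average-≥ (tuples S t) (λ σ → ∑ A₀ (weight σ)) (tuples-nonempty t) total
          σ = proj₁ rich
          T₀ = filter (centre? σ) A₀
          weight≤ : ∀ a → weight σ a ≤ [ centre? σ a ?]
          weight≤ a = case (centre? σ a)
            where
            case : (d : Dec (Centre σ a)) → weight σ a ≤ [ d ?]
            case (yes _) = ≤-trans (∑-mono (tuples as t) λ τ _ → ≤-trans (*-mono-≤ʳ {[ shift a τ ≟ᴸ σ ?]} {[ good? τ ?]} {1ℚ} ([?]-nonNeg (shift a τ ≟ᴸ σ)) ([?]-≤1 (good? τ)))
                (≤-trans (≤-reflexive (*-identityˡ _)) ([?]-mono (shift a τ ≟ᴸ σ) (shift (ℤ.- a) σ ≟ᴸ τ) λ eq → sym (unshift {a} eq))))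
              (∑-δ-≤1 _≟ᴸ_ (shift (ℤ.- a) σ) (tuples-unique t u-as))
            case (no ¬p) = ≤-reflexive (trans (∑-cong (tuples as t) λ τ τ∈ → none τ τ∈ (good? τ)) (∑-0 (tuples as t)))
              where
              none : ∀ τ → τ ∈ tuples as t → (d : Dec (Good τ)) → [ d ?] * [ shift a τ ≟ᴸ σ ?] ≡ 0ℚ
              none τ τ∈ (no _) = *-zeroˡ [ shift a τ ≟ᴸ σ ?]
              none τ τ∈ (yes p) = trans (*-identityˡ [ shift a τ ≟ᴸ σ ?]) ([?]-no (shift a τ ≟ᴸ σ) λ eq → ¬p (subst (λ z → z ∈ tuples as t × Good z) (unshift {a} eq) (τ∈ , p)))
          count : ιₙ (length A₀) ≤ 2ℚ * 5ℚ ^ t * ιₙ (length T₀)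
          count = *-cancelʳ-≤ {m ^ t} {ιₙ (length A₀)} {2ℚ * 5ℚ ^ t * ιₙ (length T₀)} (^-pos t 0<m) (begin
            ιₙ (length A₀) * m ^ t ≤⟨ *-mono-≤ˡ (ιₙ-nonNeg (length A₀)) many-good ⟩
            ιₙ (length A₀) * (2ℚ * G) ≡⟨ l₁ (ιₙ (length A₀)) G ⟩
            2ℚ * (ιₙ (length A₀) * G) ≤⟨ *-mono-≤ˡ (nonNegative⁻¹ 2ℚ) (proj₂ (proj₂ rich)) ⟩
            2ℚ * (ιₙ (length (tuples S t)) * ∑ A₀ (weight σ)) ≤⟨ *-mono-≤ˡ (nonNegative⁻¹ 2ℚ) (*-mono-≤-nonNeg (ιₙ-nonNeg (length (tuples S t))) (ιₙ-nonNeg (length T₀))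
                                                                     (≤-trans (≤-reflexive (tuples-count S t)) (^-mono t)) (≤-trans (∑-mono A₀ λ a _ → weight≤ a) (≤-reflexive (sym (length-filter-∑ (centre? σ) A₀))))) ⟩
            2ℚ * ((5ℚ * m) ^ t * ιₙ (length T₀)) ≡⟨ cong (λ z → 2ℚ * (z * ιₙ (length T₀))) (^-distrib t) ⟩
            2ℚ * (5ℚ ^ t * m ^ t * ιₙ (length T₀)) ≡⟨ l₂ (5ℚ ^ t) (m ^ t) (ιₙ (length T₀)) ⟩
            2ℚ * 5ℚ ^ t * ιₙ (length T₀) * m ^ t ∎)
            where
            l₁ : ∀ a g → a * (2ℚ * g) ≡ 2ℚ * (a * g)
            l₁ = solve-∀ ℚ-ring
            l₂ : ∀ a b c → 2ℚ * (a * b * c) ≡ 2ℚ * a * c * b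
            l₂ = solve-∀ ℚ-ring
            ^-mono : ∀ k → n ^ k ≤ (5ℚ * m) ^ k
            ^-mono zero = ≤-refl
            ^-mono (suc k) = *-mono-≤-nonNeg (ιₙ-nonNeg (length S)) (^-nonNeg k (*-nonNeg (nonNegative⁻¹ 5ℚ) (<⇒≤ 0<m))) n≤5m (^-mono k)
            ^-distrib : ∀ k → (5ℚ * m) ^ k ≡ 5ℚ ^ k * m ^ k
            ^-distrib zero = refl
            ^-distrib (suc k) = trans (cong (5ℚ * m *_) (^-distrib k)) (l m (5ℚ ^ k) (m ^ k))
              where
              l : ∀ m a b → 5ℚ * m * (a * b) ≡ 5ℚ * a * (m * b)
              l = solve-∀ ℚ-ring
          close : ∀ {a a′} r → a ∈ T₀ → a′ ∈ T₀ → m * m ≤ 5ℚ * power r → κ (r ℤ.* (a ℤ.- a′)) * ιₙ t ≤ 4000ℚ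
          close {a} {a′} r a∈ a′∈ m²≤ = almost-period r m²≤ (proj₁ C) (proj₂ C) (subst (_∈ tuples as t) (sym τ′≡) (proj₁ C′)) (subst Good (sym τ′≡) (proj₂ C′))
            where
            C = proj₂ (∈-filter⁻ (centre? σ) {xs = A₀} a∈)
            C′ = proj₂ (∈-filter⁻ (centre? σ) {xs = A₀} a′∈)
            τ′≡ : shift (a ℤ.- a′) (shift (ℤ.- a) σ) ≡ shift (ℤ.- a′) σ
            τ′≡ = trans (shift-shift (a ℤ.- a′) (ℤ.- a) σ) (cong (λ z → shift z σ) (l a a′))
              where
              l : ∀ a b → ℤ.- a ℤ.+ (a ℤ.- b) ≡ ℤ.- b
              l = ℤ-Solver.solve-∀

-- Successive minima in a Bohr set

module Lattice where

  open import Data.Integer.Base as ℤ using (ℤ; +_; -[1+_]; 0ℤ)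
  open import Data.Integer.Base using (_+_; _*_; _-_; -_; ∣_∣)
  open import Data.Integer.DivMod using (_/_; _%_; a≡a%n+[a/n]*n; n%d<d)
  open import Data.Nat.Base using (_≤_; _<_; _⊔_; z≤n; s≤s)
  open Residue

  maxOver : ∀ {A : Set} → List A → (A → ℕ) → ℕ
  maxOver [] f = 0
  maxOver (x ∷ xs) f = f x ⊔ maxOver xs f

  module _ {A : Set} {f : A → ℕ} where

    ≤-maxOver : ∀ {xs x} → x ∈ xs → f x ≤ maxOver xs f
    ≤-maxOver (here refl) = ℕ.m≤m⊔n _ _
    ≤-maxOver {y ∷ ys} (there x∈) = ℕ.≤-trans (≤-maxOver x∈) (ℕ.m≤n⊔m (f y) _)

    maxOver-≤ : ∀ xs {k K} → (∀ {x} → x ∈ xs → k ℕ.* f x ≤ K) → k ℕ.* maxOver xs f ≤ K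
    maxOver-≤ [] {k} {K} h = subst (_≤ K) (sym (ℕ.*-zeroʳ k)) z≤n
    maxOver-≤ (x ∷ xs) {k} {K} h = subst (_≤ K) (sym (ℕ.*-distribˡ-⊔ k (f x) (maxOver xs f))) (ℕ.⊔-lub (h (here refl)) (maxOver-≤ xs {k} λ p → h (there p)))

    maxOver-< : ∀ xs {K} → 0 < K → (∀ {x} → x ∈ xs → f x < K) → maxOver xs f < K
    maxOver-< [] 0<K h = 0<K
    maxOver-< (x ∷ xs) 0<K h = ℕ.⊔-pres-<m (h (here refl)) (maxOver-< xs 0<K λ p → h (there p))

  minimal : ∀ {A : Set} (f : A → ℕ) (xs : List A) → xs ≡ [] ⊎ ∃[ m ] (m ∈ xs × ∀ {x} → x ∈ xs → f m ≤ f x)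
  minimal f [] = inj₁ refl
  minimal f (x ∷ xs) with minimal f xs
  ... | inj₁ refl = inj₂ (x , here refl , λ { (here refl) → ℕ.≤-refl })
  ... | inj₂ (m , m∈ , m≤) with ℕ.≤-total (f x) (f m)
  ... | inj₁ x≤m = inj₂ (x , here refl , λ { (here refl) → ℕ.≤-refl ; (there p) → ℕ.≤-trans x≤m (m≤ p) })
  ... | inj₂ m≤x = inj₂ (m , there m∈ , λ { (here refl) → m≤x ; (there p) → m≤ p })

  ∣*∣≤ : ∀ k z u v → k * z ≡ u + v → ∣ k ∣ ℕ.* ∣ z ∣ ≤ ∣ u ∣ ℕ.+ ∣ v ∣
  ∣*∣≤ k z u v eq = subst (_≤ ∣ u ∣ ℕ.+ ∣ v ∣) (trans (cong ∣_∣ (sym eq)) (ℤ.abs-* k z)) (ℤ.∣i+j∣≤∣i∣+∣j∣ u v)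

  ∣∣-pos : ∀ {i} → i ≢ 0ℤ → 0 < ∣ i ∣
  ∣∣-pos {+ zero} ne = contradiction refl ne
  ∣∣-pos {+ suc _} ne = s≤s z≤n
  ∣∣-pos { -[1+ _ ]} ne = s≤s z≤n

  interval : ℕ → List ℤ
  interval n = map (λ k → + k - + n) (downFrom (suc (n ℕ.+ n)))

  ∈-interval : ∀ {n x} → ∣ x ∣ ≤ n → x ∈ interval n
  ∈-interval {n} {x} x≤ = subst (_∈ interval n) eq (∈-map⁺ (λ k → + k - + n) (∈-downFrom⁺ {i = ∣ x + + n ∣} (s≤s (ℕ.≤-trans (ℤ.∣i+j∣≤∣i∣+∣j∣ x (+ n)) (ℕ.+-monoˡ-≤ n x≤)))))
    where
    l : ∀ a b → a + b - b ≡ a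
    l = ℤ-Solver.solve-∀
    0≤ : 0ℤ ℤ.≤ x + + n
    0≤ = subst (ℤ._≤ x + + n) (ℤ.+-inverseˡ (+ n)) (ℤ.+-monoˡ-≤ (+ n) (-≤ x x≤))
      where
      -≤ : ∀ x → ∣ x ∣ ≤ n → - + n ℤ.≤ x
      -≤ (+ k) p = ℤ.≤-trans ℤ.neg-≤-pos (ℤ.+≤+ z≤n)
      -≤ -[1+ k ] p = ℤ.neg-mono-≤ (ℤ.+≤+ p)
    eq : + ∣ x + + n ∣ - + n ≡ x
    eq = trans (cong (_- + n) (ℤ.0≤i⇒+∣i∣≡i 0≤)) (l x (+ n))

  -- The phases φ r x alone do not bound the integer x. The field `ball` tolerates |x| ≤ 2W and
  -- yields `Good`, which gives back |x| ≤ W; this self-improvement keeps sums of short vectors in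
  -- bounds.
  record Setup : Set₁ where
    field
      N : ℕ
      φ : ℤ → ℤ → ℤ
      φ-mod : ∀ r x → φ r x ≡ r * x [mod N ]
      φ-unique : ∀ r x {y} → y ≡ r * x [mod N ] → 2 ℕ.* ∣ y ∣ < N → φ r x ≡ y
      frequencies : List ℤ
      W R₁ R₀ : ℕ
      R₀-large : 20 ℕ.* R₁ ≤ R₀
      N-large : 4 ℕ.* R₀ < N
      Good : ℤ → Set
      Good-bounded : ∀ {x} → Good x → ∣ x ∣ ≤ W
      ball : ∀ x → ∣ x ∣ ≤ 2 ℕ.* W → (∀ {r} → r ∈ frequencies → ∣ φ r x ∣ ≤ R₀) → Good x

  module Minima (setup : Setup) where
    open Setup setup

    -- Centred residues are linear as long as the combination does not wrap around modulo `N`.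
    φ-combine : ∀ r a x b y → 2 ℕ.* ∣ a * φ r x + b * φ r y ∣ < N → φ r (a * x + b * y) ≡ a * φ r x + b * φ r y
    φ-combine r a x b y = φ-unique r (a * x + b * y) (mod-trans (mod-+ (mod-*ˡ a (φ-mod r x)) (mod-*ˡ b (φ-mod r y))) (mod-≡ (l r a x b y)))
      where
      l : ∀ r a x b y → a * (r * x) + b * (r * y) ≡ r * (a * x + b * y)
      l = ℤ-Solver.solve-∀

    2R₀<N : ∀ {k} → k ≤ 2 ℕ.* R₀ → 2 ℕ.* k < N
    2R₀<N {k} k≤ = ℕ.≤-<-trans (ℕ.*-monoʳ-≤ 2 k≤) (subst (_< N) (l R₀) N-large)
      where
      l : ∀ a → 4 ℕ.* a ≡ 2 ℕ.* (2 ℕ.* a)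
      l = ℕ-Solver.solve-∀

    Small : ℤ → Set
    Small x = ∣ x ∣ ≤ 2 ℕ.* W × All (λ r → ∣ φ r x ∣ ≤ R₁) frequencies

    small? : ∀ x → Dec (Small x)
    small? x = (∣ x ∣ ℕ.≤? 2 ℕ.* W) ×-dec all? (λ r → ∣ φ r x ∣ ℕ.≤? R₁) frequencies

    φ-small : ∀ {x r} → Small x → r ∈ frequencies → ∣ φ r x ∣ ≤ R₁
    φ-small (_ , small) = All.lookup small

    R₁≤R₀ : R₁ ≤ R₀
    R₁≤R₀ = ℕ.≤-trans (ℕ.m≤m+n R₁ _) R₀-large

    small-good : ∀ {x} → Small x → Good x
    small-good {x} s = ball x (proj₁ s) λ r∈ → ℕ.≤-trans (φ-small s r∈) R₁≤R₀

    small-bounded : ∀ {x} → Small x → ∣ x ∣ ≤ W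
    small-bounded s = Good-bounded (small-good s)

    φ-0 : ∀ r → φ r 0ℤ ≡ 0ℤ
    φ-0 r = φ-unique r 0ℤ (mod-≡ (sym (ℤ.*-zeroʳ r))) (2R₀<N z≤n)

    small-0 : Small 0ℤ
    small-0 = z≤n , All.tabulate λ {r} _ → subst (λ z → ∣ z ∣ ≤ R₁) (sym (φ-0 r)) z≤n

    points nonzero : List ℤ
    points = filter small? (interval (2 ℕ.* W))
    nonzero = filter (λ x → ¬? (x ℤ.≟ 0ℤ)) points

    ∈-points : ∀ {x} → Small x → x ∈ points
    ∈-points s = ∈-filter⁺ small? (∈-interval (proj₁ s)) s

    points-small : ∀ {x} → x ∈ points → Small x
    points-small x∈ = proj₂ (∈-filter⁻ small? {xs = interval (2 ℕ.* W)} x∈)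

    ∈-nonzero : ∀ {x} → Small x → x ≢ 0ℤ → x ∈ nonzero
    ∈-nonzero s x≢0 = ∈-filter⁺ (λ x → ¬? (x ℤ.≟ 0ℤ)) (∈-points s) x≢0

    nonzero-small : ∀ {x} → x ∈ nonzero → Small x × x ≢ 0ℤ
    nonzero-small x∈ = let p , x≢0 = ∈-filter⁻ (λ x → ¬? (x ℤ.≟ 0ℤ)) {xs = points} x∈ in points-small p , x≢0

    -- The coordinate x itself is left out, so minima are measured by phases alone; `norm-pos` shows
    -- that nothing nonzero is lost.
    norm : ℤ → ℕ
    norm x = maxOver frequencies (λ r → ∣ φ r x ∣)

    norm≤R₁ : ∀ {x} → Small x → norm x ≤ R₁
    norm≤R₁ s = subst (_≤ R₁) (ℕ.*-identityˡ _) (maxOver-≤ frequencies {k = 1} λ r∈ → subst (_≤ R₁) (sym (ℕ.*-identityˡ _)) (φ-small s r∈))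

    small-by-norm : ∀ {x} → ∣ x ∣ ≤ 2 ℕ.* W → norm x ≤ R₁ → Small x
    small-by-norm x≤ n≤ = x≤ , All.tabulate λ r∈ → ℕ.≤-trans (≤-maxOver r∈) n≤

    -- All combinations of two short vectors stay in the ball, by adding one vector at a time.
    module Combinations (v₁ v₂ : ℤ) (s₁ : Small v₁) (s₂ : Small v₂) (M₁ M₂ : ℕ)
                        (M≤ : ∀ {r} → r ∈ frequencies → M₁ ℕ.* ∣ φ r v₁ ∣ ℕ.+ M₂ ℕ.* ∣ φ r v₂ ∣ ≤ R₀) where

      coordinate≤ : ∀ {r a b} → r ∈ frequencies → ∣ a ∣ ≤ M₁ → ∣ b ∣ ≤ M₂ → ∣ a * φ r v₁ + b * φ r v₂ ∣ ≤ R₀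
      coordinate≤ {r} {a} {b} r∈ a≤ b≤ = ℕ.≤-trans (ℤ.∣i+j∣≤∣i∣+∣j∣ (a * φ r v₁) (b * φ r v₂))
        (ℕ.≤-trans (ℕ.+-mono-≤ (ℕ.≤-trans (ℕ.≤-reflexive (ℤ.abs-* a (φ r v₁))) (ℕ.*-monoˡ-≤ ∣ φ r v₁ ∣ a≤))
          (ℕ.≤-trans (ℕ.≤-reflexive (ℤ.abs-* b (φ r v₂))) (ℕ.*-monoˡ-≤ ∣ φ r v₂ ∣ b≤))) (M≤ r∈))

      φ-combination : ∀ {r a b} → r ∈ frequencies → ∣ a ∣ ≤ M₁ → ∣ b ∣ ≤ M₂ → φ r (a * v₁ + b * v₂) ≡ a * φ r v₁ + b * φ r v₂
      φ-combination {r} {a} {b} r∈ a≤ b≤ = φ-combine r a v₁ b v₂ (2R₀<N (ℕ.≤-trans (coordinate≤ {r} {a} {b} r∈ a≤ b≤) (ℕ.m≤m+n R₀ _)))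

      step : ∀ a b → ∣ a ∣ ≤ M₁ → ∣ b ∣ ≤ M₂ → ∣ a * v₁ + b * v₂ ∣ ≤ 2 ℕ.* W → Good (a * v₁ + b * v₂)
      step a b a≤ b≤ x≤ = ball _ x≤ λ {r} r∈ → subst (λ z → ∣ z ∣ ≤ R₀) (sym (φ-combination {r} {a} {b} r∈ a≤ b≤)) (coordinate≤ {r} {a} {b} r∈ a≤ b≤)

      private
        near : ∀ x y v → x ≡ y + v → ∣ y ∣ ≤ W → ∣ v ∣ ≤ W → ∣ x ∣ ≤ 2 ℕ.* W
        near _ y v refl y≤ v≤ = ℕ.≤-trans (ℤ.∣i+j∣≤∣i∣+∣j∣ y v) (ℕ.≤-trans (ℕ.+-mono-≤ y≤ v≤) (ℕ.≤-reflexive (cong (W ℕ.+_) (sym (ℕ.+-identityʳ W)))))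

        ∣-∣≤W : ∀ {v} → ∣ v ∣ ≤ W → ∣ - v ∣ ≤ W
        ∣-∣≤W {v} = subst (_≤ W) (sym (ℤ.∣-i∣≡∣i∣ v))

        multiples : ∀ k → k ≤ M₁ → Good (+ k * v₁ + 0ℤ * v₂) × Good (- + k * v₁ + 0ℤ * v₂)
        multiples zero _ = step 0ℤ 0ℤ z≤n z≤n z≤n , step 0ℤ 0ℤ z≤n z≤n z≤n
        multiples (suc k) k≤ = let p , q = multiples k (ℕ.<⇒≤ k≤) in
          step (+ suc k) 0ℤ k≤ z≤n (near _ (+ k * v₁ + 0ℤ * v₂) v₁ (l (+ k) v₁ v₂) (Good-bounded p) (small-bounded s₁)) ,
          step (- + suc k) 0ℤ k≤ z≤n (near _ (- + k * v₁ + 0ℤ * v₂) (- v₁) (l′ (+ k) v₁ v₂) (Good-bounded q) (∣-∣≤W {v₁} (small-bounded s₁)))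
          where
          l : ∀ k v w → (+ 1 + k) * v + 0ℤ * w ≡ k * v + 0ℤ * w + v
          l = ℤ-Solver.solve-∀
          l′ : ∀ k v w → - (+ 1 + k) * v + 0ℤ * w ≡ - k * v + 0ℤ * w + - v
          l′ = ℤ-Solver.solve-∀

        rows : ∀ a → ∣ a ∣ ≤ M₁ → Good (a * v₁ + 0ℤ * v₂) → ∀ k → k ≤ M₂ → Good (a * v₁ + + k * v₂) × Good (a * v₁ + - + k * v₂)
        rows a a≤ g zero _ = g , g
        rows a a≤ g (suc k) k≤ = let p , q = rows a a≤ g k (ℕ.<⇒≤ k≤) in
          step a (+ suc k) a≤ k≤ (near _ (a * v₁ + + k * v₂) v₂ (l a (+ k) v₁ v₂) (Good-bounded p) (small-bounded s₂)) ,
          step a (- + suc k) a≤ k≤ (near _ (a * v₁ + - + k * v₂) (- v₂) (l′ a (+ k) v₁ v₂) (Good-bounded q) (∣-∣≤W {v₂} (small-bounded s₂)))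
          where
          l : ∀ a k v w → a * v + (+ 1 + k) * w ≡ a * v + k * w + w
          l = ℤ-Solver.solve-∀
          l′ : ∀ a k v w → a * v + - (+ 1 + k) * w ≡ a * v + - k * w + - w
          l′ = ℤ-Solver.solve-∀

        signed : ∀ (P : ℤ → Set) a → P (+ ∣ a ∣) × P (- + ∣ a ∣) → P a
        signed P (+ n) (p , _) = p
        signed P -[1+ n ] (_ , p) = p

      combination : ∀ a b → ∣ a ∣ ≤ M₁ → ∣ b ∣ ≤ M₂ → Good (a * v₁ + b * v₂)
      combination a b a≤ b≤ = signed (λ b → Good (a * v₁ + b * v₂)) b
        (rows a a≤ (signed (λ a → Good (a * v₁ + 0ℤ * v₂)) a (multiples ∣ a ∣ a≤)) ∣ b ∣ b≤)

    -- If all phases of v vanished, every multiple of v would stay in the ball, including (W + 1) v,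
    -- which is too large to be `Good`.
    norm-pos : ∀ {v} → Small v → v ≢ 0ℤ → 0 < norm v
    norm-pos {v} s v≢0 with norm v in eq
    ... | suc _ = s≤s z≤n
    ... | zero = contradiction (Good-bounded (combination (+ suc W) 0ℤ ℕ.≤-refl z≤n)) (ℕ.<⇒≱ (ℕ.<-≤-trans (ℕ.n<1+n W) big))
      where
      vanishing : ∀ {r} → r ∈ frequencies → ∣ φ r v ∣ ≡ 0
      vanishing {r} r∈ = ℕ.n≤0⇒n≡0 (subst (∣ φ r v ∣ ≤_) eq (≤-maxOver r∈))
      open Combinations v v s s (suc W) 0 (λ {r} r∈ → subst (_≤ R₀) (sym (trans (ℕ.+-identityʳ _) (trans (cong (suc W ℕ.*_) (vanishing r∈)) (ℕ.*-zeroʳ (suc W))))) z≤n)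
      big : suc W ≤ ∣ + suc W * v + 0ℤ * v ∣
      big = subst (suc W ≤_) (sym (trans (cong ∣_∣ (ℤ.+-identityʳ (+ suc W * v))) (ℤ.abs-* (+ suc W) v))) (ℕ.m≤m*n (suc W) ∣ v ∣ {{ℕ.>-nonZero (∣∣-pos v≢0)}})

    -- The size is recorded by the injection `f` of the small points into the progression; no
    -- cardinality has to be computed.
    record Progression : Set where
      field
        a₀ v₁ v₂ : ℤ
        L₁ L₂ : ℕ
        1≤L₁ : 1 ≤ L₁
        1≤L₂ : 1 ≤ L₂
        good : ∀ l₁ l₂ → + 1 ℤ.≤ l₁ → l₁ ℤ.≤ + L₁ → + 1 ℤ.≤ l₂ → l₂ ℤ.≤ + L₂ → Good (a₀ + (l₁ * v₁ + l₂ * v₂))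
        f : ℤ → ℤ
        into : ∀ x → Small x → ∃[ l₁ ] ∃[ l₂ ] ((+ 1 ℤ.≤ l₁ × l₁ ℤ.≤ + L₁) × (+ 1 ℤ.≤ l₂ × l₂ ℤ.≤ + L₂) × f x ≡ a₀ + (l₁ * v₁ + l₂ * v₂))
        injective : ∀ x y → Small x → Small y → f x ≡ f y → x ≡ y

    private
      ∣∣≤⁻ : ∀ {i n} → ∣ i ∣ ≤ n → - + n ℤ.≤ i × i ℤ.≤ + n
      ∣∣≤⁻ {+ k} p = ℤ.≤-trans ℤ.neg-≤-pos (ℤ.+≤+ z≤n) , ℤ.+≤+ p
      ∣∣≤⁻ { -[1+ k ]} p = ℤ.neg-mono-≤ (ℤ.+≤+ p) , ℤ.-≤+

      ≤⇒∣∣≤ : ∀ {i n} → - + n ℤ.≤ i → i ℤ.≤ + n → ∣ i ∣ ≤ n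
      ≤⇒∣∣≤ {+ k} _ q = ℤ.drop‿+≤+ q
      ≤⇒∣∣≤ { -[1+ k ]} {n} p _ = ℤ.drop‿+≤+ (subst (+ suc k ℤ.≤_) (ℤ.neg-involutive (+ n)) (ℤ.neg-mono-≤ p))

      shift-up : ∀ {m M} → ∣ m ∣ ≤ M → + 1 ℤ.≤ m + + suc M × m + + suc M ℤ.≤ + (2 ℕ.* M ℕ.+ 1)
      shift-up {m} {M} p = subst (ℤ._≤ m + + suc M) (l (+ M)) (ℤ.+-monoˡ-≤ (+ suc M) (proj₁ (∣∣≤⁻ {m} p))) ,
        ℤ.≤-trans (ℤ.+-monoˡ-≤ (+ suc M) (proj₂ (∣∣≤⁻ {m} p))) (ℤ.≤-reflexive (cong +_ (l′ M)))
        where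
        l : ∀ M → - M + (+ 1 + M) ≡ + 1
        l = ℤ-Solver.solve-∀
        l′ : ∀ M → M ℕ.+ suc M ≡ 2 ℕ.* M ℕ.+ 1
        l′ = ℕ-Solver.solve-∀

      shift-down : ∀ {l M} → + 1 ℤ.≤ l → l ℤ.≤ + (2 ℕ.* M ℕ.+ 1) → ∣ l - + suc M ∣ ≤ M
      shift-down {l} {M} p q = ≤⇒∣∣≤ (subst (ℤ._≤ l - + suc M) (e (+ M)) (ℤ.+-monoˡ-≤ (- + suc M) p))
        (ℤ.≤-trans (ℤ.+-monoˡ-≤ (- + suc M) q) (ℤ.≤-reflexive (trans (cong (_- + suc M) (trans (cong +_ (l′ M)) refl)) (e′ (+ M)))))
        where
        e : ∀ M → + 1 - (+ 1 + M) ≡ - M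
        e = ℤ-Solver.solve-∀
        e′ : ∀ M → M + (+ 1 + M) - (+ 1 + M) ≡ M
        e′ = ℤ-Solver.solve-∀
        l′ : ∀ M → 2 ℕ.* M ℕ.+ 1 ≡ M ℕ.+ suc M
        l′ = ℕ-Solver.solve-∀

    module Build (v₁ v₂ : ℤ) (s₁ : Small v₁) (s₂ : Small v₂) (M₁ M₂ : ℕ)
                 (M≤ : ∀ {r} → r ∈ frequencies → M₁ ℕ.* ∣ φ r v₁ ∣ ℕ.+ M₂ ℕ.* ∣ φ r v₂ ∣ ≤ R₀)
                 (m₁ m₂ : ℤ → ℤ) (m₁≤ : ∀ {x} → Small x → ∣ m₁ x ∣ ≤ M₁) (m₂≤ : ∀ {x} → Small x → ∣ m₂ x ∣ ≤ M₂)
                 (inj : ∀ x y → Small x → Small y → m₁ x * v₁ + m₂ x * v₂ ≡ m₁ y * v₁ + m₂ y * v₂ → x ≡ y) where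
      open Combinations v₁ v₂ s₁ s₂ M₁ M₂ M≤

      -- Moves the coefficients from the symmetric range [-M, M] to [1, 2M + 1].
      a₀ : ℤ
      a₀ = - (+ suc M₁ * v₁ + + suc M₂ * v₂)

      result : Progression
      result = record
        { a₀ = a₀ ; v₁ = v₁ ; v₂ = v₂ ; L₁ = 2 ℕ.* M₁ ℕ.+ 1 ; L₂ = 2 ℕ.* M₂ ℕ.+ 1
        ; 1≤L₁ = ℕ.m≤n+m 1 (2 ℕ.* M₁) ; 1≤L₂ = ℕ.m≤n+m 1 (2 ℕ.* M₂)
        ; good = λ l₁ l₂ p₁ q₁ p₂ q₂ → subst Good (down l₁ l₂ (+ suc M₁) (+ suc M₂) v₁ v₂)
            (combination (l₁ - + suc M₁) (l₂ - + suc M₂) (shift-down p₁ q₁) (shift-down p₂ q₂))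
        ; f = λ x → m₁ x * v₁ + m₂ x * v₂
        ; into = λ x s → m₁ x + + suc M₁ , m₂ x + + suc M₂ , shift-up {m₁ x} (m₁≤ s) , shift-up {m₂ x} (m₂≤ s) , up (m₁ x) (m₂ x) (+ suc M₁) (+ suc M₂) v₁ v₂
        ; injective = inj }
        where
        down : ∀ l₁ l₂ a b v w → (l₁ - a) * v + (l₂ - b) * w ≡ - (a * v + b * w) + (l₁ * v + l₂ * w)
        down = ℤ-Solver.solve-∀
        up : ∀ m n a b v w → m * v + n * w ≡ - (a * v + b * w) + ((m + a) * v + (n + b) * w)
        up = ℤ-Solver.solve-∀

    -- Determinants of the vectors (x, φ r x) and, in `det₃`, of (x, φ r x, φ s x).
    det : ℤ → ℤ → ℤ → ℤ
    det r x y = x * φ r y - y * φ r x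

    det₃ : ℤ → ℤ → ℤ → ℤ → ℤ → ℤ
    det₃ r s x y z = det r x y * φ s z + det r y z * φ s x - det r x z * φ s y

    record Independent : Set where
      field
        u₁ u₂ u₃ r s : ℤ
        small₁ : Small u₁
        small₂ : Small u₂
        small₃ : Small u₃
        r∈ : r ∈ frequencies
        s∈ : s ∈ frequencies
        det≢0 : det₃ r s u₁ u₂ u₃ ≢ 0ℤ

    smaller : ∀ a x b v {K} → 0 < K → K ≤ R₁ → ∣ a * x + b * v ∣ ≤ 2 ℕ.* W →
      (∀ {s} → s ∈ frequencies → ∣ a * φ s x + b * φ s v ∣ < K) →
      Small (a * x + b * v) × norm (a * x + b * v) < K × (∀ {s} → s ∈ frequencies → φ s (a * x + b * v) ≡ a * φ s x + b * φ s v)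
    smaller a x b v {K} 0<K K≤R₁ y≤ z< = small-by-norm y≤ (ℕ.≤-trans (ℕ.<⇒≤ n<) K≤R₁) , n< , φ≡
      where
      φ≡ : ∀ {s} → s ∈ frequencies → φ s (a * x + b * v) ≡ a * φ s x + b * φ s v
      φ≡ {s} s∈ = φ-combine s a x b v (2R₀<N (ℕ.≤-trans (ℕ.<⇒≤ (z< s∈)) (ℕ.≤-trans K≤R₁ (ℕ.≤-trans R₁≤R₀ (ℕ.m≤m+n R₀ _)))))
      n< : norm (a * x + b * v) < K
      n< = maxOver-< frequencies 0<K λ {s} s∈ → subst (λ z → ∣ z ∣ < K) (sym (φ≡ s∈)) (z< s∈)

    module RankOne (v₁ : ℤ) (s₁ : Small v₁) (v₁≢0 : v₁ ≢ 0ℤ)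
                   (min₁ : ∀ {y} → Small y → norm y < norm v₁ → y ≡ 0ℤ)
                   (dependent : ∀ {x r} → Small x → r ∈ frequencies → det r v₁ x ≡ 0ℤ) where

      instance
        v₁-nonZero : ℤ.NonZero v₁
        v₁-nonZero = ℤ.≢-nonZero v₁≢0

      -- Dependence makes the phases of the remainder of x modulo v₁ proportional to the remainder
      -- itself, with a factor below 1 relative to those of v₁. The remainder thus has smaller norm
      -- than v₁ and vanishes by minimality.
      quotient : ∀ {x} → Small x → x ≡ x / v₁ * v₁ × (∀ {r} → r ∈ frequencies → φ r x ≡ x / v₁ * φ r v₁)
      quotient {x} sx = x≡ , φ≡
        where
        l ρ : ℤ
        l = x / v₁
        ρ = + (x % v₁)
        ρ≡ : + 1 * x + - l * v₁ ≡ ρ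
        ρ≡ = trans (cong (λ z → + 1 * z + - l * v₁) (a≡a%n+[a/n]*n x v₁)) (e ρ l v₁)
          where
          e : ∀ ρ l v → + 1 * (ρ + l * v) + - l * v ≡ ρ
          e = ℤ-Solver.solve-∀
        key : ∀ {r} → r ∈ frequencies → v₁ * (+ 1 * φ r x + - l * φ r v₁) ≡ ρ * φ r v₁
        key {r} r∈ = trans (e v₁ (φ r x) l (φ r v₁) x) (trans (cong (λ d → d + (+ 1 * x + - l * v₁) * φ r v₁) (dependent sx r∈)) (trans (ℤ.+-identityˡ _) (cong (_* φ r v₁) ρ≡)))
          where
          e : ∀ v p l q x → v * (+ 1 * p + - l * q) ≡ (v * p - x * q) + (+ 1 * x + - l * v) * q
          e = ℤ-Solver.solve-∀
        bound : ∀ {r} → r ∈ frequencies → ∣ + 1 * φ r x + - l * φ r v₁ ∣ < norm v₁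
        bound {r} r∈ = ℕ.*-cancelˡ-< ∣ v₁ ∣ _ _ (begin-strict
          ∣ v₁ ∣ ℕ.* ∣ + 1 * φ r x + - l * φ r v₁ ∣ ≡⟨ trans (sym (ℤ.abs-* v₁ (+ 1 * φ r x + - l * φ r v₁))) (trans (cong ∣_∣ (key r∈)) (ℤ.abs-* ρ (φ r v₁))) ⟩
          (x % v₁) ℕ.* ∣ φ r v₁ ∣ ≤⟨ ℕ.*-monoʳ-≤ (x % v₁) (≤-maxOver r∈) ⟩
          (x % v₁) ℕ.* norm v₁ <⟨ ℕ.*-monoˡ-< (norm v₁) {{ℕ.>-nonZero (norm-pos s₁ v₁≢0)}} (n%d<d x v₁) ⟩
          ∣ v₁ ∣ ℕ.* norm v₁ ∎)
          where open ℕ.≤-Reasoning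
        ρ≤ : ∣ + 1 * x + - l * v₁ ∣ ≤ 2 ℕ.* W
        ρ≤ = ℕ.≤-trans (ℕ.≤-reflexive (cong ∣_∣ ρ≡)) (ℕ.≤-trans (ℕ.<⇒≤ (n%d<d x v₁)) (proj₁ s₁))
        y≡0 : + 1 * x + - l * v₁ ≡ 0ℤ
        y≡0 = let s , n< , _ = smaller (+ 1) x (- l) v₁ (norm-pos s₁ v₁≢0) (norm≤R₁ s₁) ρ≤ bound in min₁ s n<
        x≡ : x ≡ l * v₁
        x≡ = trans (e x l v₁) (trans (cong (_+ l * v₁) y≡0) (ℤ.+-identityˡ _))
          where
          e : ∀ x l v → x ≡ (+ 1 * x + - l * v) + l * v
          e = ℤ-Solver.solve-∀
        φ≡ : ∀ {r} → r ∈ frequencies → φ r x ≡ l * φ r v₁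
        φ≡ {r} r∈ = trans (e (φ r x) l (φ r v₁)) (trans (cong (_+ l * φ r v₁) zero′) (ℤ.+-identityˡ _))
          where
          e : ∀ x l v → x ≡ (+ 1 * x + - l * v) + l * v
          e = ℤ-Solver.solve-∀
          zero′ : + 1 * φ r x + - l * φ r v₁ ≡ 0ℤ
          zero′ = ℤ.*-cancelˡ-≡ v₁ _ 0ℤ (trans (key r∈) (trans (cong (_* φ r v₁) (trans (sym ρ≡) y≡0)) (sym (ℤ.*-zeroʳ v₁))))

      M₁ : ℕ
      M₁ = maxOver points (λ x → ∣ x / v₁ ∣)

      progression : Progression
      progression = Build.result v₁ 0ℤ s₁ small-0 M₁ 0
        (λ {r} r∈ → subst (_≤ R₀) (sym (trans (ℕ.+-identityʳ _) (ℕ.*-comm M₁ ∣ φ r v₁ ∣))) (ℕ.≤-trans (maxOver-≤ points {∣ φ r v₁ ∣} {R₁} λ {x} x∈ →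
          ℕ.≤-trans (ℕ.≤-reflexive (trans (ℕ.*-comm ∣ φ r v₁ ∣ ∣ x / v₁ ∣) (trans (sym (ℤ.abs-* (x / v₁) (φ r v₁))) (cong ∣_∣ (sym (proj₂ (quotient (points-small x∈)) r∈)))))) (φ-small (points-small x∈) r∈)) R₁≤R₀))
        (_/ v₁) (λ _ → 0ℤ) (λ sx → ≤-maxOver (∈-points sx)) (λ _ → z≤n)
        (λ x y sx sy eq → trans (proj₁ (quotient sx)) (trans (trans (sym (ℤ.+-identityʳ (x / v₁ * v₁))) (trans eq (ℤ.+-identityʳ (y / v₁ * v₁)))) (sym (proj₁ (quotient sy)))))

    record Basis : Set where
      field
        v₁ v₂ : ℤ
        s₁ : Small v₁
        s₂ : Small v₂
        v₁≢0 : v₁ ≢ 0ℤ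
        v₂≢0 : v₂ ≢ 0ℤ
        min₁ : ∀ {y} → Small y → norm y < norm v₁ → y ≡ 0ℤ
        λ₁≤λ₂ : norm v₁ ≤ norm v₂
        min₂ : ∀ {y s} → Small y → s ∈ frequencies → norm y < norm v₂ → det s v₁ y ≡ 0ℤ
        r : ℤ
        r∈ : r ∈ frequencies
        Δ≢0 : det r v₁ v₂ ≢ 0ℤ
        dependent : ∀ {x s} → Small x → s ∈ frequencies → det₃ r s v₁ v₂ x ≡ 0ℤ

    module RankTwo (basis : Basis) where
      open Basis basis

      Δ : ℤ
      Δ = det r v₁ v₂

      λ₁ λ₂ : ℕ
      λ₁ = norm v₁
      λ₂ = norm v₂

      instance
        Δ-nonZero : ℤ.NonZero Δ
        Δ-nonZero = ℤ.≢-nonZero Δ≢0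

        ∣Δ∣-nonZero : ℕ.NonZero ∣ Δ ∣
        ∣Δ∣-nonZero = ℕ.>-nonZero (∣∣-pos Δ≢0)

      -- Cramer numerators: α x / Δ and β x / Δ are the coordinates of x in the basis v₁, v₂.
      α β : ℤ → ℤ
      α x = det r x v₂
      β x = det r v₁ x

      cramer : ∀ x → Δ * x ≡ α x * v₁ + β x * v₂
      cramer x = e v₁ v₂ x (φ r v₁) (φ r v₂) (φ r x)
        where
        e : ∀ v w x a b c → (v * b - w * a) * x ≡ (x * b - w * c) * v + (v * c - x * a) * w
        e = ℤ-Solver.solve-∀

      cramer-φ : ∀ {x s} → Small x → s ∈ frequencies → Δ * φ s x ≡ α x * φ s v₁ + β x * φ s v₂
      cramer-φ {x} {s} sx s∈ = trans (e Δ v₁ v₂ x (φ r v₁) (φ r v₂) (φ r x) (φ s v₁) (φ s v₂) (φ s x)) (trans (cong (_+ (α x * φ s v₁ + β x * φ s v₂)) (dependent sx s∈)) (ℤ.+-identityˡ _))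
        where
        e : ∀ D v w x a b c a′ b′ c′ → D * c′ ≡ (D * c′ + (w * c - x * b) * a′ - (v * c - x * a) * b′) + ((x * b - w * c) * a′ + (v * c - x * a) * b′)
        e = ℤ-Solver.solve-∀

      -- If β were larger, v₂ could be shortened: v₂ + (α / β) v₁ equals (Δ / β) x, whose phases are
      -- below λ₂ / 4, and rounding α / β costs at most λ₁ / 2 ≤ λ₂ / 2. The new vector still has
      -- determinant Δ with v₁, against the minimality of v₂.
      β-bound : ∀ {x} → Small x → ∣ β x ∣ ℕ.* λ₂ ≤ 4 ℕ.* ∣ Δ ∣ ℕ.* R₁
      β-bound {x} sx = ℕ.≮⇒≥ contra
        where
        b a : ℤ
        b = β x
        a = α x
        contra : ¬ (4 ℕ.* ∣ Δ ∣ ℕ.* R₁ < ∣ b ∣ ℕ.* λ₂)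
        contra big = contradiction (trans (sym detb) (min₂ ys r∈ n<)) Δ≢0
          where
          4Δ<b : 4 ℕ.* ∣ Δ ∣ < ∣ b ∣
          4Δ<b = ℕ.*-cancelʳ-< R₁ _ _ (ℕ.<-≤-trans big (ℕ.*-monoʳ-≤ ∣ b ∣ (norm≤R₁ s₂)))
          0<b : 0 < ∣ b ∣
          0<b = ℕ.≤-<-trans z≤n 4Δ<b
          0<2b : 0 < ∣ + 2 * b ∣
          0<2b = subst (0 <_) (sym (ℤ.abs-* (+ 2) b)) (ℕ.<-≤-trans 0<b (ℕ.m≤m+n ∣ b ∣ _))
          instance
            2b-nonZero : ℤ.NonZero (+ 2 * b)
            2b-nonZero = ℕ.>-nonZero 0<2b
          n₀ ε : ℤ
          -- The integer nearest to a / b: adding ∣ b ∣ before the division by 2b centres the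
          -- remainder, so ∣ ε ∣ ≤ ∣ b ∣.
          n₀ = (+ 2 * a + + ∣ b ∣) / (+ 2 * b)
          ε = + 2 * (a - n₀ * b)
          ε≡ : ε ≡ + ((+ 2 * a + + ∣ b ∣) % (+ 2 * b)) - + ∣ b ∣
          ε≡ = trans (e a n₀ b (+ ∣ b ∣)) (trans (cong (λ z → z - n₀ * (+ 2 * b) - + ∣ b ∣) (a≡a%n+[a/n]*n (+ 2 * a + + ∣ b ∣) (+ 2 * b))) (e′ (+ ((+ 2 * a + + ∣ b ∣) % (+ 2 * b))) (n₀ * (+ 2 * b)) (+ ∣ b ∣)))
            where
            e : ∀ a n b c → + 2 * (a - n * b) ≡ (+ 2 * a + c) - n * (+ 2 * b) - c
            e = ℤ-Solver.solve-∀
            e′ : ∀ p q c → (p + q) - q - c ≡ p - c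
            e′ = ℤ-Solver.solve-∀
          ε≤ : ∣ ε ∣ ≤ ∣ b ∣
          ε≤ = subst (λ z → ∣ z ∣ ≤ ∣ b ∣) (sym ε≡) (≤⇒∣∣≤
            (subst (ℤ._≤ + ρ - + ∣ b ∣) (ℤ.+-identityˡ (- + ∣ b ∣)) (ℤ.+-monoˡ-≤ (- + ∣ b ∣) (ℤ.+≤+ {0} {ρ} z≤n)))
            (subst (+ ρ - + ∣ b ∣ ℤ.≤_) (e (+ ∣ b ∣)) (ℤ.+-monoˡ-≤ (- + ∣ b ∣) (ℤ.+≤+ (ℕ.≤-trans (ℕ.<⇒≤ (n%d<d (+ 2 * a + + ∣ b ∣) (+ 2 * b))) (ℕ.≤-reflexive (trans (ℤ.abs-* (+ 2) b) (cong (∣ b ∣ ℕ.+_) (ℕ.+-identityʳ ∣ b ∣)))))))))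
            where
            ρ : ℕ
            ρ = (+ 2 * a + + ∣ b ∣) % (+ 2 * b)
            e : ∀ c → c + c - c ≡ c
            e = ℤ-Solver.solve-∀
          y≡ : + 2 * b * (+ 1 * v₂ + n₀ * v₁) ≡ + 2 * Δ * x + - ε * v₁
          y≡ = trans (e b v₂ n₀ v₁ a) (cong (_+ - ε * v₁) (trans (cong (+ 2 *_) (sym (cramer x))) (sym (ℤ.*-assoc (+ 2) Δ x))))
            where
            e : ∀ b w n v a → + 2 * b * (+ 1 * w + n * v) ≡ + 2 * (a * v + b * w) + - (+ 2 * (a - n * b)) * v
            e = ℤ-Solver.solve-∀
          φ≡ : ∀ {s} → s ∈ frequencies → + 2 * b * (+ 1 * φ s v₂ + n₀ * φ s v₁) ≡ + 2 * Δ * φ s x + - ε * φ s v₁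
          φ≡ {s} s∈ = trans (e b (φ s v₂) n₀ (φ s v₁) a) (cong (_+ - ε * φ s v₁) (trans (cong (+ 2 *_) (sym (cramer-φ sx s∈))) (sym (ℤ.*-assoc (+ 2) Δ (φ s x)))))
            where
            e : ∀ b w n v a → + 2 * b * (+ 1 * w + n * v) ≡ + 2 * (a * v + b * w) + - (+ 2 * (a - n * b)) * v
            e = ℤ-Solver.solve-∀
          divided : ∀ z p q → + 2 * b * z ≡ + 2 * Δ * p + - ε * q → 2 ℕ.* ∣ b ∣ ℕ.* ∣ z ∣ ≤ 2 ℕ.* ∣ Δ ∣ ℕ.* ∣ p ∣ ℕ.+ ∣ b ∣ ℕ.* ∣ q ∣
          divided z p q eq = ℕ.≤-trans (ℕ.≤-reflexive (cong (ℕ._* ∣ z ∣) (sym (ℤ.abs-* (+ 2) b))))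
            (ℕ.≤-trans (∣*∣≤ (+ 2 * b) z (+ 2 * Δ * p) (- ε * q) eq) (ℕ.+-mono-≤ (ℕ.≤-reflexive (trans (ℤ.abs-* (+ 2 * Δ) p) (cong (ℕ._* ∣ p ∣) (ℤ.abs-* (+ 2) Δ))))
              (ℕ.≤-trans (ℕ.≤-reflexive (trans (ℤ.abs-* (- ε) q) (cong (ℕ._* ∣ q ∣) (ℤ.∣-i∣≡∣i∣ ε)))) (ℕ.*-monoˡ-≤ ∣ q ∣ ε≤))))
          z< : ∀ {s} → s ∈ frequencies → ∣ + 1 * φ s v₂ + n₀ * φ s v₁ ∣ < λ₂
          z< {s} s∈ = ℕ.*-cancelˡ-< (4 ℕ.* ∣ b ∣) _ _ (begin-strict
            4 ℕ.* ∣ b ∣ ℕ.* z ≡⟨ l₁ ∣ b ∣ z ⟩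
            2 ℕ.* (2 ℕ.* ∣ b ∣ ℕ.* z) ≤⟨ ℕ.*-monoʳ-≤ 2 (divided (+ 1 * φ s v₂ + n₀ * φ s v₁) (φ s x) (φ s v₁) (φ≡ s∈)) ⟩
            2 ℕ.* (2 ℕ.* ∣ Δ ∣ ℕ.* ∣ φ s x ∣ ℕ.+ ∣ b ∣ ℕ.* ∣ φ s v₁ ∣) ≤⟨ ℕ.*-monoʳ-≤ 2 (ℕ.+-mono-≤ (ℕ.*-monoʳ-≤ (2 ℕ.* ∣ Δ ∣) (φ-small sx s∈)) (ℕ.*-monoʳ-≤ ∣ b ∣ (ℕ.≤-trans (≤-maxOver s∈) λ₁≤λ₂))) ⟩
            2 ℕ.* (2 ℕ.* ∣ Δ ∣ ℕ.* R₁ ℕ.+ ∣ b ∣ ℕ.* λ₂) ≡⟨ l₂ ∣ Δ ∣ R₁ (∣ b ∣ ℕ.* λ₂) ⟩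
            4 ℕ.* ∣ Δ ∣ ℕ.* R₁ ℕ.+ 2 ℕ.* (∣ b ∣ ℕ.* λ₂) <⟨ ℕ.+-monoˡ-< _ big ⟩
            ∣ b ∣ ℕ.* λ₂ ℕ.+ 2 ℕ.* (∣ b ∣ ℕ.* λ₂) ≤⟨ ℕ.m≤m+n _ (∣ b ∣ ℕ.* λ₂) ⟩
            ∣ b ∣ ℕ.* λ₂ ℕ.+ 2 ℕ.* (∣ b ∣ ℕ.* λ₂) ℕ.+ ∣ b ∣ ℕ.* λ₂ ≡⟨ l₃ ∣ b ∣ λ₂ ⟩
            4 ℕ.* ∣ b ∣ ℕ.* λ₂ ∎)
            where
            open ℕ.≤-Reasoning
            z : ℕ
            z = ∣ + 1 * φ s v₂ + n₀ * φ s v₁ ∣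
            l₁ : ∀ b z → 4 ℕ.* b ℕ.* z ≡ 2 ℕ.* (2 ℕ.* b ℕ.* z)
            l₁ = ℕ-Solver.solve-∀
            l₂ : ∀ d R c → 2 ℕ.* (2 ℕ.* d ℕ.* R ℕ.+ c) ≡ 4 ℕ.* d ℕ.* R ℕ.+ 2 ℕ.* c
            l₂ = ℕ-Solver.solve-∀
            l₃ : ∀ b k → b ℕ.* k ℕ.+ 2 ℕ.* (b ℕ.* k) ℕ.+ b ℕ.* k ≡ 4 ℕ.* b ℕ.* k
            l₃ = ℕ-Solver.solve-∀
          y≤ : ∣ + 1 * v₂ + n₀ * v₁ ∣ ≤ 2 ℕ.* W
          y≤ = ℕ.*-cancelˡ-≤ (2 ℕ.* ∣ b ∣) {{ℕ.>-nonZero (ℕ.<-≤-trans 0<b (ℕ.m≤m+n ∣ b ∣ _))}} (begin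
            2 ℕ.* ∣ b ∣ ℕ.* ∣ + 1 * v₂ + n₀ * v₁ ∣ ≤⟨ divided (+ 1 * v₂ + n₀ * v₁) x v₁ y≡ ⟩
            2 ℕ.* ∣ Δ ∣ ℕ.* ∣ x ∣ ℕ.+ ∣ b ∣ ℕ.* ∣ v₁ ∣ ≤⟨ ℕ.+-mono-≤ (ℕ.*-mono-≤ (ℕ.≤-trans (ℕ.*-monoˡ-≤ ∣ Δ ∣ (s≤s (s≤s (z≤n {2})))) (ℕ.<⇒≤ 4Δ<b)) (small-bounded sx)) (ℕ.*-monoʳ-≤ ∣ b ∣ (small-bounded s₁)) ⟩
            ∣ b ∣ ℕ.* W ℕ.+ ∣ b ∣ ℕ.* W ≤⟨ ℕ.m≤m+n _ (2 ℕ.* (∣ b ∣ ℕ.* W)) ⟩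
            ∣ b ∣ ℕ.* W ℕ.+ ∣ b ∣ ℕ.* W ℕ.+ 2 ℕ.* (∣ b ∣ ℕ.* W) ≡⟨ l₃ ∣ b ∣ W ⟩
            2 ℕ.* ∣ b ∣ ℕ.* (2 ℕ.* W) ∎)
            where
            open ℕ.≤-Reasoning
            l₃ : ∀ b k → b ℕ.* k ℕ.+ b ℕ.* k ℕ.+ 2 ℕ.* (b ℕ.* k) ≡ 2 ℕ.* b ℕ.* (2 ℕ.* k)
            l₃ = ℕ-Solver.solve-∀
          sm : Small (+ 1 * v₂ + n₀ * v₁) × norm (+ 1 * v₂ + n₀ * v₁) < λ₂ × (∀ {s} → s ∈ frequencies → φ s (+ 1 * v₂ + n₀ * v₁) ≡ + 1 * φ s v₂ + n₀ * φ s v₁)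
          sm = smaller (+ 1) v₂ n₀ v₁ (norm-pos s₂ v₂≢0) (norm≤R₁ s₂) y≤ z<
          ys : Small (+ 1 * v₂ + n₀ * v₁)
          ys = proj₁ sm
          n< : norm (+ 1 * v₂ + n₀ * v₁) < λ₂
          n< = proj₁ (proj₂ sm)
          detb : det r v₁ (+ 1 * v₂ + n₀ * v₁) ≡ Δ
          detb = trans (cong (λ z → v₁ * z - (+ 1 * v₂ + n₀ * v₁) * φ r v₁) (proj₂ (proj₂ sm) r∈)) (e v₁ v₂ n₀ (φ r v₁) (φ r v₂))
            where
            e : ∀ v w n p q → v * (+ 1 * q + n * p) - (+ 1 * w + n * v) * p ≡ v * q - w * p
            e = ℤ-Solver.solve-∀

      α-bound : ∀ {x} → Small x → ∣ α x ∣ ℕ.* λ₁ ≤ 5 ℕ.* ∣ Δ ∣ ℕ.* R₁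
      α-bound {x} sx = maxOver-≤ frequencies {∣ α x ∣} λ {s} s∈ → begin
        ∣ α x ∣ ℕ.* ∣ φ s v₁ ∣ ≤⟨ ∣*∣≤ (α x) (φ s v₁) (Δ * φ s x) (- β x * φ s v₂) (trans (e (α x * φ s v₁) (β x) (φ s v₂)) (cong (_+ - β x * φ s v₂) (sym (cramer-φ sx s∈)))) ⟩
        ∣ Δ * φ s x ∣ ℕ.+ ∣ - β x * φ s v₂ ∣ ≡⟨ cong₂ ℕ._+_ (ℤ.abs-* Δ (φ s x)) (trans (ℤ.abs-* (- β x) (φ s v₂)) (cong (ℕ._* ∣ φ s v₂ ∣) (ℤ.∣-i∣≡∣i∣ (β x)))) ⟩
        ∣ Δ ∣ ℕ.* ∣ φ s x ∣ ℕ.+ ∣ β x ∣ ℕ.* ∣ φ s v₂ ∣ ≤⟨ ℕ.+-mono-≤ (ℕ.*-monoʳ-≤ ∣ Δ ∣ (φ-small sx s∈)) (ℕ.≤-trans (ℕ.*-monoʳ-≤ ∣ β x ∣ (≤-maxOver s∈)) (β-bound sx)) ⟩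
        ∣ Δ ∣ ℕ.* R₁ ℕ.+ 4 ℕ.* ∣ Δ ∣ ℕ.* R₁ ≡⟨ l ∣ Δ ∣ R₁ ⟩
        5 ℕ.* ∣ Δ ∣ ℕ.* R₁ ∎
        where
        open ℕ.≤-Reasoning
        e : ∀ p b q → p ≡ (p + b * q) + - b * q
        e = ℤ-Solver.solve-∀
        l : ∀ d R → d ℕ.* R ℕ.+ 4 ℕ.* d ℕ.* R ≡ 5 ℕ.* d ℕ.* R
        l = ℕ-Solver.solve-∀

      -- Integer parts of twice the coordinates. Points in the same cell differ by less than 1/2 in
      -- each coordinate, so the phases of their difference are below λ₁ / 2 + λ₂ / 2 ≤ λ₂ and
      -- minimality applies; cells of side 1 would only give λ₁ + λ₂.
      m₁ m₂ ρ₁ ρ₂ : ℤ → ℤ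
      m₁ x = (+ 2 * α x) / Δ
      m₂ x = (+ 2 * β x) / Δ
      ρ₁ x = + ((+ 2 * α x) % Δ)
      ρ₂ x = + ((+ 2 * β x) % Δ)

      rounding : ∀ a {λ′ K} → ∣ a ∣ ℕ.* λ′ ≤ K ℕ.* ∣ Δ ∣ ℕ.* R₁ → λ′ ≤ R₁ → λ′ ℕ.* ∣ (+ 2 * a) / Δ ∣ ≤ (2 ℕ.* K ℕ.+ 1) ℕ.* R₁
      rounding a {λ′} {K} a≤ λ≤ = ℕ.*-cancelˡ-≤ ∣ Δ ∣ (begin
        ∣ Δ ∣ ℕ.* (λ′ ℕ.* ∣ m ∣) ≡⟨ l₁ (∣ Δ ∣) λ′ (∣ m ∣) ⟩
        ∣ Δ ∣ ℕ.* ∣ m ∣ ℕ.* λ′ ≤⟨ ℕ.*-monoˡ-≤ λ′ (∣*∣≤ Δ m (+ 2 * a) (- + (+ 2 * a % Δ)) (trans (e Δ m (+ (+ 2 * a % Δ))) (cong (_- + (+ 2 * a % Δ)) (sym (a≡a%n+[a/n]*n (+ 2 * a) Δ))))) ⟩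
        (∣ + 2 * a ∣ ℕ.+ ∣ - + (+ 2 * a % Δ) ∣) ℕ.* λ′ ≡⟨ cong₂ (λ p q → (p ℕ.+ q) ℕ.* λ′) (ℤ.abs-* (+ 2) a) (ℤ.∣-i∣≡∣i∣ (+ (+ 2 * a % Δ))) ⟩
        (2 ℕ.* ∣ a ∣ ℕ.+ (+ 2 * a % Δ)) ℕ.* λ′ ≡⟨ l₂ (∣ a ∣) (+ 2 * a % Δ) λ′ ⟩
        2 ℕ.* (∣ a ∣ ℕ.* λ′) ℕ.+ (+ 2 * a % Δ) ℕ.* λ′ ≤⟨ ℕ.+-mono-≤ (ℕ.*-monoʳ-≤ 2 a≤) (ℕ.*-mono-≤ (ℕ.<⇒≤ (n%d<d (+ 2 * a) Δ)) λ≤) ⟩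
        2 ℕ.* (K ℕ.* ∣ Δ ∣ ℕ.* R₁) ℕ.+ ∣ Δ ∣ ℕ.* R₁ ≡⟨ l₃ K (∣ Δ ∣) R₁ ⟩
        ∣ Δ ∣ ℕ.* ((2 ℕ.* K ℕ.+ 1) ℕ.* R₁) ∎)
        where
        open ℕ.≤-Reasoning
        m : ℤ
        m = (+ 2 * a) / Δ
        e : ∀ d m ρ → d * m ≡ (ρ + m * d) - ρ
        e = ℤ-Solver.solve-∀
        l₁ : ∀ d k m → d ℕ.* (k ℕ.* m) ≡ d ℕ.* m ℕ.* k
        l₁ = ℕ-Solver.solve-∀
        l₂ : ∀ a p k → (2 ℕ.* a ℕ.+ p) ℕ.* k ≡ 2 ℕ.* (a ℕ.* k) ℕ.+ p ℕ.* k
        l₂ = ℕ-Solver.solve-∀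
        l₃ : ∀ K d R → 2 ℕ.* (K ℕ.* d ℕ.* R) ℕ.+ d ℕ.* R ≡ d ℕ.* ((2 ℕ.* K ℕ.+ 1) ℕ.* R)
        l₃ = ℕ-Solver.solve-∀

      M₁ M₂ : ℕ
      M₁ = maxOver points (λ x → ∣ m₁ x ∣)
      M₂ = maxOver points (λ x → ∣ m₂ x ∣)

      M≤ : ∀ {s} → s ∈ frequencies → M₁ ℕ.* ∣ φ s v₁ ∣ ℕ.+ M₂ ℕ.* ∣ φ s v₂ ∣ ≤ R₀
      M≤ {s} s∈ = begin
        M₁ ℕ.* ∣ φ s v₁ ∣ ℕ.+ M₂ ℕ.* ∣ φ s v₂ ∣ ≤⟨ ℕ.+-mono-≤ (ℕ.*-monoʳ-≤ M₁ (≤-maxOver s∈)) (ℕ.*-monoʳ-≤ M₂ (≤-maxOver s∈)) ⟩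
        M₁ ℕ.* λ₁ ℕ.+ M₂ ℕ.* λ₂ ≡⟨ cong₂ ℕ._+_ (ℕ.*-comm M₁ λ₁) (ℕ.*-comm M₂ λ₂) ⟩
        λ₁ ℕ.* M₁ ℕ.+ λ₂ ℕ.* M₂ ≤⟨ ℕ.+-mono-≤
                                                      (maxOver-≤ points {λ₁} λ {x} x∈ → rounding (α x) {K = 5} (α-bound (points-small x∈)) (norm≤R₁ s₁))
                                                      (maxOver-≤ points {λ₂} λ {x} x∈ → rounding (β x) {K = 4} (β-bound (points-small x∈)) (norm≤R₁ s₂)) ⟩
        -- 11 = 2 · 5 + 1 and 9 = 2 · 4 + 1 come from `α-bound` and `β-bound` by `rounding`; this is
        -- the origin of the factor 20 between the two radii.
        11 ℕ.* R₁ ℕ.+ 9 ℕ.* R₁ ≡⟨ sym (ℕ.*-distribʳ-+ R₁ 11 9) ⟩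
        20 ℕ.* R₁ ≤⟨ R₀-large ⟩
        R₀ ∎
        where open ℕ.≤-Reasoning

      open Combinations v₁ v₂ s₁ s₂ M₁ M₂ M≤ using (φ-combination)

      module _ (x y : ℤ) (sx : Small x) (sy : Small y) (eq : m₁ x * v₁ + m₂ x * v₂ ≡ m₁ y * v₁ + m₂ y * v₂) where

        φ-eq : m₁ x * φ r v₁ + m₂ x * φ r v₂ ≡ m₁ y * φ r v₁ + m₂ y * φ r v₂
        φ-eq = trans (sym (φ-combination {r} {m₁ x} {m₂ x} r∈ (≤-maxOver (∈-points sx)) (≤-maxOver (∈-points sx))))
          (trans (cong (φ r) eq) (φ-combination {r} {m₁ y} {m₂ y} r∈ (≤-maxOver (∈-points sy)) (≤-maxOver (∈-points sy))))

        m₁-eq : m₁ x ≡ m₁ y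
        m₁-eq = ℤ.*-cancelʳ-≡ (m₁ x) (m₁ y) Δ (trans (e v₁ v₂ (φ r v₁) (φ r v₂) (m₁ x) (m₂ x)) (trans (cong₂ (λ c d → φ r v₂ * c - v₂ * d) eq φ-eq) (sym (e v₁ v₂ (φ r v₁) (φ r v₂) (m₁ y) (m₂ y)))))
          where
          e : ∀ v w p q m n → m * (v * q - w * p) ≡ q * (m * v + n * w) - w * (m * p + n * q)
          e = ℤ-Solver.solve-∀

        m₂-eq : m₂ x ≡ m₂ y
        m₂-eq = ℤ.*-cancelʳ-≡ (m₂ x) (m₂ y) Δ (trans (e v₁ v₂ (φ r v₁) (φ r v₂) (m₁ x) (m₂ x)) (trans (cong₂ (λ c d → v₁ * d - φ r v₁ * c) eq φ-eq) (sym (e v₁ v₂ (φ r v₁) (φ r v₂) (m₁ y) (m₂ y)))))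
          where
          e : ∀ v w p q m n → n * (v * q - w * p) ≡ v * (m * p + n * q) - p * (m * v + n * w)
          e = ℤ-Solver.solve-∀

        e₁ e₂ : ℤ
        e₁ = ρ₁ x - ρ₁ y
        e₂ = ρ₂ x - ρ₂ y

        remainders : ∀ a b → (+ 2 * a) / Δ ≡ (+ 2 * b) / Δ → + 2 * (a - b) ≡ + ((+ 2 * a) % Δ) - + ((+ 2 * b) % Δ)
        remainders a b q≡ = trans (e a b) (trans (cong₂ _-_ (a≡a%n+[a/n]*n (+ 2 * a) Δ) (trans (a≡a%n+[a/n]*n (+ 2 * b) Δ) (cong (λ q → + ((+ 2 * b) % Δ) + q * Δ) (sym q≡)))) (e′ (+ ((+ 2 * a) % Δ)) (+ ((+ 2 * b) % Δ)) (((+ 2 * a) / Δ) * Δ)))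
          where
          e : ∀ a b → + 2 * (a - b) ≡ + 2 * a - + 2 * b
          e = ℤ-Solver.solve-∀
          e′ : ∀ p q c → (p + c) - (q + c) ≡ p - q
          e′ = ℤ-Solver.solve-∀

        e₁-def : + 2 * (α x - α y) ≡ e₁
        e₁-def = remainders (α x) (α y) m₁-eq

        e₂-def : + 2 * (β x - β y) ≡ e₂
        e₂-def = remainders (β x) (β y) m₂-eq

        e₁< : ∣ e₁ ∣ < ∣ Δ ∣
        e₁< = ∣+-+∣< (n%d<d (+ 2 * α x) Δ) (n%d<d (+ 2 * α y) Δ)

        e₂< : ∣ e₂ ∣ < ∣ Δ ∣
        e₂< = ∣+-+∣< (n%d<d (+ 2 * β x) Δ) (n%d<d (+ 2 * β y) Δ)

        z : ℤ
        z = + 1 * x + - + 1 * y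

        φz : ℤ → ℤ
        φz s = + 1 * φ s x + - + 1 * φ s y

        relation : ∀ {s} → s ∈ frequencies → + 2 * Δ * φz s ≡ e₁ * φ s v₁ + e₂ * φ s v₂
        relation {s} s∈ = trans (f Δ (φ s x) (φ s y)) (trans (cong₂ (λ p q → + 2 * (p - q)) (cramer-φ sx s∈) (cramer-φ sy s∈))
          (trans (f′ (α x) (β x) (α y) (β y) (φ s v₁) (φ s v₂)) (cong₂ (λ p q → p * φ s v₁ + q * φ s v₂) e₁-def e₂-def)))
          where
          f : ∀ D p q → + 2 * D * (+ 1 * p + - + 1 * q) ≡ + 2 * (D * p - D * q)
          f = ℤ-Solver.solve-∀
          f′ : ∀ a b c d v w → + 2 * ((a * v + b * w) - (c * v + d * w)) ≡ + 2 * (a - c) * v + + 2 * (b - d) * w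
          f′ = ℤ-Solver.solve-∀

        z≤ : ∣ z ∣ ≤ 2 ℕ.* W
        z≤ = ℕ.≤-trans (ℤ.∣i+j∣≤∣i∣+∣j∣ (+ 1 * x) (- + 1 * y)) (ℕ.≤-trans (ℕ.+-mono-≤
          (subst (_≤ W) (cong ∣_∣ (sym (ℤ.*-identityˡ x))) (small-bounded sx))
          (subst (_≤ W) (sym (trans (ℤ.abs-* (- + 1) y) (ℕ.*-identityˡ ∣ y ∣))) (small-bounded sy))) (ℕ.≤-reflexive (cong (W ℕ.+_) (sym (ℕ.+-identityʳ W)))))

        2∣Δ∣* : ∀ w → ∣ + 2 * Δ * w ∣ ≡ 2 ℕ.* ∣ Δ ∣ ℕ.* ∣ w ∣
        2∣Δ∣* w = trans (ℤ.abs-* (+ 2 * Δ) w) (cong (ℕ._* ∣ w ∣) (ℤ.abs-* (+ 2) Δ))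

        z-λ₂ : ∀ {s} → s ∈ frequencies → ∣ φz s ∣ < λ₂
        z-λ₂ {s} s∈ = ℕ.*-cancelˡ-< (2 ℕ.* ∣ Δ ∣) _ _ (begin-strict
          2 ℕ.* ∣ Δ ∣ ℕ.* ∣ φz s ∣ ≡⟨ trans (sym (2∣Δ∣* (φz s))) (cong ∣_∣ (relation s∈)) ⟩
          ∣ e₁ * φ s v₁ + e₂ * φ s v₂ ∣ ≤⟨ ℤ.∣i+j∣≤∣i∣+∣j∣ (e₁ * φ s v₁) (e₂ * φ s v₂) ⟩
          ∣ e₁ * φ s v₁ ∣ ℕ.+ ∣ e₂ * φ s v₂ ∣ ≡⟨ cong₂ ℕ._+_ (ℤ.abs-* e₁ (φ s v₁)) (ℤ.abs-* e₂ (φ s v₂)) ⟩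
          ∣ e₁ ∣ ℕ.* ∣ φ s v₁ ∣ ℕ.+ ∣ e₂ ∣ ℕ.* ∣ φ s v₂ ∣ ≤⟨ ℕ.+-mono-≤ (ℕ.*-mono-≤ (ℕ.<⇒≤ e₁<) (ℕ.≤-trans (≤-maxOver s∈) λ₁≤λ₂)) (ℕ.*-monoʳ-≤ ∣ e₂ ∣ (≤-maxOver s∈)) ⟩
          ∣ Δ ∣ ℕ.* λ₂ ℕ.+ ∣ e₂ ∣ ℕ.* λ₂ <⟨ ℕ.+-monoʳ-< (∣ Δ ∣ ℕ.* λ₂) (ℕ.*-monoˡ-< λ₂ {{ℕ.>-nonZero (norm-pos s₂ v₂≢0)}} e₂<) ⟩
          ∣ Δ ∣ ℕ.* λ₂ ℕ.+ ∣ Δ ∣ ℕ.* λ₂ ≡⟨ f (∣ Δ ∣) λ₂ ⟩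
          2 ℕ.* ∣ Δ ∣ ℕ.* λ₂ ∎)
          where
          open ℕ.≤-Reasoning
          f : ∀ d k → d ℕ.* k ℕ.+ d ℕ.* k ≡ 2 ℕ.* d ℕ.* k
          f = ℕ-Solver.solve-∀

        small-z : Small z × norm z < λ₂ × (∀ {s} → s ∈ frequencies → φ s z ≡ φz s)
        small-z = smaller (+ 1) x (- + 1) y (norm-pos s₂ v₂≢0) (norm≤R₁ s₂) z≤ z-λ₂

        e₂≡0 : e₂ ≡ 0ℤ
        e₂≡0 = trans (sym e₂-def) (cong (+ 2 *_) (trans (f x y v₁ (φ r x) (φ r y) (φ r v₁)) (trans (cong (λ w → v₁ * w - z * φ r v₁) (sym (proj₂ (proj₂ small-z) r∈))) (min₂ (proj₁ small-z) r∈ (proj₁ (proj₂ small-z))))))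
          where
          f : ∀ x y v p q a → (v * p - x * a) - (v * q - y * a) ≡ v * (+ 1 * p + - + 1 * q) - (+ 1 * x + - + 1 * y) * a
          f = ℤ-Solver.solve-∀

        z-λ₁ : ∀ {s} → s ∈ frequencies → ∣ φz s ∣ < λ₁
        z-λ₁ {s} s∈ = ℕ.*-cancelˡ-< ∣ Δ ∣ _ _ (begin-strict
          ∣ Δ ∣ ℕ.* ∣ φz s ∣ ≤⟨ ℕ.*-monoˡ-≤ ∣ φz s ∣ (ℕ.m≤m+n ∣ Δ ∣ _) ⟩
          2 ℕ.* ∣ Δ ∣ ℕ.* ∣ φz s ∣ ≡⟨ trans (sym (2∣Δ∣* (φz s))) (cong ∣_∣ (trans (relation s∈) (trans (cong (λ w → e₁ * φ s v₁ + w * φ s v₂) e₂≡0) (ℤ.+-identityʳ (e₁ * φ s v₁))))) ⟩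
          ∣ e₁ * φ s v₁ ∣ ≡⟨ ℤ.abs-* e₁ (φ s v₁) ⟩
          ∣ e₁ ∣ ℕ.* ∣ φ s v₁ ∣ ≤⟨ ℕ.*-monoʳ-≤ ∣ e₁ ∣ (≤-maxOver s∈) ⟩
          ∣ e₁ ∣ ℕ.* λ₁ <⟨ ℕ.*-monoˡ-< λ₁ {{ℕ.>-nonZero (norm-pos s₁ v₁≢0)}} e₁< ⟩
          ∣ Δ ∣ ℕ.* λ₁ ∎)
          where open ℕ.≤-Reasoning

        -- Equal cells make the norm of x - y smaller than λ₂, so x - y is parallel to v₁ and e₂ =
        -- 0. Its norm is then even smaller than λ₁, and it vanishes.
        separated : x ≡ y
        separated = trans (f x y) (trans (cong (_+ y) z≡0) (ℤ.+-identityˡ y))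
          where
          f : ∀ x y → x ≡ (+ 1 * x + - + 1 * y) + y
          f = ℤ-Solver.solve-∀
          z≡0 : z ≡ 0ℤ
          z≡0 = let s , n< , _ = smaller (+ 1) x (- + 1) y (norm-pos s₁ v₁≢0) (norm≤R₁ s₁) z≤ z-λ₁ in min₁ s n<

      progression : Progression
      progression = Build.result v₁ v₂ s₁ s₂ M₁ M₂ M≤ m₁ m₂ (λ sx → ≤-maxOver (∈-points sx)) (λ sx → ≤-maxOver (∈-points sx)) separated

    -- v₁ is a shortest nonzero small point, and v₂ a shortest one off the line of v₁. Failure of
    -- either choice lowers the rank; a small point outside the plane of both is the witness of
    -- independence.
    progression-or-independent : Progression ⊎ Independent
    progression-or-independent with minimal norm nonzero
    ... | inj₁ empty = inj₁ (Build.result 0ℤ 0ℤ small-0 small-0 0 0 (λ _ → z≤n) (λ _ → 0ℤ) (λ _ → 0ℤ) (λ _ → z≤n) (λ _ → z≤n) λ x y sx sy _ → trans (trivial sx) (sym (trivial sy)))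
      where
      trivial : ∀ {x} → Small x → x ≡ 0ℤ
      trivial {x} sx = decidable-stable (x ℤ.≟ 0ℤ) λ x≢0 → contradiction (subst (x ∈_) empty (∈-nonzero sx x≢0)) (λ ())
    ... | inj₂ (v₁ , v₁∈ , least₁) = cases (minimal norm transverse)
      where
      s₁ : Small v₁
      s₁ = proj₁ (nonzero-small v₁∈)
      v₁≢0 : v₁ ≢ 0ℤ
      v₁≢0 = proj₂ (nonzero-small v₁∈)
      min₁ : ∀ {y} → Small y → norm y < norm v₁ → y ≡ 0ℤ
      min₁ {y} sy y< = decidable-stable (y ℤ.≟ 0ℤ) λ y≢0 → contradiction (least₁ (∈-nonzero sy y≢0)) (ℕ.<⇒≱ y<)
      Transverse : ℤ → Set
      Transverse x = Any (λ r → det r v₁ x ≢ 0ℤ) frequencies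
      transverse? : ∀ x → Dec (Transverse x)
      transverse? x = any? (λ r → ¬? (det r v₁ x ℤ.≟ 0ℤ)) frequencies
      transverse : List ℤ
      transverse = filter transverse? nonzero
      ∈-transverse : ∀ {x r} → Small x → r ∈ frequencies → det r v₁ x ≢ 0ℤ → x ∈ transverse
      ∈-transverse {x} {r} sx r∈ d≢0 = ∈-filter⁺ transverse? (∈-nonzero sx x≢0) (lose r∈ d≢0)
        where
        x≢0 : x ≢ 0ℤ
        x≢0 refl = d≢0 (trans (cong (λ w → v₁ * w - 0ℤ * φ r v₁) (φ-0 r)) (e v₁ (φ r v₁)))
          where
          e : ∀ v a → v * 0ℤ - 0ℤ * a ≡ 0ℤ
          e = ℤ-Solver.solve-∀
      cases : transverse ≡ [] ⊎ ∃[ m ] (m ∈ transverse × ∀ {x} → x ∈ transverse → norm m ≤ norm x) → Progression ⊎ Independent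
      cases (inj₁ empty) = inj₁ (RankOne.progression v₁ s₁ v₁≢0 min₁ dependent)
        where
        dependent : ∀ {x r} → Small x → r ∈ frequencies → det r v₁ x ≡ 0ℤ
        dependent {x} {r} sx r∈ = decidable-stable (det r v₁ x ℤ.≟ 0ℤ) λ d≢0 → contradiction (subst (x ∈_) empty (∈-transverse sx r∈ d≢0)) λ ()
      cases (inj₂ (v₂ , v₂∈ , least₂)) = final (any? (λ x → any? (λ s → ¬? (det₃ r s v₁ v₂ x ℤ.≟ 0ℤ)) frequencies) points)
        where
        v₂∈′ : v₂ ∈ nonzero × Transverse v₂
        v₂∈′ = ∈-filter⁻ transverse? {xs = nonzero} v₂∈
        s₂ : Small v₂
        s₂ = proj₁ (nonzero-small (proj₁ v₂∈′))
        found : ∃[ r ] (r ∈ frequencies × det r v₁ v₂ ≢ 0ℤ)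
        found = find (proj₂ v₂∈′)
        r : ℤ
        r = proj₁ found
        r∈ : r ∈ frequencies
        r∈ = proj₁ (proj₂ found)
        min₂ : ∀ {y s} → Small y → s ∈ frequencies → norm y < norm v₂ → det s v₁ y ≡ 0ℤ
        min₂ {y} {s} sy s∈ y< = decidable-stable (det s v₁ y ℤ.≟ 0ℤ) λ d≢0 → contradiction (least₂ (∈-transverse sy s∈ d≢0)) (ℕ.<⇒≱ y<)
        final : Dec (Any (λ x → Any (λ s → det₃ r s v₁ v₂ x ≢ 0ℤ) frequencies) points) → Progression ⊎ Independent
        final (yes p) = let x , x∈ , q = find p ; s , s∈ , d≢0 = find q in
          inj₂ (record { u₁ = v₁ ; u₂ = v₂ ; u₃ = x ; r = r ; s = s ; small₁ = s₁ ; small₂ = s₂ ; small₃ = points-small x∈ ; r∈ = r∈ ; s∈ = s∈ ; det≢0 = d≢0 })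
        final (no ¬p) = inj₁ (RankTwo.progression (record
          { v₁ = v₁ ; v₂ = v₂ ; s₁ = s₁ ; s₂ = s₂ ; v₁≢0 = v₁≢0 ; v₂≢0 = proj₂ (nonzero-small (proj₁ v₂∈′)) ; min₁ = min₁ ; λ₁≤λ₂ = least₁ (proj₁ v₂∈′) ; min₂ = min₂
          ; r = r ; r∈ = r∈ ; Δ≢0 = proj₂ (proj₂ found) ; dependent = dependent }))
          where
          dependent : ∀ {x s} → Small x → s ∈ frequencies → det₃ r s v₁ v₂ x ≡ 0ℤ
          dependent {x} {s} sx s∈ = decidable-stable (det₃ r s v₁ v₂ x ℤ.≟ 0ℤ) λ d≢0 → contradiction (lose (∈-points sx) (lose s∈ d≢0)) ¬p

-- Bohr sets inside iterated difference sets

module Bogolyubov where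

  open import Data.Integer.Base as ℤ using (ℤ; +_)
  open import Data.Rational.Base
  open import Data.Rational.Properties
  open RationalOrder
  open ListSum
  open Rotations using (2ℚ)
  open Characters
  open Energy using (Sumset; reps; ∑-reps)

  ^-mono : ∀ {x y} k → 0ℚ ≤ x → x ≤ y → x ^ k ≤ y ^ k
  ^-mono zero 0≤x x≤y = ≤-refl
  ^-mono (suc k) 0≤x x≤y = *-mono-≤-nonNeg 0≤x (^-nonNeg k (≤-trans 0≤x x≤y)) x≤y (^-mono k 0≤x x≤y)

  ^-distrib : ∀ x y k → (x * y) ^ k ≡ x ^ k * y ^ k
  ^-distrib x y zero = refl
  ^-distrib x y (suc k) = trans (cong (x * y *_) (^-distrib x y k)) (l x y (x ^ k) (y ^ k))
    where
    l : ∀ x y a b → x * y * (a * b) ≡ x * a * (y * b)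
    l = solve-∀ ℚ-ring

  ^-≤1 : ∀ {x} k → 0ℚ ≤ x → x ≤ 1ℚ → x ^ k ≤ 1ℚ
  ^-≤1 zero 0≤x x≤1 = ≤-refl
  ^-≤1 (suc k) 0≤x x≤1 = *-mono-≤-nonNeg 0≤x 0≤1 x≤1 (^-≤1 k 0≤x x≤1)

  -- Convexity of the power function. Multiplying the case below by b leaves a surplus with the
  -- factor (b - a)².
  tangent : ∀ k {a b} → 0ℚ ≤ a → 0ℚ ≤ b → a ^ suc k + ιₙ (suc k) * a ^ k * (b - a) ≤ b ^ suc k
  tangent zero {a} {b} 0≤a 0≤b = ≤-reflexive (trans (cong (λ z → a ^ 1 + z * 1ℚ * (b - a)) (ι-def (+ 1))) (l a b))
    where
    l : ∀ a b → a * 1ℚ + 1ℚ * 1ℚ * (b - a) ≡ b * 1ℚ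
    l = solve-∀ ℚ-ring
  tangent (suc k) {a} {b} 0≤a 0≤b = ≤-trans
    (≤-by (ιₙ (suc k) * a ^ k * ((b - a) * (b - a))) (*-nonNeg (*-nonNeg (ιₙ-nonNeg (suc k)) (^-nonNeg k 0≤a)) (sq-nonNeg (b - a)))
      (trans (l a b (a ^ k) (ιₙ (suc k))) (cong (λ z → a * (a * a ^ k) + z * (a * a ^ k) * (b - a) + ιₙ (suc k) * a ^ k * ((b - a) * (b - a))) (sym (ιₙ-suc (suc k))))))
    (*-mono-≤ˡ 0≤b (tangent k 0≤a 0≤b))
    where
    l : ∀ a b x n → b * (a * x + n * x * (b - a)) ≡ a * (a * x) + (1ℚ + n) * (a * x) * (b - a) + n * x * ((b - a) * (b - a))
    l = solve-∀ ℚ-ring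

  infixl 6 _⊕_ _⊖_
  -- Lists serve as multisets: an entry recurs once for each representation, which makes exponential
  -- sums multiplicative.
  _⊕_ _⊖_ : List ℤ → List ℤ → List ℤ
  X ⊕ Y = cartesianProductWith ℤ._+_ X Y
  X ⊖ Y = X ⊕ map ℤ.-_ Y

  count-⊕ : ∀ X Y → ιₙ (length (X ⊕ Y)) ≡ ιₙ (length X) * ιₙ (length Y)
  count-⊕ X Y = trans (sym (∑-1 (X ⊕ Y))) (trans (∑-product ℤ._+_ X Y _) (trans (∑-ext X λ _ → ∑-1 Y) (∑-const X (ιₙ (length Y)))))

  count-⊖ : ∀ X Y → ιₙ (length (X ⊖ Y)) ≡ ιₙ (length X) * ιₙ (length Y)
  count-⊖ X Y = trans (count-⊕ X (map ℤ.-_ Y)) (cong (λ l → ιₙ (length X) * ιₙ l) (length-map ℤ.-_ Y))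

  zeros : List ℤ → ℚ
  zeros X = ∑ X (λ w → [ w ℤ.≟ + 0 ?])

  Bounded : ℕ → List ℤ → Set
  Bounded k X = ∀ {w} → w ∈ X → ℤ.∣ w ∣ ℕ.≤ k

  bounded-⊕ : ∀ {X Y k l} → Bounded k X → Bounded l Y → Bounded (k ℕ.+ l) (X ⊕ Y)
  bounded-⊕ {X} {Y} bx by w∈ with ∈-cartesianProductWith⁻ ℤ._+_ X Y w∈
  ... | x , y , x∈ , y∈ , refl = ℕ.≤-trans (ℤ.∣i+j∣≤∣i∣+∣j∣ x y) (ℕ.+-mono-≤ (bx x∈) (by y∈))

  bounded-⊖ : ∀ {X Y k l} → Bounded k X → Bounded l Y → Bounded (k ℕ.+ l) (X ⊖ Y)
  bounded-⊖ {X} {Y} {l = l} bx by = bounded-⊕ {X} bx λ w∈ → let y , y∈ , eq = ∈-map⁻ ℤ.-_ w∈ in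
    subst (λ z → ℤ.∣ z ∣ ℕ.≤ l) (sym eq) (subst (ℕ._≤ l) (sym (ℤ.∣-i∣≡∣i∣ y)) (by y∈))

  module Transforms (𝒞 : Circle) where
    open Circle 𝒞
    open Transform 𝒞

    Fc-⊕ : ∀ r X Y → Fc r (X ⊕ Y) ≡ Fc r X * Fc r Y - Fs r X * Fs r Y
    Fc-⊕ r X Y = trans (∑-product ℤ._+_ X Y _) (trans (∑-ext X row) (trans (∑-+ X _ _) (cong₂ _+_ (∑-*ʳ X (Fc r Y) _) (trans (∑-neg X _) (cong -_ (∑-*ʳ X (Fs r Y) _))))))
      where
      row : ∀ x → ∑ Y (λ y → c (r ℤ.* (x ℤ.+ y))) ≡ c (r ℤ.* x) * Fc r Y - s (r ℤ.* x) * Fs r Y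
      row x = trans (∑-ext Y λ y → trans (cong c (ℤ.*-distribˡ-+ r x y)) (c-+ (r ℤ.* x) (r ℤ.* y)))
        (trans (∑-+ Y _ _) (cong₂ _+_ (∑-*ˡ Y (c (r ℤ.* x)) _) (trans (∑-neg Y _) (cong -_ (∑-*ˡ Y (s (r ℤ.* x)) _)))))

    Fs-⊕ : ∀ r X Y → Fs r (X ⊕ Y) ≡ Fs r X * Fc r Y + Fc r X * Fs r Y
    Fs-⊕ r X Y = trans (∑-product ℤ._+_ X Y _) (trans (∑-ext X row) (trans (∑-+ X _ _) (cong₂ _+_ (∑-*ʳ X (Fc r Y) _) (∑-*ʳ X (Fs r Y) _))))
      where
      row : ∀ x → ∑ Y (λ y → s (r ℤ.* (x ℤ.+ y))) ≡ s (r ℤ.* x) * Fc r Y + c (r ℤ.* x) * Fs r Y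
      row x = trans (∑-ext Y λ y → trans (cong s (ℤ.*-distribˡ-+ r x y)) (s-+ (r ℤ.* x) (r ℤ.* y)))
        (trans (∑-+ Y _ _) (cong₂ _+_ (∑-*ˡ Y (s (r ℤ.* x)) _) (∑-*ˡ Y (c (r ℤ.* x)) _)))

    Fc-neg : ∀ r X → Fc r (map ℤ.-_ X) ≡ Fc r X
    Fc-neg r X = trans (∑-map ℤ.-_ X _) (∑-ext X λ x → trans (cong c (sym (ℤ.neg-distribʳ-* r x))) (c-neg (r ℤ.* x)))

    Fs-neg : ∀ r X → Fs r (map ℤ.-_ X) ≡ - Fs r X
    Fs-neg r X = trans (∑-map ℤ.-_ X _) (trans (∑-ext X λ x → trans (cong s (sym (ℤ.neg-distribʳ-* r x))) (s-neg (r ℤ.* x))) (∑-neg X _))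

    Fc-⊖ : ∀ r X → Fc r (X ⊖ X) ≡ intensity X r
    Fc-⊖ r X = trans (Fc-⊕ r X _) (trans (cong₂ (λ a b → Fc r X * a - Fs r X * b) (Fc-neg r X) (Fs-neg r X)) (l (Fc r X) (Fs r X)))
      where
      l : ∀ a b → a * a - b * - b ≡ a * a + b * b
      l = solve-∀ ℚ-ring

    Fs-⊖ : ∀ r X → Fs r (X ⊖ X) ≡ 0ℚ
    Fs-⊖ r X = trans (Fs-⊕ r X _) (trans (cong₂ (λ a b → Fs r X * a + Fc r X * b) (Fc-neg r X) (Fs-neg r X)) (l (Fc r X) (Fs r X)))
      where
      l : ∀ a b → b * a + a * - b ≡ 0ℚ
      l = solve-∀ ℚ-ring

    intensity-⊕ : ∀ r X → intensity (X ⊕ X) r ≡ intensity X r * intensity X r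
    intensity-⊕ r X = trans (cong₂ (λ a b → a * a + b * b) (Fc-⊕ r X X) (Fs-⊕ r X X)) (l (Fc r X) (Fs r X))
      where
      l : ∀ a b → (a * a - b * b) * (a * a - b * b) + (b * a + a * b) * (b * a + a * b) ≡ (a * a + b * b) * (a * a + b * b)
      l = solve-∀ ℚ-ring

    intensity-nonNeg : ∀ X r → 0ℚ ≤ intensity X r
    intensity-nonNeg X r = +-nonNeg (sq-nonNeg (Fc r X)) (sq-nonNeg (Fs r X))

    sums : List ℤ → ℕ → List ℤ
    sums X zero = + 0 ∷ []
    sums X (suc k) = (X ⊖ X) ⊕ sums X k

    F-sums : ∀ r X k → Fc r (sums X k) ≡ intensity X r ^ k × Fs r (sums X k) ≡ 0ℚ
    F-sums r X zero = trans (+-identityʳ _) (trans (cong c (ℤ.*-zeroʳ r)) c-0) , trans (+-identityʳ _) (trans (cong s (ℤ.*-zeroʳ r)) s-0)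
    F-sums r X (suc k) = let fc , fs = F-sums r X k in
      trans (Fc-⊕ r (X ⊖ X) _) (trans (cong₂ (λ a b → a * Fc r (sums X k) - b * Fs r (sums X k)) (Fc-⊖ r X) (Fs-⊖ r X))
        (trans (cong (λ z → intensity X r * z - 0ℚ * Fs r (sums X k)) fc) (l (intensity X r) (intensity X r ^ k) (Fs r (sums X k))))) ,
      trans (Fs-⊕ r (X ⊖ X) _) (trans (cong₂ (λ a b → b * Fc r (sums X k) + a * Fs r (sums X k)) (Fc-⊖ r X) (Fs-⊖ r X))
        (trans (cong (λ z → 0ℚ * Fc r (sums X k) + intensity X r * z) fs) (l′ (intensity X r) (Fc r (sums X k)))))
      where
      l : ∀ a b d → a * b - 0ℚ * d ≡ a * b
      l = solve-∀ ℚ-ring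
      l′ : ∀ a b → 0ℚ * b + a * 0ℚ ≡ 0ℚ
      l′ = solve-∀ ℚ-ring

    count-sums : ∀ X k → ιₙ (length (sums X k)) ≡ (ιₙ (length X) * ιₙ (length X)) ^ k
    count-sums X zero = ι-def (+ 1)
    count-sums X (suc k) = trans (count-⊕ (X ⊖ X) (sums X k)) (cong₂ _*_ (count-⊖ X X) (count-sums X k))

    bounded-sums : ∀ {X K} k → Bounded K X → Bounded (k ℕ.* (K ℕ.+ K)) (sums X k)
    bounded-sums zero b (here refl) = ℕ.z≤n
    bounded-sums {X} (suc k) b = bounded-⊕ {X ⊖ X} (bounded-⊖ {X} {X} b b) (bounded-sums k b)

    N′ : ℚ
    N′ = ιₙ N

    full : (ℤ → ℚ) → ℚ
    full f = ∑ (downFrom N) (λ r → f (+ r))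

    -- Summed over all frequencies, an entry 0 contributes `N` and any other entry at most 12 in
    -- absolute value by `kernel`, whose range of validity is the bound assumed on X.
    orthogonality : ∀ {X} → Bounded (2 ℕ.* q) X →
      N′ * zeros X - 12ℚ * ιₙ (length X) ≤ full (λ r → Fc r X) × full (λ r → Fc r X) ≤ N′ * zeros X + 12ℚ * ιₙ (length X)
    orthogonality {X} bounded = subst (_≤ full (λ r → Fc r X)) lower≡ (≤-trans (∑-mono X λ w w∈ → proj₁ (pointwise w w∈)) (≤-reflexive (∑-swap X (downFrom N) _))) ,
      subst (full (λ r → Fc r X) ≤_) upper≡ (≤-trans (≤-reflexive (∑-swap (downFrom N) X _)) (∑-mono X λ w w∈ → proj₂ (pointwise w w∈)))
      where
      lower≡ : ∑ X (λ w → N′ * [ w ℤ.≟ + 0 ?] - 12ℚ) ≡ N′ * zeros X - 12ℚ * ιₙ (length X)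
      lower≡ = trans (∑-+ X _ _) (cong₂ _+_ (∑-*ˡ X N′ _) (trans (∑-const X (- 12ℚ)) (l (ιₙ (length X)))))
        where
        l : ∀ a → a * - 12ℚ ≡ - (12ℚ * a)
        l = solve-∀ ℚ-ring
      upper≡ : ∑ X (λ w → N′ * [ w ℤ.≟ + 0 ?] + 12ℚ) ≡ N′ * zeros X + 12ℚ * ιₙ (length X)
      upper≡ = trans (∑-+ X _ _) (cong₂ _+_ (∑-*ˡ X N′ _) (trans (∑-const X 12ℚ) (*-comm (ιₙ (length X)) 12ℚ)))
      G : ℤ → ℚ
      G w = ∑ (downFrom N) (λ r → c (+ r ℤ.* w))
      pointwise : ∀ w → w ∈ X → N′ * [ w ℤ.≟ + 0 ?] - 12ℚ ≤ G w × G w ≤ N′ * [ w ℤ.≟ + 0 ?] + 12ℚ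
      pointwise w w∈ with w ℤ.≟ + 0
      ... | yes refl = subst (λ z → N′ * 1ℚ - 12ℚ ≤ z × z ≤ N′ * 1ℚ + 12ℚ) (sym G0)
                         (≤-by 12ℚ (nonNegative⁻¹ 12ℚ) (l N′) , ≤-by 12ℚ (nonNegative⁻¹ 12ℚ) refl)
        where
        l : ∀ a → a * 1ℚ ≡ a * 1ℚ - 12ℚ + 12ℚ
        l = solve-∀ ℚ-ring
        G0 : G (+ 0) ≡ N′ * 1ℚ
        G0 = trans (∑-ext (downFrom N) λ r → trans (cong c (ℤ.*-zeroʳ (+ r))) c-0) (trans (∑-const (downFrom N) 1ℚ) (cong (λ l → ιₙ l * 1ℚ) (length-downFrom N)))
      ... | no w≢0 = subst (λ z → z - 12ℚ ≤ G w × G w ≤ z + 12ℚ) (sym (*-zeroʳ N′))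
                       (subst₂ (λ a b → a ≤ G w × G w ≤ b) (sym (+-identityˡ (- 12ℚ))) (sym (+-identityˡ 12ℚ)) (kernel w w≢0 (bounded w∈)))

  -- s₁ and s₂ stand for the sums of the intensities and of their squares; ωm² and θm² are the
  -- average intensity, weighted by intensity, and the threshold for a frequency to be large.
  record Averages : Set where
    field
      m N E ω θ Λ a b : ℚ
      0<m : 0ℚ < m
      0<N : 0ℚ < N
      0≤ω : 0ℚ ≤ ω
      ω≤1 : ω ≤ 1ℚ
      0≤θ : 0ℚ ≤ θ
      0≤a : 0ℚ ≤ a
      0≤b : 0ℚ ≤ b
      Λ≡ : Λ ≡ a * ω ^ 39 - (a + b) * θ ^ 39
      -- Keeps the accumulated kernel errors below half of the main term, so that the conclusion of
      -- `conclude` loses only a factor 2.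
      N-large : 2ℚ * ((12ℚ * a + 2ℚ * 12ℚ * (a * ιₙ 39) + 12ℚ * b) * m) ≤ Λ * N
      energy : ω * (m * m * m) ≤ E

  module Balance (averages : Averages) where
    open Averages averages

    M : ℚ
    M = m * m

    0≤M : 0ℚ ≤ M
    0≤M = <⇒≤ (*-pos 0<m 0<m)

    -- In place of 40th powers of T, which stands for an intensity; c is the value of a character.
    pointwise : ∀ T c → 0ℚ ≤ T → - 1ℚ ≤ c → (θ * M ≤ T → a ≤ b * c) → 0ℚ ≤ b - a →
                (a * (ω * M) ^ 39 - (a + b) * (θ * M) ^ 39) * T + a * ιₙ 39 * (ω * M) ^ 38 * (T * T - ω * M * T) ≤ b * (T ^ 40 * c)
    -- The tangent to the 39th power at the mean value `ω * M` takes the place of Hölder's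
    -- inequality. Summed over all frequencies with weight T, its linear part is non-negative up to
    -- kernel errors, by the energy hypothesis.
    pointwise T c 0≤T -1≤c major 0≤b-a = ≤-trans (≤-by (a * T * (T ^ 39 - ((ω * M) ^ 39 + ιₙ 39 * (ω * M) ^ 38 * (T - ω * M))))
        (*-nonNeg (*-nonNeg 0≤a 0≤T) (≤⇒0≤ (tangent 38 (*-nonNeg 0≤ω 0≤M) 0≤T)))
        (l a (a + b) ((θ * M) ^ 39) T (T ^ 39) ((ω * M) ^ 39) (ιₙ 39) ((ω * M) ^ 38) (ω * M)))
      step
      where
      B^ : ℚ
      B^ = (θ * M) ^ 39
      0≤B^ : 0ℚ ≤ B^
      0≤B^ = ^-nonNeg 39 (*-nonNeg 0≤θ 0≤M)
      l : ∀ a d B T T^ A^ k A′ A → a * (T * T^) - d * B * T ≡ (a * A^ - d * B) * T + a * k * A′ * (T * T - A * T) + a * T * (T^ - (A^ + k * A′ * (T - A)))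
      l = solve-∀ ℚ-ring
      -- Above the threshold b c is at least a. Below it c may be as bad as -1, but T^39 is at most
      -- (θ M)^39; the loss of a + b times this is what Λ has to survive.
      step : a * (T * T ^ 39) - (a + b) * B^ * T ≤ b * (T ^ 40 * c)
      step with θ * M ≤? T
      ... | yes p = ≤-by (T * T ^ 39 * (b * c - a) + (a + b) * B^ * T)
            (+-nonNeg (*-nonNeg (*-nonNeg 0≤T (^-nonNeg 39 0≤T)) (≤⇒0≤ (major p))) (*-nonNeg (*-nonNeg (+-nonNeg 0≤a 0≤b) 0≤B^) 0≤T)) (l₁ a b B^ T (T ^ 39) c)
        where
        l₁ : ∀ a b B T T^ c → b * (T * T^ * c) ≡ a * (T * T^) - (a + b) * B * T + (T * T^ * (b * c - a) + (a + b) * B * T)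
        l₁ = solve-∀ ℚ-ring
      ... | no ¬p = ≤-by (b * (T * T ^ 39) * (c - - 1ℚ) + (a + b) * T * (B^ - T ^ 39))
            (+-nonNeg (*-nonNeg (*-nonNeg 0≤b (*-nonNeg 0≤T (^-nonNeg 39 0≤T))) (≤⇒0≤ -1≤c)) (*-nonNeg (*-nonNeg (+-nonNeg 0≤a 0≤b) 0≤T) (≤⇒0≤ (^-mono 39 0≤T (<⇒≤ (≰⇒> ¬p))))))
            (l₁ a b B^ T (T ^ 39) c)
        where
        l₁ : ∀ a b B T T^ c → b * (T * T^ * c) ≡ a * (T * T^) - (a + b) * B * T + (b * (T * T^) * (c - - 1ℚ) + (a + b) * T * (B - T^))
        l₁ = solve-∀ ℚ-ring

    conclude : ∀ s₁ s₂ X h → N * m - 12ℚ * M ≤ s₁ → s₁ ≤ N * m + 12ℚ * M → N * E - 12ℚ * (M * M) ≤ s₂ → X ≤ N * h + 12ℚ * M ^ 40 → 0ℚ ≤ Λ →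
               (a * (ω * M) ^ 39 - (a + b) * (θ * M) ^ 39) * s₁ + a * ιₙ 39 * (ω * M) ^ 38 * (s₂ - ω * M * s₁) ≤ b * X →
               Λ * (m * M ^ 39) ≤ 2ℚ * b * h
    conclude s₁ s₂ X h s₁≥ s₁≤ s₂≥ X≤ 0≤Λ main = *-cancelʳ-≤ {N} {Λ * (m * M ^ 39)} {2ℚ * b * h} 0<N (0≤⇒≤ (subst (0ℚ ≤_)
        (final N m (M ^ 38) (ω ^ 38) a b Λ (ιₙ 39) h)
        (+-nonNeg (*-nonNeg (nonNegative⁻¹ 2ℚ) (≤⇒0≤ total))
          (+-nonNeg (*-nonNeg (*-nonNeg (<⇒≤ 0<m) (^-nonNeg 39 0≤M)) (≤⇒0≤ N-large))
            (*-nonNeg (*-nonNeg (nonNegative⁻¹ (2ℚ * 12ℚ)) (*-nonNeg 0≤M (^-nonNeg 39 0≤M)))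
              (+-nonNeg (≤⇒0≤ Λ≤a) (*-nonNeg (*-nonNeg (nonNegative⁻¹ 2ℚ) (*-nonNeg 0≤a (ιₙ-nonNeg 39))) (≤⇒0≤ (^-≤1 38 0≤ω ω≤1)))))))))
      where
      Λ≤a : Λ ≤ a
      Λ≤a = ≤-trans (≤-reflexive Λ≡) (≤-by (a * (1ℚ - ω ^ 39) + (a + b) * θ ^ 39)
        (+-nonNeg (*-nonNeg 0≤a (≤⇒0≤ (^-≤1 39 0≤ω ω≤1))) (*-nonNeg (+-nonNeg 0≤a 0≤b) (^-nonNeg 39 0≤θ))) (e a (ω ^ 39) (a + b) (θ ^ 39)))
        where
        e : ∀ a w d t → a ≡ a * w - d * t + (a * (1ℚ - w) + d * t)
        e = solve-∀ ℚ-ring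
      variation : - (2ℚ * 12ℚ) * (M * M) ≤ s₂ - ω * M * s₁
      variation = ≤-by ((s₂ - (N * E - 12ℚ * (M * M))) + N * (E - ω * (m * m * m)) + ω * M * (N * m + 12ℚ * M - s₁) + 12ℚ * (1ℚ - ω) * (M * M))
        (+-nonNeg (+-nonNeg (+-nonNeg (≤⇒0≤ s₂≥) (*-nonNeg (<⇒≤ 0<N) (≤⇒0≤ energy))) (*-nonNeg (*-nonNeg 0≤ω 0≤M) (≤⇒0≤ s₁≤)))
          (*-nonNeg (*-nonNeg (nonNegative⁻¹ 12ℚ) (≤⇒0≤ ω≤1)) (*-nonNeg 0≤M 0≤M))) (e s₂ s₁ N E ω m)
        where
        e : ∀ s₂ s₁ N E ω m → s₂ - ω * (m * m) * s₁ ≡ - (2ℚ * 12ℚ) * (m * m * (m * m)) + ((s₂ - (N * E - 12ℚ * (m * m * (m * m)))) + N * (E - ω * (m * m * m)) + ω * (m * m) * (N * m + 12ℚ * (m * m) - s₁) + 12ℚ * (1ℚ - ω) * (m * m * (m * m)))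
        e = solve-∀ ℚ-ring
      coefficient : a * (ω * M) ^ 39 - (a + b) * (θ * M) ^ 39 ≡ Λ * M ^ 39
      coefficient = trans (cong₂ (λ x y → a * x - (a + b) * y) (^-distrib ω M 39) (^-distrib θ M 39)) (trans (e a (a + b) (ω ^ 39) (θ ^ 39) (M ^ 39)) (cong (_* M ^ 39) (sym Λ≡)))
        where
        e : ∀ a d x y z → a * (x * z) - d * (y * z) ≡ (a * x - d * y) * z
        e = solve-∀ ℚ-ring
      total : Λ * M ^ 39 * (N * m - 12ℚ * M) + a * ιₙ 39 * (ω ^ 38 * M ^ 38) * (- (2ℚ * 12ℚ) * (M * M)) ≤ b * (N * h + 12ℚ * M ^ 40)
      total = ≤-trans (+-mono-≤ (*-mono-≤ˡ (*-nonNeg 0≤Λ (^-nonNeg 39 0≤M)) s₁≥)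
          (*-mono-≤ˡ (*-nonNeg (*-nonNeg 0≤a (ιₙ-nonNeg 39)) (*-nonNeg (^-nonNeg 38 0≤ω) (^-nonNeg 38 0≤M))) variation))
        (≤-trans (≤-reflexive (cong₂ (λ x y → x * s₁ + a * ιₙ 39 * y * (s₂ - ω * M * s₁)) (sym coefficient) (sym (^-distrib ω M 38)))) (≤-trans main (*-mono-≤ˡ 0≤b X≤)))
      final : ∀ N m M38 w a b Λ k h →
        2ℚ * (b * (N * h + 12ℚ * (m * m * (m * m * M38))) - (Λ * (m * m * M38) * (N * m - 12ℚ * (m * m)) + a * k * (w * M38) * (- (2ℚ * 12ℚ) * (m * m * (m * m)))))
        + (m * (m * m * M38) * (Λ * N - 2ℚ * ((12ℚ * a + 2ℚ * 12ℚ * (a * k) + 12ℚ * b) * m))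
           + 2ℚ * 12ℚ * (m * m * (m * m * M38)) * (a - Λ + 2ℚ * (a * k) * (1ℚ - w)))
        ≡ 2ℚ * b * h * N - Λ * (m * (m * m * M38)) * N
      final = solve-∀ ℚ-ring

  record BallData (𝒞 : Circle) (sumset : Sumset) : Set where
    open Sumset sumset
    field
      K : ℕ
      as-bounded : Bounded K as
      -- Elements of 40A - 40A are bounded by 80K and points of the ball by 160K; their sums must
      -- stay within the range of `kernel`.
      K-small : 240 ℕ.* K ℕ.≤ 2 ℕ.* Circle.q 𝒞
      ω θ Λ a b : ℚ
      0≤ω : 0ℚ ≤ ω
      ω≤1 : ω ≤ 1ℚ
      0≤θ : 0ℚ ≤ θ
      0≤a : 0ℚ ≤ a
      a≤b : a ≤ b
      0≤Λ : 0ℚ ≤ Λ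
      Λ≡ : Λ ≡ a * ω ^ 39 - (a + b) * θ ^ 39
      N-large : 2ℚ * ((12ℚ * a + 2ℚ * 12ℚ * (a * ιₙ 39) + 12ℚ * b) * ιₙ (length as)) ≤ Λ * ιₙ (Circle.N 𝒞)
      energy : ω * (ιₙ (length as) * ιₙ (length as) * ιₙ (length as)) ≤ ∑ S (λ y → reps as y * reps as y)

  module Ball (𝒞 : Circle) (sumset : Sumset) (ball-data : BallData 𝒞 sumset) where
    open Sumset sumset
    open BallData ball-data
    open Circle 𝒞
    open Transform 𝒞
    open Transforms 𝒞

    m E : ℚ
    m = ιₙ (length as)
    E = ∑ S (λ y → reps as y * reps as y)

    0<m : 0ℚ < m
    0<m = subst (_< m) (ι-def (+ 0)) (ιₙ-mono-< nonempty)

    0<N : 0ℚ < N′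
    0<N = subst (_< N′) (ι-def (+ 0)) (ιₙ-mono-< (ℕ.≤-trans 1≤q (ℕ.m≤m+n q _)))

    averages : Averages
    averages = record { m = m ; N = N′ ; E = E ; ω = ω ; θ = θ ; Λ = Λ ; a = a ; b = b ; 0<m = 0<m ; 0<N = 0<N ; 0≤ω = 0≤ω ; ω≤1 = ω≤1 ; 0≤θ = 0≤θ
                      ; 0≤a = 0≤a ; 0≤b = ≤-trans 0≤a a≤b ; Λ≡ = Λ≡ ; N-large = N-large ; energy = energy }

    open Balance averages

    p : ℤ → ℚ
    p = intensity as

    reach : ∀ k → k ℕ.≤ 240 → ∀ {X} → Bounded (k ℕ.* K) X → Bounded (2 ℕ.* q) X
    reach k k≤ bx x∈ = ℕ.≤-trans (bx x∈) (ℕ.≤-trans (ℕ.*-monoˡ-≤ K k≤) K-small)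

    zeros-differences : zeros (as ⊖ as) ≡ m
    zeros-differences = trans (∑-product ℤ._+_ as (map ℤ.-_ as) _) (trans (∑-cong as λ x x∈ → trans (∑-map ℤ.-_ as _)
      (trans (∑-ext as λ y → trans ([?]-cong (x ℤ.+ ℤ.- y ℤ.≟ + 0) (x ℤ.≟ y) (ℤ.i-j≡0⇒i≡j x y) ℤ.i≡j⇒i-j≡0) (sym (*-identityʳ [ x ℤ.≟ y ?]))) (∑-δ ℤ._≟_ (λ _ → 1ℚ) u-as x∈))) (∑-1 as))

    zeros-energy : zeros ((as ⊕ as) ⊖ (as ⊕ as)) ≡ E
    zeros-energy = trans (∑-product ℤ._+_ (as ⊕ as) _ _) (trans (∑-product ℤ._+_ as as _) (trans (∑-ext as λ x → ∑-ext as λ y → column (x ℤ.+ y)) (sym (∑-reps (reps as) u-S as+as))))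
      where
      column : ∀ z → ∑ (map ℤ.-_ (as ⊕ as)) (λ y → [ z ℤ.+ y ℤ.≟ + 0 ?]) ≡ reps as z
      column z = trans (∑-map ℤ.-_ (as ⊕ as) _) (trans (∑-product ℤ._+_ as as _) (∑-ext as λ x → ∑-ext as λ y →
        [?]-cong (z ℤ.+ ℤ.- (x ℤ.+ y) ℤ.≟ + 0) (x ℤ.+ y ℤ.≟ z) (λ eq → sym (ℤ.i-j≡0⇒i≡j z (x ℤ.+ y) eq)) (λ eq → ℤ.i≡j⇒i-j≡0 (sym eq))))

    -- Elements of 40A - 40A, each repeated according to its number of representations.
    differences : List ℤ
    differences = sums as 40

    multiplicity : ℤ → ℚ
    multiplicity x = ∑ differences (λ w → [ w ℤ.+ x ℤ.≟ + 0 ?])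

    Dominated : ℤ → Set
    Dominated x = ∀ {r} → r ∈ downFrom N → θ * (m * m) ≤ p (+ r) → a ≤ b * c (+ r ℤ.* x)

    differences-bounded : Bounded (80 ℕ.* K) differences
    differences-bounded = subst (λ k → Bounded k differences) (l K) (bounded-sums 40 as-bounded)
      where
      l : ∀ K → 40 ℕ.* (K ℕ.+ K) ≡ 80 ℕ.* K
      l = ℕ-Solver.solve-∀

    -- By `orthogonality`, the sums over all frequencies of the intensity, of its square and of its
    -- 40th power times the character at x become m, the additive energy and the number of
    -- representations of -x. The comparison of the three is `pointwise`, term by term.
    popular : ∀ {x} → ℤ.∣ x ∣ ℕ.≤ 160 ℕ.* K → Dominated x → Λ * (m * (m * m) ^ 39) ≤ 2ℚ * b * multiplicity x
    popular {x} x≤ dominated = conclude (full p) (full (λ r → p r * p r)) (full (λ r → p r ^ 40 * c (r ℤ.* x))) (multiplicity x)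
        (subst₂ _≤_ (cong₂ (λ z l → N′ * z - 12ℚ * l) zeros-differences (count-⊖ as as)) (∑-ext (downFrom N) λ r → Fc-⊖ (+ r) as) (proj₁ first))
        (subst₂ _≤_ (∑-ext (downFrom N) λ r → Fc-⊖ (+ r) as) (cong₂ (λ z l → N′ * z + 12ℚ * l) zeros-differences (count-⊖ as as)) (proj₂ first))
        (subst₂ _≤_ (cong₂ (λ z l → N′ * z - 12ℚ * l) zeros-energy (trans (count-⊖ (as ⊕ as) (as ⊕ as)) (cong₂ _*_ (count-⊕ as as) (count-⊕ as as))))
          (∑-ext (downFrom N) λ r → trans (Fc-⊖ (+ r) (as ⊕ as)) (intensity-⊕ (+ r) as)) (proj₁ second))
        (subst₂ _≤_ (∑-ext (downFrom N) λ r → F-translated (+ r)) (cong₂ (λ z l → N′ * z + 12ℚ * l) (∑-map (ℤ._+ x) differences _) (trans (cong ιₙ (length-map (ℤ._+ x) differences)) (count-sums as 40))) (proj₂ third))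
        0≤Λ assembled
      where
      first = orthogonality {as ⊖ as} (reach 2 (ℕ.≤ᵇ⇒≤ 2 240 _) (subst (λ k → Bounded k (as ⊖ as)) (cong (K ℕ.+_) (sym (ℕ.+-identityʳ K))) (bounded-⊖ {as} {as} as-bounded as-bounded)))
      second = orthogonality {(as ⊕ as) ⊖ (as ⊕ as)} (reach 4 (ℕ.≤ᵇ⇒≤ 4 240 _) (subst (λ k → Bounded k ((as ⊕ as) ⊖ (as ⊕ as))) (l K)
        (bounded-⊖ {as ⊕ as} {as ⊕ as} (bounded-⊕ {as} {as} as-bounded as-bounded) (bounded-⊕ {as} {as} as-bounded as-bounded))))
        where
        l : ∀ K → K ℕ.+ K ℕ.+ (K ℕ.+ K) ≡ 4 ℕ.* K
        l = ℕ-Solver.solve-∀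
      translated : List ℤ
      translated = map (ℤ._+ x) differences
      third = orthogonality {translated} (reach 240 ℕ.≤-refl λ z∈ → let w , w∈ , eq = ∈-map⁻ (ℤ._+ x) z∈ in
        subst (λ z → ℤ.∣ z ∣ ℕ.≤ 240 ℕ.* K) (sym eq) (ℕ.≤-trans (ℤ.∣i+j∣≤∣i∣+∣j∣ w x) (ℕ.≤-trans (ℕ.+-mono-≤ (differences-bounded w∈) x≤) (ℕ.≤-reflexive (sym (ℕ.*-distribʳ-+ K 80 160))))))
      F-translated : ∀ r → Fc r translated ≡ p r ^ 40 * c (r ℤ.* x)
      F-translated r = trans (∑-map (ℤ._+ x) differences _) (trans (∑-ext differences λ w → trans (cong c (ℤ.*-distribˡ-+ r w x)) (c-+ (r ℤ.* w) (r ℤ.* x)))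
        (trans (∑-+ differences _ _) (trans (cong₂ _+_ (∑-*ʳ differences (c (r ℤ.* x)) _) (trans (∑-neg differences _) (cong -_ (∑-*ʳ differences (s (r ℤ.* x)) _))))
          (trans (cong₂ (λ u v → u * c (r ℤ.* x) + - (v * s (r ℤ.* x))) (proj₁ (F-sums r as 40)) (proj₂ (F-sums r as 40))) (l (p r ^ 40) (c (r ℤ.* x)) (s (r ℤ.* x)))))))
        where
        l : ∀ P u v → P * u + - (0ℚ * v) ≡ P * u
        l = solve-∀ ℚ-ring
      assembled : (a * (ω * M) ^ 39 - (a + b) * (θ * M) ^ 39) * full p + a * ιₙ 39 * (ω * M) ^ 38 * (full (λ r → p r * p r) - ω * M * full p) ≤ b * full (λ r → p r ^ 40 * c (r ℤ.* x))
      assembled = subst₂ _≤_ left (∑-*ˡ (downFrom N) b _) (∑-mono (downFrom N) λ r r∈ →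
        pointwise (p (+ r)) (c (+ r ℤ.* x)) (intensity-nonNeg as (+ r)) (-1≤c (+ r ℤ.* x)) (dominated r∈) (≤⇒0≤ a≤b))
        where
        α β : ℚ
        α = a * (ω * M) ^ 39 - (a + b) * (θ * M) ^ 39
        β = a * ιₙ 39 * (ω * M) ^ 38
        left : ∑ (downFrom N) (λ r → α * p (+ r) + β * (p (+ r) * p (+ r) - ω * M * p (+ r))) ≡ α * full p + β * (full (λ r → p r * p r) - ω * M * full p)
        left = trans (∑-+ (downFrom N) (λ r → α * p (+ r)) _) (cong₂ _+_ (∑-*ˡ (downFrom N) α _) (trans (∑-*ˡ (downFrom N) β _)
          (cong (β *_) (trans (∑-+ (downFrom N) _ _) (cong (λ z → full (λ r → p r * p r) + z) (trans (∑-neg (downFrom N) _) (cong -_ (∑-*ˡ (downFrom N) (ω * M) _))))))))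

    represented : ∀ {x} → 0ℚ < Λ → ℤ.∣ x ∣ ℕ.≤ 160 ℕ.* K → Dominated x → ℤ.- x ∈ differences
    represented {x} 0<Λ x≤ dominated = found differences (popular x≤ dominated)
      where
      found : ∀ X → Λ * (m * (m * m) ^ 39) ≤ 2ℚ * b * ∑ X (λ w → [ w ℤ.+ x ℤ.≟ + 0 ?]) → ℤ.- x ∈ X
      found [] le = contradiction (≤-trans le (≤-reflexive (*-zeroʳ (2ℚ * b)))) (<⇒≱ (*-pos 0<Λ (*-pos 0<m (^-pos 39 (*-pos 0<m 0<m)))))
      found (w ∷ ws) le with w ℤ.+ x ℤ.≟ + 0
      ... | yes eq = here (trans (sym (ℤ.+-identityˡ (ℤ.- x))) (trans (cong (ℤ._- x) (sym eq)) (l w x)))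
        where
        l : ∀ w x → w ℤ.+ x ℤ.- x ≡ w
        l = ℤ-Solver.solve-∀
      ... | no _ = there (found ws (≤-trans le (≤-reflexive (cong (2ℚ * b *_) (+-identityˡ _)))))

    -- Every point of the ball has at least Λ m^79 / (2b) representations, and there are only m^80
    -- in all.
    ball-size : ∀ {B} → Unique B → (∀ {x} → x ∈ B → ℤ.∣ x ∣ ℕ.≤ 160 ℕ.* K × Dominated x) → Λ * ιₙ (length B) ≤ 2ℚ * b * m
    ball-size {B} u-B B-ball = *-cancelʳ-≤ {m * M ^ 39} {Λ * ιₙ (length B)} {2ℚ * b * m} (*-pos 0<m (^-pos 39 (*-pos 0<m 0<m))) (begin
      Λ * ιₙ (length B) * (m * M ^ 39) ≡⟨ l Λ (ιₙ (length B)) (m * M ^ 39) ⟩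
      ιₙ (length B) * (Λ * (m * M ^ 39)) ≡⟨ ∑-const B _ ⟨
      ∑ B (λ _ → Λ * (m * M ^ 39)) ≤⟨ ∑-mono B (λ x x∈ → popular (proj₁ (B-ball x∈)) (proj₂ (B-ball x∈))) ⟩
      ∑ B (λ x → 2ℚ * b * multiplicity x) ≡⟨ ∑-*ˡ B (2ℚ * b) multiplicity ⟩
      2ℚ * b * ∑ B multiplicity ≤⟨ *-mono-≤ˡ (*-nonNeg (nonNegative⁻¹ 2ℚ) (≤-trans 0≤a a≤b)) total ⟩
      2ℚ * b * M ^ 40 ≡⟨ l′ (2ℚ * b) m (M ^ 39) ⟩
      2ℚ * b * m * (m * M ^ 39) ∎)
      where
      open ≤-Reasoning
      l : ∀ a b d → a * b * d ≡ b * (a * d)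
      l = solve-∀ ℚ-ring
      l′ : ∀ c m z → c * (m * m * z) ≡ c * m * (m * z)
      l′ = solve-∀ ℚ-ring
      total : ∑ B multiplicity ≤ M ^ 40
      total = ≤-trans (≤-reflexive (∑-swap B differences _)) (≤-trans (∑-mono differences λ w _ →
        ≤-trans (∑-mono B λ x _ → [?]-mono (w ℤ.+ x ℤ.≟ + 0) (ℤ.- w ℤ.≟ x) (λ eq → trans (sym (ℤ.+-identityʳ (ℤ.- w))) (trans (cong (ℤ._+_ (ℤ.- w)) (sym eq)) (e w x)))) (∑-δ-≤1 ℤ._≟_ (ℤ.- w) u-B))
        (≤-reflexive (trans (∑-1 differences) (count-sums as 40))))
        where
        e : ∀ w x → ℤ.- w ℤ.+ (w ℤ.+ x) ≡ x
        e = ℤ-Solver.solve-∀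

-- Centred residues compared with chords

module Centred where

  open import Data.Integer.Base as ℤ using (ℤ; +_; -[1+_])
  open import Data.Integer.Base using (∣_∣)
  open import Data.Integer.DivMod using (_%ℕ_; n%ℕd<d)
  open import Data.Rational.Base hiding (∣_∣)
  open import Data.Rational.Properties
  open RationalOrder
  open Rotations using (2ℚ; 8ℚ; 64ℚ; 1024ℚ)
  open Residue
  open Characters

  ι∣∣² : ∀ i → ι i * ι i ≡ ιₙ ∣ i ∣ * ιₙ ∣ i ∣
  ι∣∣² (+ n) = refl
  ι∣∣² -[1+ n ] = trans (cong₂ _*_ (ι-neg (+ suc n)) (ι-neg (+ suc n))) (l (ιₙ (suc n)))
    where
    l : ∀ a → (- a) * (- a) ≡ a * a
    l = solve-∀ ℚ-ring

  module Centring (𝒞 : Circle) where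
    open Circle 𝒞

    opaque
      centred : ℤ → ℤ
      centred i = + ((i ℤ.+ + (2 ℕ.* q)) %ℕ N) ℤ.- + (2 ℕ.* q)

      centred-mod : ∀ i → centred i ≡ i [mod N ]
      centred-mod i = mod-trans (mod-+ (mod-sym (%-mod N (i ℤ.+ + (2 ℕ.* q)))) (mod-refl (ℤ.- + (2 ℕ.* q)))) (mod-≡ (l i (+ (2 ℕ.* q))))
        where
        l : ∀ i h → i ℤ.+ h ℤ.- h ≡ i
        l = ℤ-Solver.solve-∀

      ∣centred∣≤ : ∀ i → ∣ centred i ∣ ℕ.≤ 2 ℕ.* q
      ∣centred∣≤ i = subst (ℕ._≤ 2 ℕ.* q) (sym (cong ∣_∣ (ℤ.m-n≡m⊖n k (2 ℕ.* q)))) (distance k (2 ℕ.* q) (subst (k ℕ.<_) (l q) (n%ℕd<d (i ℤ.+ + (2 ℕ.* q)) N)))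
        where
        k : ℕ
        k = (i ℤ.+ + (2 ℕ.* q)) %ℕ N
        l : ∀ q → 4 ℕ.* q ≡ 2 ℕ.* q ℕ.+ 2 ℕ.* q
        l = ℕ-Solver.solve-∀
        distance : ∀ k h → k ℕ.< h ℕ.+ h → ∣ k ℤ.⊖ h ∣ ℕ.≤ h
        distance k h k< with ℕ.≤-total h k
        ... | inj₁ h≤k = subst (ℕ._≤ h) (sym (trans (cong ∣_∣ (ℤ.⊖-≥ h≤k)) refl)) (ℕ.+-cancelʳ-≤ h _ _ (subst (ℕ._≤ h ℕ.+ h) (sym (ℕ.m∸n+n≡m h≤k)) (ℕ.<⇒≤ k<)))
        ... | inj₂ k≤h = subst (ℕ._≤ h) (sym (ℤ.∣⊖∣-≤ k≤h)) (ℕ.m∸n≤m h k)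

    centred-unique : ∀ i {y} → y ≡ i [mod N ] → 2 ℕ.* ∣ y ∣ ℕ.< N → centred i ≡ y
    centred-unique i {y} y≡ y< = mod-unique (mod-trans (centred-mod i) (mod-sym y≡)) (ℕ.*-cancelˡ-< 2 _ _ (ℕ.≤-<-trans (ℕ.*-monoʳ-≤ 2 (ℤ.∣i-j∣≤∣i∣+∣j∣ (centred i) y))
      (subst₂ ℕ._<_ (l₁ ∣ centred i ∣ (∣ y ∣)) (l₂ q) (ℕ.+-mono-≤-< (ℕ.*-monoʳ-≤ 2 (∣centred∣≤ i)) y<))))
      where
      l₁ : ∀ a b → 2 ℕ.* a ℕ.+ 2 ℕ.* b ≡ 2 ℕ.* (a ℕ.+ b)
      l₁ = ℕ-Solver.solve-∀
      l₂ : ∀ q → 2 ℕ.* (2 ℕ.* q) ℕ.+ 4 ℕ.* q ≡ 2 ℕ.* (4 ℕ.* q)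
      l₂ = ℕ-Solver.solve-∀

    -- ∣z w - 1∣² ≤ 2 ∣z - 1∣² + 2 ∣w - 1∣² for z and w on the unit circle.
    κ-+ : ∀ i j → κ (i ℤ.+ j) ≤ 2ℚ * κ i + 2ℚ * κ j
    κ-+ i j = ≤-by ((c i + c j - 2ℚ) * (c i + c j - 2ℚ) + (s j - s i) * (s j - s i)) (+-nonNeg (sq-nonNeg (c i + c j - 2ℚ)) (sq-nonNeg (s j - s i)))
      (trans (l₁ (c i) (c j)) (trans (cong₂ (λ u v → u + v + (1ℚ + 1ℚ) + (1ℚ + 1ℚ + 1ℚ + 1ℚ) * (1ℚ - c i - c j)) (sym (unit i)) (sym (unit j)))
        (trans (l₂ (c i) (s i) (c j) (s j)) (cong (λ z → 2ℚ * (1ℚ - z) + ((c i + c j - 2ℚ) * (c i + c j - 2ℚ) + (s j - s i) * (s j - s i))) (sym (c-+ i j))))))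
      where
      l₁ : ∀ c d → 2ℚ * (2ℚ * (1ℚ - c)) + 2ℚ * (2ℚ * (1ℚ - d)) ≡ 1ℚ + 1ℚ + (1ℚ + 1ℚ) + (1ℚ + 1ℚ + 1ℚ + 1ℚ) * (1ℚ - c - d)
      l₁ = solve-∀ ℚ-ring
      l₂ : ∀ c s d t → (c * c + s * s) + (d * d + t * t) + (1ℚ + 1ℚ) + (1ℚ + 1ℚ + 1ℚ + 1ℚ) * (1ℚ - c - d) ≡
           2ℚ * (1ℚ - (c * d - s * t)) + ((c + d - 2ℚ) * (c + d - 2ℚ) + (t - s) * (t - s))
      l₂ = solve-∀ ℚ-ring

    turns : ∀ i W → ∣ i ∣ ℕ.≤ W ℕ.* N → ∃[ k ] (i ≡ centred i ℤ.+ + N ℤ.* k × ∣ k ∣ ℕ.≤ suc W)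
    turns i W i≤ = k , i≡ , bound
      where
      d = centred-mod i
      open _≡_[mod_] (mod-sym d) renaming (quotient to k; equality to eq)
      i≡ : i ≡ centred i ℤ.+ + N ℤ.* k
      i≡ = trans eq (cong (λ z → centred i ℤ.+ z) (ℤ.*-comm k (+ N)))
      bound : ∣ k ∣ ℕ.≤ suc W
      bound = ℕ.*-cancelʳ-≤ ∣ k ∣ (suc W) N {{N≢0}} (begin
        ∣ k ∣ ℕ.* N ≡⟨ ℤ.abs-* k (+ N) ⟨
        ∣ k ℤ.* + N ∣ ≡⟨ cong ∣_∣ (trans (l (centred i) (k ℤ.* + N)) (cong (ℤ._- centred i) (sym eq))) ⟩
        ∣ i ℤ.- centred i ∣ ≤⟨ ℤ.∣i-j∣≤∣i∣+∣j∣ i (centred i) ⟩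
        ∣ i ∣ ℕ.+ ∣ centred i ∣ ≤⟨ ℕ.+-mono-≤ i≤ (ℕ.≤-trans (∣centred∣≤ i) (ℕ.*-monoˡ-≤ q (ℕ.≤ᵇ⇒≤ 2 4 _))) ⟩
        W ℕ.* N ℕ.+ N ≡⟨ ℕ.+-comm (W ℕ.* N) N ⟩
        suc W ℕ.* N ∎)
        where
        open ℕ.≤-Reasoning
        l : ∀ a b → b ≡ a ℤ.+ b ℤ.- a
        l = ℤ-Solver.solve-∀

    private
      n : ℚ
      n = ιₙ N

      sum-bound : ∀ {i j x y} → n * n * κ i ≤ x → n * n * κ j ≤ y → n * n * κ (i ℤ.+ j) ≤ 2ℚ * x + 2ℚ * y
      sum-bound {i} {j} {x} {y} p r = ≤-trans (*-mono-≤ˡ (sq-nonNeg n) (κ-+ i j)) (≤-trans (≤-reflexive (l (n * n) (κ i) (κ j)))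
        (+-mono-≤ (*-mono-≤ˡ (nonNegative⁻¹ 2ℚ) p) (*-mono-≤ˡ (nonNegative⁻¹ 2ℚ) r)))
        where
        l : ∀ n a b → n * (2ℚ * a + 2ℚ * b) ≡ 2ℚ * (n * a) + 2ℚ * (n * b)
        l = solve-∀ ℚ-ring

      turn-bound : ∀ k W → ∣ k ∣ ℕ.≤ suc W → n * n * κ (+ N ℤ.* k) ≤ 1024ℚ * (ιₙ (suc W) * ιₙ (suc W))
      turn-bound k W k≤ = ≤-trans (κ-turn k) (*-mono-≤ˡ (nonNegative⁻¹ 1024ℚ) (≤-trans (≤-reflexive (ι∣∣² k)) (sq-mono-≤ (ιₙ-nonNeg ∣ k ∣) (ιₙ-mono-≤ k≤))))

    -- Dropping whole turns changes a chord by an amount governed by their number, which W bounds;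
    -- against N² this is negligible. With its converse `centred-from-κ`, this links the characters
    -- to the phases of the lattice argument.
    κ-from-centred : ∀ i W → ∣ i ∣ ℕ.≤ W ℕ.* N → n * n * κ i ≤ 2ℚ * (64ℚ * (ιₙ ∣ centred i ∣ * ιₙ ∣ centred i ∣)) + 2ℚ * (1024ℚ * (ιₙ (suc W) * ιₙ (suc W)))
    κ-from-centred i W i≤ = let k , i≡ , k≤ = turns i W i≤ in
      subst (λ z → n * n * κ z ≤ 2ℚ * (64ℚ * (ιₙ ∣ centred i ∣ * ιₙ ∣ centred i ∣)) + 2ℚ * (1024ℚ * (ιₙ (suc W) * ιₙ (suc W)))) (sym i≡)
        (sum-bound {centred i} (subst (λ z → n * n * κ (centred i) ≤ 64ℚ * z) (ι∣∣² (centred i)) (κ-upper (centred i))) (turn-bound k W k≤))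

    centred-from-κ : ∀ i W → ∣ i ∣ ℕ.≤ W ℕ.* N → 8ℚ * (ιₙ ∣ centred i ∣ * ιₙ ∣ centred i ∣) ≤ 2ℚ * (n * n * κ i) + 2ℚ * (1024ℚ * (ιₙ (suc W) * ιₙ (suc W)))
    centred-from-κ i W i≤ = let k , i≡ , k≤ = turns i W i≤ in
      ≤-trans (≤-trans (≤-reflexive (cong (8ℚ *_) (sym (ι∣∣² (centred i))))) (κ-lower (centred i) (∣centred∣≤ i)))
        (subst (λ z → n * n * κ z ≤ 2ℚ * (n * n * κ i) + 2ℚ * (1024ℚ * (ιₙ (suc W) * ιₙ (suc W)))) (trans (cong (ℤ._+ + N ℤ.* ℤ.- k) i≡) (l (centred i) (+ N) k))
          (sum-bound {i} ≤-refl (turn-bound (ℤ.- k) W (subst (ℕ._≤ suc W) (sym (ℤ.∣-i∣≡∣i∣ k)) k≤))))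
      where
      l : ∀ a n k → a ℤ.+ n ℤ.* k ℤ.+ n ℤ.* ℤ.- k ≡ a
      l = ℤ-Solver.solve-∀

-- The choice of constants and the Bohr set of the large spectrum

module Structure where

  open import Data.Integer.Base as ℤ using (ℤ; +_)
  open import Data.Integer.Base using (∣_∣)
  open import Data.Nat.DivMod using (m/n*n≤m; m*n/n≡m; /-monoˡ-≤)
  open import Data.Rational.Base hiding (∣_∣)
  open import Data.Rational.Properties
  open RationalOrder
  open ListSum
  open Rotations using (2ℚ; 8ℚ; 64ℚ; 1024ℚ)
  open Residue
  open Characters
  open AlmostPeriods
  open Lattice
  open Energy using (Sumset; reps; energy-bound)
  open Bogolyubov
  open Centred

  module Closeness (𝒞 : Circle) where
    open Circle 𝒞
    open Centring 𝒞

    private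
      n : ℚ
      n = ιₙ N

      0<n : 0ℚ < n
      0<n = subst (_< n) (ι-def (+ 0)) (ιₙ-mono-< (ℕ.≤-trans 1≤q (ℕ.m≤m+n q _)))

      square-≤ : ∀ k l → k ℕ.* l ℕ.≤ N → ιₙ k * ιₙ k * (ιₙ l * ιₙ l) ≤ n * n
      square-≤ k l p = ≤-trans (≤-reflexive (e (ιₙ k) (ιₙ l))) (sq-mono-≤ (*-nonNeg (ιₙ-nonNeg k) (ιₙ-nonNeg l)) (subst (_≤ n) (ιₙ-* k l) (ιₙ-mono-≤ p)))
        where
        e : ∀ k l → k * k * (l * l) ≡ k * l * (k * l)
        e = solve-∀ ℚ-ring

      2≡ : 2ℚ ≡ ιₙ 2
      2≡ = sym (ι-def (+ 2))
      8≡ : 8ℚ ≡ ιₙ 8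
      8≡ = sym (ι-def (+ 8))
      64≡ : 64ℚ ≡ ιₙ 64
      64≡ = sym (ι-def (+ 64))
      1024≡ : 1024ℚ ≡ ιₙ 1024
      1024≡ = sym (ι-def (+ 1024))

    -- In units of N², the claim asks for 8 D² f² ≤ 8, where f is the modulus of the centred
    -- residue. The chord contributes 2 · 4000 / 1001 and the turns at most 2 / 1024; the factor
    -- 1001 in place of 1000 makes room for the latter.
    near-from-κ : ∀ i W D t → ∣ i ∣ ℕ.≤ W ℕ.* N → 1024 ℕ.* (D ℕ.* suc W) ℕ.≤ N → 1001 ℕ.* (D ℕ.* D) ℕ.≤ t → κ i * ιₙ t ≤ 4000ℚ → D ℕ.* ∣ centred i ∣ ℕ.≤ N
    near-from-κ i W D t i≤ large t≥ close = ιₙ-cancel-≤ (subst (_≤ n) (sym (ιₙ-* D ∣ centred i ∣)) (sq-cancel-≤ {n} {d * f} (ιₙ-nonNeg N)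
      (*-cancelʳ-≤ {8ℚ * a} {d * f * (d * f)} {n * n} (*-pos (positive⁻¹ 8ℚ) (ιₙ-pos 1000)) (0≤⇒≤ (subst (0ℚ ≤_) (e 8ℚ a b C d f n w (κ i))
        (+-nonNeg (+-nonNeg (+-nonNeg (+-nonNeg (*-nonNeg (*-nonNeg (ιₙ-nonNeg 1001) (sq-nonNeg d)) (≤⇒0≤ (subst (λ z → 8ℚ * (f * f) ≤ 2ℚ * (n * n * κ i) + 2ℚ * (z * (w * w))) 1024≡ (centred-from-κ i W i≤))))
          (*-nonNeg (*-nonNeg (nonNegative⁻¹ 2ℚ) (sq-nonNeg n)) (≤⇒0≤ adκ)))
          (*-nonNeg (nonNegative⁻¹ 2ℚ) (≤⇒0≤ b²≤)))
          (*-nonNeg (≤⇒0≤ ab) (sq-nonNeg (d * w))))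
          (*-nonNeg (≤⇒0≤ slack) (sq-nonNeg n))))))))
      where
      f d w T a b C : ℚ
      f = ιₙ ∣ centred i ∣
      d = ιₙ D
      w = ιₙ (suc W)
      T = ιₙ t
      a = ιₙ 1001
      b = ιₙ 1024
      C = ιₙ 4000
      e : ∀ g a b C d f n w k → a * (d * d) * (2ℚ * (n * n * k) + 2ℚ * (b * (w * w)) - g * (f * f)) + 2ℚ * (n * n) * (C - a * (d * d) * k) + 2ℚ * (n * n - b * b * (d * w * (d * w)))
                                + (2ℚ * (b * b) - 2ℚ * (a * b)) * (d * w * (d * w)) + (g * a - (2ℚ * C + 2ℚ)) * (n * n)
                                ≡ n * n * (g * a) - d * f * (d * f) * (g * a)
      e = solve-∀ ℚ-ring
      adκ : a * (d * d) * κ i ≤ C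
      adκ = ≤-trans (*-mono-≤ʳ {κ i} (*-nonNeg (nonNegative⁻¹ 2ℚ) (≤⇒0≤ (c≤1 i))) (subst (_≤ T) (trans (ιₙ-* 1001 (D ℕ.* D)) (cong (a *_) (ιₙ-* D D))) (ιₙ-mono-≤ t≥)))
        (≤-trans (≤-reflexive (*-comm T (κ i))) (≤-trans close (≤-reflexive (sym (ι-def (+ 4000))))))
      b²≤ : b * b * (d * w * (d * w)) ≤ n * n
      b²≤ = subst (λ z → b * b * (z * z) ≤ n * n) (ιₙ-* D (suc W)) (square-≤ 1024 (D ℕ.* suc W) large)
      ab : 2ℚ * (a * b) ≤ 2ℚ * (b * b)
      ab = *-mono-≤ˡ (nonNegative⁻¹ 2ℚ) (*-mono-≤ʳ (ιₙ-nonNeg 1024) (numeral-≤ (# 1001) (# 1024)))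
      slack : 2ℚ * C + 2ℚ ≤ 8ℚ * a
      slack = subst₂ (λ x y → x * C + x ≤ y * a) (sym 2≡) (sym 8≡) (numeral-≤ (# 2 ⊠ # 4000 ⊞ # 2) (# 8 ⊠ # 1001))

    -- A residue of at most N / 100 and the discarded turns give κ at most 0.0128 + 0.002, well
    -- below the value 0.04 at which the cosine is 0.98.
    near-dominates : ∀ i W → ∣ i ∣ ℕ.≤ W ℕ.* N → 1024 ℕ.* suc W ℕ.≤ N → 100 ℕ.* ∣ centred i ∣ ℕ.≤ N → ιₙ 98 ≤ ιₙ 100 * c i
    near-dominates i W i≤ large near = 0≤⇒≤ (*-cancelʳ-≤ {n * n} {0ℚ} (*-pos 0<n 0<n) (subst (_≤ (ιₙ 100 * c i - ιₙ 98) * (n * n)) (sym (*-zeroˡ (n * n)))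
      (subst (0ℚ ≤_) total (+-nonNeg (+-nonNeg (+-nonNeg (+-nonNeg (*-nonNeg (ιₙ-nonNeg 50) (≤⇒0≤ (subst₂ (λ y z → n * n * κ i ≤ 2ℚ * (y * (f * f)) + 2ℚ * (z * (w * w))) 64≡ 1024≡ (κ-from-centred i W i≤))))
          (≤⇒0≤ (square-≤ 100 ∣ centred i ∣ near))) (≤⇒0≤ (square-≤ 1024 (suc W) large)))
          (*-nonNeg (≤⇒0≤ slack₁) (sq-nonNeg f))) (*-nonNeg (≤⇒0≤ slack₂) (sq-nonNeg w))))))
      where
      f w : ℚ
      f = ιₙ ∣ centred i ∣
      w = ιₙ (suc W)
      e : ∀ h x y a b f n w c → h * (2ℚ * (x * (f * f)) + 2ℚ * (y * (w * w)) - n * n * (2ℚ * (1ℚ - c))) + (n * n - a * a * (f * f)) + (n * n - b * b * (w * w)) + (a * a - h * (2ℚ * x)) * (f * f) + (b * b - h * (2ℚ * y)) * (w * w)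
                            ≡ (2ℚ - 2ℚ * h * (1ℚ - c)) * (n * n)
      e = solve-∀ ℚ-ring
      100≡ : 2ℚ * ιₙ 50 ≡ ιₙ 100
      100≡ = trans (cong (_* ιₙ 50) 2≡) (sym (ιₙ-* 2 50))
      total : ιₙ 50 * (2ℚ * (ιₙ 64 * (f * f)) + 2ℚ * (ιₙ 1024 * (w * w)) - n * n * κ i) + (n * n - ιₙ 100 * ιₙ 100 * (f * f)) + (n * n - ιₙ 1024 * ιₙ 1024 * (w * w))
              + (ιₙ 100 * ιₙ 100 - ιₙ 50 * (2ℚ * ιₙ 64)) * (f * f) + (ιₙ 1024 * ιₙ 1024 - ιₙ 50 * (2ℚ * ιₙ 1024)) * (w * w) ≡ (ιₙ 100 * c i - ιₙ 98) * (n * n)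
      total = trans (e (ιₙ 50) (ιₙ 64) (ιₙ 1024) (ιₙ 100) (ιₙ 1024) f n w (c i)) (cong (_* (n * n)) (trans (cong (λ z → 2ℚ - z * (1ℚ - c i)) (trans 100≡ (trans (ιₙ-+ 98 2) (cong (λ z → ιₙ 98 + z) (sym 2≡)))))
        (trans (l (ιₙ 98) (c i)) (cong (λ z → z * c i - ιₙ 98) (trans (cong (λ z → ιₙ 98 + z) 2≡) (sym (ιₙ-+ 98 2)))))))
        where
        l : ∀ x c → 2ℚ - (x + 2ℚ) * (1ℚ - c) ≡ (x + 2ℚ) * c - x
        l = solve-∀ ℚ-ring
      slack₁ : ιₙ 50 * (2ℚ * ιₙ 64) ≤ ιₙ 100 * ιₙ 100
      slack₁ = subst (λ z → ιₙ 50 * (z * ιₙ 64) ≤ ιₙ 100 * ιₙ 100) (sym 2≡) (numeral-≤ (# 50 ⊠ (# 2 ⊠ # 64)) (# 100 ⊠ # 100))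
      slack₂ : ιₙ 50 * (2ℚ * ιₙ 1024) ≤ ιₙ 1024 * ιₙ 1024
      slack₂ = subst (λ z → ιₙ 50 * (z * ιₙ 1024) ≤ ιₙ 1024 * ιₙ 1024) (sym 2≡) (numeral-≤ (# 50 ⊠ (# 2 ⊠ # 1024)) (# 1024 ⊠ # 1024))

  -- The kernel errors in the field `N-large` of `Averages`, per element of the set, for a = 98 and
  -- b = 100.
  junk : ℚ
  junk = 12ℚ * ιₙ 98 + 2ℚ * 12ℚ * (ιₙ 98 * ιₙ 39) + 12ℚ * ιₙ 100

  -- All of this is fixed before the set is given. Samples of length `t` give clusters of density 1
  -- / P at radius N / 200; `Q` is so large that Q + 1 translates of such a cluster overfill the
  -- ball; `D` is so large that Q multiples of a point of radius N / D stay inside it; `t₁` and `P₁`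
  -- repeat `t` and `P` at that radius.
  record Constants : Set where
    field
      ω θ Λ : ℚ
      0≤ω : 0ℚ ≤ ω
      ω≤1 : ω ≤ 1ℚ
      0≤θ : 0ℚ ≤ θ
      0<Λ : 0ℚ < Λ
      Λ≡ : Λ ≡ ιₙ 98 * ω ^ 39 - (ιₙ 98 + ιₙ 100) * θ ^ 39
      ω≡ : ιₙ 100000 * ω ≡ ιₙ 25480
      θ≡ : ιₙ 100000 * ιₙ 100000 * θ ≡ ιₙ 50010 * ιₙ 50010
      G : ℕ
      G≥ : 2ℚ * junk ≤ Λ * ιₙ G
      t P : ℕ
      t≥ : 1001 ℕ.* (200 ℕ.* 200) ℕ.≤ t
      P≥ : 2ℚ * 5ℚ ^ t ≤ ιₙ P
      Q : ℕ
      Q≥ : 2ℚ * ιₙ 100 * (ιₙ 100000 * ιₙ P) < ιₙ (suc Q) * Λ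
      D : ℕ
      D≥ : 2000 ℕ.* suc Q ℕ.≤ D
      t₁ P₁ : ℕ
      t₁≥ : 1001 ℕ.* (D ℕ.* D) ℕ.≤ t₁
      P₁≥ : 2ℚ * 5ℚ ^ t₁ ≤ ιₙ P₁

  opaque
    required-N : Constants → ℕ → ℕ → ℕ
    required-N 𝒦 m K = Constants.G 𝒦 ℕ.* m ℕ.+ 10000000 ℕ.* (Constants.D 𝒦 ℕ.* suc (160 ℕ.* K))

    G*m≤required-N : ∀ 𝒦 m K → Constants.G 𝒦 ℕ.* m ℕ.≤ required-N 𝒦 m K
    G*m≤required-N 𝒦 m K = ℕ.m≤m+n (Constants.G 𝒦 ℕ.* m) _

    W≤required-N : ∀ 𝒦 m K → 10000000 ℕ.* (Constants.D 𝒦 ℕ.* suc (160 ℕ.* K)) ℕ.≤ required-N 𝒦 m K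
    W≤required-N 𝒦 m K = ℕ.m≤n+m _ (Constants.G 𝒦 ℕ.* m)

  record Configuration : Set where
    field
      𝒦 : Constants
      𝒞 : Circle
      as S : List ℤ
      u-as : Unique as
      u-S : Unique S
      as+as : ∀ {a b} → a ∈ as → b ∈ as → a ℤ.+ b ∈ S
      m-large : 100000 ℕ.≤ length as
      doubling : ιₙ 100000 * ιₙ (length S) ≤ ιₙ 400001 * ιₙ (length as)
      K : ℕ
      as-bounded : Bounded K as
      N-large : required-N 𝒦 (length as) K ℕ.≤ Circle.N 𝒞

  module Setting (configuration : Configuration) where
    open Configuration configuration
    open Constants 𝒦
    open Circle 𝒞
    open Transform 𝒞
    open Centring 𝒞
    open Closeness 𝒞

    nonempty : 1 ℕ.≤ length as
    nonempty = ℕ.≤-trans (ℕ.≤ᵇ⇒≤ 1 100000 _) m-large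

    m : ℚ
    m = ιₙ (length as)

    0<m : 0ℚ < m
    0<m = subst (_< m) (ι-def (+ 0)) (ιₙ-mono-< nonempty)

    2000≤D : 2000 ℕ.≤ D
    2000≤D = ℕ.≤-trans (ℕ.m≤m*n 2000 (suc Q)) D≥

    instance
      D≢0 : ℕ.NonZero D
      D≢0 = ℕ.>-nonZero (ℕ.≤-trans (ℕ.≤ᵇ⇒≤ 1 2000 _) 2000≤D)

    N-large′ : 10000000 ℕ.* (D ℕ.* suc (160 ℕ.* K)) ℕ.≤ N
    N-large′ = ℕ.≤-trans (W≤required-N 𝒦 (length as) K) N-large

    W<N : ∀ k d → k ℕ.≤ 10000000 → d ℕ.≤ D → k ℕ.* (d ℕ.* suc (160 ℕ.* K)) ℕ.≤ N
    W<N k d k≤ d≤ = ℕ.≤-trans (ℕ.*-mono-≤ k≤ (ℕ.*-monoˡ-≤ (suc (160 ℕ.* K)) d≤)) N-large′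

    K-small : 240 ℕ.* K ℕ.≤ 2 ℕ.* q
    K-small = ℕ.*-cancelˡ-≤ 2 (begin
      2 ℕ.* (240 ℕ.* K) ≡⟨ l₁ K ⟩
      3 ℕ.* (160 ℕ.* K) ≤⟨ ℕ.*-monoʳ-≤ 3 (ℕ.≤-trans (ℕ.n≤1+n (160 ℕ.* K)) (ℕ.≤-reflexive (sym (ℕ.*-identityˡ (suc (160 ℕ.* K)))))) ⟩
      3 ℕ.* (1 ℕ.* suc (160 ℕ.* K)) ≤⟨ W<N 3 1 (ℕ.≤ᵇ⇒≤ 3 10000000 _) (ℕ.≤-trans (ℕ.≤ᵇ⇒≤ 1 2000 _) 2000≤D) ⟩
      4 ℕ.* q ≡⟨ l₂ q ⟩
      2 ℕ.* (2 ℕ.* q) ∎)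
      where
      open ℕ.≤-Reasoning
      l₁ : ∀ K → 2 ℕ.* (240 ℕ.* K) ≡ 3 ℕ.* (160 ℕ.* K)
      l₁ K = trans (sym (ℕ.*-assoc 2 240 K)) (ℕ.*-assoc 3 160 K)
      l₂ : ∀ q → 4 ℕ.* q ≡ 2 ℕ.* (2 ℕ.* q)
      l₂ q = ℕ.*-assoc 2 2 q

    -- Representatives r between 0 and `N` keep r x below W N, which bounds the number of turns lost
    -- by centring.
    frequencies : List ℤ
    frequencies = filter (λ r → θ * (m * m) ≤? intensity as r) (map +_ (downFrom N))

    frequency : ∀ {r} → r ∈ frequencies → (∃[ k ] (k ℕ.< N × r ≡ + k)) × θ * (m * m) ≤ intensity as r
    frequency r∈ = let p , big = ∈-filter⁻ (λ r → θ * (m * m) ≤? intensity as r) {xs = map +_ (downFrom N)} r∈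
                       k , k∈ , eq = ∈-map⁻ +_ p in (k , ∈-downFrom⁻ k∈ , eq) , big

    frequency-bound : ∀ {r x W} → r ∈ frequencies → ∣ x ∣ ℕ.≤ W → ∣ r ℤ.* x ∣ ℕ.≤ W ℕ.* N
    frequency-bound {x = x} {W} r∈ x≤ with proj₁ (frequency r∈)
    ... | k , k<N , refl = ℕ.≤-trans (ℕ.≤-reflexive (trans (ℤ.abs-* (+ k) x) (ℕ.*-comm k ∣ x ∣))) (ℕ.*-mono-≤ x≤ (ℕ.<⇒≤ k<N))

    φ : ℤ → ℤ → ℤ
    φ r x = centred (r ℤ.* x)

    energy : ω * (m * m * m) ≤ ∑ S (λ y → reps as y * reps as y)
    energy = *-cancelʳ-≤ {ιₙ 100000} {ω * (m * m * m)} (ιₙ-pos 99999) (≤-trans (≤-reflexive (trans (l ω (m * m * m) (ιₙ 100000)) (cong (_* (m * m * m)) ω≡)))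
      (≤-trans (energy-bound u-as u-S as+as m-large doubling) (≤-reflexive (*-comm (ιₙ 100000) _))))
      where
      l : ∀ w x u → w * x * u ≡ u * w * x
      l = solve-∀ ℚ-ring

    sumset : Sumset
    sumset = record { as = as ; S = S ; u-as = u-as ; u-S = u-S ; as+as = as+as ; nonempty = nonempty }

    ball-data : BallData 𝒞 sumset
    ball-data = record
      { K = K ; as-bounded = as-bounded ; K-small = K-small ; ω = ω ; θ = θ ; Λ = Λ ; a = ιₙ 98 ; b = ιₙ 100 ; 0≤ω = 0≤ω ; ω≤1 = ω≤1 ; 0≤θ = 0≤θ
      ; 0≤a = ιₙ-nonNeg 98 ; a≤b = ιₙ-mono-≤ (ℕ.≤ᵇ⇒≤ 98 100 _) ; 0≤Λ = <⇒≤ 0<Λ ; Λ≡ = Λ≡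
      ; N-large = ≤-trans (≤-trans (≤-reflexive (sym (*-assoc 2ℚ junk m))) (*-mono-≤ʳ (<⇒≤ 0<m) G≥)) (≤-trans (≤-reflexive (trans (*-assoc Λ (ιₙ G) m) (cong (Λ *_) (sym (ιₙ-* G (length as))))))
          (*-mono-≤ˡ (<⇒≤ 0<Λ) (ιₙ-mono-≤ (ℕ.≤-trans (G*m≤required-N 𝒦 (length as) K) N-large))))
      ; energy = energy }

    open Ball 𝒞 sumset ball-data
      public using (Dominated; differences; differences-bounded; represented; ball-size)

    R₀ R₁ : ℕ
    R₀ = N ℕ./ 100
    R₁ = N ℕ./ D

    100R₀≤N : 100 ℕ.* R₀ ℕ.≤ N
    100R₀≤N = ℕ.≤-trans (ℕ.≤-reflexive (ℕ.*-comm 100 R₀)) (m/n*n≤m N 100)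

    DR₁≤N : D ℕ.* R₁ ℕ.≤ N
    DR₁≤N = ℕ.≤-trans (ℕ.≤-reflexive (ℕ.*-comm D R₁)) (m/n*n≤m N D)

    ≤/ : ∀ {k} d .{{_ : ℕ.NonZero d}} → d ℕ.* k ℕ.≤ N → k ℕ.≤ N ℕ./ d
    ≤/ {k} d dk≤ = subst (ℕ._≤ N ℕ./ d) (m*n/n≡m k d) (/-monoˡ-≤ d (ℕ.≤-trans (ℕ.≤-reflexive (ℕ.*-comm k d)) dk≤))

    R₀-large : 20 ℕ.* R₁ ℕ.≤ R₀
    R₀-large = ≤/ 100 (ℕ.≤-trans (ℕ.≤-reflexive (sym (ℕ.*-assoc 100 20 R₁))) (ℕ.≤-trans (ℕ.*-monoˡ-≤ R₁ 2000≤D) DR₁≤N))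

    4R₀<N : 4 ℕ.* R₀ ℕ.< N
    4R₀<N = ℕ.*-cancelˡ-< 25 _ _ (ℕ.≤-<-trans (ℕ.≤-trans (ℕ.≤-reflexive (sym (ℕ.*-assoc 25 4 R₀))) 100R₀≤N) (subst (N ℕ.<_) (ℕ.*-comm N 25) (ℕ.m<m*n N 25 (ℕ.≤ᵇ⇒≤ 2 25 _))))

    -- The sign is that of `represented`, where x is found through w + x = 0; the symmetry of 40A -
    -- 40A removes it at the end.
    Good : ℤ → Set
    Good x = ℤ.- x ∈ differences

    Good-bounded : ∀ {x} → Good x → ∣ x ∣ ℕ.≤ 80 ℕ.* K
    Good-bounded {x} g = subst (ℕ._≤ 80 ℕ.* K) (ℤ.∣-i∣≡∣i∣ x) (differences-bounded g)

    near-dominated : ∀ {x} → ∣ x ∣ ℕ.≤ 160 ℕ.* K → (∀ {r} → r ∈ frequencies → ∣ φ r x ∣ ℕ.≤ R₀) → Dominated x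
    near-dominated {x} x≤ near {r} r∈ big = near-dominates (+ r ℤ.* x) (160 ℕ.* K) (frequency-bound r∈′ x≤)
      (ℕ.≤-trans (ℕ.*-monoʳ-≤ 1024 (ℕ.m≤n*m (suc (160 ℕ.* K)) D)) (W<N 1024 D (ℕ.≤ᵇ⇒≤ 1024 10000000 _) ℕ.≤-refl))
      (ℕ.≤-trans (ℕ.*-monoʳ-≤ 100 (near r∈′)) 100R₀≤N)
      where
      r∈′ : + r ∈ frequencies
      r∈′ = ∈-filter⁺ (λ r → θ * (m * m) ≤? intensity as r) (∈-map⁺ +_ r∈) big

    ball : ∀ x → ∣ x ∣ ℕ.≤ 2 ℕ.* (80 ℕ.* K) → (∀ {r} → r ∈ frequencies → ∣ φ r x ∣ ℕ.≤ R₀) → Good x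
    ball x x≤ near = represented 0<Λ x≤′ (near-dominated x≤′ near)
      where
      x≤′ : ∣ x ∣ ℕ.≤ 160 ℕ.* K
      x≤′ = ℕ.≤-trans x≤ (ℕ.≤-reflexive (sym (ℕ.*-assoc 2 80 K)))

    n≤5m : ιₙ (length S) ≤ 5ℚ * m
    n≤5m = *-cancelʳ-≤ {ιₙ 100000} {ιₙ (length S)} {5ℚ * m} (ιₙ-pos 99999) (≤-trans (≤-trans (≤-reflexive (*-comm (ιₙ (length S)) (ιₙ 100000))) doubling)
      (≤-trans (*-mono-≤ʳ (<⇒≤ 0<m) (subst (λ z → ιₙ 400001 ≤ z * ιₙ 100000) (ι-def (+ 5)) (numeral-≤ (# 400001) (# 5 ⊠ # 100000)))) (≤-reflexive (l 5ℚ (ιₙ 100000) m))))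
      where
      l : ∀ f u m → f * u * m ≡ f * m * u
      l = solve-∀ ℚ-ring

    m²≤5p : ∀ {r} → r ∈ frequencies → m * m ≤ 5ℚ * intensity as r
    m²≤5p {r} r∈ = ≤-trans 1≤5θ (*-mono-≤ˡ (nonNegative⁻¹ 5ℚ) (proj₂ (frequency r∈)))
      where
      U : ℚ
      U = ιₙ 100000 * ιₙ 100000
      l : ∀ f θ M U → f * (U * θ) * M ≡ f * (θ * M) * U
      l = solve-∀ ℚ-ring
      1≤5θ : m * m ≤ 5ℚ * (θ * (m * m))
      1≤5θ = *-cancelʳ-≤ {U} {m * m} {5ℚ * (θ * (m * m))} (*-pos (ιₙ-pos 99999) (ιₙ-pos 99999)) (≤-trans (≤-reflexive (*-comm (m * m) U))
        (≤-trans (*-mono-≤ʳ (sq-nonNeg m) (subst₂ (λ f z → U ≤ f * z) (ι-def (+ 5)) (sym θ≡) (numeral-≤ (# 100000 ⊠ # 100000) (# 5 ⊠ (# 50010 ⊠ # 50010))))) (≤-reflexive (l 5ℚ θ (m * m) U))))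

    -- The output of `cluster` with chords converted to centred residues. It serves for
    -- representatives of lines, with d = 200, and for the whole set, with d = D.
    close : ∀ {d t P} → d ℕ.≤ D → 1001 ℕ.* (d ℕ.* d) ℕ.≤ t → 1 ℕ.≤ t → 2ℚ * 5ℚ ^ t ≤ ιₙ P → ∀ {A₀} → Unique A₀ → (∀ {a} → a ∈ A₀ → a ∈ as) →
            ∃[ T₀ ] (Unique T₀ × (∀ {a} → a ∈ T₀ → a ∈ A₀) × ιₙ (length A₀) ≤ ιₙ P * ιₙ (length T₀) ×
                     (∀ {a a′ r} → a ∈ T₀ → a′ ∈ T₀ → r ∈ frequencies → d ℕ.* ∣ φ r (a ℤ.- a′) ∣ ℕ.≤ N))
    close {d} {t} {P} d≤D t≥ 1≤t P≥ {A₀} u A₀⊆ =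
      let T₀ , u-T₀ , T₀⊆ , count , near = cluster n≤5m A₀ u A₀⊆ S-nonempty in
      T₀ , u-T₀ , T₀⊆ , ≤-trans count (*-mono-≤ʳ {ιₙ (length T₀)} (ιₙ-nonNeg (length T₀)) P≥) , λ {a} {a′} {r} a∈ a′∈ r∈ →
        nearby {a} {a′} {r} (A₀⊆ (T₀⊆ a∈)) (A₀⊆ (T₀⊆ a′∈)) r∈ (near r a∈ a′∈ (m²≤5p r∈))
      where
      open Sampling.Samples 𝒞 sumset t 1≤t using (cluster)
      S-nonempty : 1 ℕ.≤ length S
      S-nonempty = some as nonempty as+as
        where
        some : ∀ as → 1 ℕ.≤ length as → (∀ {a b} → a ∈ as → b ∈ as → a ℤ.+ b ∈ S) → 1 ℕ.≤ length S
        some (a ∷ _) _ sums = inhabited (sums (here refl) (here refl))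
          where
          inhabited : ∀ {x : ℤ} {xs} → x ∈ xs → 1 ℕ.≤ length xs
          inhabited (here _) = ℕ.s≤s ℕ.z≤n
          inhabited (there _) = ℕ.s≤s ℕ.z≤n
      spread : ∀ {a a′} → a ∈ as → a′ ∈ as → ∣ a ℤ.- a′ ∣ ℕ.≤ 160 ℕ.* K
      spread {a} {a′} a∈ a′∈ = ℕ.≤-trans (ℤ.∣i-j∣≤∣i∣+∣j∣ a a′) (ℕ.≤-trans (ℕ.+-mono-≤ (as-bounded a∈) (as-bounded a′∈))
        (ℕ.≤-trans (ℕ.≤-reflexive (cong (λ z → K ℕ.+ z) (sym (ℕ.+-identityʳ K)))) (ℕ.*-monoˡ-≤ K (ℕ.≤ᵇ⇒≤ 2 160 _))))
      nearby : ∀ {a a′ r} → a ∈ as → a′ ∈ as → r ∈ frequencies → κ (r ℤ.* (a ℤ.- a′)) * ιₙ t ≤ 4000ℚ → d ℕ.* ∣ φ r (a ℤ.- a′) ∣ ℕ.≤ N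
      nearby {a} {a′} {r} a∈ a′∈ r∈ = near-from-κ (r ℤ.* (a ℤ.- a′)) (160 ℕ.* K) d t (frequency-bound {r} {a ℤ.- a′} {160 ℕ.* K} r∈ (spread a∈ a′∈)) (W<N 1024 d (ℕ.≤ᵇ⇒≤ 1024 10000000 _) d≤D) t≥

    φ-mod : ∀ r x → φ r x ≡ r ℤ.* x [mod N ]
    φ-mod r x = centred-mod (r ℤ.* x)

    φ-unique : ∀ r x {y} → y ≡ r ℤ.* x [mod N ] → 2 ℕ.* ∣ y ∣ ℕ.< N → φ r x ≡ y
    φ-unique r x = centred-unique (r ℤ.* x)

    setup : Setup
    setup = record
      { N = N ; φ = φ ; φ-mod = φ-mod ; φ-unique = φ-unique ; frequencies = frequencies ; W = 80 ℕ.* K ; R₁ = R₁ ; R₀ = R₀ ; R₀-large = R₀-large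
      ; N-large = 4R₀<N ; Good = Good ; Good-bounded = λ {x} → Good-bounded {x} ; ball = ball }

    open Minima setup public

-- Three independent vectors contradict small doubling

module Separation where

  open import Data.Integer.Base as ℤ using (ℤ; +_; 0ℤ)
  open import Data.Integer.Base using (∣_∣)
  open import Data.Integer.DivMod using (_%ℕ_)
  open import Data.Rational.Base hiding (∣_∣)
  open import Data.Rational.Properties
  open import Data.Vec.Base using (Vec; []; _∷_)
  open RationalOrder
  open ListSum
  open Rotations using (2ℚ; 32ℚ)
  open Residue hiding (_,_)
  open Characters
  open BoxSums using (_⊕_; _≟ⱽ_; kill; 2^; box-sumset)
  open Bogolyubov using (module Transforms)
  open Structure

  record Representatives {A B : Set} (f : A → B) (xs : List A) : Set where
    field
      ys : List A
      unique : Unique ys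
      subset : ∀ {y} → y ∈ ys → y ∈ xs
      injective : InjectiveOn ys f
      covers : ∀ {x} → x ∈ xs → f x ∈ map f ys

  module _ {A B : Set} (_≟_ : DecidableEquality B) (f : A → B) where
    open import Data.List.Membership.DecPropositional _≟_ using (_∈?_)

    representatives : ∀ xs → Representatives f xs
    representatives [] = record { ys = [] ; unique = [] ; subset = λ () ; injective = λ () ; covers = λ () }
    representatives (x ∷ xs) = extend (f x ∈? map f R.ys)
      where
      module R = Representatives (representatives xs)
      extend : Dec (f x ∈ map f R.ys) → Representatives f (x ∷ xs)
      extend (yes p) = record { ys = R.ys ; unique = R.unique ; subset = λ q → there (R.subset q) ; injective = R.injective
                              ; covers = λ { (here refl) → p ; (there q) → R.covers q } }
      extend (no ¬p) = record
        { ys = x ∷ R.ys ; unique = All.tabulate (λ { q refl → ¬p (∈-map⁺ f q) }) ∷ R.unique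
        ; subset = λ { (here refl) → here refl ; (there q) → there (R.subset q) }
        ; injective = λ { (here refl) (here refl) _ → refl
                        ; (here refl) (there q) eq → contradiction (subst (_∈ map f R.ys) (sym eq) (∈-map⁺ f q)) ¬p
                        ; (there q) (here refl) eq → contradiction (subst (_∈ map f R.ys) eq (∈-map⁺ f q)) ¬p
                        ; (there q) (there q′) eq → R.injective q q′ eq }
        ; covers = λ { (here refl) → here refl ; (there q) → there (R.covers q) } }

  InRange : ℕ → ℤ → Set
  InRange L l = + 1 ℤ.≤ l × l ℤ.≤ + L

  -- The progression lies in 40A - 40A, and has at least |T₀| elements because of the injection f.
  record LargeProgression (𝒞 : Circle) (as : List ℤ) (P₁ : ℕ) : Set where
    field
      a₀ v₁ v₂ : ℤ
      L₁ L₂ : ℕ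
      1≤L₁ : 1 ℕ.≤ L₁
      1≤L₂ : 1 ℕ.≤ L₂
      contained : ∀ {l₁ l₂} → InRange L₁ l₁ → InRange L₂ l₂ → ℤ.- (a₀ ℤ.+ (l₁ ℤ.* v₁ ℤ.+ l₂ ℤ.* v₂)) ∈ Transforms.sums 𝒞 as 40
      T₀ : List ℤ
      T₀-unique : Unique T₀
      f : ℤ → ℤ
      f-injective : InjectiveOn T₀ f
      f-into : ∀ {x} → x ∈ T₀ → ∃[ l₁ ] ∃[ l₂ ] (InRange L₁ l₁ × InRange L₂ l₂ × f x ≡ a₀ ℤ.+ (l₁ ℤ.* v₁ ℤ.+ l₂ ℤ.* v₂))
      count : length as ℕ.≤ P₁ ℕ.* length T₀
      origin : ℤ
      origin∈ : origin ∈ as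

  private
    Triple : Set
    Triple = ℤ × ℤ × ℤ

    infixl 6 _+³_
    infixl 7 _·³_
    _+³_ : Triple → Triple → Triple
    (x , y , z) +³ (x′ , y′ , z′) = x ℤ.+ x′ , y ℤ.+ y′ , z ℤ.+ z′

    _·³_ : ℤ → Triple → Triple
    k ·³ (x , y , z) = k ℤ.* x , k ℤ.* y , k ℤ.* z

    -- Expanded in the same way as `det₃`, so that the two agree by definition.
    D³ : Triple → Triple → Triple → ℤ
    D³ (x₁ , y₁ , z₁) (x₂ , y₂ , z₂) (x₃ , y₃ , z₃) =
      (x₁ ℤ.* y₂ ℤ.- x₂ ℤ.* y₁) ℤ.* z₃ ℤ.+ (x₂ ℤ.* y₃ ℤ.- x₃ ℤ.* y₂) ℤ.* z₁ ℤ.- (x₁ ℤ.* y₃ ℤ.- x₃ ℤ.* y₁) ℤ.* z₂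

    linear₁ : ∀ k v w p q → D³ (v +³ k ·³ w) p q ≡ D³ v p q ℤ.+ k ℤ.* D³ w p q
    linear₁ k (x , y , z) (x′ , y′ , z′) (a , b , c) (d , e , f) = l k x y z x′ y′ z′ a b c d e f
      where
      l : ∀ k x y z x′ y′ z′ a b c d e f → (((x ℤ.+ k ℤ.* x′) ℤ.* b ℤ.- a ℤ.* (y ℤ.+ k ℤ.* y′)) ℤ.* f ℤ.+ (a ℤ.* e ℤ.- d ℤ.* b) ℤ.* (z ℤ.+ k ℤ.* z′) ℤ.- ((x ℤ.+ k ℤ.* x′) ℤ.* e ℤ.- d ℤ.* (y ℤ.+ k ℤ.* y′)) ℤ.* c) ≡ ((x ℤ.* b ℤ.- a ℤ.* y) ℤ.* f ℤ.+ (a ℤ.* e ℤ.- d ℤ.* b) ℤ.* z ℤ.- (x ℤ.* e ℤ.- d ℤ.* y) ℤ.* c) ℤ.+ k ℤ.* ((x′ ℤ.* b ℤ.- a ℤ.* y′) ℤ.* f ℤ.+ (a ℤ.* e ℤ.- d ℤ.* b) ℤ.* z′ ℤ.- (x′ ℤ.* e ℤ.- d ℤ.* y′) ℤ.* c)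
      l = ℤ-Solver.solve-∀

    linear₂ : ∀ k v w p q → D³ p (v +³ k ·³ w) q ≡ D³ p v q ℤ.+ k ℤ.* D³ p w q
    linear₂ k (x , y , z) (x′ , y′ , z′) (a , b , c) (d , e , f) = l k x y z x′ y′ z′ a b c d e f
      where
      l : ∀ k x y z x′ y′ z′ a b c d e f → ((a ℤ.* (y ℤ.+ k ℤ.* y′) ℤ.- (x ℤ.+ k ℤ.* x′) ℤ.* b) ℤ.* f ℤ.+ ((x ℤ.+ k ℤ.* x′) ℤ.* e ℤ.- d ℤ.* (y ℤ.+ k ℤ.* y′)) ℤ.* c ℤ.- (a ℤ.* e ℤ.- d ℤ.* b) ℤ.* (z ℤ.+ k ℤ.* z′)) ≡ ((a ℤ.* y ℤ.- x ℤ.* b) ℤ.* f ℤ.+ (x ℤ.* e ℤ.- d ℤ.* y) ℤ.* c ℤ.- (a ℤ.* e ℤ.- d ℤ.* b) ℤ.* z) ℤ.+ k ℤ.* ((a ℤ.* y′ ℤ.- x′ ℤ.* b) ℤ.* f ℤ.+ (x′ ℤ.* e ℤ.- d ℤ.* y′) ℤ.* c ℤ.- (a ℤ.* e ℤ.- d ℤ.* b) ℤ.* z′)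
      l = ℤ-Solver.solve-∀

    linear₃ : ∀ k v w p q → D³ p q (v +³ k ·³ w) ≡ D³ p q v ℤ.+ k ℤ.* D³ p q w
    linear₃ k (x , y , z) (x′ , y′ , z′) (a , b , c) (d , e , f) = l k x y z x′ y′ z′ a b c d e f
      where
      l : ∀ k x y z x′ y′ z′ a b c d e f → ((a ℤ.* e ℤ.- d ℤ.* b) ℤ.* (z ℤ.+ k ℤ.* z′) ℤ.+ (d ℤ.* (y ℤ.+ k ℤ.* y′) ℤ.- (x ℤ.+ k ℤ.* x′) ℤ.* e) ℤ.* c ℤ.- (a ℤ.* (y ℤ.+ k ℤ.* y′) ℤ.- (x ℤ.+ k ℤ.* x′) ℤ.* b) ℤ.* f) ≡ ((a ℤ.* e ℤ.- d ℤ.* b) ℤ.* z ℤ.+ (d ℤ.* y ℤ.- x ℤ.* e) ℤ.* c ℤ.- (a ℤ.* y ℤ.- x ℤ.* b) ℤ.* f) ℤ.+ k ℤ.* ((a ℤ.* e ℤ.- d ℤ.* b) ℤ.* z′ ℤ.+ (d ℤ.* y′ ℤ.- x′ ℤ.* e) ℤ.* c ℤ.- (a ℤ.* y′ ℤ.- x′ ℤ.* b) ℤ.* f)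
      l = ℤ-Solver.solve-∀

    alternating₁₂ : ∀ p q → D³ p p q ≡ 0ℤ
    alternating₁₂ (a , b , c) (d , e , f) = l a b c d e f
      where
      l : ∀ a b c d e f → ((a ℤ.* b ℤ.- a ℤ.* b) ℤ.* f ℤ.+ (a ℤ.* e ℤ.- d ℤ.* b) ℤ.* c ℤ.- (a ℤ.* e ℤ.- d ℤ.* b) ℤ.* c) ≡ 0ℤ
      l = ℤ-Solver.solve-∀

    alternating₂₃ : ∀ p q → D³ p q q ≡ 0ℤ
    alternating₂₃ (a , b , c) (d , e , f) = l a b c d e f
      where
      l : ∀ a b c d e f → ((a ℤ.* e ℤ.- d ℤ.* b) ℤ.* f ℤ.+ (d ℤ.* e ℤ.- d ℤ.* e) ℤ.* c ℤ.- (a ℤ.* e ℤ.- d ℤ.* b) ℤ.* f) ≡ 0ℤ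
      l = ℤ-Solver.solve-∀

    alternating₁₃ : ∀ p q → D³ p q p ≡ 0ℤ
    alternating₁₃ (a , b , c) (d , e , f) = l a b c d e f
      where
      l : ∀ a b c d e f → ((a ℤ.* e ℤ.- d ℤ.* b) ℤ.* c ℤ.+ (d ℤ.* b ℤ.- a ℤ.* e) ℤ.* c ℤ.- (a ℤ.* b ℤ.- a ℤ.* b) ℤ.* f) ≡ 0ℤ
      l = ℤ-Solver.solve-∀

  module Adjugate (e₁ e₂ e₃ : Triple) where
    Δ : ℤ
    Δ = D³ e₁ e₂ e₃

    -- By Cramer's rule these are the coordinates of v in the basis e₁, e₂, e₃, multiplied by Δ to
    -- remain integral.
    adjugate : Triple → Vec ℤ 3
    adjugate v = D³ v e₂ e₃ ∷ D³ e₁ v e₃ ∷ D³ e₁ e₂ v ∷ []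

    -- Recovers Δ times the first coordinate, hence the original integer: both injectivity and the
    -- comparison with the sumset rest on it.
    first : Vec ℤ 3 → ℤ
    first (a ∷ b ∷ c ∷ []) = a ℤ.* proj₁ e₁ ℤ.+ b ℤ.* proj₁ e₂ ℤ.+ c ℤ.* proj₁ e₃

    first-⊕ : ∀ v w → first (v ⊕ w) ≡ first v ℤ.+ first w
    first-⊕ (a ∷ b ∷ c ∷ []) (a′ ∷ b′ ∷ c′ ∷ []) = l a b c a′ b′ c′ (proj₁ e₁) (proj₁ e₂) (proj₁ e₃)
      where
      l : ∀ a b c a′ b′ c′ x y z → (a ℤ.+ a′) ℤ.* x ℤ.+ (b ℤ.+ b′) ℤ.* y ℤ.+ (c ℤ.+ c′) ℤ.* z ≡ a ℤ.* x ℤ.+ b ℤ.* y ℤ.+ c ℤ.* z ℤ.+ (a′ ℤ.* x ℤ.+ b′ ℤ.* y ℤ.+ c′ ℤ.* z)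
      l = ℤ-Solver.solve-∀

    first-adjugate : ∀ v → first (adjugate v) ≡ Δ ℤ.* proj₁ v
    first-adjugate (x , y , z) = l x y z (proj₁ e₁) (proj₁ (proj₂ e₁)) (proj₂ (proj₂ e₁)) (proj₁ e₂) (proj₁ (proj₂ e₂)) (proj₂ (proj₂ e₂)) (proj₁ e₃) (proj₁ (proj₂ e₃)) (proj₂ (proj₂ e₃))
      where
      l : ∀ x y z x₁ y₁ z₁ x₂ y₂ z₂ x₃ y₃ z₃ → ((x ℤ.* y₂ ℤ.- x₂ ℤ.* y) ℤ.* z₃ ℤ.+ (x₂ ℤ.* y₃ ℤ.- x₃ ℤ.* y₂) ℤ.* z ℤ.- (x ℤ.* y₃ ℤ.- x₃ ℤ.* y) ℤ.* z₂) ℤ.* x₁ ℤ.+ ((x₁ ℤ.* y ℤ.- x ℤ.* y₁) ℤ.* z₃ ℤ.+ (x ℤ.* y₃ ℤ.- x₃ ℤ.* y) ℤ.* z₁ ℤ.- (x₁ ℤ.* y₃ ℤ.- x₃ ℤ.* y₁) ℤ.* z) ℤ.* x₂ ℤ.+ ((x₁ ℤ.* y₂ ℤ.- x₂ ℤ.* y₁) ℤ.* z ℤ.+ (x₂ ℤ.* y ℤ.- x ℤ.* y₂) ℤ.* z₁ ℤ.- (x₁ ℤ.* y ℤ.- x ℤ.* y₁) ℤ.* z₂) ℤ.* x₃ ≡ ((x₁ ℤ.* y₂ ℤ.- x₂ ℤ.* y₁) ℤ.* z₃ ℤ.+ (x₂ ℤ.* y₃ ℤ.- x₃ ℤ.*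 y₂) ℤ.* z₁ ℤ.- (x₁ ℤ.* y₃ ℤ.- x₃ ℤ.* y₁) ℤ.* z₂) ℤ.* x
      l = ℤ-Solver.solve-∀

    adjugate-⊕ : ∀ v w → adjugate (v +³ + 1 ·³ w) ≡ adjugate v ⊕ adjugate w
    adjugate-⊕ v w = cong₂ _∷_ (trans (linear₁ (+ 1) v w e₂ e₃) (one (D³ v e₂ e₃) (D³ w e₂ e₃))) (cong₂ _∷_ (trans (linear₂ (+ 1) v w e₁ e₃) (one (D³ e₁ v e₃) (D³ e₁ w e₃))) (cong₂ _∷_ (trans (linear₃ (+ 1) v w e₁ e₂) (one (D³ e₁ e₂ v) (D³ e₁ e₂ w))) refl))
      where
      one : ∀ a b → a ℤ.+ + 1 ℤ.* b ≡ a ℤ.+ b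
      one a b = cong (λ z → a ℤ.+ z) (ℤ.*-identityˡ b)

    basis : Fin 3 → Triple
    basis 0F = e₁
    basis 1F = e₂
    basis 2F = e₃

    private
      absorb : ∀ a {b} k → b ≡ 0ℤ → a ℤ.+ k ℤ.* b ≡ a
      absorb a k refl = trans (cong (λ z → a ℤ.+ z) (ℤ.*-zeroʳ k)) (ℤ.+-identityʳ a)

      vanish : ∀ a {d} k → d ≢ 0ℤ → a ℤ.+ k ℤ.* d ≡ a → k ≡ 0ℤ
      vanish a {d} k d≢0 eq = ℤ.*-cancelʳ-≡ k 0ℤ d {{ℤ.≢-nonZero d≢0}} (trans (l a (k ℤ.* d)) (trans (cong (ℤ._- a) eq) (ℤ.+-inverseʳ a)))
        where
        l : ∀ a b → b ≡ a ℤ.+ b ℤ.- a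
        l = ℤ-Solver.solve-∀

    -- Determinants alternate, so a multiple of a basis vector changes only its own coordinate:
    -- lines in a basis direction become parallel to an axis.
    kill-translate : ∀ i k v → kill i (adjugate (v +³ k ·³ basis i)) ≡ kill i (adjugate v)
    kill-translate 0F k v = cong₂ (λ y z → 0ℤ ∷ y ∷ z ∷ []) (trans (linear₂ k v e₁ e₁ e₃) (absorb (D³ e₁ v e₃) k (alternating₁₂ e₁ e₃))) (trans (linear₃ k v e₁ e₁ e₂) (absorb (D³ e₁ e₂ v) k (alternating₁₃ e₁ e₂)))
    kill-translate 1F k v = cong₂ (λ x z → x ∷ 0ℤ ∷ z ∷ []) (trans (linear₁ k v e₂ e₂ e₃) (absorb (D³ v e₂ e₃) k (alternating₁₂ e₂ e₃))) (trans (linear₃ k v e₂ e₁ e₂) (absorb (D³ e₁ e₂ v) k (alternating₂₃ e₁ e₂)))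
    kill-translate 2F k v = cong₂ (λ x y → x ∷ y ∷ 0ℤ ∷ []) (trans (linear₁ k v e₃ e₂ e₃) (absorb (D³ v e₂ e₃) k (alternating₁₃ e₃ e₂))) (trans (linear₂ k v e₃ e₁ e₃) (absorb (D³ e₁ v e₃) k (alternating₂₃ e₁ e₃)))

    translate-injective : ∀ i k v → Δ ≢ 0ℤ → v +³ k ·³ basis i ≡ v → k ≡ 0ℤ
    translate-injective 0F k v Δ≢0 eq = vanish (D³ v e₂ e₃) k Δ≢0 (trans (sym (linear₁ k v e₁ e₂ e₃)) (cong (λ v → D³ v e₂ e₃) eq))
    translate-injective 1F k v Δ≢0 eq = vanish (D³ e₁ v e₃) k Δ≢0 (trans (sym (linear₂ k v e₂ e₁ e₃)) (cong (λ v → D³ e₁ v e₃) eq))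
    translate-injective 2F k v Δ≢0 eq = vanish (D³ e₁ e₂ v) k Δ≢0 (trans (sym (linear₃ k v e₃ e₁ e₂)) (cong (λ v → D³ e₁ e₂ v) eq))

  module Apart (configuration : Configuration) where
    open Configuration configuration
    open Constants 𝒦
    open Circle 𝒞
    open Transform 𝒞
    open Setting configuration

    window : ∀ {r} → r ∈ frequencies → ∃[ β ] m * ιₙ 75004 ≤ ιₙ 100000 * ∑ as (λ a → [ (r ℤ.* a ℤ.- β) %ℕ N ℕ.<? 2 ℕ.* q ?])
    window {r} r∈ = let β , big = arc js K turn (λ j j∈ → let a , a∈ , eq = ∈-map⁻ (λ a → r ℤ.* a) j∈ in
                                        subst (λ z → ∣ z ∣ ℕ.≤ K ℕ.* N) (sym eq) (frequency-bound {r} {a} {K} r∈ (as-bounded a∈)))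
                                      (subst (1 ℕ.≤_) (sym size) nonempty) intense in
      β , subst₂ (λ l z → ιₙ l * ιₙ 75004 ≤ ιₙ 100000 * z) size (∑-map (λ a → r ℤ.* a) as _) big
      where
      js : List ℤ
      js = map (λ a → r ℤ.* a) as
      size : length js ≡ length as
      size = length-map (λ a → r ℤ.* a) as
      -- The product 2 · 100000 · 32 = 6400000 is what the factor 10000000 in `required-N` has to
      -- cover here.
      turn : 2ℚ * ιₙ 100000 * (32ℚ * ιₙ (2 ℕ.+ K)) ≤ ιₙ N
      turn = ≤-trans (≤-reflexive (trans (cong₂ (λ x y → x * ιₙ 100000 * (y * ιₙ (2 ℕ.+ K))) (sym (ι-def (+ 2))) (sym (ι-def (+ 32))))
          (trans (sym (*-assoc (ιₙ 2 * ιₙ 100000) (ιₙ 32) (ιₙ (2 ℕ.+ K)))) (trans (cong (λ z → z * ιₙ 32 * ιₙ (2 ℕ.+ K)) (sym (ιₙ-* 2 100000))) (trans (cong (_* ιₙ (2 ℕ.+ K)) (sym (ιₙ-* 200000 32))) (sym (ιₙ-* 6400000 (2 ℕ.+ K))))))))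
        (ιₙ-mono-≤ (ℕ.≤-trans (ℕ.*-monoʳ-≤ 6400000 (ℕ.≤-trans 2+K≤ (ℕ.*-monoˡ-≤ (suc (160 ℕ.* K)) (ℕ.≤-trans (ℕ.≤ᵇ⇒≤ 2 2000 _) 2000≤D)))) (W<N 6400000 D (ℕ.≤ᵇ⇒≤ 6400000 10000000 _) ℕ.≤-refl)))
        where
        2+K≤ : 2 ℕ.+ K ℕ.≤ 2 ℕ.* suc (160 ℕ.* K)
        2+K≤ = ℕ.≤-trans (ℕ.+-monoʳ-≤ 2 (ℕ.≤-trans (ℕ.m≤n*m K 320) (ℕ.≤-reflexive (ℕ.*-assoc 2 160 K)))) (ℕ.≤-reflexive (sym (ℕ.*-suc 2 (160 ℕ.* K))))
      intense : ιₙ 50010 * ιₙ 50010 * (ιₙ (length js) * ιₙ (length js)) ≤ ιₙ 100000 * ιₙ 100000 * (∑ js c * ∑ js c + ∑ js s * ∑ js s)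
      intense = subst₂ _≤_ (trans (l (ιₙ 100000 * ιₙ 100000) θ (m * m)) (cong₂ _*_ θ≡ (cong (λ l → ιₙ l * ιₙ l) (sym size))))
        (cong (λ z → ιₙ 100000 * ιₙ 100000 * z) (cong₂ (λ x y → x * x + y * y) (sym (∑-map (λ a → r ℤ.* a) as c)) (sym (∑-map (λ a → r ℤ.* a) as s))))
        (*-mono-≤ˡ (*-nonNeg (ιₙ-nonNeg 100000) (ιₙ-nonNeg 100000)) (proj₂ (frequency r∈)))
        where
        l : ∀ u t M → u * (t * M) ≡ u * t * M
        l = solve-∀ ℚ-ring

    -- The lift ρ of a ↦ r a mod N to integers is a Freiman homomorphism on a half window.
    module Lift (r β : ℤ) where
      ρₙ : ℤ → ℕ
      ρₙ a = (r ℤ.* a ℤ.- β) %ℕ N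

      ρ : ℤ → ℤ
      ρ a = + ρₙ a

      inside? : ∀ a → Dec (ρₙ a ℕ.< 2 ℕ.* q)
      inside? a = ρₙ a ℕ.<? 2 ℕ.* q

      ρ-mod : ∀ a → ρ a ≡ r ℤ.* a ℤ.- β [mod N ]
      ρ-mod a = mod-sym (%-mod N (r ℤ.* a ℤ.- β))

      4q : ∀ {k l} → k ℕ.< 2 ℕ.* q → l ℕ.< 2 ℕ.* q → k ℕ.+ l ℕ.< N
      4q p p′ = ℕ.<-≤-trans (ℕ.+-mono-< p p′) (ℕ.≤-reflexive (e q))
        where
        e : ∀ q → 2 ℕ.* q ℕ.+ 2 ℕ.* q ≡ 4 ℕ.* q
        e = ℕ-Solver.solve-∀

      ρ-sum : ∀ {a b a′ b′} → ρₙ a ℕ.< 2 ℕ.* q → ρₙ b ℕ.< 2 ℕ.* q → ρₙ a′ ℕ.< 2 ℕ.* q → ρₙ b′ ℕ.< 2 ℕ.* q →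
              a ℤ.+ b ≡ a′ ℤ.+ b′ → ρ a ℤ.+ ρ b ≡ ρ a′ ℤ.+ ρ b′
      ρ-sum {a} {b} {a′} {b′} a< b< a′< b′< eq = mod-unique (mod-trans (mod-+ (ρ-mod a) (ρ-mod b)) (mod-trans (mod-≡ same) (mod-sym (mod-+ (ρ-mod a′) (ρ-mod b′)))))
        (∣+-+∣< (4q a< b<) (4q a′< b′<))
        where
        e : ∀ r a b β → r ℤ.* a ℤ.- β ℤ.+ (r ℤ.* b ℤ.- β) ≡ r ℤ.* (a ℤ.+ b) ℤ.- (β ℤ.+ β)
        e = ℤ-Solver.solve-∀
        same : r ℤ.* a ℤ.- β ℤ.+ (r ℤ.* b ℤ.- β) ≡ r ℤ.* a′ ℤ.- β ℤ.+ (r ℤ.* b′ ℤ.- β)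
        same = trans (e r a b β) (trans (cong (λ z → r ℤ.* z ℤ.- (β ℤ.+ β)) eq) (sym (e r a′ b′ β)))

      φ-difference : ∀ {a a′} → ρₙ a ℕ.< 2 ℕ.* q → ρₙ a′ ℕ.< 2 ℕ.* q → φ r (a ℤ.- a′) ≡ ρ a ℤ.- ρ a′
      φ-difference {a} {a′} a< a′< = φ-unique r (a ℤ.- a′) (mod-trans (mod-+ (ρ-mod a) (mod-neg (ρ-mod a′))) (mod-≡ (e r a a′ β)))
        (subst (2 ℕ.* ∣ ρ a ℤ.- ρ a′ ∣ ℕ.<_) (sym (ℕ.*-assoc 2 2 q)) (ℕ.*-monoʳ-< 2 (∣+-+∣< a< a′<)))
        where
        e : ∀ r a b β → r ℤ.* a ℤ.- β ℤ.+ ℤ.- (r ℤ.* b ℤ.- β) ≡ r ℤ.* (a ℤ.- b)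
        e = ℤ-Solver.solve-∀

    module Separated (ind : Independent) where
      open Independent ind renaming (r to r₁; s to r₂; r∈ to r₁∈; s∈ to r₂∈)

      module ρ₁ = Lift r₁ (proj₁ (window r₁∈))
      module ρ₂ = Lift r₂ (proj₁ (window r₂∈))

      tilde : ℤ → Triple
      tilde u = u , φ r₁ u , φ r₂ u

      open Adjugate (tilde u₁) (tilde u₂) (tilde u₃)

      inside? : ∀ a → Dec (ρ₁.ρₙ a ℕ.< 2 ℕ.* q × ρ₂.ρₙ a ℕ.< 2 ℕ.* q)
      inside? a = ρ₁.inside? a ×-dec ρ₂.inside? a

      as′ : List ℤ
      as′ = filter inside? as

      as′-inside : ∀ {a} → a ∈ as′ → ρ₁.ρₙ a ℕ.< 2 ℕ.* q × ρ₂.ρₙ a ℕ.< 2 ℕ.* q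
      as′-inside a∈ = proj₂ (∈-filter⁻ inside? {xs = as} a∈)

      as′⊆as : ∀ {a} → a ∈ as′ → a ∈ as
      as′⊆as a∈ = proj₁ (∈-filter⁻ inside? {xs = as} a∈)

      as′-unique : Unique as′
      as′-unique = Unique.filter⁺ inside? u-as

      -- Two sets of density 0.75004 meet in density at least 2 · 0.75004 - 1 = 0.50008.
      as′-large : ιₙ 50008 * m ≤ ιₙ 100000 * ιₙ (length as′)
      as′-large = begin
        ιₙ 50008 * m ≤⟨ ≤-by (w₁ - m * ιₙ 75004 + (w₂ - m * ιₙ 75004)) (+-nonNeg (≤⇒0≤ (proj₂ (window r₁∈))) (≤⇒0≤ (proj₂ (window r₂∈)))) (trans (l w₁ w₂ m (ιₙ 75004) (ιₙ 50008) (ιₙ 100000)) (trans (cong (λ z → ιₙ 50008 * m + (w₁ - m * ιₙ 75004 + (w₂ - m * ιₙ 75004)) + z * m) numbers) (trans (cong (λ z → ιₙ 50008 * m + (w₁ - m * ιₙ 75004 + (w₂ - m * ιₙ 75004)) + z) (*-zeroˡ m)) (+-identityʳ _)))) ⟩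
        w₁ + w₂ - ιₙ 100000 * m ≡⟨ trans (l′ (ιₙ 100000) s₁ s₂ m) (cong (ιₙ 100000 *_) (sym (trans (∑-+ as _ _) (cong₂ _+_ (∑-+ as _ _) (trans (∑-neg as (λ _ → 1ℚ)) (cong -_ (∑-1 as))))))) ⟩
        ιₙ 100000 * ∑ as (λ a → [ ρ₁.inside? a ?] + [ ρ₂.inside? a ?] - 1ℚ) ≤⟨ *-mono-≤ˡ (ιₙ-nonNeg 100000) (∑-mono as λ a _ → both (ρ₁.inside? a) (ρ₂.inside? a)) ⟩
        ιₙ 100000 * ∑ as (λ a → [ inside? a ?]) ≡⟨ cong (ιₙ 100000 *_) (sym (length-filter-∑ inside? as)) ⟩
        ιₙ 100000 * ιₙ (length as′) ∎
        where
        open ≤-Reasoning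
        s₁ s₂ w₁ w₂ : ℚ
        s₁ = ∑ as (λ a → [ ρ₁.inside? a ?])
        s₂ = ∑ as (λ a → [ ρ₂.inside? a ?])
        w₁ = ιₙ 100000 * s₁
        w₂ = ιₙ 100000 * s₂
        both : ∀ {P Q : Set} (p : Dec P) (q : Dec Q) → [ p ?] + [ q ?] - 1ℚ ≤ [ p ×-dec q ?]
        both (yes _) (yes _) = ≤-refl
        both (yes _) (no _) = ≤-refl
        both (no _) (yes _) = ≤-refl
        both (no _) (no _) = nonPositive⁻¹ (- 1ℚ)
        l : ∀ w₁ w₂ m a b c → w₁ + w₂ - c * m ≡ b * m + (w₁ - m * a + (w₂ - m * a)) + (a + a - c - b) * m
        l = solve-∀ ℚ-ring
        l′ : ∀ c x y m → c * x + c * y - c * m ≡ c * (x + y + - m)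
        l′ = solve-∀ ℚ-ring
        numbers : ιₙ 75004 + ιₙ 75004 - ιₙ 100000 - ιₙ 50008 ≡ 0ℚ
        numbers = trans (cong (λ z → z - ιₙ 100000 - ιₙ 50008) (trans (sym (ιₙ-+ 75004 75004)) (ιₙ-+ 100000 50008))) (e (ιₙ 100000) (ιₙ 50008))
          where
          e : ∀ a b → a + b - a - b ≡ 0ℚ
          e = solve-∀ ℚ-ring

      ψ : ℤ → Triple
      ψ a = a , ρ₁.ρ a , ρ₂.ρ a

      position : ℤ → Vec ℤ 3
      position a = adjugate (ψ a)

      X : List (Vec ℤ 3)
      X = map position as′

      first-position : ∀ a b → first (position a ⊕ position b) ≡ Δ ℤ.* (a ℤ.+ b)
      first-position a b = trans (first-⊕ (position a) (position b)) (trans (cong₂ ℤ._+_ (first-adjugate (ψ a)) (first-adjugate (ψ b))) (sym (ℤ.*-distribˡ-+ Δ a b)))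

      Δ-cancel : ∀ {a b} → Δ ℤ.* a ≡ Δ ℤ.* b → a ≡ b
      Δ-cancel {a} {b} = ℤ.*-cancelˡ-≡ Δ a b {{ℤ.≢-nonZero det≢0}}

      X-unique : Unique X
      X-unique = map-unique (λ {a} {b} _ _ eq → Δ-cancel (trans (sym (first-adjugate (ψ a))) (trans (cong first eq) (first-adjugate (ψ b))))) as′-unique

      Z : List (Vec ℤ 3)
      Z = deduplicate _≟ⱽ_ (cartesianProductWith _⊕_ X X)

      Z-sum : ∀ {z} → z ∈ Z → ∃[ a ] ∃[ b ] (a ∈ as′ × b ∈ as′ × z ≡ position a ⊕ position b)
      Z-sum z∈ = let x , y , x∈ , y∈ , eq = ∈-cartesianProductWith⁻ _⊕_ X X (∈-deduplicate⁻ _≟ⱽ_ (cartesianProductWith _⊕_ X X) z∈)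
                     a , a∈ , x≡ = ∈-map⁻ position x∈ ; b , b∈ , y≡ = ∈-map⁻ position y∈ in
        a , b , a∈ , b∈ , trans eq (cong₂ _⊕_ x≡ y≡)

      -- The Freiman property: on a half window the lifted residues of equal sums have equal sums,
      -- and `adjugate` is additive.
      sum-position : ∀ {a b a′ b′} → a ∈ as′ → b ∈ as′ → a′ ∈ as′ → b′ ∈ as′ → a ℤ.+ b ≡ a′ ℤ.+ b′ → position a ⊕ position b ≡ position a′ ⊕ position b′
      sum-position {a} {b} {a′} {b′} a∈ b∈ a′∈ b′∈ eq = trans (sym (adjugate-⊕ (ψ a) (ψ b))) (trans (cong adjugate (cong₂ _,_ (one {a} {b} {a′} {b′} eq)
        (cong₂ _,_ (one {ρ₁.ρ a} {ρ₁.ρ b} {ρ₁.ρ a′} {ρ₁.ρ b′} (ρ₁.ρ-sum {a} {b} {a′} {b′} (in₁ a∈) (in₁ b∈) (in₁ a′∈) (in₁ b′∈) eq)) (one {ρ₂.ρ a} {ρ₂.ρ b} {ρ₂.ρ a′} {ρ₂.ρ b′} (ρ₂.ρ-sum {a} {b} {a′} {b′} (in₂ a∈) (in₂ b∈) (in₂ a′∈) (in₂ b′∈) eq))))) (adjugate-⊕ (ψ a′) (ψ b′)))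
        where
        in₁ : ∀ {a} → a ∈ as′ → ρ₁.ρₙ a ℕ.< 2 ℕ.* q
        in₁ a∈ = proj₁ (as′-inside a∈)
        in₂ : ∀ {a} → a ∈ as′ → ρ₂.ρₙ a ℕ.< 2 ℕ.* q
        in₂ a∈ = proj₂ (as′-inside a∈)
        one : ∀ {x y x′ y′} → x ℤ.+ y ≡ x′ ℤ.+ y′ → x ℤ.+ + 1 ℤ.* y ≡ x′ ℤ.+ + 1 ℤ.* y′
        one {x} {y} {x′} {y′} eq = trans (cong (λ z → x ℤ.+ z) (ℤ.*-identityˡ y)) (trans eq (cong (λ z → x′ ℤ.+ z) (sym (ℤ.*-identityˡ y′))))

      -- By the Freiman property a sum of positions depends only on the sum of the integers, and
      -- `first` reads off the latter times Δ.
      Z-size : length Z ℕ.≤ length S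
      Z-size = subst (length Z ℕ.≤_) (length-map (λ y → Δ ℤ.* y) S) (length-inj first (deduplicate-! _≟ⱽ_ (cartesianProductWith _⊕_ X X))
        (λ z∈ z′∈ eq → let a , b , a∈ , b∈ , z≡ = Z-sum z∈ ; a′ , b′ , a′∈ , b′∈ , z′≡ = Z-sum z′∈ in
          trans z≡ (trans (sum-position a∈ b∈ a′∈ b′∈ (Δ-cancel (trans (sym (first-position a b)) (trans (cong first (sym z≡)) (trans eq (trans (cong first z′≡) (first-position a′ b′))))))) (sym z′≡)))
        (λ z z∈ → let a , b , a∈ , b∈ , z≡ = Z-sum z∈ in
          subst (_∈ map (λ y → Δ ℤ.* y) S) (sym (trans (cong first z≡) (first-position a b))) (∈-map⁺ (λ y → Δ ℤ.* y) (as+as (as′⊆as a∈) (as′⊆as b∈)))))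

      QR₁ : 200 ℕ.* (Q ℕ.* R₁) ℕ.≤ N
      QR₁ = ℕ.≤-trans (ℕ.≤-trans (ℕ.*-mono-≤ (ℕ.≤ᵇ⇒≤ 200 2000 _) (ℕ.*-monoˡ-≤ R₁ (ℕ.n≤1+n Q))) (ℕ.≤-reflexive (sym (ℕ.*-assoc 2000 (suc Q) R₁)))) (ℕ.≤-trans (ℕ.*-monoˡ-≤ R₁ D≥) DR₁≤N)

      -- The radius N / 100 is divided equally between the cluster, with N / 200, and the Q
      -- multiples of a small point.
      ≤R₀ : ∀ {k l} → 200 ℕ.* k ℕ.≤ N → l ℕ.≤ Q ℕ.* R₁ → k ℕ.+ l ℕ.≤ R₀
      ≤R₀ {k} {l} k≤ l≤ = ≤/ 100 (ℕ.*-cancelˡ-≤ 2 (begin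
        2 ℕ.* (100 ℕ.* (k ℕ.+ l)) ≡⟨ ℕ.*-assoc 2 100 (k ℕ.+ l) ⟨
        200 ℕ.* (k ℕ.+ l) ≡⟨ ℕ.*-distribˡ-+ 200 k l ⟩
        200 ℕ.* k ℕ.+ 200 ℕ.* l ≤⟨ ℕ.+-mono-≤ k≤ (ℕ.≤-trans (ℕ.*-monoʳ-≤ 200 l≤) QR₁) ⟩
        N ℕ.+ N ≡⟨ cong (λ z → N ℕ.+ z) (ℕ.+-identityʳ N) ⟨
        2 ℕ.* N ∎))
        where open ℕ.≤-Reasoning

      -- If there were many lines in the direction u, a choice of one point on each line would
      -- contain a cluster, and its translates by multiples of u would overfill the ball.
      module Direction (i : Fin 3) (u : ℤ) (u-small : Small u) (basis-u : basis i ≡ tilde u) where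

        line : ℤ → Vec ℤ 3
        line a = kill i (position a)

        open Representatives (representatives _≟ⱽ_ line as′)

        open Combinations u u u-small u-small Q 0 (λ {r} r∈ → ≤R₀ {0} ℕ.z≤n (ℕ.≤-trans (ℕ.≤-reflexive (ℕ.+-identityʳ _)) (ℕ.*-monoʳ-≤ Q (φ-small u-small r∈))))

        module _ (many : m < ιₙ 100000 * ιₙ (length ys)) where

          cluster = close {200} {t} {P} (ℕ.≤-trans (ℕ.≤ᵇ⇒≤ 200 2000 _) 2000≤D) t≥ (ℕ.≤-trans (ℕ.≤ᵇ⇒≤ 1 (1001 ℕ.* (200 ℕ.* 200)) _) t≥) P≥ unique (λ y∈ → as′⊆as (subset y∈))
          T₀ : List ℤ
          T₀ = proj₁ cluster
          T₀-unique : Unique T₀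
          T₀-unique = proj₁ (proj₂ cluster)
          T₀⊆ys : ∀ {a} → a ∈ T₀ → a ∈ ys
          T₀⊆ys = proj₁ (proj₂ (proj₂ cluster))
          count : ιₙ (length ys) ≤ ιₙ P * ιₙ (length T₀)
          count = proj₁ (proj₂ (proj₂ (proj₂ cluster)))
          near : ∀ {a a′ r} → a ∈ T₀ → a′ ∈ T₀ → r ∈ frequencies → 200 ℕ.* ∣ φ r (a ℤ.- a′) ∣ ℕ.≤ N
          near = proj₂ (proj₂ (proj₂ (proj₂ cluster)))

          point : ℤ → ℤ × ℕ → ℤ
          point a₀ (a , j) = + 1 ℤ.* (a ℤ.- a₀) ℤ.+ + j ℤ.* u

          grid : List (ℤ × ℕ)
          grid = cartesianProduct T₀ (downFrom (suc Q))

          multiple : ∀ {j} → j ℕ.≤ Q → ∣ + j ℤ.* u ∣ ℕ.≤ 80 ℕ.* K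
          multiple {j} j≤ = subst (λ z → ∣ z ∣ ℕ.≤ 80 ℕ.* K) (ℤ.+-identityʳ (+ j ℤ.* u)) (Good-bounded (combination (+ j) 0ℤ j≤ ℕ.z≤n))

          spread : ∀ {a a₀} → a ∈ T₀ → a₀ ∈ T₀ → ∣ a ℤ.- a₀ ∣ ℕ.≤ 80 ℕ.* K
          spread {a} {a₀} a∈ a₀∈ = ℕ.≤-trans (ℤ.∣i-j∣≤∣i∣+∣j∣ a a₀) (ℕ.≤-trans (ℕ.+-mono-≤ (as-bounded (T₀⊆as a∈)) (as-bounded (T₀⊆as a₀∈)))
            (ℕ.≤-trans (ℕ.≤-reflexive (cong (λ z → K ℕ.+ z) (sym (ℕ.+-identityʳ K)))) (ℕ.*-monoˡ-≤ K (ℕ.≤ᵇ⇒≤ 2 80 _))))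
            where
            T₀⊆as : ∀ {a} → a ∈ T₀ → a ∈ as
            T₀⊆as a∈ = as′⊆as (subset (T₀⊆ys a∈))

          module _ {a₀ a j} (a₀∈ : a₀ ∈ T₀) (a∈ : a ∈ T₀) (j≤ : j ℕ.≤ Q) where
            size : ∀ {r} → r ∈ frequencies → ∣ + 1 ℤ.* φ r (a ℤ.- a₀) ℤ.+ + j ℤ.* φ r u ∣ ℕ.≤ R₀
            size {r} r∈ = ℕ.≤-trans (ℤ.∣i+j∣≤∣i∣+∣j∣ (+ 1 ℤ.* φ r (a ℤ.- a₀)) (+ j ℤ.* φ r u))
              (≤R₀ {∣ + 1 ℤ.* φ r (a ℤ.- a₀) ∣} (subst (λ z → 200 ℕ.* ∣ z ∣ ℕ.≤ N) (sym (ℤ.*-identityˡ (φ r (a ℤ.- a₀)))) (near {a} {a₀} {r} a∈ a₀∈ r∈))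
                (ℕ.≤-trans (ℕ.≤-reflexive (ℤ.abs-* (+ j) (φ r u))) (ℕ.*-mono-≤ j≤ (φ-small u-small r∈))))
            φ-point : ∀ {r} → r ∈ frequencies → φ r (point a₀ (a , j)) ≡ + 1 ℤ.* φ r (a ℤ.- a₀) ℤ.+ + j ℤ.* φ r u
            φ-point {r} r∈ = φ-combine r (+ 1) (a ℤ.- a₀) (+ j) u (2R₀<N (ℕ.≤-trans (size {r} r∈) (ℕ.m≤m+n R₀ _)))
            bounded : ∣ point a₀ (a , j) ∣ ℕ.≤ 160 ℕ.* K
            bounded = ℕ.≤-trans (ℤ.∣i+j∣≤∣i∣+∣j∣ (+ 1 ℤ.* (a ℤ.- a₀)) (+ j ℤ.* u)) (ℕ.≤-trans (ℕ.+-mono-≤ {∣ + 1 ℤ.* (a ℤ.- a₀) ∣} {80 ℕ.* K} {∣ + j ℤ.* u ∣} {80 ℕ.* K}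
              (subst (λ z → ∣ z ∣ ℕ.≤ 80 ℕ.* K) (sym (ℤ.*-identityˡ (a ℤ.- a₀))) (spread a∈ a₀∈)) (multiple j≤)) (ℕ.≤-reflexive (sym (ℕ.*-distribʳ-+ K 80 80))))
            φ-bounded : ∀ {r} → r ∈ frequencies → ∣ φ r (point a₀ (a , j)) ∣ ℕ.≤ R₀
            φ-bounded {r} r∈ = subst (λ z → ∣ z ∣ ℕ.≤ R₀) (sym (φ-point {r} r∈)) (size {r} r∈)

          in-ball : ∀ {a₀} → a₀ ∈ T₀ → ∀ {x} → x ∈ map (point a₀) grid → ∣ x ∣ ℕ.≤ 160 ℕ.* K × (∀ {r} → r ∈ frequencies → ∣ φ r x ∣ ℕ.≤ R₀)
          in-ball {a₀} a₀∈ {x} x∈ = let (a , j) , p∈ , eq = ∈-map⁻ (point a₀) x∈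
                                        a∈ , j∈ = ∈-cartesianProduct⁻ T₀ (downFrom (suc Q)) p∈ ; j≤ = ℕ.s≤s⁻¹ (∈-downFrom⁻ j∈) in
            subst (λ x → ∣ x ∣ ℕ.≤ 160 ℕ.* K × (∀ {r} → r ∈ frequencies → ∣ φ r x ∣ ℕ.≤ R₀)) (sym eq) (bounded {a₀} {a} {j} a₀∈ a∈ j≤ , λ {r} → φ-bounded {a₀} {a} {j} a₀∈ a∈ j≤ {r})

          -- If two grid points coincide, then a - a′ is a multiple k u of the direction with |k| ≤
          -- Q, and the phases obey the same relation because none wraps around. The lifts of a and
          -- a′ then lie on one line, on which `ys` has a single point, and k = 0 follows.
          distinct : ∀ a₀ → InjectiveOn grid (point a₀)
          distinct a₀ {a , j} {a′ , j′} p p′ eq = cong₂ _,_ a≡a′ j≡j′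
            where
            a∈ : a ∈ ys
            a∈ = T₀⊆ys (proj₁ (∈-cartesianProduct⁻ T₀ (downFrom (suc Q)) p))
            a′∈ : a′ ∈ ys
            a′∈ = T₀⊆ys (proj₁ (∈-cartesianProduct⁻ T₀ (downFrom (suc Q)) p′))
            k : ℤ
            k = + j′ ℤ.- + j
            k≤ : ∣ k ∣ ℕ.≤ Q
            k≤ = ℕ.s≤s⁻¹ (∣+-+∣< (∈-downFrom⁻ (proj₂ (∈-cartesianProduct⁻ T₀ (downFrom (suc Q)) p′))) (∈-downFrom⁻ (proj₂ (∈-cartesianProduct⁻ T₀ (downFrom (suc Q)) p))))
            difference : a ℤ.- a′ ≡ k ℤ.* u
            difference = trans (l₁ a a′ a₀ (+ j ℤ.* u)) (trans (cong (λ z → z ℤ.- (+ 1 ℤ.* (a′ ℤ.- a₀) ℤ.+ + j ℤ.* u)) eq) (l₂ (a′ ℤ.- a₀) (+ j′) (+ j) u))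
              where
              l₁ : ∀ a a′ a₀ z → a ℤ.- a′ ≡ + 1 ℤ.* (a ℤ.- a₀) ℤ.+ z ℤ.- (+ 1 ℤ.* (a′ ℤ.- a₀) ℤ.+ z)
              l₁ = ℤ-Solver.solve-∀
              l₂ : ∀ b j′ j u → + 1 ℤ.* b ℤ.+ j′ ℤ.* u ℤ.- (+ 1 ℤ.* b ℤ.+ j ℤ.* u) ≡ (j′ ℤ.- j) ℤ.* u
              l₂ = ℤ-Solver.solve-∀
            φ-difference : ∀ {r} → r ∈ frequencies → φ r (a ℤ.- a′) ≡ k ℤ.* φ r u
            φ-difference {r} r∈ = trans (cong (φ r) (trans difference (sym (ℤ.+-identityʳ (k ℤ.* u))))) (trans (φ-combination {r} {k} {0ℤ} r∈ k≤ ℕ.z≤n) (ℤ.+-identityʳ (k ℤ.* φ r u)))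
            solve : ∀ x y z → x ℤ.- y ≡ z → x ≡ y ℤ.+ z
            solve x y z e = trans (l x y) (cong (λ z → y ℤ.+ z) e)
              where
              l : ∀ x y → x ≡ y ℤ.+ (x ℤ.- y)
              l = ℤ-Solver.solve-∀
            inside : ∀ {a} → a ∈ ys → ρ₁.ρₙ a ℕ.< 2 ℕ.* q × ρ₂.ρₙ a ℕ.< 2 ℕ.* q
            inside a∈ = as′-inside (subset a∈)
            translated : ψ a ≡ ψ a′ +³ k ·³ basis i
            translated = trans (cong₂ _,_ (solve a a′ (k ℤ.* u) difference) (cong₂ _,_
                (solve (ρ₁.ρ a) (ρ₁.ρ a′) (k ℤ.* φ r₁ u) (trans (sym (ρ₁.φ-difference {a} {a′} (proj₁ (inside a∈)) (proj₁ (inside a′∈)))) (φ-difference r₁∈)))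
                (solve (ρ₂.ρ a) (ρ₂.ρ a′) (k ℤ.* φ r₂ u) (trans (sym (ρ₂.φ-difference {a} {a′} (proj₂ (inside a∈)) (proj₂ (inside a′∈)))) (φ-difference r₂∈)))))
              (cong (λ b → ψ a′ +³ k ·³ b) (sym basis-u))
            a≡a′ : a ≡ a′
            a≡a′ = injective a∈ a′∈ (trans (cong (λ v → kill i (adjugate v)) translated) (kill-translate i k (ψ a′)))
            j≡j′ : j ≡ j′
            j≡j′ = sym (ℤ.+-injective (ℤ.i-j≡0⇒i≡j (+ j′) (+ j) (translate-injective i k (ψ a′) det≢0 (trans (sym translated) (cong ψ a≡a′)))))

          crowded : ∀ {a₀} → a₀ ∈ T₀ → Λ * (ιₙ (length T₀) * ιₙ (suc Q)) ≤ 2ℚ * ιₙ 100 * m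
          crowded {a₀} a₀∈ = subst (λ z → Λ * z ≤ 2ℚ * ιₙ 100 * m) total (ball-size {map (point a₀) grid}
            (map-unique (λ {p} {p′} → distinct a₀ {p} {p′}) (Unique.cartesianProduct⁺ T₀-unique (Unique.downFrom⁺ (suc Q))))
            (λ x∈ → let x≤ , φ≤ = in-ball a₀∈ x∈ in x≤ , near-dominated x≤ φ≤))
            where
            total : ιₙ (length (map (point a₀) grid)) ≡ ιₙ (length T₀) * ιₙ (suc Q)
            total = trans (cong ιₙ (length-map (point a₀) grid)) (trans (sym (∑-1 grid)) (trans (∑-product _,_ T₀ (downFrom (suc Q)) (λ _ → 1ℚ))
              (trans (∑-ext T₀ λ _ → ∑-1 (downFrom (suc Q))) (trans (∑-const T₀ (ιₙ (length (downFrom (suc Q))))) (cong (λ l → ιₙ (length T₀) * ιₙ l) (length-downFrom (suc Q)))))))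

          few : m < ιₙ 100000 * (ιₙ P * ιₙ (length T₀))
          few = <-≤-trans many (*-mono-≤ˡ (ιₙ-nonNeg 100000) count)

          inhabited : ∀ (T : List ℤ) → m < ιₙ 100000 * (ιₙ P * ιₙ (length T)) → ∃[ a ] a ∈ T
          inhabited (a ∷ _) _ = a , here refl
          inhabited [] p = contradiction (<⇒≤ 0<m) (<⇒≱ (<-≤-trans p (≤-reflexive (trans (cong (λ z → ιₙ 100000 * (ιₙ P * z)) (ι-def (+ 0))) (trans (cong (ιₙ 100000 *_) (*-zeroʳ (ιₙ P))) (*-zeroʳ (ιₙ 100000)))))))

          impossible : ⊥
          -- `Q` was chosen so that Q + 1 translates of a cluster, which contains more than m /
          -- (100000 P) points, exceed the bound of `ball-size`.
          impossible = contradiction (crowded (proj₂ (inhabited T₀ few))) (<⇒≱ (begin-strict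
            2ℚ * ιₙ 100 * m <⟨ *-monoʳ-<-pos (2ℚ * ιₙ 100) {{positive (*-pos (positive⁻¹ 2ℚ) (ιₙ-pos 99))}} few ⟩
            2ℚ * ιₙ 100 * (ιₙ 100000 * (ιₙ P * ιₙ (length T₀))) ≡⟨ l (2ℚ * ιₙ 100) (ιₙ 100000) (ιₙ P) (ιₙ (length T₀)) ⟩
            2ℚ * ιₙ 100 * (ιₙ 100000 * ιₙ P) * ιₙ (length T₀) ≤⟨ *-mono-≤ʳ {ιₙ (length T₀)} (ιₙ-nonNeg (length T₀)) (<⇒≤ Q≥) ⟩
            ιₙ (suc Q) * Λ * ιₙ (length T₀) ≡⟨ l′ (ιₙ (suc Q)) Λ (ιₙ (length T₀)) ⟩
            Λ * (ιₙ (length T₀) * ιₙ (suc Q)) ∎))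
            where
            open ≤-Reasoning
            l : ∀ h u p t → h * (u * (p * t)) ≡ h * (u * p) * t
            l = solve-∀ ℚ-ring
            l′ : ∀ k a t → k * a * t ≡ a * (t * k)
            l′ = solve-∀ ℚ-ring

        lines : List (Vec ℤ 3)
        lines = map line ys

        lines-few : ιₙ 100000 * ιₙ (length lines) ≤ m
        lines-few = subst (λ l → ιₙ 100000 * ιₙ l ≤ m) (sym (length-map line ys)) (≮⇒≥ impossible)

        lines-cover : ∀ {x} → x ∈ X → kill i x ∈ lines
        lines-cover x∈ = let a , a∈ , eq = ∈-map⁻ position x∈ in subst (λ x → kill i x ∈ lines) (sym eq) (covers a∈)

      module L₁ = Direction 0F u₁ small₁ refl
      module L₂ = Direction 1F u₂ small₂ refl
      module L₃ = Direction 2F u₃ small₃ refl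

      lines : Fin 3 → List (Vec ℤ 3)
      lines 0F = L₁.lines
      lines 1F = L₂.lines
      lines 2F = L₃.lines

      -- From 8 · 0.50008 = 4.00064 the three families of lines, each smaller than m / 100000, take
      -- away 3 · 8 / 100000 = 0.00024. The remaining 4.0004 exceeds the doubling constant 4.00001.
      inconsistent : ⊥
      inconsistent = contradiction doubling (<⇒≱ (<-≤-trans (*-monoˡ-<-pos m {{positive 0<m}} (ιₙ-mono-< (ℕ.<ᵇ⇒< 400001 400040 _))) large-sumset))
        where
        U n x l₁ l₂ l₃ e : ℚ
        U = ιₙ 100000
        n = ιₙ (length S)
        x = ιₙ (length as′)
        l₁ = ιₙ (length L₁.lines)
        l₂ = ιₙ (length L₂.lines)
        l₃ = ιₙ (length L₃.lines)
        e = 2^ 3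
        box : e * x ≤ n + e * (l₁ + (l₂ + (l₃ + 0ℚ)))
        box = ≤-trans (≤-reflexive (cong (λ l → e * ιₙ l) (sym (length-map position as′))))
          (≤-trans (box-sumset X X-unique Z (λ x∈ y∈ → ∈-deduplicate⁺ _≟ⱽ_ (∈-cartesianProductWith⁺ _⊕_ x∈ y∈)) lines λ { 0F → L₁.lines-cover ; 1F → L₂.lines-cover ; 2F → L₃.lines-cover })
            (+-monoˡ-≤ (e * (l₁ + (l₂ + (l₃ + 0ℚ)))) (ιₙ-mono-≤ Z-size)))
        large-sumset : ιₙ 400040 * m ≤ U * n
        large-sumset = ≤-by (U * (n + e * (l₁ + (l₂ + (l₃ + 0ℚ))) - e * x) + e * ((U * x - ιₙ 50008 * m) + (m - U * l₁) + (m - U * l₂) + (m - U * l₃)))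
          (+-nonNeg (*-nonNeg (ιₙ-nonNeg 100000) (≤⇒0≤ box)) (*-nonNeg (nonNegative⁻¹ (2^ 3))
            (+-nonNeg (+-nonNeg (+-nonNeg (≤⇒0≤ as′-large) (≤⇒0≤ L₁.lines-few)) (≤⇒0≤ L₂.lines-few)) (≤⇒0≤ L₃.lines-few))))
          (trans (identity e U n x l₁ l₂ l₃ (ιₙ 50008) m) (cong (λ z → z * m + (U * (n + e * (l₁ + (l₂ + (l₃ + 0ℚ))) - e * x) + e * ((U * x - ιₙ 50008 * m) + (m - U * l₁) + (m - U * l₂) + (m - U * l₃)))) numbers))
          where
          identity : ∀ e U n x a b c k m → U * n ≡ (e * k - (e + e + e)) * m + (U * (n + e * (a + (b + (c + 0ℚ))) - e * x) + e * ((U * x - k * m) + (m - U * a) + (m - U * b) + (m - U * c)))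
          identity = solve-∀ ℚ-ring
          numbers : e * ιₙ 50008 - (e + e + e) ≡ ιₙ 400040
          numbers = trans (cong₂ _-_ (trans (cong (_* ιₙ 50008) (sym (ι-def (+ 8)))) (trans (sym (ιₙ-* 8 50008)) (ιₙ-+ 400040 24))) (sym (ι-def (+ 24)))) (cancel (ιₙ 400040) (ιₙ 24))
            where
            cancel : ∀ a b → a + b - b ≡ a
            cancel = solve-∀ ℚ-ring

    private
      1≤t₁ : 1 ℕ.≤ t₁
      1≤t₁ = ℕ.≤-trans (ℕ.*-mono-≤ {1} {1001} {1} {D ℕ.* D} (ℕ.≤ᵇ⇒≤ 1 1001 _) (ℕ.*-mono-≤ {1} {D} {1} {D} 1≤D 1≤D)) t₁≥
        where
        1≤D : 1 ℕ.≤ D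
        1≤D = ℕ.≤-trans (ℕ.≤ᵇ⇒≤ 1 2000 _) 2000≤D

      cluster : ∃[ T₀ ] (Unique T₀ × (∀ {a} → a ∈ T₀ → a ∈ as) × ιₙ (length as) ≤ ιₙ P₁ * ιₙ (length T₀) ×
                         (∀ {a a′ r} → a ∈ T₀ → a′ ∈ T₀ → r ∈ frequencies → D ℕ.* ∣ φ r (a ℤ.- a′) ∣ ℕ.≤ N))
      cluster = close {D} {t₁} {P₁} ℕ.≤-refl t₁≥ 1≤t₁ P₁≥ {as} u-as (λ a∈ → a∈)

      T₀ : List ℤ
      T₀ = proj₁ cluster

      T₀⊆as : ∀ {a} → a ∈ T₀ → a ∈ as
      T₀⊆as = proj₁ (proj₂ (proj₂ cluster))

      count : length as ℕ.≤ P₁ ℕ.* length T₀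
      count = ιₙ-cancel-≤ (≤-trans (proj₁ (proj₂ (proj₂ (proj₂ cluster)))) (≤-reflexive (sym (ιₙ-* P₁ (length T₀)))))

      inhabited : ∀ (T : List ℤ) → length as ℕ.≤ P₁ ℕ.* length T → ∃[ a ] a ∈ T
      inhabited (a ∷ _) _ = a , here refl
      inhabited [] p = contradiction (ℕ.≤-trans nonempty (subst (length as ℕ.≤_) (ℕ.*-zeroʳ P₁) p)) λ ()

      origin : ℤ
      origin = proj₁ (inhabited T₀ count)

      origin∈ : origin ∈ T₀
      origin∈ = proj₂ (inhabited T₀ count)

      small : ∀ {a} → a ∈ T₀ → Small (a ℤ.- origin)
      small {a} a∈ = ℕ.≤-trans (ℤ.∣i-j∣≤∣i∣+∣j∣ a origin) (ℕ.≤-trans (ℕ.+-mono-≤ (as-bounded (T₀⊆as a∈)) (as-bounded (T₀⊆as origin∈)))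
          (ℕ.≤-trans (ℕ.≤-reflexive (cong (λ z → K ℕ.+ z) (sym (ℕ.+-identityʳ K)))) (ℕ.*-monoʳ-≤ 2 (ℕ.m≤n*m K 80)))) ,
        All.tabulate λ {r} r∈ → ≤/ D (proj₂ (proj₂ (proj₂ (proj₂ cluster))) {a} {origin} {r} a∈ origin∈ r∈)

      from-progression : Progression → LargeProgression 𝒞 as P₁
      from-progression progression = record
        { a₀ = a₀ ; v₁ = v₁ ; v₂ = v₂ ; L₁ = L₁ ; L₂ = L₂ ; 1≤L₁ = 1≤L₁ ; 1≤L₂ = 1≤L₂
        ; contained = λ {l₁} {l₂} (p₁ , q₁) (p₂ , q₂) → good l₁ l₂ p₁ q₁ p₂ q₂
        ; T₀ = T₀ ; T₀-unique = proj₁ (proj₂ cluster) ; f = λ a → f (a ℤ.- origin)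
        ; f-injective = λ {a} {b} a∈ b∈ eq → shift a b (injective (a ℤ.- origin) (b ℤ.- origin) (small a∈) (small b∈) eq)
        ; f-into = λ {a} a∈ → into (a ℤ.- origin) (small a∈) ; count = count ; origin = origin ; origin∈ = T₀⊆as origin∈ }
        where
        open Progression progression
        shift : ∀ a b → a ℤ.- origin ≡ b ℤ.- origin → a ≡ b
        shift a b eq = trans (e a origin) (trans (cong (ℤ._+ origin) eq) (sym (e b origin)))
          where
          e : ∀ a o → a ≡ a ℤ.- o ℤ.+ o
          e = ℤ-Solver.solve-∀

    large-progression : LargeProgression 𝒞 as P₁
    large-progression = [ from-progression , (λ independent → ⊥-elim (Separated.inconsistent independent)) ]′ progression-or-independent

-- Numerical constants, real numbers and the conclusion

module Final where

  open import Data.Integer.Base as ℤ using (ℤ; +_; 0ℤ)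
  open import Data.Integer.Base using (∣_∣)
  open import Data.Rational.Base hiding (∣_∣)
  open import Data.Rational.Properties
  open import Data.Vec.Functional as Vector using (Vector)
  open import Relation.Unary using (Pred; Satisfiable; _⊆_; _≐_)
  open import Defs renaming (∑ to ∑ᵛ; _⊖_ to _⊖ᵖ_) hiding (+-cauchy; *-cauchy)
  open RationalOrder
  open ListSum
  open Rotations using (2ℚ)
  open Characters
  open AlmostPeriods using (5ℚ)
  open Lattice using (maxOver; ≤-maxOver)
  open Bogolyubov hiding (_⊕_) renaming (_⊖_ to _⊝_)
  open Structure
  open Separation

  record Inverse (n : ℕ) : Set where
    field
      inverse : ℚ
      inverse-pos : 0ℚ < inverse
      inverse-* : ιₙ n * inverse ≡ 1ℚ

  invert : ∀ n → Inverse (suc n)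
  invert n = record { inverse = 1/ ιₙ (suc n) ; inverse-pos = positive⁻¹ _ {{1/pos⇒pos (ιₙ (suc n))}} ; inverse-* = *-inverseʳ (ιₙ (suc n)) }
    where
    instance
      ι-pos′ : Positive (ιₙ (suc n))
      ι-pos′ = positive (ιₙ-pos n)
      ι-nonZero : NonZero (ιₙ (suc n))
      ι-nonZero = pos⇒nonZero (ιₙ (suc n))

  private
    -- For ω = 0.2548 and θ = 0.5001² the excess of 98 ω³⁹ over 198 θ³⁹ is positive.
    module Numbers (V w : ℕ) (ω-num : 100000 ℕ.* w ≡ 25480 ℕ.* suc V) (θ-num : 100000 ℕ.* 100000 ≡ suc V) (w≤V : w ℕ.≤ suc V)
                   (excess : 198 ℕ.* (50010 ℕ.* 50010) ℕ.^ 39 ℕ.< 98 ℕ.* w ℕ.^ 39) where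
      open Inverse (invert V) renaming (inverse to v; inverse-pos to 0<v; inverse-* to Vv≡1)

      ω θ Λ : ℚ
      ω = ιₙ w * v
      θ = ιₙ (50010 ℕ.* 50010) * v
      Λ = ιₙ 98 * ω ^ 39 - (ιₙ 98 + ιₙ 100) * θ ^ 39

      0≤ω : 0ℚ ≤ ω
      0≤ω = *-nonNeg (ιₙ-nonNeg w) (<⇒≤ 0<v)

      0≤θ : 0ℚ ≤ θ
      0≤θ = *-nonNeg (ιₙ-nonNeg _) (<⇒≤ 0<v)

      ω≤1 : ω ≤ 1ℚ
      ω≤1 = ≤-trans (*-mono-≤ʳ (<⇒≤ 0<v) (ιₙ-mono-≤ w≤V)) (≤-reflexive Vv≡1)

      ω≡ : ιₙ 100000 * ω ≡ ιₙ 25480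
      ω≡ = trans (sym (*-assoc (ιₙ 100000) (ιₙ w) v)) (trans (cong (_* v) (trans (sym (ιₙ-* 100000 w)) (trans (cong ιₙ ω-num) (ιₙ-* 25480 (suc V)))))
        (trans (*-assoc (ιₙ 25480) (ιₙ (suc V)) v) (trans (cong (ιₙ 25480 *_) Vv≡1) (*-identityʳ (ιₙ 25480)))))

      θ≡ : ιₙ 100000 * ιₙ 100000 * θ ≡ ιₙ 50010 * ιₙ 50010
      θ≡ = trans (cong (_* θ) (trans (sym (ιₙ-* 100000 100000)) (cong ιₙ θ-num))) (trans (l (ιₙ (suc V)) (ιₙ (50010 ℕ.* 50010)) v)
        (trans (cong (ιₙ (50010 ℕ.* 50010) *_) Vv≡1) (trans (*-identityʳ _) (ιₙ-* 50010 50010))))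
        where
        l : ∀ a b c → a * (b * c) ≡ b * (a * c)
        l = solve-∀ ℚ-ring

      0<Λ : 0ℚ < Λ
      0<Λ = subst (0ℚ <_) (sym factor) (*-pos (<⇒0< (subst₂ _<_ (number 198 (50010 ℕ.* 50010)) (number 98 w) (ιₙ-mono-< excess))) (^-pos 39 0<v))
        where
        number : ∀ a b → ιₙ (a ℕ.* b ℕ.^ 39) ≡ ιₙ a * ιₙ b ^ 39
        number a b = trans (ιₙ-* a (b ℕ.^ 39)) (cong (ιₙ a *_) (ιₙ-^ b 39))
        factor : Λ ≡ (ιₙ 98 * ιₙ w ^ 39 - ιₙ 198 * ιₙ (50010 ℕ.* 50010) ^ 39) * v ^ 39
        factor = trans (cong₂ (λ x y → ιₙ 98 * x - (ιₙ 98 + ιₙ 100) * y) (^-distrib (ιₙ w) v 39) (^-distrib (ιₙ (50010 ℕ.* 50010)) v 39))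
          (trans (l (ιₙ 98) (ιₙ 98 + ιₙ 100) (ιₙ w ^ 39) (ιₙ (50010 ℕ.* 50010) ^ 39) (v ^ 39)) (cong (λ z → (ιₙ 98 * ιₙ w ^ 39 - z * ιₙ (50010 ℕ.* 50010) ^ 39) * v ^ 39) (sym (ιₙ-+ 98 100))))
          where
          l : ∀ a d x y z → a * (x * z) - d * (y * z) ≡ (a * x - d * y) * z
          l = solve-∀ ℚ-ring

      natural-bound : ∀ x → ∃[ n ] x ≤ ιₙ n
      natural-bound x = let n , x≤ = archimedean (positive⁻¹ 1ℚ) x in n , ≤-trans x≤ (≤-reflexive (*-identityˡ (ιₙ n)))

      build : ∀ t → 1001 ℕ.* (200 ℕ.* 200) ℕ.≤ t → Constants
      build t t≥ =
        let G , G≥ = archimedean 0<Λ (2ℚ * junk)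
            P , P≥ = natural-bound (2ℚ * 5ℚ ^ t)
            Q , Q≥ = archimedean 0<Λ (2ℚ * ιₙ 100 * (ιₙ 100000 * ιₙ P))
            D = 2000 ℕ.* suc Q
            t₁ = 1001 ℕ.* (D ℕ.* D)
            P₁ , P₁≥ = natural-bound (2ℚ * 5ℚ ^ t₁)
        in record
          { ω = ω ; θ = θ ; Λ = Λ ; 0≤ω = 0≤ω ; ω≤1 = ω≤1 ; 0≤θ = 0≤θ ; 0<Λ = 0<Λ ; Λ≡ = refl ; ω≡ = ω≡ ; θ≡ = θ≡
          ; G = G ; G≥ = G≥ ; t = t ; P = P ; t≥ = t≥ ; P≥ = P≥ ; Q = Q
          ; Q≥ = ≤-<-trans Q≥ (subst (_< ιₙ (suc Q) * Λ) (*-comm (ιₙ Q) Λ) (*-monoˡ-<-pos Λ {{positive 0<Λ}} (ιₙ-mono-< (ℕ.n<1+n Q))))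
          ; D = D ; D≥ = ℕ.≤-refl ; t₁ = t₁ ; P₁ = P₁ ; t₁≥ = ℕ.≤-refl ; P₁≥ = P₁≥ }

  opaque
    constants : Constants
    -- The common denominator is 10^10, so ω = 2548000000 / 10^10 and θ = 50010² / 10^10. The excess
    -- compares two natural numbers of several hundred digits.
    constants = Numbers.build 9999999999 2548000000 refl refl (ℕ.≤ᵇ⇒≤ 2548000000 10000000000 _) (ℕ.<ᵇ⇒< (198 ℕ.* (50010 ℕ.* 50010) ℕ.^ 39) (98 ℕ.* 2548000000 ℕ.^ 39) _)
      (1001 ℕ.* (200 ℕ.* 200)) ℕ.≤-refl

  Represented : Pred ℤ 0ℓ → ℕ → Pred ℤ 0ℓ
  Represented A k x = Σ[ u ∈ Vector ℤ k ] Σ[ v ∈ Vector ℤ k ] ((∀ i → A (u i)) × (∀ i → A (v i)) × x ≡ ∑ᵛ u ℤ.- ∑ᵛ v)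

  cons : ∀ {A : Pred ℤ 0ℓ} {k a} {u : Vector ℤ k} → A a → (∀ i → A (u i)) → ∀ i → A ((a Vector.∷ u) i)
  cons Aa Au zero = Aa
  cons Aa Au (suc i) = Au i

  represented-0 : ∀ {A : Pred ℤ 0ℓ} {a} → A a → ∀ k → Represented A k 0ℤ
  represented-0 {a = a} Aa k = (λ _ → a) , (λ _ → a) , (λ _ → Aa) , (λ _ → Aa) , sym (ℤ.+-inverseʳ (∑ᵛ {k} λ _ → a))

  represented-neg : ∀ {A : Pred ℤ 0ℓ} {k x} → Represented A k (ℤ.- x) → Represented A k x
  represented-neg {x = x} (u , v , Au , Av , eq) = v , u , Av , Au , trans (sym (ℤ.neg-involutive x)) (trans (cong ℤ.-_ eq) (l (∑ᵛ u) (∑ᵛ v)))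
    where
    l : ∀ a b → ℤ.- (a ℤ.- b) ≡ b ℤ.- a
    l = ℤ-Solver.solve-∀

  represented-sums : ∀ 𝒞 {A : Pred ℤ 0ℓ} {as} → (∀ {a} → a ∈ as → A a) → ∀ k {w} → w ∈ Transforms.sums 𝒞 as k → Represented A k w
  represented-sums 𝒞 ⊆A zero (here refl) = (λ ()) , (λ ()) , (λ ()) , (λ ()) , refl
  represented-sums 𝒞 {A} {as} ⊆A (suc k) w∈ =
    let d , w′ , d∈ , w′∈ , w≡ = ∈-cartesianProductWith⁻ ℤ._+_ (as ⊝ as) (Transforms.sums 𝒞 as k) w∈
        a , b′ , a∈ , b′∈ , d≡ = ∈-cartesianProductWith⁻ ℤ._+_ as (map ℤ.-_ as) d∈
        b , b∈ , b′≡ = ∈-map⁻ ℤ.-_ b′∈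
        u , v , Au , Av , w′≡ = represented-sums 𝒞 {A} ⊆A k w′∈
    in a Vector.∷ u , b Vector.∷ v , cons {A} {u = u} (⊆A a∈) Au , cons {A} {u = v} (⊆A b∈) Av ,
       trans w≡ (trans (cong₂ ℤ._+_ (trans d≡ (cong (λ z → a ℤ.+ z) b′≡)) w′≡) (l a b (∑ᵛ u) (∑ᵛ v)))
    where
    l : ∀ a b u v → a ℤ.+ ℤ.- b ℤ.+ (u ℤ.- v) ≡ a ℤ.+ u ℤ.- (b ℤ.+ v)
    l = ℤ-Solver.solve-∀

  range : ℕ → List ℤ
  range L = map (λ k → + suc k) (downFrom L)

  ∈-range : ∀ {L l} → InRange L l → l ∈ range L
  ∈-range {L} {+ suc k} (_ , ℤ.+≤+ k<L) = ∈-map⁺ (λ k → + suc k) (∈-downFrom⁺ k<L)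
  ∈-range {L} {+ zero} (ℤ.+≤+ () , _)

  range-∈ : ∀ {L l} → l ∈ range L → InRange L l
  range-∈ {L} l∈ = let k , k∈ , eq = ∈-map⁻ (λ k → + suc k) l∈ in subst (InRange L) (sym eq) (ℤ.+≤+ (ℕ.s≤s ℕ.z≤n) , ℤ.+≤+ (∈-downFrom⁻ k∈))

  Conclusion : Pred ℤ 0ℓ → ℕ → ℝ → Set₁
  Conclusion A m c = ∃[ d ] Σ[ P ∈ Pred ℤ 0ℓ ] ∃[ p ]
    (1 ℕ.≤ d × d ℕ.≤ 2 × IsProgression d P × P ⊆ (41 · A ⊖ᵖ 40 · A) × ∣ P ∣≡ p × c *ᵣ fromℕ m ≤ᵣ fromℕ p)

  module Translate (A : Pred ℤ 0ℓ) {a} (Aa : A a) (a₀ v₁ v₂ : ℤ) (L₁ L₂ : ℕ) (1≤L₁ : 1 ℕ.≤ L₁) (1≤L₂ : 1 ℕ.≤ L₂)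
                   (represented : ∀ {l₁ l₂} → InRange L₁ l₁ → InRange L₂ l₂ → Represented A 40 (a₀ ℤ.+ (l₁ ℤ.* v₁ ℤ.+ l₂ ℤ.* v₂))) where

    pair : ∀ {X : Set} → X → X → Vector X 2
    pair x y 0F = x
    pair x y 1F = y

    -- Translation by an element a of A leads from 40A - 40A into 41A - 40A and preserves the size.
    P : Pred ℤ 0ℓ
    P = progression (a ℤ.+ a₀) (pair v₁ v₂) (pair L₁ L₂)

    value : ℤ → ℤ → ℤ
    value l₁ l₂ = a ℤ.+ a₀ ℤ.+ (l₁ ℤ.* v₁ ℤ.+ (l₂ ℤ.* v₂ ℤ.+ 0ℤ))

    value≡ : ∀ l₁ l₂ → value l₁ l₂ ≡ a ℤ.+ (a₀ ℤ.+ (l₁ ℤ.* v₁ ℤ.+ l₂ ℤ.* v₂))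
    value≡ l₁ l₂ = e a a₀ (l₁ ℤ.* v₁) (l₂ ℤ.* v₂)
      where
      e : ∀ a b x y → a ℤ.+ b ℤ.+ (x ℤ.+ (y ℤ.+ 0ℤ)) ≡ a ℤ.+ (b ℤ.+ (x ℤ.+ y))
      e = ℤ-Solver.solve-∀

    values : List ℤ
    values = deduplicate ℤ._≟_ (cartesianProductWith value (range L₁) (range L₂))

    ∈-values : ∀ {l₁ l₂} → InRange L₁ l₁ → InRange L₂ l₂ → value l₁ l₂ ∈ values
    ∈-values p₁ p₂ = ∈-deduplicate⁺ ℤ._≟_ (∈-cartesianProductWith⁺ value (∈-range p₁) (∈-range p₂))

    values≐P : (_∈ values) ≐ P
    values≐P = (λ {x} x∈ → let l₁ , l₂ , l₁∈ , l₂∈ , eq = ∈-cartesianProductWith⁻ value (range L₁) (range L₂) (∈-deduplicate⁻ ℤ._≟_ (cartesianProductWith value (range L₁) (range L₂)) x∈) in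
                  pair l₁ l₂ , (λ { 0F → range-∈ l₁∈ ; 1F → range-∈ l₂∈ }) , eq) ,
               (λ {x} (l , bounds , eq) → subst (_∈ values) (sym eq) (∈-values (bounds 0F) (bounds 1F)))

    P⊆ : P ⊆ (41 · A ⊖ᵖ 40 · A)
    P⊆ {x} (l , bounds , eq) = let u , v , Au , Av , r≡ = represented (bounds 0F) (bounds 1F) in
      ∑ᵛ (a Vector.∷ u) , ∑ᵛ v , (a Vector.∷ u , cons {A} {u = u} Aa Au , refl) , (v , Av , refl) ,
      trans eq (trans (value≡ (l 0F) (l 1F)) (trans (cong (λ z → a ℤ.+ z) r≡) (e a (∑ᵛ u) (∑ᵛ v))))
      where
      e : ∀ a u v → a ℤ.+ (u ℤ.- v) ≡ a ℤ.+ u ℤ.- v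
      e = ℤ-Solver.solve-∀

    conclude : ∀ {m C c T} {f : ℤ → ℤ} → 0ℚ < c → c * ιₙ C ≡ 1ℚ → Unique T → InjectiveOn T f →
               (∀ {x} → x ∈ T → ∃[ l₁ ] ∃[ l₂ ] (InRange L₁ l₁ × InRange L₂ l₂ × f x ≡ a₀ ℤ.+ (l₁ ℤ.* v₁ ℤ.+ l₂ ℤ.* v₂))) →
               m ℕ.≤ C ℕ.* length T → Conclusion A m (fromℚ c)
    conclude {m} {C} {c} {T} {f} 0<c cC≡1 u-T inj into m≤ = 2 , P , length values , ℕ.≤ᵇ⇒≤ 1 2 _ , ℕ.≤-refl ,
      (a ℤ.+ a₀ , pair v₁ v₂ , pair L₁ L₂ , (λ { 0F → 1≤L₁ ; 1F → 1≤L₂ }) , (λ p → p) , (λ p → p)) ,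
      P⊆ , (values , deduplicate-! ℤ._≟_ (cartesianProductWith value (range L₁) (range L₂)) , values≐P , refl) ,
      λ ε 0<ε → 0 , λ _ _ → ≤-trans bound (≤-by ε (<⇒≤ 0<ε) refl)
      where
      T≤ : length T ℕ.≤ length values
      T≤ = length-inj (λ x → a ℤ.+ f x) u-T (λ {x} {y} x∈ y∈ eq → inj x∈ y∈ (shift (f x) (f y) eq))
        (λ x x∈ → let l₁ , l₂ , p₁ , p₂ , eq = into x∈ in subst (_∈ values) (trans (value≡ l₁ l₂) (cong (λ z → a ℤ.+ z) (sym eq))) (∈-values p₁ p₂))
        where
        shift : ∀ x y → a ℤ.+ x ≡ a ℤ.+ y → x ≡ y
        shift x y eq = trans (e a x) (trans (cong (ℤ._- a) eq) (sym (e a y)))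
          where
          e : ∀ a x → x ≡ a ℤ.+ x ℤ.- a
          e = ℤ-Solver.solve-∀
      bound : c * (+ m / 1) ≤ + length values / 1
      bound = subst₂ _≤_ (cong (c *_) (ι-def (+ m))) (ι-def (+ length values)) (≤-trans (*-mono-≤ˡ (<⇒≤ 0<c) (ιₙ-mono-≤ (ℕ.≤-trans m≤ (ℕ.*-monoʳ-≤ C T≤))))
        (≤-reflexive (trans (cong (c *_) (ιₙ-* C (length values))) (trans (sym (*-assoc c (ιₙ C) _)) (trans (cong (_* ιₙ (length values)) cC≡1) (*-identityˡ _))))))

  private
    -- The sum of `P₁` and 100000 bounds both, so c = 1 / C serves large sets, where the progression
    -- has at least m / P₁ elements, and small sets, where one element is enough.
    C : ℕ
    C = suc (Constants.P₁ constants ℕ.+ 100000)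

    open Inverse (invert (Constants.P₁ constants ℕ.+ 100000)) renaming (inverse to γ; inverse-pos to 0<γ; inverse-* to Cγ≡1)

    γC≡1 : γ * ιₙ C ≡ 1ℚ
    γC≡1 = trans (*-comm γ (ιₙ C)) Cγ≡1

  -- Both steps are 0, so the progression is the single point a, obtained as a plus a trivial
  -- representation of 0.
  small-case : ∀ {A : Pred ℤ 0ℓ} {a m} → A a → m ℕ.≤ 100000 → Conclusion A m (fromℚ γ)
  small-case {A} {a} {m} Aa m≤ = Translate.conclude A Aa 0ℤ 0ℤ 0ℤ 1 1 ℕ.≤-refl ℕ.≤-refl
    (λ {l₁} {l₂} _ _ → subst (Represented A 40) (sym (zero′ l₁ l₂)) (represented-0 {A} Aa 40)) {f = λ x → x} 0<γ γC≡1 ([] ∷ []) (λ _ _ eq → eq)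
    (λ { (here refl) → + 1 , + 1 , (ℤ.≤-refl , ℤ.≤-refl) , (ℤ.≤-refl , ℤ.≤-refl) , refl })
    (ℕ.≤-trans m≤ (ℕ.≤-trans (ℕ.m≤n+m 100000 (Constants.P₁ constants)) (ℕ.≤-trans (ℕ.n≤1+n _) (ℕ.≤-reflexive (sym (ℕ.*-identityʳ C))))))
    where
    zero′ : ∀ l₁ l₂ → 0ℤ ℤ.+ (l₁ ℤ.* 0ℤ ℤ.+ l₂ ℤ.* 0ℤ) ≡ 0ℤ
    zero′ = ℤ-Solver.solve-∀

  large-case : ∀ {A : Pred ℤ 0ℓ} {as S} → (∀ {a} → a ∈ as → A a) → Unique as → Unique S → (∀ {a b} → a ∈ as → b ∈ as → a ℤ.+ b ∈ S) →
               100000 ℕ.≤ length as → ιₙ 100000 * ιₙ (length S) ≤ ιₙ 400001 * ιₙ (length as) → Conclusion A (length as) (fromℚ γ)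
  large-case {A} {as} {S} ⊆A u-as u-S as+as m-large doubling = conclude
    where
    -- Here `N` is chosen, after the set is known; `constants` depends on neither.
    c = circle (required-N constants (length as) (maxOver as ∣_∣))
    𝒞 : Circle
    𝒞 = proj₁ c
    configuration : Configuration
    configuration = record
      { 𝒦 = constants ; 𝒞 = 𝒞 ; as = as ; S = S ; u-as = u-as ; u-S = u-S ; as+as = as+as ; m-large = m-large ; doubling = doubling
      ; K = maxOver as ∣_∣ ; as-bounded = ≤-maxOver ; N-large = proj₂ c }
    open LargeProgression (Apart.large-progression configuration)
    conclude : Conclusion A (length as) (fromℚ γ)
    conclude = Translate.conclude A (⊆A origin∈) a₀ v₁ v₂ L₁ L₂ 1≤L₁ 1≤L₂
      (λ {l₁} {l₂} p₁ p₂ → represented-neg {A} {40} {a₀ ℤ.+ (l₁ ℤ.* v₁ ℤ.+ l₂ ℤ.* v₂)} (represented-sums 𝒞 {A} {as} ⊆A 40 (contained p₁ p₂)))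
      {length as} {C} {γ} {T₀} {f} 0<γ γC≡1 T₀-unique f-injective f-into
      (ℕ.≤-trans count (ℕ.*-monoˡ-≤ (length T₀) (ℕ.≤-trans (ℕ.m≤m+n (Constants.P₁ constants) 100000) (ℕ.n≤1+n _))))

  open Inverse (invert 99999) using () renaming (inverse to δ₀; inverse-pos to 0<δ₀; inverse-* to δ₀≡)

  -- The gap ε between δ and δ₀ = 1/100000 absorbs the error allowed by the order on real numbers.
  rational-doubling : ∀ δ {m n} → δ <ᵣ fromℚ δ₀ → 1 ℕ.≤ m → fromℕ n ≤ᵣ (fromℕ 4 +ᵣ δ) *ᵣ fromℕ m → ιₙ 100000 * ιₙ n ≤ ιₙ 400001 * ιₙ m
  rational-doubling δ {m} {n} (ε , 0<ε , i , gap) 1≤m doubling =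
    let j , bound = doubling (ε * ιₙ m) (*-pos 0<ε (subst (_< ιₙ m) (ι-def (+ 0)) (ιₙ-mono-< 1≤m)))
        k = i ℕ.⊔ j
        d = seq δ k
        n≤ : ιₙ n ≤ (ιₙ 4 + d) * ιₙ m + ε * ιₙ m
        n≤ = subst₂ _≤_ (sym (ι-def (+ n))) (cong₂ (λ x y → (x + d) * y + ε * ιₙ m) (sym (ι-def (+ 4))) (sym (ι-def (+ m)))) (bound k (ℕ.m≤n⊔m i j))
    in ≤-trans (*-mono-≤ˡ (ιₙ-nonNeg 100000) n≤) (≤-by (ιₙ 100000 * ((δ₀ - (d + ε)) * ιₙ m))
         (*-nonNeg (ιₙ-nonNeg 100000) (*-nonNeg (≤⇒0≤ (gap k (ℕ.m≤m⊔n i j))) (ιₙ-nonNeg m)))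
         (trans (cong (_* ιₙ m) split) (e (ιₙ 100000) (ιₙ 4) d ε δ₀ (ιₙ m))))
    where
    split : ιₙ 400001 ≡ ιₙ 100000 * ιₙ 4 + ιₙ 100000 * δ₀
    split = trans (ιₙ-+ 400000 1) (cong₂ _+_ (ιₙ-* 100000 4) (trans (ι-def (+ 1)) (sym δ₀≡)))
    e : ∀ U f d ε δ m → (U * f + U * δ) * m ≡ U * ((f + d) * m + ε * m) + U * ((δ - (d + ε)) * m)
    e = solve-∀ ℚ-ring

  proof : Σ[ δ₀ ∈ ℝ ] (0ᵣ <ᵣ δ₀ × (∀ (δ : ℝ) → 0ᵣ <ᵣ δ → δ <ᵣ δ₀ → Σ[ c ∈ ℝ ] (0ᵣ <ᵣ c ×
    (∀ (A : Pred ℤ 0ℓ) (m n : ℕ) → ∣ A ∣≡ m → Satisfiable A → ∣ 2 · A ∣≡ n → fromℕ n ≤ᵣ (fromℕ 4 +ᵣ δ) *ᵣ fromℕ m → Conclusion A m c))))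
  proof = fromℚ δ₀ , positive-real 0<δ₀ , λ δ _ δ<δ₀ → fromℚ γ , positive-real 0<γ ,
    λ { A m n (as , u-as , (⊆A , A⊆) , refl) (a , Aa) (S , u-S , (_ , S⊇) , refl) doubling → cases A as S u-as ⊆A (A⊆ Aa) u-S
          (λ {a} {b} a∈ b∈ → S⊇ (a Vector.∷ (b Vector.∷ λ ()) , cons {A} {u = b Vector.∷ λ ()} (⊆A a∈) (cons {A} {u = λ ()} (⊆A b∈) λ ()) , cong (λ z → a ℤ.+ z) (sym (ℤ.+-identityʳ b))))
          (λ 1≤m → rational-doubling δ {length as} {length S} δ<δ₀ 1≤m doubling) }
    where
    positive-real : ∀ {x} → 0ℚ < x → 0ᵣ <ᵣ fromℚ x
    positive-real {x} 0<x = x , 0<x , 0 , λ _ _ → ≤-reflexive (+-identityˡ x)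
    cases : ∀ A as S → Unique as → (∀ {a} → a ∈ as → A a) → ∀ {a} → a ∈ as → Unique S → (∀ {a b} → a ∈ as → b ∈ as → a ℤ.+ b ∈ S) →
            (1 ℕ.≤ length as → ιₙ 100000 * ιₙ (length S) ≤ ιₙ 400001 * ιₙ (length as)) → Conclusion A (length as) (fromℚ γ)
    cases A as S u-as ⊆A a∈ u-S as+as doubling with ℕ.≤-total 100000 (length as)
    ... | inj₁ large = large-case {A} ⊆A u-as u-S as+as large (doubling (ℕ.≤-trans (ℕ.≤ᵇ⇒≤ 1 100000 _) large))
    ... | inj₂ small = small-case {A} (⊆A a∈) small

open import Defs
open import Data.Integer.Base using (ℤ)
open import Data.Nat.Base using (ℕ; _≤_)
open import Data.Product.Base using (Σ-syntax; ∃-syntax; _×_)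
open import Level using (0ℓ)
open import Relation.Unary using (Pred; Satisfiable; _⊆_)

corollary1p4 : Σ[ δ₀ ∈ ℝ ] (0ᵣ <ᵣ δ₀ ×
    (∀ (δ : ℝ) → 0ᵣ <ᵣ δ → δ <ᵣ δ₀ →
    Σ[ c ∈ ℝ ] (0ᵣ <ᵣ c ×
    (∀ (A : Pred ℤ 0ℓ) (m n : ℕ) → ∣ A ∣≡ m → Satisfiable A →
    ∣ 2 · A ∣≡ n → fromℕ n ≤ᵣ (fromℕ 4 +ᵣ δ) *ᵣ fromℕ m →
    ∃[ d ] Σ[ P ∈ Pred ℤ 0ℓ ] ∃[ p ]
    (1 ≤ d × d ≤ 2 × IsProgression d P × P ⊆ (41 · A ⊖ 40 · A) ×
    ∣ P ∣≡ p × c *ᵣ fromℕ m ≤ᵣ fromℕ p)))))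
corollary1p4 = Final.proof
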